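{- The graphs $G_{E_8}$ and $\overline{\Gamma}_1$ (the complement of $\Gamma_1$) are quantum isomorphic, non-isomorphic strongly regular graphs.
   Context: The $E_8$ root system $\Psi_{E_8}\subset\mathbb{R}^8$ consists of the 240 vectors $\pm e_i\pm e_j$ ($1\le i<j\le 8$) and all $x\in\{\pm1\}^8$ with $\prod_i x_i=1$. $G_{E_8}$ is the graph with vertices $v_x$, $x\in\Psi_{E_8}$, where $v_x=v_{ -x}$ (120 vertices), and $v_x\sim v_y$ iff $\langle x,y\rangle=0$. The folded halved 8-cube graph has as vertices the pairs $\{x,\mathbf{1}+x\}$ for $x\in\mathbb{F}_2^8$ with $\sum_ix_i=0$ ($\mathbf{1}$ the all-ones vector), two vertices $\{x,\mathbf{1}+x\},\{y,\mathbf{1}+y\}$ being adjacent iff $x+y$ or $x+y+\mathbf{1}$ has exactly two nonzero coordinates. The graph $\Gamma_1$ (Brouwer–Ivanov–Klin) has as vertices one orbit of the independent sets of size 8 of the folded halved 8-cube graph under the group $\mathbb{Z}_2^6\times A_8$ (generated by translations by even-weight vectors and even permutations of the 8 coordinates), namely the orbit of size 120 considered by Brouwer, Ivanov and Klin; two vertices are adjacent iff the corresponding independent sets have exactly two points in common. A graph is strongly regular with parameters $(n,k,\lambda,\mu)$ if it has $n$ vertices, is $k$-regular, adjacent vertices have $\lambda$ common neighbours and distinct non-adjacent vertices have $\mu$ common neighbours. A quantum permutation matrix over a unital $C^*$-algebra $\mathcal{A}$ is $u=(u_{ij})\in M_n(\mathcal{A})$ with $u_{ij}=u_{ij}^*=u_{ij}^2$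 and $\sum_ku_{ik}=1=\sum_ku_{ki}$ for all $i$. Graphs $G_1,G_2$ on $n$ vertices are quantum isomorphic if there is a unital $C^*$-algebra $\mathcal{A}$ and a quantum permutation matrix $u\in M_n(\mathcal{A})$ with $A_{G_1}u=uA_{G_2}$, where $A_G$ denotes the adjacency matrix. -}

module Defs where

open import Level using (0ℓ; _⊔_) renaming (suc to lsuc)
open import Algebra.Bundles using (Ring; CommutativeRing)
open import Algebra.Module.Structures using (IsLeftModule)
open import Algebra.Structures using (IsRing)
import Algebra.Consequences.Setoid as Consequences
import Algebra.Definitions.RawMonoid as RawMonoidSum
open import Data.Bool.Base using (Bool; true; false; if_then_else_; _xor_)
import Data.Bool.Properties as Bool
open import Data.Fin.Base as Fin using (Fin)
open import Data.Fin.Properties as Fin using (all?)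
open import Data.Fin.Permutation as Perm using (Permutation′; _⟨$⟩ʳ_)
import Data.Fin.Permutation.Transposition.List as Transpositions
open import Data.Integer.Base as ℤ using (ℤ; 0ℤ; 1ℤ; _◃_)
import Data.Integer.Properties as ℤ
open import Data.List.Base as List using (List)
open import Data.List.Relation.Unary.All using (All)
open import Data.Nat.Base as ℕ using (ℕ)
open import Data.Nat.Divisibility using (_∣_)
import Data.Nat.Properties as ℕ
open import Data.Product.Base using (Σ; Σ-syntax; ∃; ∃-syntax; _×_; _,_; proj₁; proj₂; swap)
open import Data.Rational.Base as ℚ using (ℚ; 0ℚ; 1ℚ; ½)
import Data.Rational.Properties as ℚ
open import Data.Rational.Solver using (module +-*-Solver)
open import Data.Sign.Base as Sign using (Sign)
open import Data.Sum.Base using (_⊎_; inj₁; inj₂)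
open import Data.Vec.Base as Vec using (Vec; []; _∷_; replicate; zipWith; _[_]≔_)
import Data.Vec.Properties as Vec
open import Function.Bundles using (_⇔_; mk⇔; Equivalence; Inverse)
import Function.Properties.Equivalence as ⇔
open import Relation.Binary.Bundles using (Setoid)
open import Relation.Binary.Core using (Rel)
open import Relation.Binary.Construct.Closure.ReflexiveTransitive using (Star)
open import Relation.Binary.PropositionalEquality
  using (_≡_; _≢_; refl; sym; trans; cong; cong₂; subst)
open import Relation.Binary.Structures using (IsEquivalence)
open import Relation.Nullary using (¬_; contradiction)
open import Relation.Nullary.Decidable using (Dec; from-yes; ¬?; _→-dec_; _⊎-dec_)
open import Relation.Nullary.Reflects using (Reflects)
open import Relation.Unary using (Pred; U)

------------------------------------------------------------------------
-- Real numbers: Cauchy sequences of rationals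

IsCauchy : (ℕ → ℚ) → Set
IsCauchy f = ∀ ε → 0ℚ ℚ.< ε →
  ∃[ N ] ∀ m n → N ℕ.≤ m → N ℕ.≤ n → ℚ.∣ f m ℚ.- f n ∣ ℚ.< ε

-- Without η, which would make conversion checking unfold ℚ arithmetic.
record ℝ : Set where
  no-eta-equality
  constructor mkℝ
  field
    seq    : ℕ → ℚ
    cauchy : IsCauchy seq

open ℝ public

infix 4 _≈ᴿ_ _≤ᴿ_

record _≈ᴿ_ (x y : ℝ) : Set where
  constructor mk≈
  field
    close : ∀ ε → 0ℚ ℚ.< ε →
      ∃[ N ] ∀ n → N ℕ.≤ n → ℚ.∣ seq x n ℚ.- seq y n ∣ ℚ.< ε

open _≈ᴿ_ public

record _≤ᴿ_ (x y : ℝ) : Set where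
  constructor mk≤
  field
    below : ∀ ε → 0ℚ ℚ.< ε →
      ∃[ N ] ∀ n → N ℕ.≤ n → seq x n ℚ.< seq y n ℚ.+ ε

open _≤ᴿ_ public

private
  ∣p-p∣<ε : ∀ p {ε} → 0ℚ ℚ.< ε → ℚ.∣ p ℚ.- p ∣ ℚ.< ε
  ∣p-p∣<ε p 0<ε = subst (ℚ._< _) (sym (cong ℚ.∣_∣ (ℚ.+-inverseʳ p))) 0<ε

  ∣p-q∣-comm : ∀ p q → ℚ.∣ p ℚ.- q ∣ ≡ ℚ.∣ q ℚ.- p ∣
  ∣p-q∣-comm p q = trans (sym (ℚ.∣-p∣≡∣p∣ (p ℚ.- q))) (cong ℚ.∣_∣ lemma)
    where
    open +-*-Solver
    lemma : ℚ.- (p ℚ.- q) ≡ q ℚ.- p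
    lemma = solve 2 (λ a b → :- (a :- b) := b :- a) refl p q

  half : ∀ {ε} → 0ℚ ℚ.< ε → 0ℚ ℚ.< ½ ℚ.* ε
  half {ε} 0<ε = subst (ℚ._< ½ ℚ.* ε) (ℚ.*-zeroʳ ½) (ℚ.*-monoʳ-<-pos ½ 0<ε)

  half+half : ∀ ε → ½ ℚ.* ε ℚ.+ ½ ℚ.* ε ≡ ε
  half+half ε = trans (sym (ℚ.*-distribʳ-+ ε ½ ½)) (ℚ.*-identityˡ ε)

  sum<ε : ∀ p q r s {ε} →
    ℚ.∣ p ℚ.- r ∣ ℚ.< ½ ℚ.* ε → ℚ.∣ q ℚ.- s ∣ ℚ.< ½ ℚ.* ε →
    ℚ.∣ (p ℚ.+ q) ℚ.- (r ℚ.+ s) ∣ ℚ.< ε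
  sum<ε p q r s {ε} p≈r q≈s = begin-strict
    ℚ.∣ (p ℚ.+ q) ℚ.- (r ℚ.+ s) ∣              ≡⟨ cong ℚ.∣_∣ rearrange ⟩
    ℚ.∣ (p ℚ.- r) ℚ.+ (q ℚ.- s) ∣              ≤⟨ ℚ.∣p+q∣≤∣p∣+∣q∣ (p ℚ.- r) (q ℚ.- s) ⟩
    ℚ.∣ p ℚ.- r ∣ ℚ.+ ℚ.∣ q ℚ.- s ∣            <⟨ ℚ.+-mono-< p≈r q≈s ⟩
    ½ ℚ.* ε ℚ.+ ½ ℚ.* ε                        ≡⟨ half+half ε ⟩
    ε                                          ∎
    where
    open ℚ.≤-Reasoning
    open +-*-Solver
    rearrange : (p ℚ.+ q) ℚ.- (r ℚ.+ s) ≡ (p ℚ.- r) ℚ.+ (q ℚ.- s)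
    rearrange = solve 4 (λ a b c d → (a :+ b) :- (c :+ d) := (a :- c) :+ (b :- d)) refl p q r s

  triangle<ε : ∀ p q r {ε} →
    ℚ.∣ p ℚ.- q ∣ ℚ.< ½ ℚ.* ε → ℚ.∣ q ℚ.- r ∣ ℚ.< ½ ℚ.* ε → ℚ.∣ p ℚ.- r ∣ ℚ.< ε
  triangle<ε p q r {ε} p≈q q≈r =
    subst (λ t → ℚ.∣ t ∣ ℚ.< ε)
      (solve 3 (λ a b c → (a :+ b) :- (b :+ c) := a :- c) refl p q r)
      (sum<ε p q q r p≈q q≈r)
    where open +-*-Solver

  neg-close : ∀ p q → ℚ.∣ (ℚ.- p) ℚ.- (ℚ.- q) ∣ ≡ ℚ.∣ p ℚ.- q ∣
  neg-close p q = trans (cong ℚ.∣_∣ lemma) (ℚ.∣-p∣≡∣p∣ (p ℚ.- q))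
    where
    open +-*-Solver
    lemma : (ℚ.- p) ℚ.- (ℚ.- q) ≡ ℚ.- (p ℚ.- q)
    lemma = solve 2 (λ a b → (:- a) :- (:- b) := :- (a :- b)) refl p q

  -- The tolerance for the factors that keeps a product of factors bounded by
  -- M within ε.
  tolerance : ∀ M {ε} → 0ℚ ℚ.< M → 0ℚ ℚ.< ε →
    ∃[ δ ] (0ℚ ℚ.< δ × M ℚ.* δ ≡ ½ ℚ.* ε)
  tolerance M {ε} 0<M 0<ε = M⁻¹ ℚ.* (½ ℚ.* ε) , 0<δ , M*δ
    where
    instance
      M-pos = ℚ.positive 0<M
      M-nonZero = ℚ.pos⇒nonZero M
    M⁻¹ = ℚ.1/ M
    instance
      M⁻¹-pos = ℚ.1/pos⇒pos M
    0<δ : 0ℚ ℚ.< M⁻¹ ℚ.* (½ ℚ.* ε)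
    0<δ = subst (ℚ._< M⁻¹ ℚ.* (½ ℚ.* ε)) (ℚ.*-zeroʳ M⁻¹) (ℚ.*-monoʳ-<-pos M⁻¹ (half 0<ε))
    M*δ : M ℚ.* (M⁻¹ ℚ.* (½ ℚ.* ε)) ≡ ½ ℚ.* ε
    M*δ = trans (sym (ℚ.*-assoc M M⁻¹ _))
         (trans (cong (ℚ._* (½ ℚ.* ε)) (ℚ.*-inverseʳ M)) (ℚ.*-identityˡ _))

  product≤ : ∀ p q {M δ} → ℚ.∣ p ∣ ℚ.≤ M → ℚ.∣ q ∣ ℚ.< δ → 0ℚ ℚ.< M →
    ℚ.∣ p ℚ.* q ∣ ℚ.< M ℚ.* δ
  product≤ p q {M} {δ} p≤M q<δ 0<M = begin-strict
    ℚ.∣ p ℚ.* q ∣        ≡⟨ ℚ.∣p*q∣≡∣p∣*∣q∣ p q ⟩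
    ℚ.∣ p ∣ ℚ.* ℚ.∣ q ∣  ≤⟨ ℚ.*-monoʳ-≤-nonNeg ℚ.∣ q ∣ p≤M ⟩
    M ℚ.* ℚ.∣ q ∣        <⟨ ℚ.*-monoʳ-<-pos M q<δ ⟩
    M ℚ.* δ              ∎
    where
    open ℚ.≤-Reasoning
    instance
      M-pos = ℚ.positive 0<M
      ∣q∣-nonNeg = ℚ.nonNegative (ℚ.0≤∣p∣ q)

  product<ε : ∀ p q r s {M δ ε} → 0ℚ ℚ.< M → M ℚ.* δ ≡ ½ ℚ.* ε →
    ℚ.∣ p ∣ ℚ.≤ M → ℚ.∣ s ∣ ℚ.≤ M →
    ℚ.∣ p ℚ.- r ∣ ℚ.< δ → ℚ.∣ q ℚ.- s ∣ ℚ.< δ →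
    ℚ.∣ (p ℚ.* q) ℚ.- (r ℚ.* s) ∣ ℚ.< ε
  product<ε p q r s {M} {δ} {ε} 0<M Mδ p≤M s≤M p≈r q≈s = begin-strict
    ℚ.∣ p ℚ.* q ℚ.- r ℚ.* s ∣                            ≡⟨ cong ℚ.∣_∣ rearrange ⟩
    ℚ.∣ p ℚ.* (q ℚ.- s) ℚ.+ s ℚ.* (p ℚ.- r) ∣            ≤⟨ ℚ.∣p+q∣≤∣p∣+∣q∣ (p ℚ.* (q ℚ.- s)) (s ℚ.* (p ℚ.- r)) ⟩
    ℚ.∣ p ℚ.* (q ℚ.- s) ∣ ℚ.+ ℚ.∣ s ℚ.* (p ℚ.- r) ∣      <⟨ ℚ.+-mono-< (product≤ p (q ℚ.- s) p≤M q≈s 0<M)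
                                                                        (product≤ s (p ℚ.- r) s≤M p≈r 0<M) ⟩
    M ℚ.* δ ℚ.+ M ℚ.* δ                                  ≡⟨ cong₂ ℚ._+_ Mδ Mδ ⟩
    ½ ℚ.* ε ℚ.+ ½ ℚ.* ε                                  ≡⟨ half+half ε ⟩
    ε                                                    ∎
    where
    open ℚ.≤-Reasoning
    open +-*-Solver
    rearrange : p ℚ.* q ℚ.- r ℚ.* s ≡ p ℚ.* (q ℚ.- s) ℚ.+ s ℚ.* (p ℚ.- r)
    rearrange = solve 4 (λ a b c d → a :* b :- c :* d := a :* (b :- d) :+ d :* (a :- c)) refl p q r s

  0<1 : 0ℚ ℚ.< 1ℚ
  0<1 = ℚ.positive⁻¹ 1ℚ

  eventually-bounded : ∀ x →
    ∃[ M ] (0ℚ ℚ.< M × ∃[ N ] ∀ n → N ℕ.≤ n → ℚ.∣ seq x n ∣ ℚ.≤ M)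
  eventually-bounded x with cauchy x 1ℚ 0<1
  ... | N , close₁ = ℚ.∣ xN ∣ ℚ.+ 1ℚ , 0<M , N , bound
    where
    xN = seq x N
    0<M : 0ℚ ℚ.< ℚ.∣ xN ∣ ℚ.+ 1ℚ
    0<M = subst (ℚ._< ℚ.∣ xN ∣ ℚ.+ 1ℚ) (ℚ.+-identityʳ 0ℚ) (ℚ.+-mono-≤-< (ℚ.0≤∣p∣ xN) 0<1)
    bound : ∀ n → N ℕ.≤ n → ℚ.∣ seq x n ∣ ℚ.≤ ℚ.∣ xN ∣ ℚ.+ 1ℚ
    bound n N≤n = begin
      ℚ.∣ seq x n ∣                        ≡⟨ cong ℚ.∣_∣ (solve 2 (λ a b → a := b :+ (a :- b)) refl (seq x n) xN) ⟩
      ℚ.∣ xN ℚ.+ (seq x n ℚ.- xN) ∣        ≤⟨ ℚ.∣p+q∣≤∣p∣+∣q∣ xN _ ⟩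
      ℚ.∣ xN ∣ ℚ.+ ℚ.∣ seq x n ℚ.- xN ∣    ≤⟨ ℚ.+-monoʳ-≤ ℚ.∣ xN ∣ (ℚ.<⇒≤ (close₁ n N N≤n ℕ.≤-refl)) ⟩
      ℚ.∣ xN ∣ ℚ.+ 1ℚ                      ∎
      where
      open ℚ.≤-Reasoning
      open +-*-Solver

  common-bound : ∀ x y →
    ∃[ M ] (0ℚ ℚ.< M × ∃[ N ] ∀ n → N ℕ.≤ n → ℚ.∣ seq x n ∣ ℚ.≤ M × ℚ.∣ seq y n ∣ ℚ.≤ M)
  common-bound x y = M ℚ.⊔ M′ , 0<M⊔M′ , N ℕ.⊔ N′ , λ n N≤n →
      ℚ.≤-trans {ℚ.∣ seq x n ∣} {M} {M ℚ.⊔ M′} (x≤ n (ℕ.m⊔n≤o⇒m≤o N N′ N≤n)) (ℚ.p≤p⊔q M M′)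
    , ℚ.≤-trans {ℚ.∣ seq y n ∣} {M′} {M ℚ.⊔ M′} (y≤ n (ℕ.m⊔n≤o⇒n≤o N N′ N≤n)) (ℚ.p≤q⊔p M M′)
    where
    M  = proj₁ (eventually-bounded x)
    M′ = proj₁ (eventually-bounded y)
    N  = proj₁ (proj₂ (proj₂ (eventually-bounded x)))
    N′ = proj₁ (proj₂ (proj₂ (eventually-bounded y)))
    x≤ = proj₂ (proj₂ (proj₂ (eventually-bounded x)))
    y≤ = proj₂ (proj₂ (proj₂ (eventually-bounded y)))
    0<M⊔M′ : 0ℚ ℚ.< M ℚ.⊔ M′
    0<M⊔M′ = ℚ.<-≤-trans {0ℚ} {M} {M ℚ.⊔ M′} (proj₁ (proj₂ (eventually-bounded x))) (ℚ.p≤p⊔q M M′)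

fromℚ : ℚ → ℝ
fromℚ q = mkℝ (λ _ → q) (λ ε 0<ε → 0 , λ _ _ _ _ → ∣p-p∣<ε q 0<ε)

0ᴿ 1ᴿ : ℝ
0ᴿ = fromℚ 0ℚ
1ᴿ = fromℚ 1ℚ

infixl 6 _+ᴿ_
infixl 7 _*ᴿ_
infix  8 -ᴿ_

_+ᴿ_ : ℝ → ℝ → ℝ
seq    (x +ᴿ y) n = seq x n ℚ.+ seq y n
cauchy (x +ᴿ y) ε 0<ε =
  let N  , x-close = cauchy x (½ ℚ.* ε) (half 0<ε)
      N′ , y-close = cauchy y (½ ℚ.* ε) (half 0<ε)
  in N ℕ.⊔ N′ , λ m n N≤m N≤n → sum<ε (seq x m) (seq y m) (seq x n) (seq y n)
    (x-close m n (ℕ.m⊔n≤o⇒m≤o N N′ N≤m) (ℕ.m⊔n≤o⇒m≤o N N′ N≤n))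
    (y-close m n (ℕ.m⊔n≤o⇒n≤o N N′ N≤m) (ℕ.m⊔n≤o⇒n≤o N N′ N≤n))

-ᴿ_ : ℝ → ℝ
seq    (-ᴿ x) n = ℚ.- seq x n
cauchy (-ᴿ x) ε 0<ε = let N , x-close = cauchy x ε 0<ε in N , λ m n N≤m N≤n →
  subst (ℚ._< ε) (sym (neg-close (seq x m) (seq x n))) (x-close m n N≤m N≤n)

_*ᴿ_ : ℝ → ℝ → ℝ
seq    (x *ᴿ y) n = seq x n ℚ.* seq y n
cauchy (x *ᴿ y) ε 0<ε =
  let M , 0<M , B , bound = common-bound x y
      δ , 0<δ , Mδ = tolerance M 0<M 0<ε
      N  , x-close = cauchy x δ 0<δ
      N′ , y-close = cauchy y δ 0<δ
  in B ℕ.⊔ (N ℕ.⊔ N′) , λ m n ≤m ≤n →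
  let ≤m′ = ℕ.m⊔n≤o⇒n≤o B (N ℕ.⊔ N′) ≤m
      ≤n′ = ℕ.m⊔n≤o⇒n≤o B (N ℕ.⊔ N′) ≤n
  in product<ε (seq x m) (seq y m) (seq x n) (seq y n) 0<M Mδ
       (proj₁ (bound m (ℕ.m⊔n≤o⇒m≤o B (N ℕ.⊔ N′) ≤m)))
       (proj₂ (bound n (ℕ.m⊔n≤o⇒m≤o B (N ℕ.⊔ N′) ≤n)))
       (x-close m n (ℕ.m⊔n≤o⇒m≤o N N′ ≤m′) (ℕ.m⊔n≤o⇒m≤o N N′ ≤n′))
       (y-close m n (ℕ.m⊔n≤o⇒n≤o N N′ ≤m′) (ℕ.m⊔n≤o⇒n≤o N N′ ≤n′))

pointwise : ∀ {x y} → (∀ n → seq x n ≡ seq y n) → x ≈ᴿ y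
pointwise {x} {y} x≡y .close ε 0<ε = 0 , λ n _ →
  subst (λ t → ℚ.∣ seq x n ℚ.- t ∣ ℚ.< ε) (x≡y n) (∣p-p∣<ε (seq x n) 0<ε)

≈ᴿ-isEquivalence : IsEquivalence _≈ᴿ_
≈ᴿ-isEquivalence = record
  { refl  = pointwise (λ _ → refl)
  ; sym   = λ {x} {y} x≈y → mk≈ λ ε 0<ε → let N , c = close x≈y ε 0<ε in
      N , λ n N≤n → subst (ℚ._< ε) (∣p-q∣-comm (seq x n) (seq y n)) (c n N≤n)
  ; trans = λ {x} {y} {z} x≈y y≈z → mk≈ λ ε 0<ε →
      let N  , c  = close x≈y (½ ℚ.* ε) (half 0<ε)
          N′ , c′ = close y≈z (½ ℚ.* ε) (half 0<ε)
      in N ℕ.⊔ N′ , λ n ≤n → triangle<ε (seq x n) (seq y n) (seq z n)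
           (c n (ℕ.m⊔n≤o⇒m≤o N N′ ≤n)) (c′ n (ℕ.m⊔n≤o⇒n≤o N N′ ≤n))
  }

+ᴿ-cong : ∀ {x x′ y y′} → x ≈ᴿ x′ → y ≈ᴿ y′ → x +ᴿ y ≈ᴿ x′ +ᴿ y′
+ᴿ-cong {x} {x′} {y} {y′} x≈ y≈ .close ε 0<ε =
  let N  , c  = close x≈ (½ ℚ.* ε) (half 0<ε)
      N′ , c′ = close y≈ (½ ℚ.* ε) (half 0<ε)
  in N ℕ.⊔ N′ , λ n ≤n → sum<ε (seq x n) (seq y n) (seq x′ n) (seq y′ n)
       (c n (ℕ.m⊔n≤o⇒m≤o N N′ ≤n)) (c′ n (ℕ.m⊔n≤o⇒n≤o N N′ ≤n))

-ᴿ-cong : ∀ {x x′} → x ≈ᴿ x′ → -ᴿ x ≈ᴿ -ᴿ x′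
-ᴿ-cong {x} {x′} x≈ .close ε 0<ε = let N , c = close x≈ ε 0<ε in
  N , λ n N≤n → subst (ℚ._< ε) (sym (neg-close (seq x n) (seq x′ n))) (c n N≤n)

*ᴿ-cong : ∀ {x x′ y y′} → x ≈ᴿ x′ → y ≈ᴿ y′ → x *ᴿ y ≈ᴿ x′ *ᴿ y′
*ᴿ-cong {x} {x′} {y} {y′} x≈ y≈ .close ε 0<ε =
  let M , 0<M , B , bound = common-bound x y′
      δ , 0<δ , Mδ = tolerance M 0<M 0<ε
      N  , c  = close x≈ δ 0<δ
      N′ , c′ = close y≈ δ 0<δ
  in B ℕ.⊔ (N ℕ.⊔ N′) , λ n ≤n →
  let ≤n′ = ℕ.m⊔n≤o⇒n≤o B (N ℕ.⊔ N′) ≤n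
      b   = bound n (ℕ.m⊔n≤o⇒m≤o B (N ℕ.⊔ N′) ≤n)
  in product<ε (seq x n) (seq y n) (seq x′ n) (seq y′ n) 0<M Mδ (proj₁ b) (proj₂ b)
       (c n (ℕ.m⊔n≤o⇒m≤o N N′ ≤n′)) (c′ n (ℕ.m⊔n≤o⇒n≤o N N′ ≤n′))

module ≈ᴿ = IsEquivalence ≈ᴿ-isEquivalence

private
  module ℝ-laws where
    open import Algebra.Definitions _≈ᴿ_

    +-assoc : Associative _+ᴿ_
    +-assoc x y z = pointwise (λ n → ℚ.+-assoc (seq x n) (seq y n) (seq z n))

    +-comm : Commutative _+ᴿ_
    +-comm x y = pointwise (λ n → ℚ.+-comm (seq x n) (seq y n))

    +-identityˡ : LeftIdentity 0ᴿ _+ᴿ_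
    +-identityˡ x = pointwise (λ n → ℚ.+-identityˡ (seq x n))

    +-inverseˡ : LeftInverse 0ᴿ -ᴿ_ _+ᴿ_
    +-inverseˡ x = pointwise (λ n → ℚ.+-inverseˡ (seq x n))

    *-assoc : Associative _*ᴿ_
    *-assoc x y z = pointwise (λ n → ℚ.*-assoc (seq x n) (seq y n) (seq z n))

    *-comm : Commutative _*ᴿ_
    *-comm x y = pointwise (λ n → ℚ.*-comm (seq x n) (seq y n))

    *-identityˡ : LeftIdentity 1ᴿ _*ᴿ_
    *-identityˡ x = pointwise (λ n → ℚ.*-identityˡ (seq x n))

    distribˡ : _*ᴿ_ DistributesOverˡ _+ᴿ_
    distribˡ x y z = pointwise (λ n → ℚ.*-distribˡ-+ (seq x n) (seq y n) (seq z n))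

    setoid : Setoid 0ℓ 0ℓ
    setoid = record { isEquivalence = ≈ᴿ-isEquivalence }

ℝ-commutativeRing : CommutativeRing 0ℓ 0ℓ
ℝ-commutativeRing = record
  { Carrier = ℝ
  ; _≈_     = _≈ᴿ_
  ; _+_     = _+ᴿ_
  ; _*_     = _*ᴿ_
  ; -_      = -ᴿ_
  ; 0#      = 0ᴿ
  ; 1#      = 1ᴿ
  ; isCommutativeRing = record
    { isRing = record
      { +-isAbelianGroup = record
        { isGroup = record
          { isMonoid = record
            { isSemigroup = record
              { isMagma = record { isEquivalence = ≈ᴿ-isEquivalence ; ∙-cong = +ᴿ-cong }
              ; assoc   = +-assoc
              }
            ; identity = Consequences.comm∧idˡ⇒id setoid +-comm +-identityˡ
            }
          ; inverse = Consequences.comm∧invˡ⇒inv setoid +-comm +-inverseˡ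
          ; ⁻¹-cong = -ᴿ-cong
          }
        ; comm = +-comm
        }
      ; *-cong     = *ᴿ-cong
      ; *-assoc    = *-assoc
      ; *-identity = Consequences.comm∧idˡ⇒id setoid *-comm *-identityˡ
      ; distrib    = Consequences.comm∧distrˡ⇒distr setoid +ᴿ-cong *-comm distribˡ
      }
    ; *-comm = *-comm
    }
  }
  where open ℝ-laws

------------------------------------------------------------------------
-- Complex numbers

record ℂ : Set where
  constructor _+i_
  field
    re im : ℝ

open ℂ public

conj : ℂ → ℂ
conj (a +i b) = a +i (-ᴿ b)

∣_∣² : ℂ → ℝ
∣ a +i b ∣² = a *ᴿ a +ᴿ b *ᴿ b

private
  module ℚ-identities where
    open import Data.Rational.Base using (_+_; _*_; -_)
    open +-*-Solver

    assoc-re : ∀ a b c d e f →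
      (a * c + - (b * d)) * e + - ((a * d + b * c) * f) ≡ a * (c * e + - (d * f)) + - (b * (c * f + d * e))
    assoc-re = solve 6 (λ a b c d e f →
      (a :* c :+ :- (b :* d)) :* e :+ :- ((a :* d :+ b :* c) :* f)
        := a :* (c :* e :+ :- (d :* f)) :+ :- (b :* (c :* f :+ d :* e))) refl

    assoc-im : ∀ a b c d e f →
      (a * c + - (b * d)) * f + (a * d + b * c) * e ≡ a * (c * f + d * e) + b * (c * e + - (d * f))
    assoc-im = solve 6 (λ a b c d e f →
      (a :* c :+ :- (b :* d)) :* f :+ (a :* d :+ b :* c) :* e
        := a :* (c :* f :+ d :* e) :+ b :* (c :* e :+ :- (d :* f))) refl

    distrib-re : ∀ a b c d e f →
      a * (c + e) + - (b * (d + f)) ≡ (a * c + - (b * d)) + (a * e + - (b * f))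
    distrib-re = solve 6 (λ a b c d e f →
      a :* (c :+ e) :+ :- (b :* (d :+ f)) := (a :* c :+ :- (b :* d)) :+ (a :* e :+ :- (b :* f))) refl

    distrib-im : ∀ a b c d e f →
      a * (d + f) + b * (c + e) ≡ (a * d + b * c) + (a * f + b * e)
    distrib-im = solve 6 (λ a b c d e f →
      a :* (d :+ f) :+ b :* (c :+ e) := (a :* d :+ b :* c) :+ (a :* f :+ b :* e)) refl

    identity-re : ∀ a b → 1ℚ * a + - (0ℚ * b) ≡ a
    identity-re = solve 2 (λ a b → con 1ℚ :* a :+ :- (con 0ℚ :* b) := a) refl

    identity-im : ∀ a b → 1ℚ * b + 0ℚ * a ≡ b
    identity-im = solve 2 (λ a b → con 1ℚ :* b :+ con 0ℚ :* a := b) refl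

    comm-re : ∀ a b c d → a * c + - (b * d) ≡ c * a + - (d * b)
    comm-re = solve 4 (λ a b c d → a :* c :+ :- (b :* d) := c :* a :+ :- (d :* b)) refl

    comm-im : ∀ a b c d → a * d + b * c ≡ c * b + d * a
    comm-im = solve 4 (λ a b c d → a :* d :+ b :* c := c :* b :+ d :* a) refl

infix 4 _≈ᶜ_
_≈ᶜ_ : Rel ℂ 0ℓ
z ≈ᶜ w = re z ≈ᴿ re w × im z ≈ᴿ im w

infixl 6 _+ᶜ_
_+ᶜ_ : ℂ → ℂ → ℂ
z +ᶜ w = (re z +ᴿ re w) +i (im z +ᴿ im w)

infixl 7 _*ᶜ_
_*ᶜ_ : ℂ → ℂ → ℂ
z *ᶜ w = (re z *ᴿ re w +ᴿ -ᴿ (im z *ᴿ im w)) +i (re z *ᴿ im w +ᴿ im z *ᴿ re w)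

private
  module ℂ-identities where
    open ℚ-identities

    ≈ᶜ-isEquivalence : IsEquivalence _≈ᶜ_
    ≈ᶜ-isEquivalence = record
      { refl  = ≈ᴿ.refl , ≈ᴿ.refl
      ; sym   = λ (p , q) → ≈ᴿ.sym p , ≈ᴿ.sym q
      ; trans = λ (p , q) (p′ , q′) → ≈ᴿ.trans p p′ , ≈ᴿ.trans q q′
      }

    setoid : Setoid 0ℓ 0ℓ
    setoid = record { isEquivalence = ≈ᶜ-isEquivalence }

    +-cong : ∀ {z z′ w w′} → z ≈ᶜ z′ → w ≈ᶜ w′ → z +ᶜ w ≈ᶜ z′ +ᶜ w′
    +-cong (p , q) (p′ , q′) = +ᴿ-cong p p′ , +ᴿ-cong q q′

    *-cong : ∀ {z z′ w w′} → z ≈ᶜ z′ → w ≈ᶜ w′ → z *ᶜ w ≈ᶜ z′ *ᶜ w′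
    *-cong (p , q) (p′ , q′) =
      +ᴿ-cong (*ᴿ-cong p p′) (-ᴿ-cong (*ᴿ-cong q q′)) , +ᴿ-cong (*ᴿ-cong p q′) (*ᴿ-cong q p′)

    *-assoc : ∀ z w v → (z *ᶜ w) *ᶜ v ≈ᶜ z *ᶜ (w *ᶜ v)
    *-assoc (a +i b) (c +i d) (e +i f) =
        pointwise (λ n → assoc-re (seq a n) (seq b n) (seq c n) (seq d n) (seq e n) (seq f n))
      , pointwise (λ n → assoc-im (seq a n) (seq b n) (seq c n) (seq d n) (seq e n) (seq f n))

    *-comm : ∀ z w → z *ᶜ w ≈ᶜ w *ᶜ z
    *-comm (a +i b) (c +i d) =
        pointwise (λ n → comm-re (seq a n) (seq b n) (seq c n) (seq d n))
      , pointwise (λ n → comm-im (seq a n) (seq b n) (seq c n) (seq d n))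

    *-identityˡ : ∀ z → (1ᴿ +i 0ᴿ) *ᶜ z ≈ᶜ z
    *-identityˡ (a +i b) =
        pointwise (λ n → identity-re (seq a n) (seq b n))
      , pointwise (λ n → identity-im (seq a n) (seq b n))

    distribˡ : ∀ z w v → z *ᶜ (w +ᶜ v) ≈ᶜ z *ᶜ w +ᶜ z *ᶜ v
    distribˡ (a +i b) (c +i d) (e +i f) =
        pointwise (λ n → distrib-re (seq a n) (seq b n) (seq c n) (seq d n) (seq e n) (seq f n))
      , pointwise (λ n → distrib-im (seq a n) (seq b n) (seq c n) (seq d n) (seq e n) (seq f n))

ℂ-commutativeRing : CommutativeRing 0ℓ 0ℓ
ℂ-commutativeRing = record
  { Carrier = ℂ
  ; _≈_     = _≈ᶜ_
  ; _+_     = _+ᶜ_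
  ; _*_     = _*ᶜ_
  ; -_      = λ z → (-ᴿ re z) +i (-ᴿ im z)
  ; 0#      = 0ᴿ +i 0ᴿ
  ; 1#      = 1ᴿ +i 0ᴿ
  ; isCommutativeRing = record
    { isRing = record
      { +-isAbelianGroup = record
        { isGroup = record
          { isMonoid = record
            { isSemigroup = record
              { isMagma = record { isEquivalence = ≈ᶜ-isEquivalence ; ∙-cong = +-cong }
              ; assoc   = λ z w v → R.+-assoc (re z) (re w) (re v) , R.+-assoc (im z) (im w) (im v)
              }
            ; identity = (λ z → R.+-identityˡ (re z) , R.+-identityˡ (im z))
                       , (λ z → R.+-identityʳ (re z) , R.+-identityʳ (im z))
            }
          ; inverse = (λ z → R.-‿inverseˡ (re z) , R.-‿inverseˡ (im z))
                    , (λ z → R.-‿inverseʳ (re z) , R.-‿inverseʳ (im z))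
          ; ⁻¹-cong = λ (p , q) → -ᴿ-cong p , -ᴿ-cong q
          }
        ; comm = λ z w → R.+-comm (re z) (re w) , R.+-comm (im z) (im w)
        }
      ; *-cong     = *-cong
      ; *-assoc    = *-assoc
      ; *-identity = Consequences.comm∧idˡ⇒id setoid *-comm *-identityˡ
      ; distrib    = Consequences.comm∧distrˡ⇒distr setoid +-cong *-comm distribˡ
      }
    ; *-comm = *-comm
    }
  }
  where
  module R = CommutativeRing ℝ-commutativeRing
  open ℂ-identities

------------------------------------------------------------------------
-- Unital C*-algebras

-- The zero algebra is excluded: over it every two graphs of the same order
-- would be quantum isomorphic.  Homogeneity of the norm is stated squared,
-- ‖ z • a ‖² = |z|² ‖ a ‖², which avoids square roots.
record CStarAlgebra : Set₁ where
  infix  4 _≈_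
  infixl 6 _+_
  infixl 7 _*_
  infixr 7 _•_
  infix  8 -_
  infix  9 _⋆
  field
    Carrier : Set
    _≈_     : Rel Carrier 0ℓ
    _+_ _*_ : Carrier → Carrier → Carrier
    -_      : Carrier → Carrier
    0# 1#   : Carrier
    isRing  : IsRing _≈_ _+_ _*_ -_ 0# 1#
    _•_     : ℂ → Carrier → Carrier
    isLeftModule : IsLeftModule (CommutativeRing.ring ℂ-commutativeRing) _≈_ _+_ 0# -_ _•_
    •-*-assoc : ∀ z a b → (z • a) * b ≈ z • (a * b)
    *-•-comm  : ∀ z a b → a * (z • b) ≈ z • (a * b)
    nontrivial : ¬ (1# ≈ 0#)

    _⋆           : Carrier → Carrier
    ⋆-cong       : ∀ {a b} → a ≈ b → a ⋆ ≈ b ⋆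
    ⋆-involutive : ∀ a → (a ⋆) ⋆ ≈ a
    ⋆-+          : ∀ a b → (a + b) ⋆ ≈ a ⋆ + b ⋆
    ⋆-•          : ∀ z a → (z • a) ⋆ ≈ conj z • (a ⋆)
    ⋆-*          : ∀ a b → (a * b) ⋆ ≈ b ⋆ * a ⋆

    ‖_‖          : Carrier → ℝ
    ‖‖-cong      : ∀ {a b} → a ≈ b → ‖ a ‖ ≈ᴿ ‖ b ‖
    ‖‖-nonneg    : ∀ a → 0ᴿ ≤ᴿ ‖ a ‖
    ‖‖-definite  : ∀ a → ‖ a ‖ ≈ᴿ 0ᴿ → a ≈ 0#
    ‖‖-triangle  : ∀ a b → ‖ a + b ‖ ≤ᴿ ‖ a ‖ +ᴿ ‖ b ‖
    ‖‖-homogeneous : ∀ z a → ‖ z • a ‖ *ᴿ ‖ z • a ‖ ≈ᴿ ∣ z ∣² *ᴿ (‖ a ‖ *ᴿ ‖ a ‖)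
    ‖‖-submultiplicative : ∀ a b → ‖ a * b ‖ ≤ᴿ ‖ a ‖ *ᴿ ‖ b ‖
    C*-identity  : ∀ a → ‖ a ⋆ * a ‖ ≈ᴿ ‖ a ‖ *ᴿ ‖ a ‖
    complete     : (s : ℕ → Carrier) →
      (∀ ε → 0ℚ ℚ.< ε → ∃[ N ] ∀ m n → N ℕ.≤ m → N ℕ.≤ n → ‖ s m + - s n ‖ ≤ᴿ fromℚ ε) →
      ∃[ a ] ∀ ε → 0ℚ ℚ.< ε → ∃[ N ] ∀ n → N ℕ.≤ n → ‖ s n + - a ‖ ≤ᴿ fromℚ ε

  ring : Ring 0ℓ 0ℓ
  ring = record { isRing = isRing }

  open Ring ring public using (+-rawMonoid)
  open RawMonoidSum +-rawMonoid public using (sum)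

------------------------------------------------------------------------
-- Cardinalities

-- P has exactly n elements up to ≈.
record Enumeration {c ℓ p} (S : Setoid c ℓ) (P : Pred (Setoid.Carrier S) p) (n : ℕ)
    : Set (c ⊔ ℓ ⊔ p) where
  open Setoid S using (Carrier; _≈_)
  field
    element   : Fin n → Carrier
    sound     : ∀ i → P (element i)
    injective : ∀ i j → element i ≈ element j → i ≡ j
    exhaustive : ∀ x → P x → ∃[ i ] x ≈ element i

Enumeration-resp : ∀ {c ℓ p q} {S : Setoid c ℓ} {P : Pred (Setoid.Carrier S) p}
  {Q : Pred (Setoid.Carrier S) q} {n} →
  (∀ x → P x ⇔ Q x) → Enumeration S P n → Enumeration S Q n
Enumeration-resp P⇔Q e = record
  { element    = element
  ; sound      = λ i → Equivalence.to (P⇔Q _) (sound i)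
  ; injective  = injective
  ; exhaustive = λ x Qx → exhaustive x (Equivalence.from (P⇔Q x) Qx)
  }
  where open Enumeration e

------------------------------------------------------------------------
-- Graphs

-- Simple graphs; the vertices form a setoid so that they may be classes such
-- as {x, -x}, given by representatives.
record Graph : Set₁ where
  infix 4 _~_
  field
    vertices : Setoid 0ℓ 0ℓ
  open Setoid vertices public using (_≈_) renaming (Carrier to Vertex)
  field
    _~_      : Rel Vertex 0ℓ
    ~-resp   : ∀ {u u′ v v′} → u ≈ u′ → v ≈ v′ → u ~ v → u′ ~ v′
    ~-sym    : ∀ {u v} → u ~ v → v ~ u
    ~-irrefl : ∀ {v} → ¬ (v ~ v)

complement : Graph → Graph
complement G = record
  { vertices = vertices
  ; _~_      = λ u v → ¬ (u ≈ v) × ¬ (u ~ v)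
  ; ~-resp   = λ u≈ v≈ (u≉v , u≁v) →
      (λ u′≈v′ → u≉v (V.trans u≈ (V.trans u′≈v′ (V.sym v≈)))) ,
      (λ u′~v′ → u≁v (~-resp (V.sym u≈) (V.sym v≈) u′~v′))
  ; ~-sym    = λ (u≉v , u≁v) → (λ v≈u → u≉v (V.sym v≈u)) , (λ v~u → u≁v (~-sym v~u))
  ; ~-irrefl = λ (v≉v , _) → v≉v V.refl
  }
  where
  open Graph G
  module V = Setoid vertices

record _≅_ (G H : Graph) : Set where
  private
    module G = Graph G
    module H = Graph H
  field
    bijection : Inverse G.vertices H.vertices
    adjacency : ∀ u v → u G.~ v ⇔ Inverse.to bijection u H.~ Inverse.to bijection v

record IsSRG (G : Graph) (n k l m : ℕ) : Set where
  open Graph G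
  field
    order        : Enumeration vertices U n
    regular      : ∀ v → Enumeration vertices (v ~_) k
    adjacent     : ∀ u v → u ~ v → Enumeration vertices (λ w → u ~ w × v ~ w) l
    non-adjacent : ∀ u v → ¬ (u ≈ v) → ¬ (u ~ v) → Enumeration vertices (λ w → u ~ w × v ~ w) m

StronglyRegular : Graph → Set
StronglyRegular G = ∃[ n ] ∃[ k ] ∃[ l ] ∃[ m ] IsSRG G n k l m

record AdjacencyMatrix (G : Graph) (n : ℕ) : Set where
  open Graph G
  field
    labelling : Enumeration vertices U n
    entry     : Fin n → Fin n → Bool
  open Enumeration labelling public using () renaming (element to vertex)
  field
    reflects  : ∀ i j → Reflects (vertex i ~ vertex j) (entry i j)

module _ (𝒜 : CStarAlgebra) where
  open CStarAlgebra 𝒜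

  record IsQuantumPermutation {n} (u : Fin n → Fin n → Carrier) : Set where
    field
      self-adjoint : ∀ i j → u i j ≈ u i j ⋆
      idempotent   : ∀ i j → u i j ≈ u i j * u i j
      row-sum      : ∀ i → sum (λ k → u i k) ≈ 1#
      column-sum   : ∀ i → sum (λ k → u k i) ≈ 1#

  matrix : ∀ {n} → (Fin n → Fin n → Bool) → Fin n → Fin n → Carrier
  matrix A i j = if A i j then 1# else 0#

  infixl 7 _·_
  _·_ : ∀ {n} → (Fin n → Fin n → Carrier) → (Fin n → Fin n → Carrier) → Fin n → Fin n → Carrier
  (a · b) i j = sum (λ k → a i k * b k j)

-- The choice of labellings is immaterial: relabelling permutes the rows and
-- columns of u.
record QuantumIsomorphic (G H : Graph) : Set₁ where
  field
    n  : ℕ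
    A₁ : AdjacencyMatrix G n
    A₂ : AdjacencyMatrix H n
    𝒜  : CStarAlgebra
  open CStarAlgebra 𝒜 using (Carrier; _≈_)
  field
    u  : Fin n → Fin n → Carrier
    isQuantumPermutation : IsQuantumPermutation 𝒜 u
  private
    _∙_ = _·_ 𝒜
    M₁ = matrix 𝒜 (AdjacencyMatrix.entry A₁)
    M₂ = matrix 𝒜 (AdjacencyMatrix.entry A₂)
  field
    intertwines : ∀ i j → (M₁ ∙ u) i j ≈ (u ∙ M₂) i j

record IndependentSet (G : Graph) (k : ℕ) : Set where
  open Graph G
  field
    point       : Fin k → Vertex
    injective   : ∀ i j → point i ≈ point j → i ≡ j
    independent : ∀ i j → ¬ (point i ~ point j)

module _ {G : Graph} {k : ℕ} where
  open Graph G

  infix 4 _∈_ _≐_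
  _∈_ : Vertex → IndependentSet G k → Set
  v ∈ S = ∃[ i ] v ≈ IndependentSet.point S i

  _≐_ : Rel (IndependentSet G k) 0ℓ
  S ≐ T = ∀ v → v ∈ S ⇔ v ∈ T

------------------------------------------------------------------------
-- The graph of the E₈ root system

infix 7 _·ᶻ_
_·ᶻ_ : ∀ {n} → Vec ℤ n → Vec ℤ n → ℤ
x ·ᶻ y = Vec.foldr′ ℤ._+_ 0ℤ (zipWith ℤ._*_ x y)

±e : Sign → Fin 8 → Vec ℤ 8
±e s i = replicate 8 0ℤ [ i ]≔ (s ◃ 1)

data E₈Root : Vec ℤ 8 → Set where
  pair : ∀ i j → i Fin.< j → (s t : Sign) → E₈Root (zipWith ℤ._+_ (±e s i) (±e t j))
  spin : (s : Vec Sign 8) → Vec.foldr′ Sign._*_ Sign.+ s ≡ Sign.+ → E₈Root (Vec.map (_◃ 1) s)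

-ᵛ_ : ∀ {n} → Vec ℤ n → Vec ℤ n
-ᵛ_ = Vec.map (ℤ.-_)

private
  -ᵛ-involutive : ∀ {n} (x : Vec ℤ n) → -ᵛ (-ᵛ x) ≡ x
  -ᵛ-involutive []      = refl
  -ᵛ-involutive (a ∷ x) = cong₂ _∷_ (ℤ.neg-involutive a) (-ᵛ-involutive x)

  ·ᶻ-comm : ∀ {n} (x y : Vec ℤ n) → x ·ᶻ y ≡ y ·ᶻ x
  ·ᶻ-comm x y = cong (Vec.foldr′ ℤ._+_ 0ℤ) (Vec.zipWith-comm ℤ.*-comm x y)

  ·ᶻ-negˡ : ∀ {n} (x y : Vec ℤ n) → (-ᵛ x) ·ᶻ y ≡ ℤ.- (x ·ᶻ y)
  ·ᶻ-negˡ []      []      = refl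
  ·ᶻ-negˡ (a ∷ x) (b ∷ y) = trans
    (cong₂ ℤ._+_ (sym (ℤ.neg-distribˡ-* a b)) (·ᶻ-negˡ x y))
    (sym (ℤ.neg-distrib-+ (a ℤ.* b) (x ·ᶻ y)))

  negˡ-⊥ : ∀ {n} (x y : Vec ℤ n) → x ·ᶻ y ≡ 0ℤ → (-ᵛ x) ·ᶻ y ≡ 0ℤ
  negˡ-⊥ x y x⊥y = trans (·ᶻ-negˡ x y) (cong ℤ.-_ x⊥y)

  spin-norm : ∀ {n} (s : Vec Sign n) → Vec.map (_◃ 1) s ·ᶻ Vec.map (_◃ 1) s ≡ ℤ.+ n
  spin-norm []           = refl
  spin-norm (Sign.+ ∷ s) = cong (ℤ._+_ 1ℤ) (spin-norm s)
  spin-norm (Sign.- ∷ s) = cong (ℤ._+_ 1ℤ) (spin-norm s)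

  pair-norm : ∀ s t i j → i Fin.< j →
    zipWith ℤ._+_ (±e s i) (±e t j) ·ᶻ zipWith ℤ._+_ (±e s i) (±e t j) ≢ 0ℤ
  pair-norm s t = check s t
    where
    check? : ∀ s t → Dec (∀ i j → i Fin.< j →
      zipWith ℤ._+_ (±e s i) (±e t j) ·ᶻ zipWith ℤ._+_ (±e s i) (±e t j) ≢ 0ℤ)
    check? s t = all? λ i → all? λ j → (i Fin.<? j) →-dec ¬? (_ ℤ.≟ 0ℤ)
    check : ∀ s t i j → i Fin.< j →
      zipWith ℤ._+_ (±e s i) (±e t j) ·ᶻ zipWith ℤ._+_ (±e s i) (±e t j) ≢ 0ℤ
    check Sign.+ Sign.+ = from-yes (check? Sign.+ Sign.+)
    check Sign.+ Sign.- = from-yes (check? Sign.+ Sign.-)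
    check Sign.- Sign.+ = from-yes (check? Sign.- Sign.+)
    check Sign.- Sign.- = from-yes (check? Sign.- Sign.-)

root-anisotropic : ∀ {x} → E₈Root x → x ·ᶻ x ≢ 0ℤ
root-anisotropic (pair i j i<j s t) = pair-norm s t i j i<j
root-anisotropic (spin s _) eq with trans (sym (spin-norm s)) eq
... | ()

G-E₈ : Graph
G-E₈ = record
  { vertices = record
    { Carrier = Σ[ x ∈ Vec ℤ 8 ] E₈Root x
    ; _≈_     = λ (x , _) (y , _) → y ≡ x ⊎ y ≡ -ᵛ x
    ; isEquivalence = record
      { refl  = inj₁ refl
      ; sym   = λ { (inj₁ refl) → inj₁ refl
                  ; {x , _} (inj₂ refl) → inj₂ (sym (-ᵛ-involutive x)) }
      ; trans = λ { (inj₁ refl) y≈z → y≈z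
                  ; (inj₂ refl) (inj₁ refl) → inj₂ refl
                  ; {x , _} (inj₂ refl) (inj₂ refl) → inj₁ (-ᵛ-involutive x) }
      }
    }
  ; _~_      = λ (x , _) (y , _) → x ·ᶻ y ≡ 0ℤ
  ; ~-resp   = λ {u} {u′} {v} {v′} u≈ v≈ u⊥v →
      ⊥-sym (proj₁ v′) (proj₁ u′) (resp v≈ (⊥-sym (proj₁ u′) (proj₁ v) (resp u≈ u⊥v)))
  ; ~-sym    = λ {u} {v} → ⊥-sym (proj₁ u) (proj₁ v)
  ; ~-irrefl = λ {v} → root-anisotropic (proj₂ v)
  }
  where
  ⊥-sym : ∀ (x y : Vec ℤ 8) → x ·ᶻ y ≡ 0ℤ → y ·ᶻ x ≡ 0ℤ
  ⊥-sym x y = trans (·ᶻ-comm y x)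
  resp : ∀ {x x′ y : Vec ℤ 8} → x′ ≡ x ⊎ x′ ≡ -ᵛ x → x ·ᶻ y ≡ 0ℤ → x′ ·ᶻ y ≡ 0ℤ
  resp (inj₁ refl) x⊥y = x⊥y
  resp {x} {y = y} (inj₂ refl) x⊥y = negˡ-⊥ x y x⊥y

------------------------------------------------------------------------
-- The folded halved 8-cube

-- 𝔽₂ⁿ, with true for 1.
Word : ℕ → Set
Word = Vec Bool

infixl 6 _⊕_
_⊕_ : ∀ {n} → Word n → Word n → Word n
_⊕_ = zipWith _xor_

𝟎 𝟏 : ∀ {n} → Word n
𝟎 = replicate _ false
𝟏 = replicate _ true

EvenWeight : ∀ {n} → Word n → Set
EvenWeight x = Vec.foldr′ _xor_ false x ≡ false

weight : ∀ {n} → Word n → ℕ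
weight = Vec.count (Bool._≟ true)

infix 4 _≋_
_≋_ : ∀ {n} → Rel (Word n) 0ℓ
x ≋ y = y ≡ x ⊎ y ≡ 𝟏 ⊕ x

private
  ⊕-comm : ∀ {n} (x y : Word n) → x ⊕ y ≡ y ⊕ x
  ⊕-comm = Vec.zipWith-comm Bool.xor-comm

  ⊕-assoc : ∀ {n} (x y z : Word n) → (x ⊕ y) ⊕ z ≡ x ⊕ (y ⊕ z)
  ⊕-assoc = Vec.zipWith-assoc Bool.xor-assoc

  ⊕-self : ∀ {n} (x : Word n) → x ⊕ x ≡ 𝟎
  ⊕-self []      = refl
  ⊕-self (b ∷ x) = cong₂ _∷_ (Bool.xor-same b) (⊕-self x)

  𝟏⊕𝟏⊕ : ∀ {n} (x : Word n) → 𝟏 ⊕ (𝟏 ⊕ x) ≡ x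
  𝟏⊕𝟏⊕ x = trans (sym (⊕-assoc 𝟏 𝟏 x))
    (trans (cong (_⊕ x) (⊕-self 𝟏)) (Vec.zipWith-identityˡ Bool.xor-identityˡ x))

≋-isEquivalence : ∀ {n} → IsEquivalence (_≋_ {n})
≋-isEquivalence = record
  { refl  = inj₁ refl
  ; sym   = λ { (inj₁ refl) → inj₁ refl ; {x} (inj₂ refl) → inj₂ (sym (𝟏⊕𝟏⊕ x)) }
  ; trans = λ { (inj₁ refl) y≋z → y≋z
              ; (inj₂ refl) (inj₁ refl) → inj₂ refl
              ; {x} (inj₂ refl) (inj₂ refl) → inj₁ (𝟏⊕𝟏⊕ x) }
  }

foldedHalved8Cube : Graph
foldedHalved8Cube = record
  { vertices = record
    { Carrier = Σ[ x ∈ Word 8 ] EvenWeight x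
    ; _≈_     = λ (x , _) (y , _) → x ≋ y
    ; isEquivalence = record
      { refl = ≋.refl ; sym = ≋.sym ; trans = ≋.trans }
    }
  ; _~_      = λ (x , _) (y , _) → Adj x y
  ; ~-resp   = λ {u} {u′} {v} {v′} u≈ v≈ u~v →
      Adj-sym (proj₁ v′) (proj₁ u′) (resp v≈ (Adj-sym (proj₁ u′) (proj₁ v) (resp u≈ u~v)))
  ; ~-sym    = λ {u} {v} → Adj-sym (proj₁ u) (proj₁ v)
  ; ~-irrefl = λ {v} → Adj-irrefl (proj₁ v)
  }
  where
  module ≋ = IsEquivalence (≋-isEquivalence {8})
  Adj : Rel (Word 8) 0ℓ
  Adj x y = weight (x ⊕ y) ≡ 2 ⊎ weight (x ⊕ y ⊕ 𝟏) ≡ 2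
  Adj-sym : ∀ x y → Adj x y → Adj y x
  Adj-sym x y = subst (λ t → weight t ≡ 2 ⊎ weight (t ⊕ 𝟏) ≡ 2) (⊕-comm x y)
  resp : ∀ {x x′ y} → x ≋ x′ → Adj x y → Adj x′ y
  resp (inj₁ refl) adj = adj
  resp {x} {_} {y} (inj₂ refl) (inj₁ p) = inj₂ (subst (λ t → weight t ≡ 2) (sym eq) p)
    where
    eq : (𝟏 ⊕ x) ⊕ y ⊕ 𝟏 ≡ x ⊕ y
    eq = trans (⊕-comm ((𝟏 ⊕ x) ⊕ y) 𝟏) (trans (cong (𝟏 ⊕_) (⊕-assoc 𝟏 x y)) (𝟏⊕𝟏⊕ (x ⊕ y)))
  resp {x} {_} {y} (inj₂ refl) (inj₂ p) = inj₁ (subst (λ t → weight t ≡ 2) (sym eq) p)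
    where
    eq : (𝟏 ⊕ x) ⊕ y ≡ x ⊕ y ⊕ 𝟏
    eq = trans (⊕-assoc 𝟏 x y) (⊕-comm 𝟏 (x ⊕ y))
  Adj-irrefl : ∀ x → ¬ Adj x x
  Adj-irrefl x adj with subst (λ t → weight t ≡ 2 ⊎ weight (t ⊕ 𝟏) ≡ 2) (⊕-self x) adj
  ... | inj₁ ()
  ... | inj₂ ()

------------------------------------------------------------------------
-- The graph Γ₁

Coclique : Set
Coclique = IndependentSet foldedHalved8Cube 8

-- An example: the eight complementary pairs of words of the extended
-- Hamming code.
hammingCoclique : Coclique
hammingCoclique = record
  { point       = point
  ; injective   = from-yes (all? λ i → all? λ j →
      (proj₁ (point i) ≋? proj₁ (point j)) →-dec (i Fin.≟ j))
  ; independent = from-yes (all? λ i → all? λ j →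
      ¬? ((weight (proj₁ (point i) ⊕ proj₁ (point j)) ℕ.≟ 2)
        ⊎-dec (weight (proj₁ (point i) ⊕ proj₁ (point j) ⊕ 𝟏) ℕ.≟ 2)))
  }
  where
  O I : Bool
  O = false
  I = true
  _≋?_ : ∀ (x y : Word 8) → Dec (x ≋ y)
  x ≋? y = Vec.≡-dec Bool._≟_ y x ⊎-dec Vec.≡-dec Bool._≟_ y (𝟏 ⊕ x)
  point : Fin 8 → Σ[ x ∈ Word 8 ] EvenWeight x
  point = Vec.lookup
    ( ((O ∷ O ∷ O ∷ O ∷ O ∷ O ∷ O ∷ O ∷ []) , refl)
    ∷ ((O ∷ O ∷ O ∷ O ∷ I ∷ I ∷ I ∷ I ∷ []) , refl)
    ∷ ((O ∷ O ∷ I ∷ I ∷ O ∷ O ∷ I ∷ I ∷ []) , refl)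
    ∷ ((O ∷ O ∷ I ∷ I ∷ I ∷ I ∷ O ∷ O ∷ []) , refl)
    ∷ ((O ∷ I ∷ O ∷ I ∷ O ∷ I ∷ O ∷ I ∷ []) , refl)
    ∷ ((O ∷ I ∷ O ∷ I ∷ I ∷ O ∷ I ∷ O ∷ []) , refl)
    ∷ ((O ∷ I ∷ I ∷ O ∷ O ∷ I ∷ I ∷ O ∷ []) , refl)
    ∷ ((O ∷ I ∷ I ∷ O ∷ I ∷ O ∷ O ∷ I ∷ []) , refl)
    ∷ [])

_∈ʷ_ : Word 8 → Coclique → Set
x ∈ʷ S = ∃[ i ] x ≋ proj₁ (IndependentSet.point S i)

-- For a bijection f of 𝔽₂⁸ compatible with x ↦ 𝟏 + x this says T = f(S).
_maps_onto_ : (Word 8 → Word 8) → Coclique → Coclique → Set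
f maps S onto T = ∀ x → x ∈ʷ S ⇔ f x ∈ʷ T

-- Products of an even number of transpositions.  The library allows the
-- trivial "transposition" of i with i, which must be excluded.
EvenPermutation : ∀ {n} → Permutation′ n → Set
EvenPermutation {n} π = Σ[ ts ∈ Transpositions.TranspositionList n ]
  All (λ (i , j) → i ≢ j) ts × 2 ∣ List.length ts × π Perm.≈ Transpositions.eval ts

permute : ∀ {n} → Permutation′ n → Word n → Word n
permute π x = Vec.tabulate (λ i → Vec.lookup x (π ⟨$⟩ʳ i))

-- The action of the generators of ℤ₂⁶ ⋊ A₈ on the independent sets.
data _↝_ (S T : Coclique) : Set where
  translation : ∀ t → EvenWeight t → (t ⊕_) maps S onto T → S ↝ T
  permutation : ∀ π → EvenPermutation π → permute π maps S onto T → S ↝ T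

InOrbitOf : Coclique → Pred Coclique 0ℓ
InOrbitOf S T = Star _↝_ S T

-- There are 240 cocliques of size 8, in two orbits of size 120 interchanged by
-- the odd permutations of the coordinates; S₀ selects the orbit.
Γ₁ : Coclique → Graph
Γ₁ S₀ = record
  { vertices = record
    { Carrier = ∃ (InOrbitOf S₀)
    ; _≈_     = λ (S , _) (T , _) → S ≐ T
    ; isEquivalence = record
      { refl  = λ _ → ⇔.refl
      ; sym   = λ S≐T v → ⇔.sym (S≐T v)
      ; trans = λ S≐T T≐R v → ⇔.trans (S≐T v) (T≐R v)
      }
    }
  ; _~_      = λ (S , _) (T , _) → MeetInTwo S T
  ; ~-resp   = λ S≐ T≐ → Enumeration-resp λ v → mk⇔
      (λ (v∈S , v∈T) → Equivalence.to (S≐ v) v∈S , Equivalence.to (T≐ v) v∈T)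
      (λ (v∈S , v∈T) → Equivalence.from (S≐ v) v∈S , Equivalence.from (T≐ v) v∈T)
  ; ~-sym    = Enumeration-resp λ _ → mk⇔ swap swap
  ; ~-irrefl = λ {S} → irrefl (proj₁ S)
  }
  where
  open Graph foldedHalved8Cube using (vertices)
  module V = Setoid vertices
  MeetInTwo : Rel Coclique 0ℓ
  MeetInTwo S T = Enumeration vertices (λ v → v ∈ S × v ∈ T) 2
  irrefl : ∀ S → ¬ MeetInTwo S S
  irrefl S e = contradiction (Fin.injective⇒≤ {f = f} f-injective) λ { (ℕ.s≤s (ℕ.s≤s ())) }
    where
    open IndependentSet S
    open Enumeration e using (exhaustive)
    covered : ∀ i → ∃[ j ] point i V.≈ Enumeration.element e j
    covered i = exhaustive (point i) ((i , V.refl {point i}) , (i , V.refl {point i}))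
    f : Fin 8 → Fin 2
    f i = proj₁ (covered i)
    f-injective : ∀ {i j} → f i ≡ f j → i ≡ j
    f-injective {i} {j} eq = injective i j
      (V.trans {point i} {Enumeration.element e (f j)} {point j}
        (subst (λ k → point i V.≈ Enumeration.element e k) eq (proj₂ (covered i)))
        (V.sym {point j} {Enumeration.element e (f j)} (proj₂ (covered j))))

module Submission where

-- Both graphs live on the pairs (u , f) of a nonzero u ∈ 𝔽₂⁴ and a covector f with f(u) = b.
-- For b = 1, distinct pairs being adjacent iff f(v) + g(u) = 0, this is the orthogonality graph of
-- E₈/2E₈, i.e. G_E₈.  For b = 0, pairs being adjacent iff f(v) + g(u) = 1 (or u = v and f ≠ g), it is
-- the complement of Γ₁: by the Klein correspondence an even word modulo 𝟏 is an alternating form ω on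
-- 𝔽₂⁴, its weight modulo 4 is given by the Pfaffian, and the cocliques of one orbit are the cosets
-- {ω | ω u = h}; those of the other orbit come from the other class of totally singular subspaces.
-- A transposition of coordinates is a reflection and swaps the classes, so even permutations keep them.
--
-- The eight lines (u , f) with fixed u form an orthogonal basis of ℝ⁸.  The quantum permutation sends
-- (u , f) to (u , h) with the projection onto the line (u , f + h).  Its rows and columns sum to 1
-- because these lines form a basis, and the intertwining relation holds because complementary partial
-- sums of a row and a column are orthogonal.
--
-- Both graphs have parameters (120 , 63 , 30 , 36).  They are told apart by the third root on the plane
-- of two non-orthogonal roots: it is orthogonal to every root orthogonal to both, and no vertex of the
-- complement of Γ₁ plays that role for a suitable non-edge.
--
-- M₈(ℂ) is realised constructively as the commutant of a complex structure on ℝ¹⁶.  Its norm is the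
-- operator norm of real matrices: for a rational matrix A the inequality |Av|² ≤ r²|v|² is decidable,
-- since semidefiniteness of a rational quadratic form is, so the norm of A can be located to any
-- precision by search.  All norm axioms follow from |av|² ≤ ‖a‖²|v|² and from
-- "s|av|² ≤ t|v|² for all v implies s‖a‖² ≤ t".

module StronglyRegularGraphs where

  open import Defs
  open import Data.Bool.Base using (Bool; _∧_; false; if_then_else_; not; true)
  import Data.Bool.Properties as Bool
  open import Data.Fin.Base as Fin using (Fin; suc; zero)
  import Data.Fin.Properties as Fin
  open import Data.Nat.Base as ℕ using (NonZero; _*_; _+_; _<_; _≤_; suc; zero; ℕ)
  import Data.Nat.DivMod as ℕ
  import Data.Nat.Properties as ℕ
  open import Data.Nat.Solver using (module +-*-Solver)
  open import Data.Product.Base using (_,_; _×_; proj₁; proj₂; ∃-syntax)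
  open import Data.Unit.Base using (tt)
  open import Data.Vec.Base as Vec using (Vec; []; _∷_; lookup)
  import Data.Vec.Properties as Vec
  open import Function.Base using (_∘_)
  open import Relation.Binary.Bundles using (Setoid)
  open import Relation.Binary.PropositionalEquality
  open import Relation.Nullary using (contradiction; no; yes; ¬_)
  open import Relation.Nullary.Reflects using (Reflects; invert; ofʸ; ofⁿ)
  open import Relation.Unary using (Pred; U)

  holds : ∀ {p} {P : Set p} {b} → Reflects P b → b ≡ true → P
  holds (ofʸ p) refl = p

  true-of : ∀ {p} {P : Set p} {b} → Reflects P b → P → b ≡ true
  true-of (ofʸ _)  _ = refl
  true-of (ofⁿ ¬p) p = contradiction p ¬p

  false-of : ∀ {p} {P : Set p} {b} → Reflects P b → ¬ P → b ≡ false
  false-of (ofʸ p) ¬p = contradiction p ¬p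
  false-of (ofⁿ _) _  = refl

  private
    select-step : ∀ {m n} (b : Bool) → (Fin m → Fin n) → Fin (if b then suc m else m) → Fin (suc n)
    select-step true  s zero    = zero
    select-step true  s (suc k) = suc (s k)
    select-step false s k       = suc (s k)

  -- Opaque, so that conversion checking does not unroll count {120}.
  opaque
    count : ∀ {n} → (Fin n → Bool) → ℕ
    count {zero}  p = 0
    count {suc n} p = if p zero then suc (count (p ∘ suc)) else count (p ∘ suc)

    select : ∀ {n} (p : Fin n → Bool) → Fin (count p) → Fin n
    select {suc n} p = select-step (p zero) (select (p ∘ suc))

    select-sound : ∀ {n} (p : Fin n → Bool) k → p (select p k) ≡ true
    select-sound {suc n} p = step (p zero) refl
      where
      step : ∀ b → p zero ≡ b → ∀ k → p (select-step b (select (p ∘ suc)) k) ≡ true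
      step true  eq zero    = eq
      step true  eq (suc k) = select-sound (p ∘ suc) k
      step false eq k       = select-sound (p ∘ suc) k

    select-injective : ∀ {n} (p : Fin n → Bool) k l → select p k ≡ select p l → k ≡ l
    select-injective {suc n} p = step (p zero)
      where
      step : ∀ b k l → select-step b (select (p ∘ suc)) k ≡ select-step b (select (p ∘ suc)) l → k ≡ l
      step true  zero    zero    _  = refl
      step true  (suc k) (suc l) eq = cong suc (select-injective (p ∘ suc) k l (Fin.suc-injective eq))
      step false k       l       eq = select-injective (p ∘ suc) k l (Fin.suc-injective eq)

    select-exhaustive : ∀ {n} (p : Fin n → Bool) i → p i ≡ true → ∃[ k ] i ≡ select p k
    select-exhaustive {suc n} p i pi = step (p zero) refl i pi
      where
      step : ∀ b → p zero ≡ b → ∀ i → p i ≡ true → ∃[ k ] i ≡ select-step b (select (p ∘ suc)) k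
      step true  eq zero    _  = zero , refl
      step false eq zero    pi with trans (sym eq) pi
      ... | ()
      step true  eq (suc i) pi = let k , i≡ = select-exhaustive (p ∘ suc) i pi in suc k , cong suc i≡
      step false eq (suc i) pi = let k , i≡ = select-exhaustive (p ∘ suc) i pi in k , cong suc i≡

    count-cong : ∀ {n} {p q : Fin n → Bool} → (∀ k → p k ≡ q k) → count p ≡ count q
    count-cong {zero}  _  = refl
    count-cong {suc n} eq = cong₂ (λ b c → if b then suc c else c) (eq zero) (count-cong (eq ∘ suc))

    count-≤ : ∀ {n} (p : Fin n → Bool) → count p ≤ n
    count-≤ {zero}  p = ℕ.z≤n
    count-≤ {suc n} p with p zero
    ... | true  = ℕ.s≤s (count-≤ (p ∘ suc))
    ... | false = ℕ.m≤n⇒m≤1+n (count-≤ (p ∘ suc))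

  module _ {c ℓ} {S : Setoid c ℓ} where
    open Setoid S using (Carrier; _≈_) renaming (sym to ≈-sym; trans to ≈-trans)

    subEnumeration : ∀ {p n m} {P : Pred Carrier p} (e : Enumeration S U n) (b : Fin n → Bool) →
      (∀ i → Reflects (P (Enumeration.element e i)) (b i)) → (∀ {x y} → x ≈ y → P x → P y) →
      count b ≡ m → Enumeration S P m
    subEnumeration {P = P} e b reflects resp refl = record
      { element    = element ∘ select b
      ; sound      = λ k → invert (subst (Reflects _) (select-sound b k) (reflects (select b k)))
      ; injective  = λ k l → select-injective b k l ∘ injective _ _
      ; exhaustive = λ x Px → let i , x≈ = exhaustive x tt
                                  k , i≡ = select-exhaustive b i (true-of (reflects i) (resp x≈ Px))
                              in k , subst (λ t → x ≈ element t) i≡ x≈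
      }
      where
      open Enumeration e

    saturated : ∀ {p n} {P : Pred Carrier p} → Enumeration S P n → (∀ x y → x ≈ y → P x → P y) →
      (f : Fin n → Carrier) → (∀ i → P (f i)) → (∀ i j → f i ≈ f j → i ≡ j) →
      ∀ x → P x → ∃[ i ] x ≈ f i
    saturated {n = n} e resp f f∈P f-injective x Px with Enumeration.exhaustive e x Px
    ... | k , x≈k with Fin.any? (λ i → proj₁ (Enumeration.exhaustive e (f i) (f∈P i)) Fin.≟ k)
    ... | yes (i , refl) = i , ≈-trans x≈k (≈-sym (proj₂ (Enumeration.exhaustive e (f i) (f∈P i))))
    ... | no  missed     = contradiction (Fin.injective⇒≤ g-injective) ℕ.1+n≰n
      where
      module E = Enumeration e
      image : ∀ i → ∃[ k ] f i ≈ E.element k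
      image i = E.exhaustive (f i) (f∈P i)
      g : Fin (suc n) → Fin n
      g zero    = k
      g (suc i) = proj₁ (image i)
      g-injective : ∀ {i j} → g i ≡ g j → i ≡ j
      g-injective {zero}  {zero}  _  = refl
      g-injective {zero}  {suc j} eq = contradiction (j , sym eq) missed
      g-injective {suc i} {zero}  eq = contradiction (i , eq) missed
      g-injective {suc i} {suc j} eq = cong suc (f-injective i j (≈-trans (proj₂ (image i))
        (subst (λ t → E.element t ≈ f j) (sym eq) (≈-sym (proj₂ (image j))))))

  bit : Bool → ℕ
  bit b = if b then 1 else 0

  common : ∀ {n} → (Fin n → Fin n → Bool) → Fin n → Fin n → ℕ
  common a i j = count (λ k → a i k ∧ a j k)

  module _ {G : Graph} where
    open Graph G

    stronglyRegular : ∀ {n k l m} (A : AdjacencyMatrix G n) → let open AdjacencyMatrix A in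
      (∀ i → common entry i i ≡ k) →
      (∀ i j → i ≢ j → common entry i j ≡ (if entry i j then l else m)) →
      IsSRG G n k l m
    stronglyRegular {k = k} {l} {m} A diagonal off-diagonal = record
      { order        = labelling
      ; regular      = λ u → let i , u≈ = exhaustive u tt in
          Enumeration-resp (λ w → ⇔-both (u≈ , V.refl) )
            (subEnumeration labelling (λ j → entry i j ∧ entry i j) (λ j → both (reflects i j) (reflects i j))
              (λ w≈ (p , q) → ~-resp V.refl w≈ p , ~-resp V.refl w≈ q) (diagonal i))
      ; adjacent     = λ u v u~v →
          let i , u≈ = exhaustive u tt
              j , v≈ = exhaustive v tt
              i~j    = ~-resp u≈ v≈ u~v
          in neighbours u≈ v≈ (trans (off-diagonal i j (λ i≡j → ~-irrefl (subst (λ t → vertex i ~ vertex t) (sym i≡j) i~j)))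
               (cong (if_then l else m) (true-of (reflects i j) i~j)))
      ; non-adjacent = λ u v u≉v u≁v →
          let i , u≈ = exhaustive u tt
              j , v≈ = exhaustive v tt
          in neighbours u≈ v≈ (trans (off-diagonal i j (λ i≡j → u≉v (V.trans u≈ (V.sym (subst (λ t → v ≈ vertex t) (sym i≡j) v≈)))))
               (cong (if_then l else m) (false-of (reflects i j) (u≁v ∘ ~-resp (V.sym u≈) (V.sym v≈)))))
      }
      where
      open AdjacencyMatrix A
      open Enumeration labelling using (exhaustive)
      open import Function.Bundles using (_⇔_; mk⇔)
      module V = Setoid vertices

      both : ∀ {P Q : Set} {p q} → Reflects P p → Reflects Q q → Reflects (P × Q) (p ∧ q)
      both (ofʸ p)  (ofʸ q)  = ofʸ (p , q)
      both (ofʸ p)  (ofⁿ ¬q) = ofⁿ (¬q ∘ proj₂)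
      both (ofⁿ ¬p) _        = ofⁿ (¬p ∘ proj₁)

      ⇔-both : ∀ {u i w} → u ≈ vertex i × (w ≈ w) → (vertex i ~ w × vertex i ~ w) ⇔ (u ~ w)
      ⇔-both (u≈ , w≈) = mk⇔ (λ (p , _) → ~-resp (V.sym u≈) w≈ p)
                             (λ p → ~-resp u≈ w≈ p , ~-resp u≈ w≈ p)

      neighbours : ∀ {u v i j c} → u ≈ vertex i → v ≈ vertex j → common entry i j ≡ c →
        Enumeration vertices (λ w → u ~ w × v ~ w) c
      neighbours {i = i} {j} u≈ v≈ eq =
        Enumeration-resp (λ w → mk⇔ (λ (p , q) → ~-resp (V.sym u≈) V.refl p , ~-resp (V.sym v≈) V.refl q)
                                     (λ (p , q) → ~-resp u≈ V.refl p , ~-resp v≈ V.refl q))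
          (subEnumeration labelling (λ k → entry i k ∧ entry j k) (λ k → both (reflects i k) (reflects j k))
            (λ w≈ (p , q) → ~-resp V.refl w≈ p , ~-resp V.refl w≈ q) eq)

  allVec : ∀ {a} {A : Set a} {n} → (Fin n → A → Bool) → Vec A n → Bool
  allVec f []       = true
  allVec f (x ∷ xs) = if f zero x then allVec (f ∘ suc) xs else false

  allVec-sound : ∀ {a} {A : Set a} {n} (f : Fin n → A → Bool) xs → allVec f xs ≡ true →
    ∀ i → f i (lookup xs i) ≡ true
  allVec-sound f (x ∷ xs) eq i with f zero x in eq₀ | i
  ... | true | zero   = eq₀
  ... | true | suc i′ = allVec-sound (f ∘ suc) xs eq i′
  allVec-sound f (x ∷ xs) () i | false | _

  -- The square of a 0/1 matrix is computed on rows packed into single numbers in base B,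
  -- so that a sum of rows costs one addition per row.
  module Packed (B : ℕ) .{{_ : NonZero B}} where

    pack : ∀ {n} → Vec ℕ n → ℕ
    pack []       = 0
    pack (d ∷ ds) = d + B * pack ds

    pack-injective : ∀ {n} (ds es : Vec ℕ n) → (∀ i → lookup ds i < B) → (∀ i → lookup es i < B) →
      pack ds ≡ pack es → ds ≡ es
    pack-injective []       []       _  _  _  = refl
    pack-injective (d ∷ ds) (e ∷ es) d< e< eq = cong₂ _∷_ d≡e
      (pack-injective ds es (d< ∘ suc) (e< ∘ suc)
        (ℕ.*-cancelˡ-≡ _ _ B (ℕ.+-cancelˡ-≡ d _ _ (trans eq (cong (_+ B * pack es) (sym d≡e))))))
      where
      digit : ∀ d p → d < B → (d + B * p) ℕ.% B ≡ d
      digit d p d<B = trans (cong (λ t → (d + t) ℕ.% B) (ℕ.*-comm B p))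
        (trans (ℕ.[m+kn]%n≡m%n d p B) (ℕ.m<n⇒m%n≡m d<B))
      d≡e : d ≡ e
      d≡e = trans (sym (digit d _ (d< zero))) (trans (cong (ℕ._% B) eq) (digit e _ (e< zero)))

    combine : ∀ {n} → Vec Bool n → Vec ℕ n → ℕ
    combine []          []       = 0
    combine (true ∷ p)  (e ∷ es) = e + combine p es
    combine (false ∷ p) (e ∷ es) = combine p es

    combine-rows : ∀ {m n} → Vec Bool m → Vec (Vec ℕ n) m → Vec ℕ n
    combine-rows []          []       = Vec.replicate _ 0
    combine-rows (true ∷ p)  (r ∷ rs) = Vec.zipWith _+_ r (combine-rows p rs)
    combine-rows (false ∷ p) (r ∷ rs) = combine-rows p rs

    pack-0 : ∀ n → pack (Vec.replicate n 0) ≡ 0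
    pack-0 zero    = refl
    pack-0 (suc n) = trans (cong (B *_) (pack-0 n)) (ℕ.*-zeroʳ B)

    pack-+ : ∀ {n} (ds es : Vec ℕ n) → pack (Vec.zipWith _+_ ds es) ≡ pack ds + pack es
    pack-+ []       []       = refl
    pack-+ (d ∷ ds) (e ∷ es) = trans (cong (λ t → d + e + B * t) (pack-+ ds es))
      (solve 5 (λ d e b x y → d :+ e :+ b :* (x :+ y) := d :+ b :* x :+ (e :+ b :* y)) refl
        d e B (pack ds) (pack es))
      where open +-*-Solver

    combine-pack : ∀ {m n} (p : Vec Bool m) (rs : Vec (Vec ℕ n) m) →
      combine p (Vec.map pack rs) ≡ pack (combine-rows p rs)
    combine-pack {n = n} [] [] = sym (pack-0 n)
    combine-pack (true ∷ p) (r ∷ rs) =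
      trans (cong (pack r +_) (combine-pack p rs)) (sym (pack-+ r _))
    combine-pack (false ∷ p) (r ∷ rs) = combine-pack p rs

    opaque
      unfolding count
      lookup-combine-rows : ∀ {m n} (p : Vec Bool m) (rs : Vec (Vec Bool n) m) j →
        lookup (combine-rows p (Vec.map (Vec.map bit) rs)) j ≡
        count (λ k → lookup p k ∧ lookup (lookup rs k) j)
      lookup-combine-rows [] [] j = Vec.lookup-replicate j 0
      lookup-combine-rows (true ∷ p) (r ∷ rs) j = trans
        (Vec.lookup-zipWith _+_ j (Vec.map bit r) _)
        (trans (cong₂ _+_ (Vec.lookup-map j bit r) (lookup-combine-rows p rs j)) (step (lookup r j)))
        where
        step : ∀ b {c} → bit b + c ≡ (if b then suc c else c)
        step true  = refl
        step false = refl
      lookup-combine-rows (false ∷ p) (r ∷ rs) j = lookup-combine-rows p rs j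

    expected : ∀ {n} (k l m : ℕ) → Fin n → Vec Bool n → Vec ℕ n
    expected k l m zero    (_ ∷ bs) = k ∷ Vec.map (if_then l else m) bs
    expected k l m (suc i) (b ∷ bs) = (if b then l else m) ∷ expected k l m i bs

    lookup-expected-diagonal : ∀ {n k l m} (i : Fin n) bs → lookup (expected k l m i bs) i ≡ k
    lookup-expected-diagonal zero    (_ ∷ _)  = refl
    lookup-expected-diagonal (suc i) (_ ∷ bs) = lookup-expected-diagonal i bs

    lookup-expected : ∀ {n k l m} (i j : Fin n) bs → i ≢ j →
      lookup (expected k l m i bs) j ≡ (if lookup bs j then l else m)
    lookup-expected zero    zero    _        i≢j = contradiction refl i≢j
    lookup-expected zero    (suc j) (_ ∷ bs) _   = Vec.lookup-map j _ bs
    lookup-expected (suc i) zero    (_ ∷ _)  _   = refl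
    lookup-expected (suc i) (suc j) (_ ∷ bs) i≢j = lookup-expected i j bs (i≢j ∘ cong suc)

    square-test : ∀ {n} → ℕ → ℕ → ℕ → Vec (Vec Bool n) n → Bool
    square-test k l m t = go (Vec.map (pack ∘ Vec.map bit) t)
      where
      go : Vec ℕ _ → Bool
      go packed = allVec (λ i r → combine r packed ℕ.≡ᵇ pack (expected k l m i r)) t

  module _ where
    open Packed

    square-test-sound : ∀ {n} B .{{_ : NonZero B}} {k l m} (t : Vec (Vec Bool n) n) →
      n < B → k < B → l < B → m < B → square-test B k l m t ≡ true → ∀ i j →
      count (λ h → lookup (lookup t i) h ∧ lookup (lookup t h) j) ≡
      lookup (expected B k l m i (lookup t i)) j
    square-test-sound {n} B {k} {l} {m} t n< k< l< m< eq i j = trans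
      (sym (lookup-combine-rows B (lookup t i) t j))
      (cong (λ v → lookup v j) (pack-injective B
        (combine-rows B (lookup t i) (Vec.map (Vec.map bit) t)) (expected B k l m i (lookup t i))
        (λ h → ℕ.≤-<-trans (subst (_≤ n) (sym (lookup-combine-rows B (lookup t i) t h)) (count-≤ _)) n<)
        (expected< i (lookup t i))
        (trans (sym (combine-pack B (lookup t i) (Vec.map (Vec.map bit) t)))
          (trans (cong (combine B (lookup t i)) (sym (Vec.map-∘ (pack B) (Vec.map bit) t)))
            (ℕ.≡ᵇ⇒≡ _ _ (subst Data.Bool.Base.T (sym (allVec-sound _ t eq i)) tt))))))
      where
      value< : ∀ b → (if b then l else m) < B
      value< true  = l<
      value< false = m<
      expected< : ∀ {n} (i : Fin n) bs j → lookup (expected B k l m i bs) j < B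
      expected< zero    (_ ∷ _)  zero    = k<
      expected< zero    (_ ∷ bs) (suc j) = subst (_< B) (sym (Vec.lookup-map j _ bs)) (value< _)
      expected< (suc i) (b ∷ _)  zero    = value< b
      expected< (suc i) (_ ∷ bs) (suc j) = expected< i bs j

module Flags where

  open import Defs
  open import Data.Bool.Base using (Bool; _xor_; _∧_; false; if_then_else_; not; true)
  import Data.Bool.Properties as Bool
  open import Data.Fin.Base as Fin using (Fin; combine; remQuot; suc; zero)
  import Data.Fin.Properties as Fin
  open import Data.Nat.Base as ℕ using (suc; zero; ℕ)
  import Data.Nat.Properties as ℕ
  open import Data.Product.Base using (_,_; _×_; proj₁; proj₂; uncurry; ∃-syntax)
  open import Data.Vec.Base as Vec using (Vec; []; _∷_; lookup; tabulate)
  import Data.Vec.Properties as Vec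
  open import Function.Base using (_∘_)
  open import Relation.Binary.Definitions using (DecidableEquality)
  open import Relation.Binary.PropositionalEquality
  open import Relation.Nullary using (Dec; contradiction)
  open import Relation.Nullary.Decidable using (_×-dec_; _→-dec_; from-yes; map′; ¬?)
  open import Relation.Nullary.Reflects using (Reflects; ofʸ; ofⁿ)
  open StronglyRegularGraphs

  dot : ∀ {n} → Word n → Word n → Bool
  dot []      []      = false
  dot (a ∷ x) (b ∷ y) = (a ∧ b) xor dot x y

  xor-medial : ∀ a b c d → (a xor b) xor (c xor d) ≡ (a xor c) xor (b xor d)
  xor-medial false b c d = begin
    b xor (c xor d) ≡⟨ Bool.xor-assoc b c d ⟨
    (b xor c) xor d ≡⟨ cong (_xor d) (Bool.xor-comm b c) ⟩
    (c xor b) xor d ≡⟨ Bool.xor-assoc c b d ⟩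
    c xor (b xor d) ∎
    where open ≡-Reasoning
  xor-medial true false c d = Bool.not-distribˡ-xor c d
  xor-medial true true false d = sym (Bool.not-involutive d)
  xor-medial true true true  d = refl

  dot-comm : ∀ {n} (x y : Word n) → dot x y ≡ dot y x
  dot-comm []      []      = refl
  dot-comm (a ∷ x) (b ∷ y) = cong₂ _xor_ (Bool.∧-comm a b) (dot-comm x y)

  dot-⊕ʳ : ∀ {n} (x y z : Word n) → dot x (y ⊕ z) ≡ dot x y xor dot x z
  dot-⊕ʳ []      []      []      = refl
  dot-⊕ʳ (a ∷ x) (b ∷ y) (c ∷ z) = trans
    (cong₂ _xor_ (Bool.∧-distribˡ-xor a b c) (dot-⊕ʳ x y z))
    (xor-medial (a ∧ b) (a ∧ c) (dot x y) (dot x z))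

  dot-⊕ˡ : ∀ {n} (x y z : Word n) → dot (x ⊕ y) z ≡ dot x z xor dot y z
  dot-⊕ˡ x y z = trans (dot-comm (x ⊕ y) z) (trans (dot-⊕ʳ z x y) (cong₂ _xor_ (dot-comm z x) (dot-comm z y)))

  dot-𝟎ˡ : ∀ {n} (x : Word n) → dot 𝟎 x ≡ false
  dot-𝟎ˡ []      = refl
  dot-𝟎ˡ (_ ∷ x) = dot-𝟎ˡ x

  ⊕-comm : ∀ {n} (x y : Word n) → x ⊕ y ≡ y ⊕ x
  ⊕-comm = Vec.zipWith-comm Bool.xor-comm

  ⊕-assoc : ∀ {n} (x y z : Word n) → (x ⊕ y) ⊕ z ≡ x ⊕ (y ⊕ z)
  ⊕-assoc = Vec.zipWith-assoc Bool.xor-assoc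

  ⊕-same : ∀ {n} (x : Word n) → x ⊕ x ≡ 𝟎
  ⊕-same []      = refl
  ⊕-same (a ∷ x) = cong₂ _∷_ (Bool.xor-same a) (⊕-same x)

  ⊕-identityˡ : ∀ {n} (x : Word n) → 𝟎 ⊕ x ≡ x
  ⊕-identityˡ = Vec.zipWith-identityˡ Bool.xor-identityˡ

  ⊕-identityʳ : ∀ {n} (x : Word n) → x ⊕ 𝟎 ≡ x
  ⊕-identityʳ x = trans (⊕-comm x 𝟎) (⊕-identityˡ x)

  ⊕-cancel : ∀ {n} (x y : Word n) → x ⊕ (x ⊕ y) ≡ y
  ⊕-cancel x y = trans (sym (⊕-assoc x x y)) (trans (cong (_⊕ y) (⊕-same x)) (⊕-identityˡ y))

  ⊕-medial : ∀ {n} (a b c d : Word n) → (a ⊕ b) ⊕ (c ⊕ d) ≡ (a ⊕ c) ⊕ (b ⊕ d)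
  ⊕-medial []      []      []      []      = refl
  ⊕-medial (a ∷ x) (b ∷ y) (c ∷ z) (d ∷ w) = cong₂ _∷_ (xor-medial a b c d) (⊕-medial x y z w)

  ⊕≡𝟎 : ∀ {n} {x y : Word n} → x ⊕ y ≡ 𝟎 → x ≡ y
  ⊕≡𝟎 {x = x} {y} eq = trans (sym (⊕-identityʳ x)) (trans (cong (x ⊕_) (sym eq)) (⊕-cancel x y))

  _≟ʷ_ : ∀ {n} → DecidableEquality (Word n)
  _≟ʷ_ = Vec.≡-dec Bool._≟_

  infix 4 _==_
  _==_ : ∀ {n} → Word n → Word n → Bool
  []          == []          = true
  (true ∷ x)  == (true ∷ y)  = x == y
  (false ∷ x) == (false ∷ y) = x == y
  (_ ∷ _)     == (_ ∷ _)     = false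

  ==-reflects : ∀ {n} (x y : Word n) → Reflects (x ≡ y) (x == y)
  ==-reflects []          []          = ofʸ refl
  ==-reflects (true ∷ x)  (true ∷ y)  with x == y | ==-reflects x y
  ... | true  | ofʸ eq = ofʸ (cong (true ∷_) eq)
  ... | false | ofⁿ ≢  = ofⁿ (≢ ∘ Vec.∷-injectiveʳ)
  ==-reflects (false ∷ x) (false ∷ y) with x == y | ==-reflects x y
  ... | true  | ofʸ eq = ofʸ (cong (false ∷_) eq)
  ... | false | ofⁿ ≢  = ofⁿ (≢ ∘ Vec.∷-injectiveʳ)
  ==-reflects (true ∷ _)  (false ∷ _) = ofⁿ λ ()
  ==-reflects (false ∷ _) (true ∷ _)  = ofⁿ λ ()

  ==-refl : ∀ {n} (x : Word n) → (x == x) ≡ true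
  ==-refl x with x == x | ==-reflects x x
  ... | true  | _      = refl
  ... | false | ofⁿ ≢  = contradiction refl ≢

  ==-≢ : ∀ {n} {x y : Word n} → x ≢ y → (x == y) ≡ false
  ==-≢ {x = x} {y} ≢ with x == y | ==-reflects x y
  ... | true  | ofʸ eq = contradiction eq ≢
  ... | false | _      = refl

  allWords? : ∀ {n p} {P : Word n → Set p} → (∀ x → Dec (P x)) → Dec (∀ x → P x)
  allWords? {zero}  P? = map′ (λ { p [] → p }) (λ p → p []) (P? [])
  allWords? {suc n} P? = map′ (λ { (p , q) (false ∷ x) → p x ; (p , q) (true ∷ x) → q x })
    (λ p → p ∘ (false ∷_) , p ∘ (true ∷_))
    (allWords? (P? ∘ (false ∷_)) ×-dec allWords? (P? ∘ (true ∷_)))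

  words : ∀ n → Vec (Word n) (2 ℕ.^ n)
  words zero    = [] ∷ []
  words (suc n) = Vec.map (false ∷_) (words n) Vec.++ (Vec.map (true ∷_) (words n) Vec.++ [])

  -- The covector f with f · u = b and entries x off the leading position of u.
  fill : ∀ {n} → Word (suc n) → Bool → Word n → Word (suc n)
  fill         (true ∷ u)  b x       = (b xor dot u x) ∷ x
  fill {suc n} (false ∷ u) b (a ∷ x) = a ∷ fill u b x
  fill {zero}  (false ∷ u) b x       = b ∷ x

  axis : Fin 15 → Word 4
  axis i = lookup (words 4) (suc i)

  bits : Fin 8 → Word 3
  bits = lookup (words 3)

  Flag : Set
  Flag = Word 4 × Word 4

  flag : Bool → Fin 15 → Fin 8 → Flag
  flag b i x = axis i , fill (axis i) b (bits x)

  -- Opaque, as are the tables below, to keep conversion checking from evaluating them.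
  opaque
    flagAt : Bool → Fin 120 → Flag
    flagAt b k = uncurry (flag b) (remQuot {15} 8 k)

  adjacent : Bool → Flag → Flag → Bool
  adjacent b (u , f) (v , g) = if u == v then not (f == g) else b xor (dot f v xor dot g u)

  entry : Bool → Fin 120 → Fin 120 → Bool
  entry b k l = adjacent b (flagAt b k) (flagAt b l)

  flags : (b : Bool) → Vec Flag 120
  flags b = tabulate (flagAt b)

  adjacencies : ∀ {m n} → Bool → Vec Flag m → Vec Flag n → Vec (Vec Bool n) m
  adjacencies b ps qs = Vec.map (λ p → Vec.map (adjacent b p) qs) ps

  lookup-adjacencies : ∀ {m n} b (ps : Vec Flag m) (qs : Vec Flag n) k l →
    lookup (lookup (adjacencies b ps qs) k) l ≡ adjacent b (lookup ps k) (lookup qs l)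
  lookup-adjacencies b ps qs k l = trans
    (cong (λ r → lookup r l) (Vec.lookup-map k (λ p → Vec.map (adjacent b p) qs) ps))
    (Vec.lookup-map l (adjacent b (lookup ps k)) qs)

  opaque
    unfolding flagAt

    table : Bool → Vec (Vec Bool 120) 120
    table b = adjacencies b (flags b) (flags b)

    lookup-table : ∀ b k l → lookup (lookup (table b) k) l ≡ entry b k l
    lookup-table b k l = trans (lookup-adjacencies b (flags b) (flags b) k l)
      (cong₂ (adjacent b) (Vec.lookup∘tabulate (flagAt b) k) (Vec.lookup∘tabulate (flagAt b) l))

    square-table : ∀ b → Packed.square-test 128 63 30 36 (table b) ≡ true
    square-table true  = refl
    square-table false = refl

  ==-sym : ∀ {n} (x y : Word n) → (x == y) ≡ (y == x)
  ==-sym x y with x == y | ==-reflects x y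
  ... | true  | ofʸ refl = sym (==-refl x)
  ... | false | ofⁿ ≢    = sym (==-≢ (≢ ∘ sym))

  adjacent-sym : ∀ b p q → adjacent b p q ≡ adjacent b q p
  adjacent-sym b (u , f) (v , g) rewrite ==-sym u v | ==-sym f g | Bool.xor-comm (dot f v) (dot g u) = refl

  module _ {n} {a : Fin n → Fin n → Bool} (B : ℕ) .{{_ : ℕ.NonZero B}} (k l m : ℕ) (t : Vec (Vec Bool n) n)
    (a-sym : ∀ i j → a i j ≡ a j i) (lookup-t : ∀ i j → lookup (lookup t i) j ≡ a i j)
    (n< : n ℕ.< B) (k< : k ℕ.< B) (l< : l ℕ.< B) (m< : m ℕ.< B)
    (test : Packed.square-test B k l m t ≡ true) where

    private
      common-expected : ∀ i j → common a i j ≡ lookup (Packed.expected B k l m i (lookup t i)) j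
      common-expected i j = trans
        (count-cong λ h → cong₂ _∧_ (sym (lookup-t i h)) (trans (a-sym j h) (sym (lookup-t h j))))
        (square-test-sound B {k = k} {l} {m} t n< k< l< m< test i j)

    common-diagonal : ∀ i → common a i i ≡ k
    common-diagonal i = trans (common-expected i i) (Packed.lookup-expected-diagonal B i (lookup t i))

    common-off-diagonal : ∀ i j → i ≢ j → common a i j ≡ (if a i j then l else m)
    common-off-diagonal i j i≢j = trans (common-expected i j)
      (trans (Packed.lookup-expected B i j (lookup t i) i≢j) (cong (if_then l else m) (lookup-t i j)))

  entry-sym : ∀ b i j → entry b i j ≡ entry b j i
  entry-sym b i j = adjacent-sym b (flagAt b i) (flagAt b j)

  entry-regular : ∀ b i → common (entry b) i i ≡ 63
  entry-regular b = common-diagonal {a = entry b} 128 63 30 36 (table b) (entry-sym b)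
    (lookup-table b) (ℕ.<ᵇ⇒< 120 128 _) (ℕ.<ᵇ⇒< 63 128 _) (ℕ.<ᵇ⇒< 30 128 _) (ℕ.<ᵇ⇒< 36 128 _) (square-table b)

  entry-common : ∀ b i j → i ≢ j → common (entry b) i j ≡ (if entry b i j then 30 else 36)
  entry-common b = common-off-diagonal {a = entry b} 128 63 30 36 (table b) (entry-sym b)
    (lookup-table b) (ℕ.<ᵇ⇒< 120 128 _) (ℕ.<ᵇ⇒< 63 128 _) (ℕ.<ᵇ⇒< 30 128 _) (ℕ.<ᵇ⇒< 36 128 _) (square-table b)

  IsFlag : Bool → Flag → Set
  IsFlag b (u , f) = u ≢ 𝟎 × dot f u ≡ b

  isFlag? : ∀ b p → Dec (IsFlag b p)
  isFlag? b (u , f) = ¬? (u ≟ʷ 𝟎) ×-dec (dot f u Bool.≟ b)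

  abstract
    flag-isFlag : ∀ b i x → IsFlag b (flag b i x)
    flag-isFlag true  = from-yes (Fin.all? λ i → Fin.all? λ x → isFlag? true (flag true i x))
    flag-isFlag false = from-yes (Fin.all? λ i → Fin.all? λ x → isFlag? false (flag false i x))

    axis-surjective : ∀ u → u ≢ 𝟎 → ∃[ i ] axis i ≡ u
    axis-surjective = from-yes (allWords? λ u → ¬? (u ≟ʷ 𝟎) →-dec Fin.any? λ i → axis i ≟ʷ u)

    axis-injective : ∀ i j → axis i ≡ axis j → i ≡ j
    axis-injective = from-yes (Fin.all? λ i → Fin.all? λ j → (axis i ≟ʷ axis j) →-dec (i Fin.≟ j))

    fill-surjective : ∀ b i f → dot f (axis i) ≡ b → ∃[ x ] fill (axis i) b (bits x) ≡ f
    fill-surjective true  = from-yes (Fin.all? λ i → allWords? λ f →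
      (dot f (axis i) Bool.≟ true) →-dec Fin.any? λ x → fill (axis i) true (bits x) ≟ʷ f)
    fill-surjective false = from-yes (Fin.all? λ i → allWords? λ f →
      (dot f (axis i) Bool.≟ false) →-dec Fin.any? λ x → fill (axis i) false (bits x) ≟ʷ f)

    fill-injective : ∀ b i x y → fill (axis i) b (bits x) ≡ fill (axis i) b (bits y) → x ≡ y
    fill-injective true  = from-yes (Fin.all? λ i → Fin.all? λ x → Fin.all? λ y →
      (fill (axis i) true (bits x) ≟ʷ fill (axis i) true (bits y)) →-dec (x Fin.≟ y))
    fill-injective false = from-yes (Fin.all? λ i → Fin.all? λ x → Fin.all? λ y →
      (fill (axis i) false (bits x) ≟ʷ fill (axis i) false (bits y)) →-dec (x Fin.≟ y))

  flag-surjective : ∀ b u f → IsFlag b (u , f) → ∃[ i ] ∃[ x ] flag b i x ≡ (u , f)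
  flag-surjective b u f (u≢𝟎 , f·u) =
    let i , i≡ = axis-surjective u u≢𝟎
        x , x≡ = fill-surjective b i f (subst (λ t → dot f t ≡ b) (sym i≡) f·u)
    in i , x , cong₂ _,_ i≡ x≡

  flag-injective : ∀ b p q → uncurry (flag b) p ≡ uncurry (flag b) q → p ≡ q
  flag-injective b (i , x) (j , y) eq = step (axis-injective i j (cong proj₁ eq))
    where
    step : i ≡ j → (i , x) ≡ (j , y)
    step refl = cong (i ,_) (fill-injective b i x y (cong proj₂ eq))

  opaque
    unfolding flagAt

    flagAt-isFlag : ∀ b k → IsFlag b (flagAt b k)
    flagAt-isFlag b k = flag-isFlag b (proj₁ (remQuot {15} 8 k)) (proj₂ (remQuot {15} 8 k))

    flagAt-combine : ∀ b i x → flagAt b (combine i x) ≡ flag b i x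
    flagAt-combine b i x = cong (uncurry (flag b)) (Fin.remQuot-combine {15} {8} i x)

    flagAt-injective : ∀ b k l → flagAt b k ≡ flagAt b l → k ≡ l
    flagAt-injective b k l eq = begin
      k                                  ≡⟨ Fin.combine-remQuot {15} 8 k ⟨
      uncurry combine (remQuot {15} 8 k) ≡⟨ cong (uncurry combine) (flag-injective b (remQuot {15} 8 k) (remQuot {15} 8 l) eq) ⟩
      uncurry combine (remQuot {15} 8 l) ≡⟨ Fin.combine-remQuot {15} 8 l ⟩
      l                                  ∎
      where open ≡-Reasoning

  flagAt-surjective : ∀ b p → IsFlag b p → ∃[ k ] flagAt b k ≡ p
  flagAt-surjective b (u , f) p-flag =
    let i , x , eq = flag-surjective b u f p-flag
    in combine i x , trans (flagAt-combine b i x) eq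

  ⟪_,_⟫ : Flag → Flag → Bool
  ⟪ (u , f) , (v , g) ⟫ = dot f v xor dot g u

  infixl 6 _⊞_
  _⊞_ : ∀ {m n} → Word m × Word n → Word m × Word n → Word m × Word n
  (u , f) ⊞ (v , g) = u ⊕ v , f ⊕ g

  private
    true≢false : true ≢ false
    true≢false ()

    adjacent-irrefl : ∀ p → adjacent true p p ≡ false
    adjacent-irrefl (u , f) rewrite ==-refl u | ==-refl f = refl

    ⟪⟫-diagonal : ∀ p → ⟪ p , p ⟫ ≡ false
    ⟪⟫-diagonal (u , f) = Bool.xor-same (dot f u)

    ⟪⟫-comm : ∀ p q → ⟪ p , q ⟫ ≡ ⟪ q , p ⟫
    ⟪⟫-comm (u , f) (v , g) = Bool.xor-comm (dot f v) (dot g u)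

    ⟪⟫-⊞ : ∀ p q r → ⟪ p ⊞ q , r ⟫ ≡ ⟪ p , r ⟫ xor ⟪ q , r ⟫
    ⟪⟫-⊞ (u , f) (v , g) (w , h) = trans
      (cong₂ _xor_ (dot-⊕ˡ f g w) (dot-⊕ʳ h u v))
      (xor-medial (dot f w) (dot g w) (dot h u) (dot h v))

    -- f · u is the quadratic form with polar form ⟪_,_⟫.
    q-⊞ : ∀ u f v g → dot (f ⊕ g) (u ⊕ v) ≡ (dot f u xor dot g v) xor ⟪ (u , f) , (v , g) ⟫
    q-⊞ u f v g = begin
      dot (f ⊕ g) (u ⊕ v)                                 ≡⟨ dot-⊕ˡ f g (u ⊕ v) ⟩
      dot f (u ⊕ v) xor dot g (u ⊕ v)                     ≡⟨ cong₂ _xor_ (dot-⊕ʳ f u v) (dot-⊕ʳ g u v) ⟩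
      (dot f u xor dot f v) xor (dot g u xor dot g v)     ≡⟨ cong ((dot f u xor dot f v) xor_) (Bool.xor-comm (dot g u) (dot g v)) ⟩
      (dot f u xor dot f v) xor (dot g v xor dot g u)     ≡⟨ xor-medial (dot f u) (dot f v) (dot g v) (dot g u) ⟩
      (dot f u xor dot g v) xor (dot f v xor dot g u)     ∎
      where open ≡-Reasoning

    adjacent-true : ∀ p q → IsFlag true p → IsFlag true q → p ≢ q → adjacent true p q ≡ not ⟪ p , q ⟫
    adjacent-true (u , f) (v , g) (_ , f·u) (_ , g·v) p≢q with u == v | ==-reflects u v
    ... | false | _        = refl
    ... | true  | ofʸ refl = trans (cong not (==-≢ (p≢q ∘ cong (u ,_))))
                               (sym (cong₂ (λ a b → not (a xor b)) f·u g·v))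

    orthogonal : ∀ p r → IsFlag true p → IsFlag true r → adjacent true p r ≡ true → ⟪ p , r ⟫ ≡ false
    orthogonal p r p-flag r-flag p~r = Bool.not-injective (trans (sym (adjacent-true p r p-flag r-flag
      λ p≡r → true≢false (trans (sym p~r) (trans (cong (λ t → adjacent true t r) p≡r) (adjacent-irrefl r))))) p~r)

  module _ (p q : Flag) (p-flag : IsFlag true p) (q-flag : IsFlag true q) (pq : ⟪ p , q ⟫ ≡ true) where

    private
      ⟪p⊞q,p⟫ : ⟪ p ⊞ q , p ⟫ ≡ true
      ⟪p⊞q,p⟫ = trans (⟪⟫-⊞ p q p) (cong₂ _xor_ (⟪⟫-diagonal p) (trans (⟪⟫-comm q p) pq))

      ⟪p⊞q,q⟫ : ⟪ p ⊞ q , q ⟫ ≡ true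
      ⟪p⊞q,q⟫ = trans (⟪⟫-⊞ p q q) (cong₂ _xor_ pq (⟪⟫-diagonal q))

      distinct : ∀ r s → ⟪ r , s ⟫ ≡ true → r ≢ s
      distinct r s rs r≡s = true≢false (trans (sym rs) (trans (cong (⟪_, s ⟫) r≡s) (⟪⟫-diagonal s)))

    sum-isFlag : IsFlag true (p ⊞ q)
    sum-isFlag = u+v≢𝟎 , norm
      where
      norm : dot (proj₂ (p ⊞ q)) (proj₁ (p ⊞ q)) ≡ true
      norm = trans (q-⊞ (proj₁ p) (proj₂ p) (proj₁ q) (proj₂ q))
        (cong₂ _xor_ (cong₂ _xor_ (proj₂ p-flag) (proj₂ q-flag)) pq)
      u+v≢𝟎 : proj₁ (p ⊞ q) ≢ 𝟎
      u+v≢𝟎 u+v≡𝟎 = true≢false (trans (sym norm) (trans (cong (dot (proj₂ (p ⊞ q))) u+v≡𝟎)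
        (trans (dot-comm (proj₂ (p ⊞ q)) 𝟎) (dot-𝟎ˡ (proj₂ (p ⊞ q))))))

    sum-≢ˡ : p ⊞ q ≢ p
    sum-≢ˡ = distinct (p ⊞ q) p ⟪p⊞q,p⟫

    sum-≢ʳ : p ⊞ q ≢ q
    sum-≢ʳ = distinct (p ⊞ q) q ⟪p⊞q,q⟫

    sum-adjacent : ∀ r → IsFlag true r → adjacent true p r ≡ true → adjacent true q r ≡ true →
      adjacent true (p ⊞ q) r ≡ true
    sum-adjacent r r-flag p~r q~r =
      trans (adjacent-true (p ⊞ q) r sum-isFlag r-flag sum≢r)
        (cong not (trans (⟪⟫-⊞ p q r) (cong₂ _xor_ pr (orthogonal q r q-flag r-flag q~r))))
      where
      pr = orthogonal p r p-flag r-flag p~r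
      sum≢r : p ⊞ q ≢ r
      sum≢r eq = true≢false (trans (sym ⟪p⊞q,p⟫) (trans (cong (⟪_, p ⟫) eq) (trans (⟪⟫-comm r p) pr)))

  third-flag : ∀ k l → k ≢ l → entry true k l ≡ false →
    ∃[ w ] (w ≢ k × w ≢ l × ∀ z → entry true k z ≡ true → entry true l z ≡ true → entry true w z ≡ true)
  third-flag k l k≢l k≁l = w
    , (λ w≡k → sum-≢ˡ p q p-flag q-flag pq (trans (sym w≡) (cong (flagAt true) w≡k)))
    , (λ w≡l → sum-≢ʳ p q p-flag q-flag pq (trans (sym w≡) (cong (flagAt true) w≡l)))
    , λ z k~z l~z → trans (cong (λ t → adjacent true t (flagAt true z)) w≡)
        (sum-adjacent p q p-flag q-flag pq (flagAt true z) (flagAt-isFlag true z) k~z l~z)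
    where
    p = flagAt true k
    q = flagAt true l
    p-flag = flagAt-isFlag true k
    q-flag = flagAt-isFlag true l
    pq : ⟪ p , q ⟫ ≡ true
    pq = Bool.not-injective (trans (sym (adjacent-true p q p-flag q-flag (k≢l ∘ flagAt-injective true k l))) k≁l)
    third = flagAt-surjective true (p ⊞ q) (sum-isFlag p q p-flag q-flag pq)
    w  = proj₁ third
    w≡ = proj₂ third

  eight : Fin 120
  eight = Fin.fromℕ< {8} (ℕ.<ᵇ⇒< 8 120 _)

  opaque
    unfolding flagAt

    third-flag-fails : ∀ w → w ≢ zero → w ≢ eight →
      ∃[ z ] (entry false zero z ≡ true × entry false eight z ≡ true × entry false w z ≡ false)
    third-flag-fails = from-yes (Fin.all? λ w → ¬? (w Fin.≟ zero) →-dec (¬? (w Fin.≟ eight) →-dec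
      Fin.any? λ z → (entry false zero z Bool.≟ true) ×-dec ((entry false eight z Bool.≟ true) ×-dec (entry false w z Bool.≟ false))))

    eight-nonadjacent : entry false zero eight ≡ false
    eight-nonadjacent = refl

module RootLines where

  open import Defs
  open import Data.Bool.Base using (Bool; _xor_; _∧_; false; if_then_else_; not; true)
  import Data.Bool.Properties as Bool
  open import Data.Fin.Base as Fin using (Fin; remQuot; suc; zero)
  import Data.Fin.Properties as Fin
  open import Data.Integer.Base as ℤ using (-1ℤ; 0ℤ; 1ℤ; _◃_; ℤ)
  import Data.Integer.Properties as ℤ
  open import Data.Nat.Base using (suc; zero)
  open import Data.Product.Base using (_,_; _×_; proj₁; proj₂; ∃; ∃-syntax)
  open import Data.Sign.Base as Sign using (Sign)
  import Data.Sign.Properties as Sign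
  open import Data.Sum.Base using ([_,_]′; _⊎_; inj₁; inj₂)
  open import Data.Unit.Base using (tt)
  open import Data.Vec.Base as Vec using (Vec; []; _∷_; lookup)
  import Data.Vec.Properties as Vec
  open import Data.Vec.Relation.Unary.Any as Any using (Any)
  import Data.Vec.Relation.Unary.Any.Properties as Any
  open import Function.Base using (_∘_)
  open import Relation.Binary.Bundles using (Setoid)
  open import Relation.Binary.Definitions using (DecidableEquality)
  open import Relation.Binary.PropositionalEquality
  open import Relation.Nullary using (Dec; contradiction; no; yes)
  open import Relation.Nullary.Decidable using (_×-dec_; _→-dec_; _⊎-dec_; from-yes; map′)
  open import Relation.Nullary.Reflects using (Reflects; ofʸ; ofⁿ)
  open Flags
  open StronglyRegularGraphs

  infixl 7 _⨯_
  _⨯_ : Word 3 → Word 3 → Word 3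
  (a ∷ b ∷ c ∷ []) ⨯ (x ∷ y ∷ z ∷ []) =
    ((b ∧ z) xor (c ∧ y)) ∷ ((a ∧ z) xor (c ∧ x)) ∷ ((a ∧ y) xor (b ∧ x)) ∷ []

  -- y ↦ ρ y · m is a quadratic form with polar form det (m , _ , _) taking the value 1 at m ≠ 0.
  ρ : Word 3 → Word 3
  ρ (a ∷ b ∷ c ∷ []) = ((b ∧ c) xor a) ∷ ((a ∧ c) xor (a xor b)) ∷ ((a ∧ b) xor (a xor (b xor c))) ∷ []

  ±1 : Bool → ℤ
  ±1 b = if b then -1ℤ else 1ℤ

  -- The coordinates of ℝ⁸ are indexed by 𝔽₂³.  For fixed u the eight lines are the joint
  -- eigenlines of eight commuting Pauli matrices.
  coordinate : Flag → Word 3 → ℤ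
  coordinate (true ∷ m  , _ ∷ f) y = ±1 (dot f y xor dot (ρ y) m)
  coordinate (false ∷ d , a ∷ f) y = if y ⨯ d == f ⊕ ρ d then ±1 (not a ∧ dot f y) else 0ℤ

  opaque
    root : Flag → Vec ℤ 8
    root p = Vec.map (coordinate p) (words 3)

  private
    SpinForm PairForm : Vec ℤ 8 → Set
    SpinForm x = Vec.foldr′ Sign._*_ Sign.+ (Vec.map ℤ.sign x) ≡ Sign.+ × Vec.map (_◃ 1) (Vec.map ℤ.sign x) ≡ x
    PairForm x = ∃[ i ] ∃[ j ] (i Fin.< j × ∃[ s ] ∃[ t ] zipWith± s t i j ≡ x)
      where
      zipWith± : Bool → Bool → Fin 8 → Fin 8 → Vec ℤ 8
      zipWith± s t i j = Vec.zipWith ℤ._+_ (±e (if s then Sign.- else Sign.+) i) (±e (if t then Sign.- else Sign.+) j)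

    infix 4 _≟ᶻ_
    _≟ᶻ_ : DecidableEquality (Vec ℤ 8)
    _≟ᶻ_ = Vec.≡-dec ℤ._≟_

    anyBool? : ∀ {P : Bool → Set} → (∀ b → Dec (P b)) → Dec (∃ P)
    anyBool? P? = map′ [ (true ,_) , (false ,_) ]′ (λ { (true , p) → inj₁ p ; (false , p) → inj₂ p })
      (P? true ⊎-dec P? false)

    rootForm? : ∀ x → Dec (SpinForm x ⊎ PairForm x)
    rootForm? x = (_ Sign.≟ _) ×-dec (_ ≟ᶻ _) ⊎-dec
      Fin.any? λ i → Fin.any? λ j → (i Fin.<? j) ×-dec (anyBool? λ s → anyBool? λ t → _ ≟ᶻ x)

    fromForm : ∀ x → SpinForm x ⊎ PairForm x → E₈Root x
    fromForm x (inj₁ (even , eq))                 = subst E₈Root eq (spin (Vec.map ℤ.sign x) even)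
    fromForm x (inj₂ (i , j , i<j , s , t , refl)) = pair i j i<j _ _

    isZero : ℤ → Bool
    isZero (ℤ.+ zero) = true
    isZero _          = false

    isZero-reflects : ∀ z → Reflects (z ≡ 0ℤ) (isZero z)
    isZero-reflects (ℤ.+ zero)  = ofʸ refl
    isZero-reflects ℤ.+[1+ _ ]  = ofⁿ λ ()
    isZero-reflects ℤ.-[1+ _ ]  = ofⁿ λ ()

    agree : Bool → Bool → Bool
    agree a b = not (a xor b)

    agree⇒≡ : ∀ a b → agree a b ≡ true → a ≡ b
    agree⇒≡ true  true  _ = refl
    agree⇒≡ false false _ = refl

    withRoot : Flag → Flag × Vec ℤ 8
    withRoot p = p , root p

    compare : Flag × Vec ℤ 8 → Flag × Vec ℤ 8 → Bool
    compare (p , x) (q , y) = agree (isZero (x ·ᶻ y)) (adjacent true p q)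

    orthogonality-test : ∀ {n} → Vec (Flag × Vec ℤ 8) n → Bool
    orthogonality-test rs = allVec (λ _ p → allVec (λ _ q → compare p q) rs) rs

    orthogonality-sound : ∀ {n} (ps : Vec Flag n) → orthogonality-test (Vec.map withRoot ps) ≡ true →
      ∀ k l → isZero (root (lookup ps k) ·ᶻ root (lookup ps l)) ≡ adjacent true (lookup ps k) (lookup ps l)
    orthogonality-sound ps test k l = subst₂
      (λ (p , x) (q , y) → isZero (x ·ᶻ y) ≡ adjacent true p q)
      (Vec.lookup-map k withRoot ps) (Vec.lookup-map l withRoot ps)
      (agree⇒≡ _ _ (allVec-sound (λ _ q → compare (lookup rs k) q) rs
        (allVec-sound (λ _ p → allVec (λ _ q → compare p q) rs) rs test k) l))
      where rs = Vec.map withRoot ps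

    roots : Vec (Vec ℤ 8) 120
    roots = Vec.map root (flags true)

    lookup-roots : ∀ k → lookup roots k ≡ root (flagAt true k)
    lookup-roots k = trans (Vec.lookup-map k root (flags true)) (cong root (Vec.lookup∘tabulate (flagAt true) k))

    IsUpToSign : Vec ℤ 8 → Vec ℤ 8 → Set
    IsUpToSign x y = y ≡ x ⊎ y ≡ -ᵛ x

    isUpToSign? : ∀ x y → Dec (IsUpToSign x y)
    isUpToSign? x y = (y ≟ᶻ x) ⊎-dec (y ≟ᶻ (-ᵛ x))

    allSigns? : ∀ {n} {P : Vec Sign n → Set} → (∀ s → Dec (P s)) → Dec (∀ s → P s)
    allSigns? {zero}  P? = map′ (λ { p [] → p }) (λ p → p []) (P? [])
    allSigns? {suc n} P? = map′ (λ { (p , q) (Sign.+ ∷ x) → p x ; (p , q) (Sign.- ∷ x) → q x })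
      (λ p → p ∘ (Sign.+ ∷_) , p ∘ (Sign.- ∷_))
      (allSigns? (P? ∘ (Sign.+ ∷_)) ×-dec allSigns? (P? ∘ (Sign.- ∷_)))

    spins? : ∀ rs → Dec (∀ s → Vec.foldr′ Sign._*_ Sign.+ s ≡ Sign.+ →
      Any (IsUpToSign (Vec.map (_◃ 1) s)) {120} rs)
    spins? rs = allSigns? λ s → (Vec.foldr′ Sign._*_ Sign.+ s Sign.≟ Sign.+) →-dec
      Any.any? (isUpToSign? (Vec.map (_◃ 1) s)) rs

    pairs? : ∀ s t rs → Dec (∀ i j → i Fin.< j →
      Any (IsUpToSign (Vec.zipWith ℤ._+_ (±e s i) (±e t j))) {120} rs)
    pairs? s t rs = Fin.all? λ i → Fin.all? λ j → (i Fin.<? j) →-dec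
      Any.any? (isUpToSign? (Vec.zipWith ℤ._+_ (±e s i) (±e t j))) rs

  opaque
    unfolding flagAt root

    root-isRoot : ∀ k → E₈Root (root (flagAt true k))
    root-isRoot k = fromForm (root (flagAt true k)) (check (proj₁ (remQuot {15} 8 k)) (proj₂ (remQuot {15} 8 k)))
      where
      check : ∀ i x → SpinForm (root (flag true i x)) ⊎ PairForm (root (flag true i x))
      check = from-yes (Fin.all? λ i → Fin.all? λ x → rootForm? (root (flag true i x)))

    root-orthogonal : ∀ k l →
      Reflects (root (flagAt true k) ·ᶻ root (flagAt true l) ≡ 0ℤ) (entry true k l)
    root-orthogonal k l = subst (Reflects _)
      (trans (cong₂ (λ p q → isZero (root p ·ᶻ root q)) (sym (flag≡ k)) (sym (flag≡ l)))
        (trans (orthogonality-sound (flags true) refl k l) (cong₂ (adjacent true) (flag≡ k) (flag≡ l))))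
      (isZero-reflects (root (flagAt true k) ·ᶻ root (flagAt true l)))
      where
      flag≡ : ∀ k → lookup (flags true) k ≡ flagAt true k
      flag≡ = Vec.lookup∘tabulate (flagAt true)

    root-exhaustive : ∀ {x} → E₈Root x → ∃[ k ] IsUpToSign x (root (flagAt true k))
    root-exhaustive {x} r = Any.index found , subst (IsUpToSign x) (lookup-roots (Any.index found)) (Any.lookup-index found)
      where
      find : ∀ {x} → E₈Root x → Any (IsUpToSign x) roots
      find (spin s even)                   = from-yes (spins? roots) s even
      find (pair i j i<j Sign.+ Sign.+) = from-yes (pairs? Sign.+ Sign.+ roots) i j i<j
      find (pair i j i<j Sign.+ Sign.-) = from-yes (pairs? Sign.+ Sign.- roots) i j i<j
      find (pair i j i<j Sign.- Sign.+) = from-yes (pairs? Sign.- Sign.+ roots) i j i<j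
      find (pair i j i<j Sign.- Sign.-) = from-yes (pairs? Sign.- Sign.- roots) i j i<j
      found : Any (IsUpToSign x) roots
      found = find r

  element : Fin 120 → Graph.Vertex G-E₈
  element k = root (flagAt true k) , root-isRoot k

  -- Proportional roots have equal rows, and a row determines its flag.
  root-injective : ∀ k l → IsUpToSign (root (flagAt true k)) (root (flagAt true l)) → k ≡ l
  root-injective k l k≈l with k Fin.≟ l
  ... | yes k≡l = k≡l
  ... | no  k≢l = contradiction (trans (sym (entry-regular true k)) (trans same-row
      (trans (entry-common true k l k≢l) (cong (if_then 30 else 36) k≁l)))) λ ()
    where
    open Graph G-E₈ using (_~_; ~-resp; ~-irrefl)
    module V = Setoid (Graph.vertices G-E₈)

    agrees : ∀ {P Q : Set} {p q} → (P → Q) → (Q → P) → Reflects P p → Reflects Q q → p ≡ q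
    agrees f g (ofʸ p)  (ofʸ q)  = refl
    agrees f g (ofʸ p)  (ofⁿ ¬q) = contradiction (f p) ¬q
    agrees f g (ofⁿ ¬p) (ofʸ q)  = contradiction (g q) ¬p
    agrees f g (ofⁿ ¬p) (ofⁿ ¬q) = refl

    same-entry : ∀ z → entry true k z ≡ entry true l z
    same-entry z = agrees (~-resp {element k} {element l} {element z} {element z} k≈l (inj₁ refl))
      (~-resp {element l} {element k} {element z} {element z} (V.sym {element k} {element l} k≈l) (inj₁ refl))
      (root-orthogonal k z) (root-orthogonal l z)

    same-row : common (entry true) k k ≡ common (entry true) k l
    same-row = count-cong λ z → cong (entry true k z ∧_) (same-entry z)

    k≁l : entry true k l ≡ false
    k≁l = agrees (λ k⊥l → ~-irrefl {element l} (~-resp {element k} {element l} {element l} {element l} k≈l (inj₁ refl) k⊥l))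
      (λ ()) (root-orthogonal k l) (ofⁿ λ ())

  E₈-adjacency : AdjacencyMatrix G-E₈ 120
  E₈-adjacency = record
    { labelling = record
      { element    = element
      ; sound      = λ _ → tt
      ; injective  = root-injective
      ; exhaustive = λ (_ , x-root) _ → root-exhaustive x-root
      }
    ; entry     = entry true
    ; reflects  = root-orthogonal
    }

  E₈-stronglyRegular : StronglyRegular G-E₈
  E₈-stronglyRegular = 120 , 63 , 30 , 36 ,
    stronglyRegular E₈-adjacency (entry-regular true) (entry-common true)

module LinearAlgebra where

  open import Algebra.Bundles using (CommutativeRing; Ring)
  import Algebra.Properties.Ring as RingProperties
  import Algebra.Properties.Semiring.Sum as SemiringSum
  open import Algebra.Structures using (IsRing)
  open import Data.Bool.Base using (Bool; false; if_then_else_; not; true)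
  open import Data.Fin.Base as Fin using (Fin; _↑ʳ_; _↑ˡ_; combine; join; splitAt; suc; zero)
  import Data.Fin.Properties as Fin
  open import Data.Nat.Base using (suc; zero; ℕ)
  open import Data.Nat.Base as ℕ using (suc; zero; ℕ)
  open import Data.Product.Base using (_,_)
  open import Data.Sum.Base using (_⊎_; inj₁; inj₂)
  open import Function.Base using (_∘_)
  open import Level using (_⊔_)
  open import Relation.Binary.PropositionalEquality as ≡ using (_≡_)
  open import Relation.Nullary using (contradiction; no; yes)
  open import Relation.Nullary.Decidable using (dec-false; dec-true; does)

  module Matrices {c ℓ} (R : CommutativeRing c ℓ) where
    open CommutativeRing R hiding (zero)
    open SemiringSum semiring public using (sum; sum-cong-≋; ∑-distrib-+; ∑-comm; *-distribˡ-sum; *-distribʳ-sum; sum-replicate-zero)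
    open import Relation.Binary.Reasoning.Setoid setoid

    -‿sum : ∀ {n} (f : Fin n → Carrier) → - sum f ≈ sum (λ i → - f i)
    -‿sum {zero}  f = RingProperties.-0#≈0# ring
    -‿sum {suc n} f = trans (sym (RingProperties.-‿+-comm ring (f zero) (sum (f ∘ suc))))
      (+-congˡ (-‿sum (f ∘ suc)))

    sum-zero : ∀ {n} (f : Fin n → Carrier) → (∀ i → f i ≈ 0#) → sum f ≈ 0#
    sum-zero {n} f f≈0 = trans (sum-cong-≋ f≈0) (sum-replicate-zero n)

    δ : ∀ {n} → Fin n → Fin n → Carrier
    δ i j = if does (i Fin.≟ j) then 1# else 0#

    sum-δˡ : ∀ {n} i (f : Fin n → Carrier) → sum (λ k → δ i k * f k) ≈ f i
    sum-δˡ zero    f = begin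
      1# * f zero + sum (λ k → 0# * f (suc k)) ≈⟨ +-cong (*-identityˡ (f zero)) (sum-zero (λ k → 0# * f (suc k)) λ k → zeroˡ (f (suc k))) ⟩
      f zero + 0#                              ≈⟨ +-identityʳ _ ⟩
      f zero                                   ∎
    sum-δˡ (suc i) f = begin
      0# * f zero + sum (λ k → δ i k * f (suc k)) ≈⟨ +-cong (zeroˡ _) (sum-δˡ i (f ∘ suc)) ⟩
      0# + f (suc i)                              ≈⟨ +-identityˡ _ ⟩
      f (suc i)                                   ∎

    δ-sym : ∀ {n} (i j : Fin n) → δ i j ≈ δ j i
    δ-sym zero    zero    = refl
    δ-sym zero    (suc j) = refl
    δ-sym (suc i) zero    = refl
    δ-sym (suc i) (suc j) = δ-sym i j

    sum-δʳ : ∀ {n} i (f : Fin n → Carrier) → sum (λ k → f k * δ k i) ≈ f i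
    sum-δʳ i f = trans (sum-cong-≋ λ k → trans (*-comm (f k) (δ k i)) (*-congʳ (δ-sym k i))) (sum-δˡ i f)

    Vector : ℕ → Set c
    Vector n = Fin n → Carrier

    Matrix : ℕ → Set c
    Matrix n = Fin n → Fin n → Carrier

    infix 4 _≊_
    record _≊_ {n} (A B : Matrix n) : Set (c ⊔ ℓ) where
      constructor entrywise
      field
        at : ∀ i j → A i j ≈ B i j
    open _≊_ public

    infixl 6 _⊹_
    infixl 7 _⊛_
    infix  8 ⊝_
    _⊹_ _⊛_ : ∀ {n} → Matrix n → Matrix n → Matrix n
    (A ⊹ B) i j = A i j + B i j
    (A ⊛ B) i j = sum λ k → A i k * B k j

    ⊝_ transpose : ∀ {n} → Matrix n → Matrix n
    (⊝ A) i j = - A i j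
    transpose A i j = A j i

    infixr 7 _◂_
    _◂_ : ∀ {n} → Carrier → Matrix n → Matrix n
    (c ◂ A) i j = c * A i j

    O I : ∀ {n} → Matrix n
    O _ _ = 0#
    I     = δ

    ⊛-cong : ∀ {n} {A A′ B B′ : Matrix n} → A ≊ A′ → B ≊ B′ → A ⊛ B ≊ A′ ⊛ B′
    ⊛-cong p q .at i j = sum-cong-≋ λ k → *-cong (at p i k) (at q k j)

    sum-interchange : ∀ {m n} (x : Vector m) (A : Fin m → Fin n → Carrier) (y : Vector n) →
      sum (λ k → sum (λ h → x h * A h k) * y k) ≈ sum (λ h → x h * sum (λ k → A h k * y k))
    sum-interchange x A y = begin
      sum (λ k → sum (λ h → x h * A h k) * y k)   ≈⟨ (sum-cong-≋ λ k → *-distribʳ-sum (y k) (λ h → x h * A h k)) ⟩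
      sum (λ k → sum (λ h → x h * A h k * y k))   ≈⟨ ∑-comm (λ k h → x h * A h k * y k) ⟩
      sum (λ h → sum (λ k → x h * A h k * y k))   ≈⟨ (sum-cong-≋ λ h → sum-cong-≋ λ k → *-assoc (x h) (A h k) (y k)) ⟩
      sum (λ h → sum (λ k → x h * (A h k * y k))) ≈⟨ (sum-cong-≋ λ h → *-distribˡ-sum (x h) (λ k → A h k * y k)) ⟨
      sum (λ h → x h * sum (λ k → A h k * y k))   ∎

    matrix-isRing : ∀ n → IsRing (_≊_ {n}) _⊹_ _⊛_ ⊝_ O I
    matrix-isRing n = record
      { +-isAbelianGroup = record
        { isGroup = record
          { isMonoid = record
            { isSemigroup = record
              { isMagma = record
                { isEquivalence = record
                  { refl  = entrywise λ _ _ → refl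
                  ; sym   = λ p → entrywise λ i j → sym (at p i j)
                  ; trans = λ p q → entrywise λ i j → trans (at p i j) (at q i j)
                  }
                ; ∙-cong = λ p q → entrywise λ i j → +-cong (at p i j) (at q i j)
                }
              ; assoc = λ A B C → entrywise λ i j → +-assoc (A i j) (B i j) (C i j)
              }
            ; identity = (λ A → entrywise λ i j → +-identityˡ (A i j))
                       , (λ A → entrywise λ i j → +-identityʳ (A i j))
            }
          ; inverse = (λ A → entrywise λ i j → -‿inverseˡ (A i j))
                    , (λ A → entrywise λ i j → -‿inverseʳ (A i j))
          ; ⁻¹-cong = λ p → entrywise λ i j → -‿cong (at p i j)
          }
        ; comm = λ A B → entrywise λ i j → +-comm (A i j) (B i j)
        }
      ; *-cong     = ⊛-cong
      ; *-assoc    = λ A B C → entrywise λ i j → sum-interchange (A i) B (λ k → C k j)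
      ; *-identity = (λ A → entrywise λ i j → sum-δˡ i (λ k → A k j))
                   , (λ A → entrywise λ i j → sum-δʳ j (A i))
      ; distrib    = (λ A B C → entrywise λ i j → trans
                        (sum-cong-≋ λ k → distribˡ (A i k) (B k j) (C k j))
                        (∑-distrib-+ (λ k → A i k * B k j) (λ k → A i k * C k j)))
                   , (λ A B C → entrywise λ i j → trans
                        (sum-cong-≋ λ k → distribʳ (A k j) (B i k) (C i k))
                        (∑-distrib-+ (λ k → B i k * A k j) (λ k → C i k * A k j)))
      }

    matrixRing : ℕ → Ring c (c ⊔ ℓ)
    matrixRing n = record { isRing = matrix-isRing n }

    transpose-⊛ : ∀ {n} (A B : Matrix n) → transpose (A ⊛ B) ≊ transpose B ⊛ transpose A
    transpose-⊛ A B .at i j = sum-cong-≋ λ k → *-comm (A j k) (B k i)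

    ◂-⊛ˡ : ∀ {n} c (A B : Matrix n) → (c ◂ A) ⊛ B ≊ c ◂ (A ⊛ B)
    ◂-⊛ˡ c A B .at i j = trans (sum-cong-≋ λ k → *-assoc c (A i k) (B k j))
      (sym (*-distribˡ-sum c λ k → A i k * B k j))

    ◂-⊛ʳ : ∀ {n} c (A B : Matrix n) → A ⊛ (c ◂ B) ≊ c ◂ (A ⊛ B)
    ◂-⊛ʳ c A B .at i j = trans
      (sum-cong-≋ λ k → trans (sym (*-assoc (A i k) c (B k j))) (trans (*-congʳ (*-comm (A i k) c)) (*-assoc c (A i k) (B k j))))
      (sym (*-distribˡ-sum c λ k → A i k * B k j))

    infixr 7 _⊙_
    _⊙_ : ∀ {n} → Matrix n → Vector n → Vector n
    (A ⊙ v) i = sum λ j → A i j * v j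

    infix 8 _∙_
    _∙_ : ∀ {n} → Vector n → Vector n → Carrier
    v ∙ w = sum λ i → v i * w i

    ⊛-⊙ : ∀ {n} (A B : Matrix n) v i → ((A ⊛ B) ⊙ v) i ≈ (A ⊙ (B ⊙ v)) i
    ⊛-⊙ A B v i = sum-interchange (A i) B v

    ∙-cong : ∀ {n} {v v′ w w′ : Vector n} → (∀ i → v i ≈ v′ i) → (∀ i → w i ≈ w′ i) → v ∙ w ≈ v′ ∙ w′
    ∙-cong p q = sum-cong-≋ λ i → *-cong (p i) (q i)

    ∙-comm : ∀ {n} (v w : Vector n) → v ∙ w ≈ w ∙ v
    ∙-comm v w = sum-cong-≋ λ i → *-comm (v i) (w i)

    adjoint : ∀ {n} (A : Matrix n) v w → (A ⊙ v) ∙ w ≈ v ∙ (transpose A ⊙ w)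
    adjoint A v w = begin
      sum (λ i → sum (λ j → A i j * v j) * w i)   ≈⟨ (sum-cong-≋ λ i → *-congʳ (sum-cong-≋ λ j → *-comm (A i j) (v j))) ⟩
      sum (λ i → sum (λ j → v j * A i j) * w i)   ≈⟨ sum-interchange v (λ j i → A i j) w ⟩
      sum (λ j → v j * sum (λ i → A i j * w i))   ∎

  module RingSums {c ℓ} (R : Ring c ℓ) where
    open Ring R hiding (zero)
    open import Algebra.Properties.Semiring.Sum semiring
    open import Relation.Binary.Reasoning.Setoid setoid

    indicator : Bool → Carrier
    indicator b = if b then 1# else 0#

    sum-zero : ∀ {n} (f : Fin n → Carrier) → (∀ i → f i ≈ 0#) → sum f ≈ 0#
    sum-zero {n} f f≈0 = trans (sum-cong-≋ f≈0) (sum-replicate-zero n)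

    sum-pick : ∀ {n} (i : Fin n) (f : Fin n → Carrier) → (∀ j → (j ≡ i → _≡_ {A = ℕ} 0 1) → f j ≈ 0#) → sum f ≈ f i
    sum-pick zero    f f≈0 = trans (+-congˡ (sum-zero (f ∘ suc) λ j → f≈0 (suc j) λ ())) (+-identityʳ (f zero))
    sum-pick (suc i) f f≈0 = trans (+-cong (f≈0 zero λ ()) (sum-pick i (f ∘ suc) λ j j≢i → f≈0 (suc j) (j≢i ∘ Fin.suc-injective)))
      (+-identityˡ (f (suc i)))

    sum-split : ∀ m {n} (f : Fin (m ℕ.+ n) → Carrier) →
      sum f ≈ sum (λ i → f (i ↑ˡ n)) + sum (λ j → f (m ↑ʳ j))
    sum-split zero    f = sym (+-identityˡ (sum f))
    sum-split (suc m) f = trans (+-congˡ (sum-split m (f ∘ suc))) (sym (+-assoc _ _ _))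

    sum-combine : ∀ {m n} (f : Fin (m ℕ.* n) → Carrier) → sum f ≈ sum (λ i → sum (λ x → f (combine {m} {n} i x)))
    sum-combine {zero}      f = refl
    sum-combine {suc m} {n} f = trans (sum-split n f) (+-congˡ (sum-combine {m} {n} (λ k → f (n ↑ʳ k))))

    private
      complementˡ : ∀ b x → indicator b * x + indicator (not b) * x ≈ x
      complementˡ true  x = trans (+-cong (*-identityˡ x) (zeroˡ x)) (+-identityʳ x)
      complementˡ false x = trans (+-cong (zeroˡ x) (*-identityˡ x)) (+-identityˡ x)

      complementʳ : ∀ b x → x * indicator b + x * indicator (not b) ≈ x
      complementʳ true  x = trans (+-cong (*-identityʳ x) (zeroʳ x)) (+-identityʳ x)
      complementʳ false x = trans (+-cong (zeroʳ x) (*-identityʳ x)) (+-identityˡ x)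

      products : ∀ {m n} (x : Fin m → Carrier) (y : Fin n → Carrier) (p : Fin m → Bool) (q : Fin n → Bool) →
        (∀ k l → p k ≡ true → q l ≡ true → x k * y l ≈ 0#) →
        sum (λ k → indicator (p k) * x k) * sum (λ l → y l * indicator (q l)) ≈ 0#
      products x y p q xy≈0 = trans (*-distribʳ-sum _ (λ k → indicator (p k) * x k)) (sum-zero _ λ k →
        trans (*-distribˡ-sum _ (λ l → y l * indicator (q l))) (sum-zero _ λ l → cell (p k) (q l) (x k) (y l) (xy≈0 k l)))
        where
        cell : ∀ b d x y → (b ≡ true → d ≡ true → x * y ≈ 0#) → indicator b * x * (y * indicator d) ≈ 0#
        cell true  true  x y xy≈0 = trans (*-cong (*-identityˡ x) (*-identityʳ y)) (xy≈0 ≡.refl ≡.refl)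
        cell true  false x y _    = trans (*-congˡ (zeroʳ y)) (zeroʳ _)
        cell false d     x y _    = trans (*-congʳ (zeroˡ x)) (zeroˡ _)

    -- With B = Σ [p] x, B′ = Σ [¬p] x and A = Σ y [q], A′ = Σ y [¬q] we have B + B′ = 1 = A + A′ and
    -- B A′ = 0 = B′ A, so B = B A = A.
    intertwine : ∀ {m n} (x : Fin m → Carrier) (y : Fin n → Carrier) (p : Fin m → Bool) (q : Fin n → Bool) →
      sum x ≈ 1# → sum y ≈ 1# →
      (∀ k l → p k ≡ not (q l) → x k * y l ≈ 0#) →
      sum (λ k → indicator (p k) * x k) ≈ sum (λ l → y l * indicator (q l))
    intertwine x y p q Σx≈1 Σy≈1 orthogonal = trans B≈BA (sym A≈BA)
      where
      B  = sum (λ k → indicator (p k) * x k)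
      B′ = sum (λ k → indicator (not (p k)) * x k)
      A  = sum (λ l → y l * indicator (q l))
      A′ = sum (λ l → y l * indicator (not (q l)))
      B+B′≈1 : B + B′ ≈ 1#
      B+B′≈1 = trans (sym (∑-distrib-+ (λ k → indicator (p k) * x k) (λ k → indicator (not (p k)) * x k)))
        (trans (sum-cong-≋ λ k → complementˡ (p k) (x k)) Σx≈1)
      A+A′≈1 : A + A′ ≈ 1#
      A+A′≈1 = trans (sym (∑-distrib-+ (λ l → y l * indicator (q l)) (λ l → y l * indicator (not (q l)))))
        (trans (sum-cong-≋ λ l → complementʳ (q l) (y l)) Σy≈1)
      opposite : ∀ {a b} → a ≡ true → not b ≡ true → a ≡ not b
      opposite a b = ≡.trans a (≡.sym b)
      flip : ∀ a b → not a ≡ true → b ≡ true → a ≡ not b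
      flip false true _ _ = ≡.refl
      BA′≈0 : B * A′ ≈ 0#
      BA′≈0 = products x y p (not ∘ q) λ k l a b → orthogonal k l (opposite a b)
      B′A≈0 : B′ * A ≈ 0#
      B′A≈0 = products x y (not ∘ p) q λ k l a b → orthogonal k l (flip (p k) (q l) a b)
      B≈BA : B ≈ B * A
      B≈BA = begin
        B               ≈⟨ *-identityʳ B ⟨
        B * 1#          ≈⟨ *-congˡ A+A′≈1 ⟨
        B * (A + A′)    ≈⟨ distribˡ B A A′ ⟩
        B * A + B * A′  ≈⟨ +-congˡ BA′≈0 ⟩
        B * A + 0#      ≈⟨ +-identityʳ (B * A) ⟩
        B * A           ∎
      A≈BA : A ≈ B * A
      A≈BA = begin
        A               ≈⟨ *-identityˡ A ⟨
        1# * A          ≈⟨ *-congʳ B+B′≈1 ⟨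
        (B + B′) * A    ≈⟨ distribʳ A B B′ ⟩
        B * A + B′ * A  ≈⟨ +-congˡ B′A≈0 ⟩
        B * A + 0#      ≈⟨ +-identityʳ (B * A) ⟩
        B * A           ∎

  module Blocks {c ℓ} (R : CommutativeRing c ℓ) (n : ℕ) where
    open CommutativeRing R hiding (zero)
    open Matrices R
    open RingSums ring using (sum-split)
    open RingProperties ring using (-‿distribʳ-*; -‿distribˡ-*; -0#≈0#; -‿involutive)
    open import Relation.Binary.Reasoning.Setoid setoid

    Block : Set c
    Block = Fin n ⊎ Fin n → Fin n ⊎ Fin n → Carrier

    ⟦_⟧ : Block → Matrix (n ℕ.+ n)
    ⟦ b ⟧ i j = b (splitAt n i) (splitAt n j)

    ⟦⟧-⊛ : ∀ b b′ i j → (⟦ b ⟧ ⊛ ⟦ b′ ⟧) i j ≈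
      sum (λ k → b (splitAt n i) (inj₁ k) * b′ (inj₁ k) (splitAt n j)) +
      sum (λ k → b (splitAt n i) (inj₂ k) * b′ (inj₂ k) (splitAt n j))
    ⟦⟧-⊛ b b′ i j = trans (sum-split n (λ k → ⟦ b ⟧ i k * ⟦ b′ ⟧ k j)) (+-cong
      (sum-cong-≋ λ k → reflexive (≡.cong (λ s → b (splitAt n i) s * b′ s (splitAt n j)) (Fin.splitAt-↑ˡ n k n)))
      (sum-cong-≋ λ k → reflexive (≡.cong (λ s → b (splitAt n i) s * b′ s (splitAt n j)) (Fin.splitAt-↑ʳ n n k))))

    double : Matrix n → Block
    double a (inj₁ i) (inj₁ j) = a i j
    double a (inj₂ i) (inj₂ j) = a i j
    double a (inj₁ _) (inj₂ _) = 0#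
    double a (inj₂ _) (inj₁ _) = 0#

    rotation : Block
    rotation (inj₁ i) (inj₂ j) = - δ i j
    rotation (inj₂ i) (inj₁ j) = δ i j
    rotation (inj₁ _) (inj₁ _) = 0#
    rotation (inj₂ _) (inj₂ _) = 0#

    D : Matrix n → Matrix (n ℕ.+ n)
    D a = ⟦ double a ⟧

    rot : Matrix (n ℕ.+ n)
    rot = ⟦ rotation ⟧

    private
      sum-0ˡ : (f : Vector n) → sum (λ k → 0# * f k) ≈ 0#
      sum-0ˡ f = sum-zero (λ k → 0# * f k) λ k → zeroˡ (f k)

      sum-0ʳ : (f : Vector n) → sum (λ k → f k * 0#) ≈ 0#
      sum-0ʳ f = sum-zero (λ k → f k * 0#) λ k → zeroʳ (f k)

      sum-00 : sum {n} (λ _ → 0# * 0#) ≈ 0#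
      sum-00 = sum-0ˡ (λ _ → 0#)

      left : ∀ {x y z} → x ≈ z → y ≈ 0# → x + y ≈ z
      left p q = trans (+-cong p q) (+-identityʳ _)

      right : ∀ {x y z} → x ≈ 0# → y ≈ z → x + y ≈ z
      right p q = trans (+-cong p q) (+-identityˡ _)

      none : ∀ {x y} → x ≈ 0# → y ≈ 0# → x + y ≈ 0#
      none = left

      sum-−δˡ : ∀ i (f : Vector n) → sum (λ k → (- δ i k) * f k) ≈ - f i
      sum-−δˡ i f = trans (sum-cong-≋ λ k → sym (-‿distribˡ-* (δ i k) (f k)))
        (trans (sym (-‿sum λ k → δ i k * f k)) (-‿cong (sum-δˡ i f)))

      sum-−δʳ : ∀ j (f : Vector n) → sum (λ k → f k * (- δ k j)) ≈ - f j
      sum-−δʳ j f = trans (sum-cong-≋ λ k → sym (-‿distribʳ-* (f k) (δ k j)))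
        (trans (sym (-‿sum λ k → f k * δ k j)) (-‿cong (sum-δʳ j f)))

    D-⊛ : ∀ a b → D a ⊛ D b ≊ D (a ⊛ b)
    D-⊛ a b .at i j = trans (⟦⟧-⊛ (double a) (double b) i j) (cases (splitAt n i) (splitAt n j))
      where
      cases : ∀ s t → sum (λ k → double a s (inj₁ k) * double b (inj₁ k) t) +
        sum (λ k → double a s (inj₂ k) * double b (inj₂ k) t) ≈ double (a ⊛ b) s t
      cases (inj₁ i) (inj₁ j) = left refl sum-00
      cases (inj₁ i) (inj₂ j) = none (sum-0ʳ (a i)) (sum-0ˡ λ k → b k j)
      cases (inj₂ i) (inj₁ j) = none (sum-0ˡ λ k → b k j) (sum-0ʳ (a i))
      cases (inj₂ i) (inj₂ j) = right sum-00 refl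

    D-rot : ∀ a → D a ⊛ rot ≊ rot ⊛ D a
    D-rot a .at i j = trans (trans (⟦⟧-⊛ (double a) rotation i j) (cases (splitAt n i) (splitAt n j)))
      (sym (⟦⟧-⊛ rotation (double a) i j))
      where
      cases : ∀ s t →
        sum (λ k → double a s (inj₁ k) * rotation (inj₁ k) t) + sum (λ k → double a s (inj₂ k) * rotation (inj₂ k) t) ≈
        sum (λ k → rotation s (inj₁ k) * double a (inj₁ k) t) + sum (λ k → rotation s (inj₂ k) * double a (inj₂ k) t)
      cases (inj₁ i) (inj₁ j) = trans (none (sum-0ʳ (a i)) (sum-0ˡ λ k → δ k j)) (sym (none (sum-0ˡ λ k → a k j) (sum-0ʳ λ k → - δ i k)))
      cases (inj₁ i) (inj₂ j) = trans (left (sum-−δʳ j (a i)) sum-00) (sym (right sum-00 (sum-−δˡ i λ k → a k j)))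
      cases (inj₂ i) (inj₁ j) = trans (right sum-00 (sum-δʳ j (a i))) (sym (left (sum-δˡ i λ k → a k j) sum-00))
      cases (inj₂ i) (inj₂ j) = trans (none (sum-0ˡ λ k → - δ k j) (sum-0ʳ (a i))) (sym (none (sum-0ʳ (δ i)) (sum-0ˡ λ k → a k j)))

    δ-injective : ∀ {m o} (f : Fin m → Fin o) → (∀ {i j} → f i ≡ f j → i ≡ j) → ∀ i j → δ (f i) (f j) ≈ δ i j
    δ-injective f f-inj i j = reflexive (≡.cong (if_then 1# else 0#) bools)
      where
      bools : does (f i Fin.≟ f j) ≡ does (i Fin.≟ j)
      bools with i Fin.≟ j
      ... | yes i≡j = dec-true (f i Fin.≟ f j) (≡.cong f i≡j)
      ... | no  i≢j = dec-false (f i Fin.≟ f j) (i≢j ∘ f-inj)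

    δ-distinct : ∀ {m} {i j : Fin m} → (i ≡ j → _≡_ {A = ℕ} 0 1) → δ i j ≈ 0#
    δ-distinct {i = i} {j} i≢j = reflexive (≡.cong (if_then 1# else 0#) (dec-false (i Fin.≟ j) λ i≡j → contradiction (i≢j i≡j) λ ()))

    D-I : D I ≊ I
    D-I .at i j = trans (cases (splitAt n i) (splitAt n j)) (reflexive (≡.cong₂ δ (Fin.join-splitAt n n i) (Fin.join-splitAt n n j)))
      where
      ↑ˡ≢↑ʳ : ∀ i j → i ↑ˡ n ≡ n ↑ʳ j → _≡_ {A = ℕ} 0 1
      ↑ˡ≢↑ʳ i j eq with ≡.trans (≡.sym (Fin.splitAt-↑ˡ n i n)) (≡.trans (≡.cong (splitAt n) eq) (Fin.splitAt-↑ʳ n n j))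
      ... | ()
      cases : ∀ s t → double I s t ≈ δ (join n n s) (join n n t)
      cases (inj₁ i) (inj₁ j) = sym (δ-injective (_↑ˡ n) (λ {i} {j} → Fin.↑ˡ-injective n i j) i j)
      cases (inj₂ i) (inj₂ j) = sym (δ-injective (n ↑ʳ_) (λ {i} {j} → Fin.↑ʳ-injective n i j) i j)
      cases (inj₁ i) (inj₂ j) = sym (δ-distinct (↑ˡ≢↑ʳ i j))
      cases (inj₂ i) (inj₁ j) = sym (δ-distinct (↑ˡ≢↑ʳ j i ∘ ≡.sym))

    rot² : rot ⊛ rot ≊ ⊝ I
    rot² .at i j = trans (trans (⟦⟧-⊛ rotation rotation i j) (cases (splitAt n i) (splitAt n j))) (-‿cong (at D-I i j))
      where
      cases : ∀ s t → sum (λ k → rotation s (inj₁ k) * rotation (inj₁ k) t) +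
        sum (λ k → rotation s (inj₂ k) * rotation (inj₂ k) t) ≈ - double I s t
      cases (inj₁ i) (inj₁ j) = right sum-00 (sum-−δˡ i λ k → δ k j)
      cases (inj₁ i) (inj₂ j) = trans (none (sum-0ˡ λ k → - δ k j) (sum-0ʳ λ k → - δ i k)) (sym -0#≈0#)
      cases (inj₂ i) (inj₁ j) = trans (none (sum-0ʳ (δ i)) (sum-0ˡ λ k → δ k j)) (sym -0#≈0#)
      cases (inj₂ i) (inj₂ j) = left (sum-δˡ i λ k → - δ k j) sum-00

    rotᵀ : transpose rot ≊ ⊝ rot
    rotᵀ .at i j = cases (splitAt n i) (splitAt n j)
      where
      cases : ∀ s t → rotation t s ≈ - rotation s t
      cases (inj₁ i) (inj₁ j) = sym -0#≈0#
      cases (inj₁ i) (inj₂ j) = trans (δ-sym j i) (sym (-‿involutive (δ i j)))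
      cases (inj₂ i) (inj₁ j) = -‿cong (δ-sym j i)
      cases (inj₂ i) (inj₂ j) = sym -0#≈0#

    D-transpose : ∀ a → transpose (D a) ≊ D (transpose a)
    D-transpose a .at i j = cases (splitAt n i) (splitAt n j)
      where
      cases : ∀ s t → double a t s ≈ double (transpose a) s t
      cases (inj₁ i) (inj₁ j) = refl
      cases (inj₁ i) (inj₂ j) = refl
      cases (inj₂ i) (inj₁ j) = refl
      cases (inj₂ i) (inj₂ j) = refl

    D-cong : ∀ {a b} → a ≊ b → D a ≊ D b
    D-cong {a} {b} p .at i j = cases (splitAt n i) (splitAt n j)
      where
      cases : ∀ s t → double a s t ≈ double b s t
      cases (inj₁ i) (inj₁ j) = at p i j
      cases (inj₁ i) (inj₂ j) = refl
      cases (inj₂ i) (inj₁ j) = refl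
      cases (inj₂ i) (inj₂ j) = at p i j

    D-sum : ∀ {m} (a : Fin m → Matrix n) i j → sum (λ k → D (a k) i j) ≈ D (λ i j → sum (λ k → a k i j)) i j
    D-sum {m} a i j = cases (splitAt n i) (splitAt n j)
      where
      cases : ∀ s t → sum (λ k → double (a k) s t) ≈ double (λ i j → sum (λ k → a k i j)) s t
      cases (inj₁ i) (inj₁ j) = refl
      cases (inj₁ i) (inj₂ j) = sum-replicate-zero m
      cases (inj₂ i) (inj₁ j) = sum-replicate-zero m
      cases (inj₂ i) (inj₂ j) = refl

    D-O : D O ≊ O
    D-O .at i j = cases (splitAt n i) (splitAt n j)
      where
      cases : ∀ s t → double O s t ≈ 0#
      cases (inj₁ i) (inj₁ j) = refl
      cases (inj₁ i) (inj₂ j) = refl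
      cases (inj₂ i) (inj₁ j) = refl
      cases (inj₂ i) (inj₂ j) = refl

module QuadraticForms where

  open import Data.Fin.Base as Fin using (Fin; suc; zero)
  import Data.Fin.Properties as Fin
  open import Data.Nat.Base as ℕ using (suc; zero; ℕ)
  open import Data.Product.Base using (_,_; _×_; ∃-syntax)
  open import Data.Rational.Base
  import Data.Rational.Properties as ℚ
  open import Data.Rational.Solver using (module +-*-Solver)
  open import Data.Sum.Base using (_⊎_; inj₁; inj₂)
  open import Data.Unit.Base using (tt; ⊤)
  open import Function.Base using (_∘_)
  open import Relation.Binary.Definitions using (tri<; tri>; tri≈)
  open import Relation.Binary.PropositionalEquality
  open import Relation.Nullary using (no; yes)
  open import Relation.Nullary.Decidable using (decidable-stable; ¬?)
  open LinearAlgebra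

  module ℚᴹ = Matrices ℚ.+-*-commutativeRing

  p≤q⇒0≤q-p : ∀ {p q} → p ≤ q → 0ℚ ≤ q - p
  p≤q⇒0≤q-p {p} {q} p≤q = subst (_≤ q - p) (ℚ.+-inverseʳ p) (ℚ.+-monoˡ-≤ (- p) p≤q)

  0≤q-p⇒p≤q : ∀ {p q} → 0ℚ ≤ q - p → p ≤ q
  0≤q-p⇒p≤q {p} {q} 0≤ = subst₂ _≤_ (ℚ.+-identityˡ p)
    (solve 2 (λ p q → (q :- p) :+ p := q) refl p q) (ℚ.+-monoˡ-≤ p 0≤)
    where open +-*-Solver

  *-nonNeg : ∀ {p q} → 0ℚ ≤ p → 0ℚ ≤ q → 0ℚ ≤ p * q
  *-nonNeg {p} {q} 0≤p 0≤q = ℚ.nonNegative⁻¹ (p * q) {{ℚ.nonNeg*nonNeg⇒nonNeg p {{nonNegative 0≤p}} q {{nonNegative 0≤q}}}}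

  +-nonNeg : ∀ {p q} → 0ℚ ≤ p → 0ℚ ≤ q → 0ℚ ≤ p + q
  +-nonNeg {p} {q} 0≤p 0≤q = subst (_≤ p + q) (ℚ.+-identityʳ 0ℚ) (ℚ.+-mono-≤ 0≤p 0≤q)

  *-pos : ∀ {p q} → 0ℚ < p → 0ℚ < q → 0ℚ < p * q
  *-pos {p} {q} 0<p 0<q = ℚ.positive⁻¹ (p * q) {{ℚ.pos*pos⇒pos p {{positive 0<p}} q {{positive 0<q}}}}

  *-monoˡ-≤ : ∀ {p q} r → 0ℚ ≤ r → p ≤ q → r * p ≤ r * q
  *-monoˡ-≤ r 0≤r = ℚ.*-monoˡ-≤-nonNeg r {{nonNegative 0≤r}}

  *-mono-≤ : ∀ {p q r s} → 0ℚ ≤ r → 0ℚ ≤ q → p ≤ q → r ≤ s → p * r ≤ q * s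
  *-mono-≤ {p} {q} {r} {s} 0≤r 0≤q p≤q r≤s = ℚ.≤-trans
    (ℚ.*-monoʳ-≤-nonNeg r {{nonNegative 0≤r}} p≤q) (*-monoˡ-≤ q 0≤q r≤s)

  square-nonNeg : ∀ p → 0ℚ ≤ p * p
  square-nonNeg p with ℚ.≤-total 0ℚ p
  ... | inj₁ 0≤p = *-nonNeg 0≤p 0≤p
  ... | inj₂ p≤0 = subst (0ℚ ≤_) (solve 1 (λ p → :- p :* :- p := p :* p) refl p) (*-nonNeg 0≤-p 0≤-p)
    where
    open +-*-Solver
    0≤-p = ℚ.neg-antimono-≤ p≤0

  square-cancel-≤ : ∀ {p q} → 0ℚ ≤ q → p * p ≤ q * q → p ≤ q
  square-cancel-≤ {p} {q} 0≤q p²≤q² = ℚ.≮⇒≥ λ q<p → ℚ.<-irrefl refl (ℚ.<-≤-trans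
    (ℚ.≤-<-trans (*-monoˡ-≤ q 0≤q (ℚ.<⇒≤ q<p))
      (ℚ.*-monoˡ-<-pos p {{positive (ℚ.≤-<-trans 0≤q q<p)}} q<p)) p²≤q²)

  -- (h , b , Q) stands for h x² + 2 x (b · v) + Q(v).
  Form : ℕ → Set
  Form zero    = ⊤
  Form (suc m) = ℚ × ℚᴹ.Vector m × Form m

  open ℚᴹ using (Vector; _∙_; _⊙_; δ; sum)

  eval : ∀ {m} → Form m → Vector m → ℚ
  eval {zero}  _           v = 0ℚ
  eval {suc m} (h , b , Q) v =
    h * (v zero * v zero) + (v zero + v zero) * (b ∙ (v ∘ suc)) + eval Q (v ∘ suc)

  infixl 6 _⊞_
  _⊞_ : ∀ {m} → Form m → Form m → Form m
  _⊞_ {zero}  _           _             = tt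
  _⊞_ {suc m} (h , b , Q) (h′ , b′ , Q′) = h + h′ , (λ i → b i + b′ i) , Q ⊞ Q′

  rankOne : ∀ {m} → ℚ → Vector m → Form m
  rankOne {zero}  c b = tt
  rankOne {suc m} c b = c * (b zero * b zero) , (λ i → c * b zero * b (suc i)) , rankOne c (b ∘ suc)

  scalar : ∀ {m} → ℚ → Form m
  scalar {zero}  c = tt
  scalar {suc m} c = c , (λ _ → 0ℚ) , scalar c

  ∙-+ˡ : ∀ {m} (b b′ v : Vector m) → (λ i → b i + b′ i) ∙ v ≡ b ∙ v + b′ ∙ v
  ∙-+ˡ b b′ v = trans (ℚᴹ.sum-cong-≋ λ i → ℚ.*-distribʳ-+ (v i) (b i) (b′ i))
    (ℚᴹ.∑-distrib-+ (λ i → b i * v i) (λ i → b′ i * v i))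

  ∙-*ˡ : ∀ {m} c (b v : Vector m) → (λ i → c * b i) ∙ v ≡ c * (b ∙ v)
  ∙-*ˡ c b v = trans (ℚᴹ.sum-cong-≋ λ i → ℚ.*-assoc c (b i) (v i))
    (sym (ℚᴹ.*-distribˡ-sum c λ i → b i * v i))

  ∙-zeroˡ : ∀ {m} (b v : Vector m) → (∀ i → b i ≡ 0ℚ) → b ∙ v ≡ 0ℚ
  ∙-zeroˡ b v b≡0 = ℚᴹ.sum-zero _ λ i → trans (cong (_* v i) (b≡0 i)) (ℚ.*-zeroˡ (v i))

  eval-⊞ : ∀ {m} (Q Q′ : Form m) v → eval (Q ⊞ Q′) v ≡ eval Q v + eval Q′ v
  eval-⊞ {zero}  _           _              v = refl
  eval-⊞ {suc m} (h , b , Q) (h′ , b′ , Q′) v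
    rewrite ∙-+ˡ b b′ (v ∘ suc) | eval-⊞ Q Q′ (v ∘ suc) =
    solve 7 (λ h h′ x s s′ q q′ →
        (h :+ h′) :* (x :* x) :+ (x :+ x) :* (s :+ s′) :+ (q :+ q′) :=
        (h :* (x :* x) :+ (x :+ x) :* s :+ q) :+ (h′ :* (x :* x) :+ (x :+ x) :* s′ :+ q′))
      refl h h′ (v zero) (b ∙ (v ∘ suc)) (b′ ∙ (v ∘ suc)) (eval Q (v ∘ suc)) (eval Q′ (v ∘ suc))
    where open +-*-Solver

  eval-rankOne : ∀ {m} c (b v : Vector m) → eval (rankOne c b) v ≡ c * (b ∙ v * b ∙ v)
  eval-rankOne {zero}  c b v = sym (ℚ.*-zeroʳ c)
  eval-rankOne {suc m} c b v
    rewrite ∙-*ˡ (c * b zero) (b ∘ suc) (v ∘ suc) | eval-rankOne c (b ∘ suc) (v ∘ suc) =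
    solve 4 (λ c b x s →
        c :* (b :* b) :* (x :* x) :+ (x :+ x) :* (c :* b :* s) :+ c :* (s :* s) :=
        c :* ((b :* x :+ s) :* (b :* x :+ s)))
      refl c (b zero) (v zero) ((b ∘ suc) ∙ (v ∘ suc))
    where open +-*-Solver

  eval-scalar : ∀ {m} c (v : Vector m) → eval (scalar c) v ≡ c * (v ∙ v)
  eval-scalar {zero}  c v = sym (ℚ.*-zeroʳ c)
  eval-scalar {suc m} c v
    rewrite ∙-zeroˡ (λ _ → 0ℚ) (v ∘ suc) (λ _ → refl) | eval-scalar c (v ∘ suc) =
    solve 3 (λ c x s → c :* (x :* x) :+ (x :+ x) :* con 0ℚ :+ c :* s := c :* (x :* x :+ s))
      refl c (v zero) ((v ∘ suc) ∙ (v ∘ suc))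
    where open +-*-Solver

  infixr 5 _◃_
  _◃_ : ∀ {m} → ℚ → Vector m → Vector (suc m)
  (x ◃ v) zero    = x
  (x ◃ v) (suc i) = v i

  eval-0 : ∀ {m} (Q : Form m) → eval Q (λ _ → 0ℚ) ≡ 0ℚ
  eval-0 {zero}  _           = refl
  eval-0 {suc m} (h , b , Q) rewrite eval-0 Q =
    solve 2 (λ h s → h :* (con 0ℚ :* con 0ℚ) :+ (con 0ℚ :+ con 0ℚ) :* s :+ con 0ℚ := con 0ℚ)
      refl h (b ∙ (λ _ → 0ℚ))
    where open +-*-Solver

  semidefinite? : ∀ {m} (Q : Form m) → (∀ v → 0ℚ ≤ eval Q v) ⊎ (∃[ v ] eval Q v < 0ℚ)
  semidefinite? {zero}  _ = inj₁ λ _ → ℚ.≤-refl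
  semidefinite? {suc m} (h , b , Q) with ℚ.<-cmp h 0ℚ
  ... | tri< h<0 _ _ = inj₂ (1ℚ ◃ (λ _ → 0ℚ) , subst (_< 0ℚ) (sym value) h<0)
    where
    open +-*-Solver
    value : h * (1ℚ * 1ℚ) + (1ℚ + 1ℚ) * (b ∙ (λ _ → 0ℚ)) + eval Q (λ _ → 0ℚ) ≡ h
    value rewrite ℚᴹ.∙-comm b (λ _ → 0ℚ) | ∙-zeroˡ (λ _ → 0ℚ) b (λ _ → refl) | eval-0 Q =
      solve 1 (λ h → h :* (con 1ℚ :* con 1ℚ) :+ (con 1ℚ :+ con 1ℚ) :* con 0ℚ :+ con 0ℚ := h) refl h
  ... | tri> _ _ h>0 = complete (semidefinite? (Q ⊞ rankOne (- k) b))
    where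
    instance
      h-pos : Positive h
      h-pos = positive h>0
      h-nonZero : NonZero h
      h-nonZero = ℚ.pos⇒nonZero h
    k = 1/ h
    open +-*-Solver
    square : ∀ x v → eval (h , b , Q) (x ◃ v) ≡
      h * ((x + b ∙ v * k) * (x + b ∙ v * k)) + eval (Q ⊞ rankOne (- k) b) v
    square x v rewrite eval-⊞ Q (rankOne (- k) b) v | eval-rankOne (- k) b v = begin
      h * (x * x) + (x + x) * s + q
        ≡⟨ solve 5 (λ h k x s q →
             h :* (x :* x) :+ (x :+ x) :* s :+ q :=
             h :* (x :* x) :+ (x :+ x) :* (con 1ℚ :* s) :+ (con 1ℚ :* (k :* (s :* s)) :- k :* (s :* s) :+ q))
             refl h k x s q ⟩
      h * (x * x) + (x + x) * (1ℚ * s) + (1ℚ * (k * (s * s)) - k * (s * s) + q)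
        ≡⟨ cong (λ t → h * (x * x) + (x + x) * (t * s) + (t * (k * (s * s)) - k * (s * s) + q)) (sym (ℚ.*-inverseʳ h)) ⟩
      h * (x * x) + (x + x) * (h * k * s) + (h * k * (k * (s * s)) - k * (s * s) + q)
        ≡⟨ solve 5 (λ h k x s q →
             h :* (x :* x) :+ (x :+ x) :* (h :* k :* s) :+ (h :* k :* (k :* (s :* s)) :- k :* (s :* s) :+ q) :=
             h :* ((x :+ s :* k) :* (x :+ s :* k)) :+ (q :+ :- k :* (s :* s)))
             refl h k x s q ⟩
      h * ((x + s * k) * (x + s * k)) + (q + - k * (s * s)) ∎
      where
      open ≡-Reasoning
      s = b ∙ v
      q = eval Q v
    complete : (∀ v → 0ℚ ≤ eval (Q ⊞ rankOne (- k) b) v) ⊎ (∃[ v ] eval (Q ⊞ rankOne (- k) b) v < 0ℚ) →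
      (∀ v → 0ℚ ≤ eval (h , b , Q) v) ⊎ (∃[ v ] eval (h , b , Q) v < 0ℚ)
    complete (inj₁ Q≥0) = inj₁ λ v → subst (0ℚ ≤_) (sym (square (v zero) (v ∘ suc)))
      (+-nonNeg (*-nonNeg (ℚ.<⇒≤ h>0) (square-nonNeg (v zero + b ∙ (v ∘ suc) * k))) (Q≥0 (v ∘ suc)))
    complete (inj₂ (v , Q<0)) = inj₂ (- (b ∙ v * k) ◃ v , subst (_< 0ℚ) (sym (trans (square (- (b ∙ v * k)) v) vanish)) Q<0)
      where
      vanish : h * ((- (b ∙ v * k) + b ∙ v * k) * (- (b ∙ v * k) + b ∙ v * k)) + eval (Q ⊞ rankOne (- k) b) v ≡
        eval (Q ⊞ rankOne (- k) b) v
      vanish = solve 3 (λ h t q → h :* ((:- t :+ t) :* (:- t :+ t)) :+ q := q) refl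
        h (b ∙ v * k) (eval (Q ⊞ rankOne (- k) b) v)
  ... | tri≈ _ refl _ with Fin.any? (λ j → ¬? (b j ℚ.≟ 0ℚ))
  ... | yes (j , bj≢0) = inj₂ (x ◃ δ j , subst (_< 0ℚ) (sym value) (ℚ.negative⁻¹ (- 1ℚ)))
    where
    instance
      bj-nonZero : NonZero (b j)
      bj-nonZero = ≢-nonZero bj≢0
    open +-*-Solver
    q = eval Q (δ j)
    x = - (½ * (q + 1ℚ) * 1/ b j)
    value : 0ℚ * (x * x) + (x + x) * (b ∙ δ j) + q ≡ - 1ℚ
    value rewrite ℚᴹ.∙-comm b (δ j) | ℚᴹ.sum-δˡ j b = begin
      0ℚ * (x * x) + (x + x) * b j + q
        ≡⟨ solve 3 (λ q k b → let x = :- (con ½ :* (q :+ con 1ℚ) :* k) in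
             con 0ℚ :* (x :* x) :+ (x :+ x) :* b :+ q := :- ((q :+ con 1ℚ) :* (b :* k)) :+ q)
             refl q (1/ b j) (b j) ⟩
      - ((q + 1ℚ) * (b j * 1/ b j)) + q ≡⟨ cong (λ t → - ((q + 1ℚ) * t) + q) (ℚ.*-inverseʳ (b j)) ⟩
      - ((q + 1ℚ) * 1ℚ) + q             ≡⟨ solve 1 (λ q → :- ((q :+ con 1ℚ) :* con 1ℚ) :+ q := con (- 1ℚ)) refl q ⟩
      - 1ℚ                              ∎
      where open ≡-Reasoning
  ... | no b≡0 = restrict (semidefinite? Q)
    where
    open +-*-Solver
    value : ∀ x v → 0ℚ * (x * x) + (x + x) * (b ∙ v) + eval Q v ≡ eval Q v
    value x v rewrite ∙-zeroˡ b v (λ j → decidable-stable (b j ℚ.≟ 0ℚ) λ bj≢0 → b≡0 (j , bj≢0)) =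
      solve 2 (λ x q → con 0ℚ :* (x :* x) :+ (x :+ x) :* con 0ℚ :+ q := q) refl x (eval Q v)
    restrict : (∀ v → 0ℚ ≤ eval Q v) ⊎ (∃[ v ] eval Q v < 0ℚ) →
      (∀ v → 0ℚ ≤ eval (0ℚ , b , Q) v) ⊎ (∃[ v ] eval (0ℚ , b , Q) v < 0ℚ)
    restrict (inj₁ Q≥0)       = inj₁ λ v → subst (0ℚ ≤_) (sym (value (v zero) (v ∘ suc))) (Q≥0 (v ∘ suc))
    restrict (inj₂ (v , Q<0)) = inj₂ (0ℚ ◃ v , subst (_< 0ℚ) (sym (value 0ℚ v)) Q<0)

  defect : ∀ {k m} → (Fin k → Vector m) → ℚ → Form m
  defect {zero}  A c = scalar c
  defect {suc k} A c = rankOne (- 1ℚ) (A zero) ⊞ defect (A ∘ suc) c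

  eval-defect : ∀ {k m} (A : Fin k → Vector m) c v →
    eval (defect A c) v ≡ c * (v ∙ v) - (λ i → A i ∙ v) ∙ (λ i → A i ∙ v)
  eval-defect {zero}  A c v = trans (eval-scalar c v) (sym (ℚ.+-identityʳ (c * (v ∙ v))))
  eval-defect {suc k} A c v = trans
    (trans (eval-⊞ (rankOne (- 1ℚ) (A zero)) (defect (A ∘ suc) c) v)
      (cong₂ _+_ (eval-rankOne (- 1ℚ) (A zero) v) (eval-defect (A ∘ suc) c v)))
    (solve 3 (λ a x s → con (- 1ℚ) :* a :+ (x :- s) := x :- (a :+ s)) refl
      (A zero ∙ v * A zero ∙ v) (c * (v ∙ v)) ((λ i → A (suc i) ∙ v) ∙ (λ i → A (suc i) ∙ v)))
    where open +-*-Solver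

  contraction? : ∀ {m} (A : ℚᴹ.Matrix m) c →
    (∀ v → (A ⊙ v) ∙ (A ⊙ v) ≤ c * (v ∙ v)) ⊎ (∃[ v ] c * (v ∙ v) < (A ⊙ v) ∙ (A ⊙ v))
  contraction? A c with semidefinite? (defect A c)
  ... | inj₁ Q≥0       = inj₁ λ v → 0≤q-p⇒p≤q (subst (0ℚ ≤_) (eval-defect A c v) (Q≥0 v))
  ... | inj₂ (v , Q<0) = inj₂ (v , subst₂ _<_
    (solve 2 (λ p q → (p :- q) :+ q := p) refl (c * (v ∙ v)) ((A ⊙ v) ∙ (A ⊙ v)))
    (ℚ.+-identityˡ _)
    (ℚ.+-monoˡ-< ((A ⊙ v) ∙ (A ⊙ v)) (subst (_< 0ℚ) (eval-defect A c v) Q<0)))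
    where open +-*-Solver

module RationalNorm where

  open import Data.Fin.Base using (suc; zero)
  import Data.Integer.Base as ℤ
  import Data.Integer.Properties as ℤ
  open import Data.Nat.Base as ℕ using (suc; zero; ℕ)
  import Data.Nat.Properties as ℕ
  open import Data.Product.Base using (_,_; _×_; proj₁; proj₂; ∃-syntax)
  open import Data.Rational.Base
  import Data.Rational.Properties as ℚ
  open import Data.Rational.Solver using (module +-*-Solver)
  open import Data.Rational.Unnormalised.Base as ℚᵘ using (*≡*; *≤*; mkℚᵘ)
  import Data.Rational.Unnormalised.Properties as ℚᵘ
  open import Data.Sum.Base using (inj₁; inj₂)
  open import Function.Base using (_∘_)
  open import Relation.Binary.PropositionalEquality
  open LinearAlgebra
  open QuadraticForms

  open ℚᴹ using (Vector; Matrix; _∙_; _⊙_; _⊹_; δ; sum)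

  0<1 : 0ℚ < 1ℚ
  0<1 = ℚ.positive⁻¹ 1ℚ

  0≤1 : 0ℚ ≤ 1ℚ
  0≤1 = ℚ.<⇒≤ 0<1

  reciprocal : ∀ p → 0ℚ < p → ∃[ r ] (0ℚ < r × p * r ≡ 1ℚ)
  reciprocal p 0<p = 1/ p , ℚ.positive⁻¹ (1/ p) {{ℚ.1/pos⇒pos p}} , ℚ.*-inverseʳ p
    where
    instance
      p-pos : Positive p
      p-pos = positive 0<p
      p-nonZero : NonZero p
      p-nonZero = ℚ.pos⇒nonZero p

  *-cancelʳ-≤ : ∀ {p q} r → 0ℚ < r → p * r ≤ q * r → p ≤ q
  *-cancelʳ-≤ r 0<r = ℚ.*-cancelʳ-≤-pos r {{positive 0<r}}

  *-monoʳ-≤ : ∀ {p q} r → 0ℚ ≤ r → p ≤ q → p * r ≤ q * r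
  *-monoʳ-≤ r 0≤r = ℚ.*-monoʳ-≤-nonNeg r {{nonNegative 0≤r}}

  infixr 8 _⋅_
  _⋅_ : ℕ → ℚ → ℚ
  zero  ⋅ q = 0ℚ
  suc n ⋅ q = q + n ⋅ q

  ⋅-assoc : ∀ n p q → n ⋅ (p * q) ≡ (n ⋅ p) * q
  ⋅-assoc zero    p q = sym (ℚ.*-zeroˡ q)
  ⋅-assoc (suc n) p q = trans (cong ((p * q) +_) (⋅-assoc n p q)) (sym (ℚ.*-distribʳ-+ q p (n ⋅ p)))

  ⋅-nonNeg : ∀ n {q} → 0ℚ ≤ q → 0ℚ ≤ n ⋅ q
  ⋅-nonNeg zero    _   = ℚ.≤-refl
  ⋅-nonNeg (suc n) 0≤q = +-nonNeg 0≤q (⋅-nonNeg n 0≤q)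

  ⋅-mono : ∀ {m n} → m ℕ.≤ n → m ⋅ 1ℚ ≤ n ⋅ 1ℚ
  ⋅-mono {n = n} ℕ.z≤n   = ⋅-nonNeg n 0≤1
  ⋅-mono (ℕ.s≤s m≤n) = ℚ.+-monoʳ-≤ 1ℚ (⋅-mono m≤n)

  suc⋅1-pos : ∀ n → 0ℚ < suc n ⋅ 1ℚ
  suc⋅1-pos n = ℚ.<-≤-trans 0<1 (subst (_≤ suc n ⋅ 1ℚ) (ℚ.+-identityʳ 1ℚ) (ℚ.+-monoʳ-≤ 1ℚ (⋅-nonNeg n 0≤1)))

  archimedean : ∀ p → ∃[ n ] p ≤ n ⋅ 1ℚ
  archimedean p@(mkℚ num d _) = ℤ.∣ num ∣ , ℚ.toℚᵘ-cancel-≤ (ℚᵘ.≤-respʳ-≃ (ℚᵘ.≃-sym (toℚᵘ-⋅ ℤ.∣ num ∣)) num≤)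
    where
    toℚᵘ-⋅ : ∀ n → toℚᵘ (n ⋅ 1ℚ) ℚᵘ.≃ mkℚᵘ (ℤ.+ n) 0
    toℚᵘ-⋅ zero    = *≡* refl
    toℚᵘ-⋅ (suc n) = ℚᵘ.≃-trans (ℚ.toℚᵘ-homo-+ 1ℚ (n ⋅ 1ℚ))
      (ℚᵘ.≃-trans (ℚᵘ.+-congʳ (toℚᵘ 1ℚ) (toℚᵘ-⋅ n)) (*≡* (cong (λ t → (ℤ.+ 1 ℤ.+ t) ℤ.* ℤ.+ 1) (ℤ.*-identityʳ (ℤ.+ n)))))
    num≤ : toℚᵘ p ℚᵘ.≤ mkℚᵘ (ℤ.+ ℤ.∣ num ∣) 0
    num≤ = *≤* (begin
      num ℤ.* ℤ.+ 1                  ≡⟨ ℤ.*-identityʳ num ⟩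
      num                          ≤⟨ ≤abs num ⟩
      ℤ.+ ℤ.∣ num ∣                  ≤⟨ ℤ.+≤+ (ℕ.m≤m*n ℤ.∣ num ∣ (suc d)) ⟩
      ℤ.+ (ℤ.∣ num ∣ ℕ.* suc d)      ≡⟨ ℤ.pos-* ℤ.∣ num ∣ (suc d) ⟩
      ℤ.+ ℤ.∣ num ∣ ℤ.* ℤ.+ suc d      ∎)
      where
      open ℤ.≤-Reasoning
      ≤abs : ∀ i → i ℤ.≤ ℤ.+ ℤ.∣ i ∣
      ≤abs (ℤ.+ n)      = ℤ.≤-refl
      ≤abs ℤ.-[1+ n ] = ℤ.-≤+

  ∙-nonNeg : ∀ {m} (v : Vector m) → 0ℚ ≤ v ∙ v
  ∙-nonNeg {zero}  v = ℚ.≤-refl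
  ∙-nonNeg {suc m} v = +-nonNeg (square-nonNeg (v zero)) (∙-nonNeg (v ∘ suc))

  cauchy-schwarz : ∀ {m} (v w : Vector m) → v ∙ w * v ∙ w ≤ v ∙ v * w ∙ w
  cauchy-schwarz {zero}  v w = ℚ.≤-refl
  cauchy-schwarz {suc m} v w = 0≤q-p⇒p≤q (subst (0ℚ ≤_)
    (solve 5 (λ a b X Y Z →
        (X :* Y :- Z :* Z) :+ ((X :* (b :* b) :+ Y :* (a :* a)) :- (Z :* a :* b :+ Z :* a :* b)) :=
        (a :* a :+ X) :* (b :* b :+ Y) :- (a :* b :+ Z) :* (a :* b :+ Z))
      refl a b X Y Z)
    (+-nonNeg (p≤q⇒0≤q-p Z²≤XY) (p≤q⇒0≤q-p cross)))
    where
    open +-*-Solver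
    a = v zero
    b = w zero
    X = (v ∘ suc) ∙ (v ∘ suc)
    Y = (w ∘ suc) ∙ (w ∘ suc)
    Z = (v ∘ suc) ∙ (w ∘ suc)
    Z²≤XY : Z * Z ≤ X * Y
    Z²≤XY = cauchy-schwarz (v ∘ suc) (w ∘ suc)
    cross : Z * a * b + Z * a * b ≤ X * (b * b) + Y * (a * a)
    cross = square-cancel-≤
      (+-nonNeg (*-nonNeg (∙-nonNeg (v ∘ suc)) (square-nonNeg b)) (*-nonNeg (∙-nonNeg (w ∘ suc)) (square-nonNeg a)))
      (0≤q-p⇒p≤q (subst (0ℚ ≤_)
        (solve 5 (λ a b X Y Z → let p = X :* (b :* b); q = Y :* (a :* a); d = a :* b :+ a :* b in
            (p :- q) :* (p :- q) :+ (X :* Y :- Z :* Z) :* (d :* d) :=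
            (p :+ q) :* (p :+ q) :- (Z :* a :* b :+ Z :* a :* b) :* (Z :* a :* b :+ Z :* a :* b))
          refl a b X Y Z)
        (+-nonNeg (square-nonNeg (X * (b * b) - Y * (a * a))) (*-nonNeg (p≤q⇒0≤q-p Z²≤XY) (square-nonNeg (a * b + a * b))))))

  sum-mono-≤ : ∀ {m} (f g : Vector m) → (∀ i → f i ≤ g i) → sum f ≤ sum g
  sum-mono-≤ {zero}  f g f≤g = ℚ.≤-refl
  sum-mono-≤ {suc m} f g f≤g = ℚ.+-mono-≤ (f≤g zero) (sum-mono-≤ (f ∘ suc) (g ∘ suc) (f≤g ∘ suc))

  sum-const : ∀ m c → sum {m} (λ _ → c) ≡ (m ⋅ 1ℚ) * c
  sum-const zero    c = sym (ℚ.*-zeroˡ c)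
  sum-const (suc m) c = trans (cong₂ _+_ (sym (ℚ.*-identityˡ c)) (sum-const m c))
    (sym (ℚ.*-distribʳ-+ c 1ℚ (m ⋅ 1ℚ)))

  sum-square-+ : ∀ {m} (x y : Vector m) →
    (λ i → x i + y i) ∙ (λ i → x i + y i) ≡ x ∙ x + (x ∙ y + x ∙ y) + y ∙ y
  sum-square-+ {zero}  x y = refl
  sum-square-+ {suc m} x y = trans (cong ((x zero + y zero) * (x zero + y zero) +_) (sum-square-+ (x ∘ suc) (y ∘ suc)))
    (solve 5 (λ a b X Z Y → (a :+ b) :* (a :+ b) :+ (X :+ (Z :+ Z) :+ Y) :=
        (a :* a :+ X) :+ ((a :* b :+ Z) :+ (a :* b :+ Z)) :+ (b :* b :+ Y))
      refl (x zero) (y zero) ((x ∘ suc) ∙ (x ∘ suc)) ((x ∘ suc) ∙ (y ∘ suc)) ((y ∘ suc) ∙ (y ∘ suc)))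
    where open +-*-Solver

  triangle : ∀ {m} (x y : Vector m) r s q → 0ℚ ≤ r → 0ℚ ≤ s → 0ℚ ≤ q →
    x ∙ x ≤ r * r * q → y ∙ y ≤ s * s * q →
    (λ i → x i + y i) ∙ (λ i → x i + y i) ≤ (r + s) * (r + s) * q
  triangle x y r s q 0≤r 0≤s 0≤q x≤ y≤ = subst₂ _≤_ (sym (sum-square-+ x y))
    (solve 3 (λ r s q → r :* r :* q :+ (r :* s :* q :+ r :* s :* q) :+ s :* s :* q := (r :+ s) :* (r :+ s) :* q)
      refl r s q)
    (ℚ.+-mono-≤ (ℚ.+-mono-≤ x≤ (ℚ.+-mono-≤ xy≤ xy≤)) y≤)
    where
    open +-*-Solver
    xy≤ : x ∙ y ≤ r * s * q
    xy≤ = square-cancel-≤ (*-nonNeg (*-nonNeg 0≤r 0≤s) 0≤q) (begin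
      x ∙ y * x ∙ y                     ≤⟨ cauchy-schwarz x y ⟩
      x ∙ x * y ∙ y                     ≤⟨ *-mono-≤ (∙-nonNeg y) (ℚ.≤-trans (∙-nonNeg x) x≤) x≤ y≤ ⟩
      r * r * q * (s * s * q)           ≡⟨ solve 3 (λ r s q → r :* r :* q :* (s :* s :* q) := r :* s :* q :* (r :* s :* q)) refl r s q ⟩
      r * s * q * (r * s * q)           ∎)
      where open ℚ.≤-Reasoning

  record Bounded {m} (A : Matrix m) (r : ℚ) : Set where
    field
      bound : ∀ v → (A ⊙ v) ∙ (A ⊙ v) ≤ r * r * v ∙ v
  open Bounded public

  Bounded-resp : ∀ {m} {A B : Matrix m} {r} → (∀ i j → A i j ≡ B i j) → Bounded A r → Bounded B r
  Bounded-resp {A = A} {B} {r} A≡B A≤ .bound v = subst (_≤ r * r * v ∙ v)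
    (ℚᴹ.∙-cong (λ i → eq i) (λ i → eq i)) (bound A≤ v)
    where
    eq : ∀ i → (A ⊙ v) i ≡ (B ⊙ v) i
    eq i = ℚᴹ.sum-cong-≋ λ j → cong (_* v j) (A≡B i j)

  Bounded-+ : ∀ {m} {A B : Matrix m} {r s} → 0ℚ ≤ r → 0ℚ ≤ s → Bounded A r → Bounded B s → Bounded (A ⊹ B) (r + s)
  Bounded-+ {A = A} {B} {r} {s} 0≤r 0≤s A≤ B≤ .bound v = subst (_≤ (r + s) * (r + s) * v ∙ v)
    (ℚᴹ.∙-cong (λ i → sym (eq i)) (λ i → sym (eq i)))
    (triangle (A ⊙ v) (B ⊙ v) r s (v ∙ v) 0≤r 0≤s (∙-nonNeg v) (bound A≤ v) (bound B≤ v))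
    where
    eq : ∀ i → ((A ⊹ B) ⊙ v) i ≡ (A ⊙ v) i + (B ⊙ v) i
    eq i = ∙-+ˡ (A i) (B i) v

  frobenius : ∀ {m} (A : Matrix m) v → (A ⊙ v) ∙ (A ⊙ v) ≤ sum (λ i → A i ∙ A i) * v ∙ v
  frobenius A v = ℚ.≤-trans (sum-mono-≤ _ _ λ i → cauchy-schwarz (A i) v)
    (ℚ.≤-reflexive (sym (ℚᴹ.*-distribʳ-sum (v ∙ v) λ i → A i ∙ A i)))

  small-entries : ∀ {m} (A : Matrix m) θ → (∀ i j → A i j * A i j ≤ θ * θ) → Bounded A ((m ⋅ 1ℚ) * θ)
  small-entries {m} A θ A≤ .bound v = ℚ.≤-trans (frobenius A v) (*-monoʳ-≤ (v ∙ v) (∙-nonNeg v) (begin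
    sum (λ i → A i ∙ A i)             ≤⟨ sum-mono-≤ _ (λ _ → M * (θ * θ)) (λ i → ℚ.≤-trans (sum-mono-≤ _ _ (A≤ i)) (ℚ.≤-reflexive (sum-const m (θ * θ)))) ⟩
    sum {m} (λ _ → M * (θ * θ))       ≡⟨ sum-const m (M * (θ * θ)) ⟩
    M * (M * (θ * θ))                 ≡⟨ solve 2 (λ M θ → M :* (M :* (θ :* θ)) := M :* θ :* (M :* θ)) refl M θ ⟩
    M * θ * (M * θ)                   ∎))
    where
    open +-*-Solver
    open ℚ.≤-Reasoning
    M = m ⋅ 1ℚ

  -- The operator norm of A lies in [norm - ε , norm].
  record Approximation {m} (A : Matrix m) (ε : ℚ) : Set where
    field
      norm    : ℚ
      norm≥0  : 0ℚ ≤ norm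
      bounded : Bounded A norm
      witness : Vector m
      nonzero : 0ℚ < witness ∙ witness
      gain    : ℚ
      gain≥0  : 0ℚ ≤ gain
      gain≥   : norm ≤ gain + ε
      gains   : gain * gain * witness ∙ witness ≤ (A ⊙ witness) ∙ (A ⊙ witness)

    gain-below : ∀ {r} → 0ℚ ≤ r → Bounded A r → gain ≤ r
    gain-below 0≤r A≤ = square-cancel-≤ 0≤r (*-cancelʳ-≤ _ nonzero (ℚ.≤-trans gains (bound A≤ witness)))

  approximate : ∀ {m} (A : Matrix (suc m)) ε → 0ℚ < ε → Approximation A ε
  approximate {m} A ε 0<ε = search (proj₁ start) (proj₂ start)
    where
    open +-*-Solver
    F = sum (λ i → A i ∙ A i)
    e₀ : Vector (suc m)
    e₀ = δ zero
    0≤F : 0ℚ ≤ F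
    0≤F = subst (_≤ F) (trans (sum-const (suc m) 0ℚ) (ℚ.*-zeroʳ (suc m ⋅ 1ℚ)))
      (sum-mono-≤ (λ _ → 0ℚ) (λ i → A i ∙ A i) (λ i → ∙-nonNeg (A i)))

    start : ∃[ k ] Bounded A (k ⋅ ε)
    start with reciprocal ε 0<ε
    ... | r , 0<r , εr≡1 with archimedean ((F + 1ℚ) * r)
    ... | k , ≤k = k , record { bound = λ v → ℚ.≤-trans (frobenius A v) (*-monoʳ-≤ (v ∙ v) (∙-nonNeg v)
      (ℚ.≤-trans F≤ (*-mono-≤ 0≤F+1 (ℚ.≤-trans 0≤F+1 F+1≤) F+1≤ F+1≤))) }
      where
      0≤F+1 = +-nonNeg 0≤F 0≤1
      F≤ : F ≤ (F + 1ℚ) * (F + 1ℚ)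
      F≤ = 0≤q-p⇒p≤q (subst (0ℚ ≤_)
        (solve 1 (λ F → F :* F :+ F :+ con 1ℚ := (F :+ con 1ℚ) :* (F :+ con 1ℚ) :- F) refl F)
        (+-nonNeg (+-nonNeg (square-nonNeg F) 0≤F) 0≤1))
      F+1≤ : F + 1ℚ ≤ k ⋅ ε
      F+1≤ = begin
        F + 1ℚ                 ≡⟨ trans (sym (ℚ.*-identityʳ (F + 1ℚ))) (cong ((F + 1ℚ) *_) (sym εr≡1)) ⟩
        (F + 1ℚ) * (ε * r)     ≡⟨ solve 3 (λ a b c → a :* (b :* c) := a :* c :* b) refl (F + 1ℚ) ε r ⟩
        (F + 1ℚ) * r * ε       ≤⟨ *-monoʳ-≤ ε (ℚ.<⇒≤ 0<ε) ≤k ⟩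
        (k ⋅ 1ℚ) * ε           ≡⟨ trans (sym (⋅-assoc k 1ℚ ε)) (cong (k ⋅_) (ℚ.*-identityˡ ε)) ⟩
        k ⋅ ε                  ∎
        where open ℚ.≤-Reasoning

    search : ∀ k → Bounded A (k ⋅ ε) → Approximation A ε
    search zero    A≤ = record
      { norm    = 0ℚ
      ; norm≥0  = ℚ.≤-refl
      ; bounded = A≤
      ; witness = e₀
      ; nonzero = subst (0ℚ <_) (sym (ℚᴹ.sum-δˡ {suc m} zero e₀)) 0<1
      ; gain    = 0ℚ
      ; gain≥0  = ℚ.≤-refl
      ; gain≥   = +-nonNeg ℚ.≤-refl (ℚ.<⇒≤ 0<ε)
      ; gains   = ℚ.≤-trans (ℚ.≤-reflexive (ℚ.*-zeroˡ (e₀ ∙ e₀))) (∙-nonNeg (A ⊙ e₀))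
      }
    search (suc k) A≤ with contraction? A (k ⋅ ε * k ⋅ ε)
    ... | inj₁ A≤′      = search k (record { bound = A≤′ })
    ... | inj₂ (w , w<) = record
      { norm    = suc k ⋅ ε
      ; norm≥0  = ⋅-nonNeg (suc k) (ℚ.<⇒≤ 0<ε)
      ; bounded = A≤
      ; witness = w
      ; nonzero = ℚ.≰⇒> λ w≤0 → ℚ.<-irrefl refl (ℚ.<-≤-trans
          (ℚ.≤-<-trans (*-nonNeg (square-nonNeg (k ⋅ ε)) (∙-nonNeg w)) w<)
          (ℚ.≤-trans (bound A≤ w) (ℚ.≤-trans (*-monoˡ-≤ _ (square-nonNeg (suc k ⋅ ε)) w≤0) (ℚ.≤-reflexive (ℚ.*-zeroʳ (suc k ⋅ ε * suc k ⋅ ε))))))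
      ; gain    = k ⋅ ε
      ; gain≥0  = ⋅-nonNeg k (ℚ.<⇒≤ 0<ε)
      ; gain≥   = ℚ.≤-reflexive (ℚ.+-comm ε (k ⋅ ε))
      ; gains   = ℚ.<⇒≤ w<
      }

module RealOrder where

  open import Defs hiding (∣_∣²)
  open import Data.Nat.Base as ℕ using (ℕ)
  import Data.Nat.Properties as ℕ
  open import Data.Product.Base using (_,_; _×_; proj₁; proj₂; ∃-syntax)
  open import Data.Rational.Base hiding (nonNeg)
  import Data.Rational.Properties as ℚ
  open import Data.Rational.Solver using (module +-*-Solver)
  open import Data.Sum.Base using (inj₁; inj₂)
  open import Relation.Binary.PropositionalEquality
  open LinearAlgebra
  open QuadraticForms
  open RationalNorm

  module ℝᴹ = Matrices ℝ-commutativeRing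

  ∣∣<-elim : ∀ {p ε} → ∣ p ∣ < ε → p < ε × - p < ε
  ∣∣<-elim {p} {ε} p<ε with ℚ.≤-total 0ℚ p
  ... | inj₁ 0≤p = subst (_< ε) (ℚ.0≤p⇒∣p∣≡p 0≤p) p<ε
                 , ℚ.≤-<-trans (ℚ.≤-trans (ℚ.neg-antimono-≤ 0≤p) (ℚ.0≤∣p∣ p)) p<ε
  ... | inj₂ p≤0 = ℚ.≤-<-trans (ℚ.≤-trans p≤0 (ℚ.0≤∣p∣ p)) p<ε
                 , subst (_< ε) (trans (sym (ℚ.∣-p∣≡∣p∣ p)) (ℚ.0≤p⇒∣p∣≡p (ℚ.neg-antimono-≤ p≤0))) p<ε

  ∣∣<-intro : ∀ {p ε} → p < ε → - p < ε → ∣ p ∣ < ε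
  ∣∣<-intro {p} {ε} p<ε -p<ε with ℚ.∣p∣≡p∨∣p∣≡-p p
  ... | inj₁ eq = subst (_< ε) (sym eq) p<ε
  ... | inj₂ eq = subst (_< ε) (sym eq) -p<ε

  p-q<r⇒p<q+r : ∀ {p} q {r} → p - q < r → p < q + r
  p-q<r⇒p<q+r {p} q {r} p-q<r = subst (_< q + r) (solve 2 (λ p q → q :+ (p :- q) := p) refl p q) (ℚ.+-monoʳ-< q p-q<r)
    where open +-*-Solver

  p<q+r⇒p-q<r : ∀ {p} q {r} → p < q + r → p - q < r
  p<q+r⇒p-q<r {p} q {r} p<q+r = subst (p - q <_) (solve 2 (λ q r → (q :+ r) :- q := r) refl q r) (ℚ.+-monoˡ-< (- q) p<q+r)
    where open +-*-Solver

  ∣p-q∣<r⇒p<q+r : ∀ p q {r} → ∣ p - q ∣ < r → p < q + r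
  ∣p-q∣<r⇒p<q+r p q p≈q = p-q<r⇒p<q+r q (proj₁ (∣∣<-elim p≈q))

  ∣p-q∣<r⇒q<p+r : ∀ p q {r} → ∣ p - q ∣ < r → q < p + r
  ∣p-q∣<r⇒q<p+r p q {r} p≈q = p-q<r⇒p<q+r p (subst (_< r) (solve 2 (λ p q → :- (p :- q) := q :- p) refl p q) (proj₂ (∣∣<-elim p≈q)))
    where open +-*-Solver

  ∣p-q∣<r⁺ : ∀ p q {r} → p < q + r → q < p + r → ∣ p - q ∣ < r
  ∣p-q∣<r⁺ p q {r} p< q< = ∣∣<-intro (p<q+r⇒p-q<r q p<)
    (subst (_< r) (solve 2 (λ p q → q :- p := :- (p :- q)) refl p q) (p<q+r⇒p-q<r p q<))
    where open +-*-Solver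

  p<p+q : ∀ p {q} → 0ℚ < q → p < p + q
  p<p+q p {q} 0<q = subst (_< p + q) (ℚ.+-identityʳ p) (ℚ.+-monoʳ-< p 0<q)

  half-pos : ∀ {ε} → 0ℚ < ε → 0ℚ < ½ * ε
  half-pos = *-pos (ℚ.positive⁻¹ ½)

  halves : ∀ ε → ½ * ε + ½ * ε ≡ ε
  halves = solve 1 (λ ε → con ½ :* ε :+ con ½ :* ε := ε) refl
    where open +-*-Solver

  ⊔ˡ : ∀ {M N n} → M ℕ.⊔ N ℕ.≤ n → M ℕ.≤ n
  ⊔ˡ {M} {N} = ℕ.m⊔n≤o⇒m≤o M N

  ⊔ʳ : ∀ {M N n} → M ℕ.⊔ N ℕ.≤ n → N ℕ.≤ n
  ⊔ʳ {M} {N} = ℕ.m⊔n≤o⇒n≤o M N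

  eventually-≤ : ∀ {x y} N → (∀ n → N ℕ.≤ n → seq x n ≤ seq y n) → x ≤ᴿ y
  eventually-≤ {x} {y} N x≤y .below ε 0<ε = N , λ n N≤n → ℚ.≤-<-trans (x≤y n N≤n) (p<p+q (seq y n) 0<ε)

  pointwise-≤ : ∀ {x y} → (∀ n → seq x n ≤ seq y n) → x ≤ᴿ y
  pointwise-≤ x≤y = eventually-≤ 0 λ n _ → x≤y n

  ≤ᴿ-reflexive : ∀ {x y} → x ≈ᴿ y → x ≤ᴿ y
  ≤ᴿ-reflexive {x} {y} x≈y .below ε 0<ε = let N , c = close x≈y ε 0<ε in
    N , λ n N≤n → ∣p-q∣<r⇒p<q+r (seq x n) (seq y n) (c n N≤n)

  ≤ᴿ-refl : ∀ {x} → x ≤ᴿ x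
  ≤ᴿ-refl {x} = ≤ᴿ-reflexive ≈ᴿ.refl

  ≤ᴿ-trans : ∀ {x y z} → x ≤ᴿ y → y ≤ᴿ z → x ≤ᴿ z
  ≤ᴿ-trans {x} {y} {z} x≤y y≤z .below ε 0<ε =
    let M , b = below x≤y (½ * ε) (half-pos 0<ε)
        N , c = below y≤z (½ * ε) (half-pos 0<ε)
    in M ℕ.⊔ N , λ n ≤n → subst (seq x n <_)
         (trans (ℚ.+-assoc (seq z n) (½ * ε) (½ * ε)) (cong (seq z n +_) (halves ε)))
         (ℚ.<-trans (b n (⊔ˡ ≤n)) (ℚ.+-monoˡ-< (½ * ε) (c n (⊔ʳ {M} ≤n))))

  ≤ᴿ-antisym : ∀ {x y} → x ≤ᴿ y → y ≤ᴿ x → x ≈ᴿ y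
  ≤ᴿ-antisym {x} {y} x≤y y≤x .close ε 0<ε =
    let M , b = below x≤y ε 0<ε
        N , c = below y≤x ε 0<ε
    in M ℕ.⊔ N , λ n ≤n → ∣p-q∣<r⁺ (seq x n) (seq y n) (b n (⊔ˡ ≤n)) (c n (⊔ʳ {M} ≤n))

  ≤ᴿ-resp : ∀ {x x′ y y′} → x ≈ᴿ x′ → y ≈ᴿ y′ → x ≤ᴿ y → x′ ≤ᴿ y′
  ≤ᴿ-resp x≈ y≈ x≤y = ≤ᴿ-trans (≤ᴿ-reflexive (≈ᴿ.sym x≈)) (≤ᴿ-trans x≤y (≤ᴿ-reflexive y≈))

  +ᴿ-mono-≤ : ∀ {x x′ y y′} → x ≤ᴿ x′ → y ≤ᴿ y′ → x +ᴿ y ≤ᴿ x′ +ᴿ y′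
  +ᴿ-mono-≤ {x} {x′} {y} {y′} x≤ y≤ .below ε 0<ε =
    let M , b = below x≤ (½ * ε) (half-pos 0<ε)
        N , c = below y≤ (½ * ε) (half-pos 0<ε)
    in M ℕ.⊔ N , λ n ≤n → subst (seq x n + seq y n <_)
         (solve 3 (λ p q e → (p :+ con ½ :* e) :+ (q :+ con ½ :* e) := p :+ q :+ e) refl (seq x′ n) (seq y′ n) ε)
         (ℚ.+-mono-< (b n (⊔ˡ ≤n)) (c n (⊔ʳ {M} ≤n)))
    where open +-*-Solver

  ≤ᴿ-closed : ∀ {x y} → (∀ ε → 0ℚ < ε → x ≤ᴿ y +ᴿ fromℚ ε) → x ≤ᴿ y
  ≤ᴿ-closed {x} {y} x≤ .below ε 0<ε =
    let N , c = below (x≤ (½ * ε) (half-pos 0<ε)) (½ * ε) (half-pos 0<ε)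
    in N , λ n N≤n → subst (seq x n <_)
         (trans (ℚ.+-assoc (seq y n) (½ * ε) (½ * ε)) (cong (seq y n +_) (halves ε))) (c n N≤n)

  fromℚ-mono-≤ : ∀ {p q} → p ≤ q → fromℚ p ≤ᴿ fromℚ q
  fromℚ-mono-≤ p≤q = pointwise-≤ λ _ → p≤q

  bounded-seq : ∀ x → ∃[ M ] (0ℚ < M × ∃[ N ] ∀ n → N ℕ.≤ n → seq x n ≤ M × - seq x n ≤ M)
  bounded-seq x with cauchy x 1ℚ 0<1
  ... | N , c = M , 0<M , N , λ n N≤n → upper n N≤n , lower n N≤n
    where
    open ℚ.≤-Reasoning
    open +-*-Solver
    a = seq x N
    M = ∣ a ∣ + 1ℚ
    0<M : 0ℚ < M
    0<M = ℚ.≤-<-trans (ℚ.0≤∣p∣ a) (p<p+q ∣ a ∣ 0<1)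
    ≤∣∣ : ∀ p → p ≤ ∣ p ∣
    ≤∣∣ p with ℚ.≤-total 0ℚ p
    ... | inj₁ 0≤p = ℚ.≤-reflexive (sym (ℚ.0≤p⇒∣p∣≡p 0≤p))
    ... | inj₂ p≤0 = ℚ.≤-trans p≤0 (ℚ.0≤∣p∣ p)
    upper : ∀ n → N ℕ.≤ n → seq x n ≤ M
    upper n N≤n = ℚ.≤-trans (ℚ.<⇒≤ (∣p-q∣<r⇒p<q+r (seq x n) a (c n N N≤n ℕ.≤-refl))) (ℚ.+-monoˡ-≤ 1ℚ (≤∣∣ a))
    lower : ∀ n → N ℕ.≤ n → - seq x n ≤ M
    lower n N≤n = begin
      - seq x n        ≡⟨ solve 2 (λ a x → :- x := :- a :+ (a :- x)) refl a (seq x n) ⟩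
      - a + (a - seq x n) ≤⟨ ℚ.+-mono-≤ (subst (- a ≤_) (ℚ.∣-p∣≡∣p∣ a) (≤∣∣ (- a))) (ℚ.<⇒≤ (proj₁ (∣∣<-elim (c N n ℕ.≤-refl N≤n)))) ⟩
      M                ∎

  product-above : ∀ {p q M M′ ζ} → 0ℚ < M → 0ℚ < M′ → 0ℚ < ζ → p ≤ M → q ≤ M′ →
    0ℚ < p + ζ → 0ℚ < q + ζ → 0ℚ < p * q + (M + M′) * ζ
  product-above {p} {q} {M} {M′} {ζ} 0<M 0<M′ 0<ζ p≤M q≤M′ 0<p+ζ 0<q+ζ with ℚ.≤-total 0ℚ p | ℚ.≤-total 0ℚ q
  ... | inj₁ 0≤p | inj₁ 0≤q = ℚ.<-≤-trans (*-pos (ℚ.<-trans 0<M (p<p+q M 0<M′)) 0<ζ)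
    (subst (_≤ p * q + (M + M′) * ζ) (ℚ.+-identityˡ ((M + M′) * ζ)) (ℚ.+-monoˡ-≤ ((M + M′) * ζ) (*-nonNeg 0≤p 0≤q)))
  ... | inj₂ p≤0 | inj₂ q≤0 = ℚ.<-≤-trans (*-pos (ℚ.<-trans 0<M (p<p+q M 0<M′)) 0<ζ)
    (subst (_≤ p * q + (M + M′) * ζ) (ℚ.+-identityˡ ((M + M′) * ζ)) (ℚ.+-monoˡ-≤ ((M + M′) * ζ)
      (subst (0ℚ ≤_) (solve 2 (λ p q → :- p :* :- q := p :* q) refl p q)
        (*-nonNeg (ℚ.neg-antimono-≤ p≤0) (ℚ.neg-antimono-≤ q≤0)))))
    where open +-*-Solver
  ... | inj₁ 0≤p | inj₂ q≤0 = ℚ.<-≤-trans (*-pos 0<M′ 0<ζ) (0≤q-p⇒p≤q (subst (0ℚ ≤_)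
    (solve 5 (λ p q M M′ ζ → p :* (q :+ ζ) :+ (M :- p) :* ζ := p :* q :+ (M :+ M′) :* ζ :- M′ :* ζ) refl p q M M′ ζ)
    (+-nonNeg (*-nonNeg 0≤p (ℚ.<⇒≤ 0<q+ζ)) (*-nonNeg (p≤q⇒0≤q-p p≤M) (ℚ.<⇒≤ 0<ζ)))))
    where open +-*-Solver
  ... | inj₂ p≤0 | inj₁ 0≤q = ℚ.<-≤-trans (*-pos 0<M 0<ζ) (0≤q-p⇒p≤q (subst (0ℚ ≤_)
    (solve 5 (λ p q M M′ ζ → q :* (p :+ ζ) :+ (M′ :- q) :* ζ := p :* q :+ (M :+ M′) :* ζ :- M :* ζ) refl p q M M′ ζ)
    (+-nonNeg (*-nonNeg 0≤q (ℚ.<⇒≤ 0<p+ζ)) (*-nonNeg (p≤q⇒0≤q-p q≤M′) (ℚ.<⇒≤ 0<ζ)))))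
    where open +-*-Solver

  *ᴿ-nonNeg : ∀ {x y} → 0ᴿ ≤ᴿ x → 0ᴿ ≤ᴿ y → 0ᴿ ≤ᴿ x *ᴿ y
  *ᴿ-nonNeg {x} {y} 0≤x 0≤y .below ε 0<ε =
    let M  , 0<M  , K  , bx = bounded-seq x
        M′ , 0<M′ , K′ , by = bounded-seq y
        r , 0<r , Mr≡1 = reciprocal (M + M′) (ℚ.<-trans 0<M (p<p+q M 0<M′))
        L  , lx = below 0≤x (r * ε) (*-pos 0<r 0<ε)
        L′ , ly = below 0≤y (r * ε) (*-pos 0<r 0<ε)
    in (K ℕ.⊔ K′) ℕ.⊔ (L ℕ.⊔ L′) , λ n ≤n → subst (λ t → 0ℚ < seq x n * seq y n + t)
         (trans (sym (ℚ.*-assoc (M + M′) r ε)) (trans (cong (_* ε) Mr≡1) (ℚ.*-identityˡ ε)))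
         (product-above {seq x n} {seq y n} 0<M 0<M′ (*-pos 0<r 0<ε)
           (proj₁ (bx n (⊔ˡ {K} {K′} (⊔ˡ ≤n)))) (proj₁ (by n (⊔ʳ {K} {K′} (⊔ˡ ≤n))))
           (lx n (⊔ˡ {L} {L′} (⊔ʳ {K ℕ.⊔ K′} ≤n))) (ly n (⊔ʳ {L} {L′} (⊔ʳ {K ℕ.⊔ K′} ≤n))))

  0≤y-x⁺ : ∀ {x y} → x ≤ᴿ y → 0ᴿ ≤ᴿ y +ᴿ -ᴿ x
  0≤y-x⁺ {x} {y} x≤y = ≤ᴿ-resp (pointwise λ n → ℚ.+-inverseʳ (seq x n)) ≈ᴿ.refl (+ᴿ-mono-≤ x≤y (≤ᴿ-refl { -ᴿ x}))

  0≤y-x⁻ : ∀ {x y} → 0ᴿ ≤ᴿ y +ᴿ -ᴿ x → x ≤ᴿ y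
  0≤y-x⁻ {x} {y} 0≤ = ≤ᴿ-resp
    (pointwise λ n → ℚ.+-identityˡ (seq x n))
    (pointwise λ n → solve 2 (λ y x → (y :- x) :+ x := y) refl (seq y n) (seq x n))
    (+ᴿ-mono-≤ 0≤ (≤ᴿ-refl {x}))
    where open +-*-Solver

  *ᴿ-monoˡ-≤ : ∀ {x y} z → 0ᴿ ≤ᴿ z → x ≤ᴿ y → z *ᴿ x ≤ᴿ z *ᴿ y
  *ᴿ-monoˡ-≤ {x} {y} z 0≤z x≤y = 0≤y-x⁻ (≤ᴿ-resp ≈ᴿ.refl
    (pointwise λ n → solve 3 (λ z y x → z :* (y :- x) := z :* y :- z :* x) refl (seq z n) (seq y n) (seq x n))
    (*ᴿ-nonNeg 0≤z (0≤y-x⁺ x≤y)))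
    where open +-*-Solver

  *ᴿ-monoʳ-≤ : ∀ {x y} z → 0ᴿ ≤ᴿ z → x ≤ᴿ y → x *ᴿ z ≤ᴿ y *ᴿ z
  *ᴿ-monoʳ-≤ {x} {y} z 0≤z x≤y = ≤ᴿ-resp
    (pointwise λ n → ℚ.*-comm (seq z n) (seq x n)) (pointwise λ n → ℚ.*-comm (seq z n) (seq y n))
    (*ᴿ-monoˡ-≤ z 0≤z x≤y)

  *ᴿ-mono-≤ : ∀ {x x′ y y′} → 0ᴿ ≤ᴿ y → 0ᴿ ≤ᴿ x′ → x ≤ᴿ x′ → y ≤ᴿ y′ → x *ᴿ y ≤ᴿ x′ *ᴿ y′
  *ᴿ-mono-≤ {x} {x′} {y} {y′} 0≤y 0≤x′ x≤ y≤ = ≤ᴿ-trans (*ᴿ-monoʳ-≤ y 0≤y x≤) (*ᴿ-monoˡ-≤ x′ 0≤x′ y≤)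

  squareᴿ-nonNeg : ∀ x → 0ᴿ ≤ᴿ x *ᴿ x
  squareᴿ-nonNeg x = pointwise-≤ λ n → square-nonNeg (seq x n)

  -- If p ≥ q + ε then p² ≥ (q + ε)² > q² + ½ ε², since q > - ¼ ε.
  squareᴿ-cancel-≤ : ∀ {x y} → 0ᴿ ≤ᴿ y → x *ᴿ x ≤ᴿ y *ᴿ y → x ≤ᴿ y
  squareᴿ-cancel-≤ {x} {y} 0≤y x²≤y² .below ε 0<ε =
    let η = ½ * ε
        M , b = below 0≤y (½ * η) (half-pos (half-pos 0<ε))
        N , c = below x²≤y² (η * ε) (*-pos (half-pos 0<ε) 0<ε)
    in M ℕ.⊔ N , λ n ≤n → step (seq x n) (seq y n) (b n (⊔ˡ ≤n)) (c n (⊔ʳ {M} ≤n))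
    where
    open +-*-Solver
    step : ∀ p q → 0ℚ < q + ½ * (½ * ε) → p * p < q * q + ½ * ε * ε → p < q + ε
    step p q 0<q+ p²< = ℚ.≰⇒> λ q+ε≤p → ℚ.<-irrefl refl (ℚ.<-≤-trans
      (ℚ.<-≤-trans p²< (0≤q-p⇒p≤q (subst (0ℚ ≤_)
        (solve 2 (λ q ε → let h = con ½ in
            (q :+ h :* (h :* ε)) :* (ε :+ ε) := (q :+ ε) :* (q :+ ε) :- (q :* q :+ h :* ε :* ε)) refl q ε)
        (*-nonNeg (ℚ.<⇒≤ 0<q+) (+-nonNeg (ℚ.<⇒≤ 0<ε) (ℚ.<⇒≤ 0<ε))))))
      (*-mono-≤ (0≤q+ε q+ε≤p) (ℚ.≤-trans (0≤q+ε q+ε≤p) q+ε≤p) q+ε≤p q+ε≤p))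
      where
      0≤q+ε : q + ε ≤ p → 0ℚ ≤ q + ε
      0≤q+ε _ = subst (0ℚ ≤_)
        (solve 2 (λ q ε → let h = con ½ in (q :+ h :* (h :* ε)) :+ (h :* ε :+ h :* (h :* ε)) := q :+ ε) refl q ε)
        (+-nonNeg (ℚ.<⇒≤ 0<q+) (+-nonNeg (ℚ.<⇒≤ (half-pos 0<ε)) (ℚ.<⇒≤ (half-pos (half-pos 0<ε)))))

module OperatorNorm where

  open import Defs hiding (_·_; _≋_; ∣_∣²)
  open import Data.Fin.Base as Fin using (Fin; suc; zero)
  import Data.Fin.Properties as Fin
  open import Data.Nat.Base as ℕ using (suc; zero; ℕ)
  import Data.Nat.Properties as ℕ
  open import Data.Product.Base using (_,_; _×_; proj₁; proj₂; ∃-syntax)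
  open import Data.Rational.Base
  import Data.Rational.Properties as ℚ
  open import Data.Rational.Solver using (module +-*-Solver)
  open import Function.Base using (_∘_)
  open import Relation.Binary.PropositionalEquality hiding (isEquivalence)
  open LinearAlgebra
  open QuadraticForms
  open RationalNorm
  open RealOrder

  open ℝᴹ using (Vector; Matrix; _∙_; _⊙_; _⊹_; _⊛_; ⊝_; transpose; O; I; _≊_; entrywise; at)

  stage : ∀ {m} → Matrix m → ℕ → ℚᴹ.Matrix m
  stage a n i j = seq (a i j) n

  stageᵛ : ∀ {m} → Vector m → ℕ → ℚᴹ.Vector m
  stageᵛ v n i = seq (v i) n

  seq-sum : ∀ {m} (f : Vector m) n → seq (ℝᴹ.sum f) n ≡ ℚᴹ.sum (stageᵛ f n)
  seq-sum {zero}  f n = refl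
  seq-sum {suc m} f n = cong (seq (f zero) n +_) (seq-sum (f ∘ suc) n)

  seq-∙ : ∀ {m} (v w : Vector m) n → seq (v ∙ w) n ≡ stageᵛ v n ℚᴹ.∙ stageᵛ w n
  seq-∙ v w n = seq-sum (λ i → v i *ᴿ w i) n

  seq-norm² : ∀ {m} (a : Matrix m) v n → seq ((a ⊙ v) ∙ (a ⊙ v)) n ≡
    (stage a n ℚᴹ.⊙ stageᵛ v n) ℚᴹ.∙ (stage a n ℚᴹ.⊙ stageᵛ v n)
  seq-norm² a v n = trans (seq-∙ (a ⊙ v) (a ⊙ v) n) (ℚᴹ.∙-cong row row)
    where
    row : ∀ i → seq ((a ⊙ v) i) n ≡ (stage a n ℚᴹ.⊙ stageᵛ v n) i
    row i = seq-∙ (a i) v n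

  uniformly : ∀ {m} {P : Fin m → ℕ → Set} → (∀ i → ∃[ N ] ∀ n → N ℕ.≤ n → P i n) →
    ∃[ N ] ∀ n → N ℕ.≤ n → ∀ i → P i n
  uniformly {zero}  f = 0 , λ _ _ ()
  uniformly {suc m} f =
    let M , p = f zero
        N , q = uniformly (f ∘ suc)
    in M ℕ.⊔ N , λ { n ≤n zero → p n (⊔ˡ ≤n) ; n ≤n (suc i) → q n (⊔ʳ {M} ≤n) i }

  precision : ℕ → ℚ
  precision n = proj₁ (reciprocal (suc n ⋅ 1ℚ) (suc⋅1-pos n))

  precision-pos : ∀ n → 0ℚ < precision n
  precision-pos n = proj₁ (proj₂ (reciprocal (suc n ⋅ 1ℚ) (suc⋅1-pos n)))

  precision-inverse : ∀ n → (suc n ⋅ 1ℚ) * precision n ≡ 1ℚ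
  precision-inverse n = proj₂ (proj₂ (reciprocal (suc n ⋅ 1ℚ) (suc⋅1-pos n)))

  precision-small : ∀ ε → 0ℚ < ε → ∃[ N ] ∀ n → N ℕ.≤ n → precision n ≤ ε
  precision-small ε 0<ε =
    let r , 0<r , εr≡1 = reciprocal ε 0<ε
        N , r≤N = archimedean r
    in N , λ n N≤n → *-cancelʳ-≤ r 0<r (begin
         precision n * r            ≤⟨ *-monoˡ-≤ (precision n) (ℚ.<⇒≤ (precision-pos n)) (ℚ.≤-trans r≤N (⋅-mono (ℕ.m≤n⇒m≤1+n N≤n))) ⟩
         precision n * suc n ⋅ 1ℚ   ≡⟨ trans (ℚ.*-comm (precision n) (suc n ⋅ 1ℚ)) (precision-inverse n) ⟩
         1ℚ                         ≡⟨ εr≡1 ⟨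
         ε * r                      ∎)
    where open ℚ.≤-Reasoning

  module _ {m} (a : Matrix (suc m)) where

    private
      dim = suc m ⋅ 1ℚ

      approximation : ∀ n → Approximation (stage a n) (precision n)
      approximation n = approximate (stage a n) (precision n) (precision-pos n)

      module approx n = Approximation (approximation n)

      settle : ∀ η → 0ℚ < η → ∃[ N ] ((∀ n → N ℕ.≤ n → precision n ≤ η) ×
        ∀ p q → N ℕ.≤ p → N ℕ.≤ q → Bounded (λ i j → stage a p i j - stage a q i j) η)
      settle η 0<η =
        let K , small = precision-small η 0<η
            N , cl    = uniformly λ i → uniformly λ j → entry i j
        in K ℕ.⊔ N , (λ n ≤n → small n (⊔ˡ ≤n)) , λ p q ≤p ≤q →
             subst (Bounded _) dimθ≡η (small-entries (λ i j → stage a p i j - stage a q i j) θ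
               λ i j → ∣∣<⇒square≤ {stage a p i j} {stage a q i j} {limit i j} (cl p (⊔ʳ {K} ≤p) i j) (cl q (⊔ʳ {K} ≤q) i j))
        where
        open +-*-Solver
        r = precision m
        θ = r * η
        0<θ : 0ℚ < θ
        0<θ = *-pos (precision-pos m) 0<η
        dimθ≡η : dim * θ ≡ η
        dimθ≡η = trans (sym (ℚ.*-assoc dim r η)) (trans (cong (_* η) (precision-inverse m)) (ℚ.*-identityˡ η))
        limit : Fin (suc m) → Fin (suc m) → ℚ
        limit i j = seq (a i j) (proj₁ (cauchy (a i j) (½ * θ) (half-pos 0<θ)))
        entry : ∀ i j → ∃[ N ] ∀ n → N ℕ.≤ n → ∣ seq (a i j) n - limit i j ∣ < ½ * θ
        entry i j = let N , c = cauchy (a i j) (½ * θ) (half-pos 0<θ) in N , λ n N≤n → c n N N≤n ℕ.≤-refl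
        ∣∣<⇒square≤ : ∀ {x y l} → ∣ x - l ∣ < ½ * θ → ∣ y - l ∣ < ½ * θ → (x - y) * (x - y) ≤ θ * θ
        ∣∣<⇒square≤ {x} {y} {l} x≈l y≈l = 0≤q-p⇒p≤q (subst (0ℚ ≤_)
          (solve 3 (λ x y θ → (θ :- (x :- y)) :* (θ :- (y :- x)) := θ :* θ :- (x :- y) :* (x :- y)) refl x y θ)
          (*-nonNeg (p≤q⇒0≤q-p (below-θ x y x≈l y≈l)) (p≤q⇒0≤q-p (below-θ y x y≈l x≈l))))
          where
          below-θ : ∀ x y → ∣ x - l ∣ < ½ * θ → ∣ y - l ∣ < ½ * θ → x - y ≤ θ
          below-θ x y x≈l y≈l = ℚ.<⇒≤ (subst₂ _<_
            (solve 3 (λ x y l → (x :- l) :+ :- (y :- l) := x :- y) refl x y l)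
            (halves θ)
            (ℚ.+-mono-< (proj₁ (∣∣<-elim x≈l)) (proj₂ (∣∣<-elim y≈l))))

      lipschitz : ∀ {η p q} → 0ℚ < η → precision q ≤ η →
        Bounded (λ i j → stage a q i j - stage a p i j) η → approx.norm q ≤ approx.norm p + η + η
      lipschitz {η} {p} {q} 0<η q≤η close = begin
          approx.norm q                  ≤⟨ approx.gain≥ q ⟩
          approx.gain q + precision q    ≤⟨ ℚ.+-mono-≤ (approx.gain-below q (+-nonNeg (approx.norm≥0 p) (ℚ.<⇒≤ 0<η))
              (Bounded-resp (λ i j → solve 2 (λ a b → a :+ (b :- a) := b) refl (stage a p i j) (stage a q i j))
                (Bounded-+ (approx.norm≥0 p) (ℚ.<⇒≤ 0<η) (approx.bounded p) close))) q≤η ⟩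
          approx.norm p + η + η          ∎
        where
        open ℚ.≤-Reasoning
        open +-*-Solver

    opnorm : ℝ
    seq    opnorm n = approx.norm n
    cauchy opnorm ε 0<ε =
      let η = ½ * (½ * ε)
          0<η = half-pos (half-pos 0<ε)
          N , small , cl = settle η 0<η
          step : ∀ p q → N ℕ.≤ p → N ℕ.≤ q → approx.norm q < approx.norm p + ε
          step p q ≤p ≤q = ℚ.≤-<-trans (lipschitz {p = p} {q} 0<η (small q ≤q) (cl q p ≤q ≤p)) (shrink (approx.norm p))
      in N , λ p q ≤p ≤q → ∣p-q∣<r⁺ (approx.norm p) (approx.norm q) (step q p ≤q ≤p) (step p q ≤p ≤q)
      where
      open +-*-Solver
      shrink : ∀ x → x + ½ * (½ * ε) + ½ * (½ * ε) < x + ε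
      shrink x = subst₂ _<_ (ℚ.+-identityʳ _)
        (solve 2 (λ x ε → let h = con ½ in (x :+ h :* (h :* ε) :+ h :* (h :* ε)) :+ h :* ε := x :+ ε) refl x ε)
        (ℚ.+-monoʳ-< (x + ½ * (½ * ε) + ½ * (½ * ε)) (half-pos 0<ε))

    opnorm-nonNeg : 0ᴿ ≤ᴿ opnorm
    opnorm-nonNeg = pointwise-≤ approx.norm≥0

    opnorm-bound : ∀ v → (a ⊙ v) ∙ (a ⊙ v) ≤ᴿ opnorm *ᴿ opnorm *ᴿ v ∙ v
    opnorm-bound v = pointwise-≤ λ n → subst₂ _≤_ (sym (seq-norm² a v n))
      (cong (approx.norm n * approx.norm n *_) (sym (seq-∙ v v n)))
      (bound (approx.bounded n) (stageᵛ v n))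

    -- With ρ and w the gain and witness at one late stage p, every later norm N satisfies N ≤ ρ + 3η,
    -- while s ρ² |w|² ≤ s |a w|² + O(η) |w|² ≤ t |w|² + O(η) |w|².
    opnorm-least : ∀ s t → (∀ n → 0ℚ ≤ seq s n) →
      (∀ v → s *ᴿ ((a ⊙ v) ∙ (a ⊙ v)) ≤ᴿ t *ᴿ v ∙ v) → s *ᴿ (opnorm *ᴿ opnorm) ≤ᴿ t
    opnorm-least s t 0≤s s≤t .below ε 0<ε =
      let S , 0<S , K , s≤S = bounded-seq s
          B , 0<B , L , N≤B = bounded-seq opnorm
          C = 1ℚ + S * (B + B + 1ℚ) + S * (6 ⋅ 1ℚ * B + 9 ⋅ 1ℚ)
          r , 0<r , Cr≡1 = reciprocal (C + ε) (ℚ.<-≤-trans 0<ε (subst (_≤ C + ε) (ℚ.+-identityˡ ε) (ℚ.+-monoˡ-≤ ε (0≤C (ℚ.<⇒≤ 0<S) (ℚ.<⇒≤ 0<B)))))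
          η = r * ε
          0<η = *-pos 0<r 0<ε
          P , small , cl = settle η 0<η
          p = L ℕ.⊔ P
          w = approx.witness p
          W = w ℚᴹ.∙ w
          Q , hyp = below (s≤t (λ i → fromℚ (w i))) (η * W) (*-pos 0<η (approx.nonzero p))
      in (K ℕ.⊔ Q) ℕ.⊔ p , λ n ≤n →
        conclude (seq s n) (seq t n) (approx.norm n) (approx.gain p) W
          ((stage a n ℚᴹ.⊙ w) ℚᴹ.∙ (stage a n ℚᴹ.⊙ w)) S B r 0<r Cr≡1
          (0≤s n) (proj₁ (s≤S n (⊔ˡ {K} {Q} (⊔ˡ ≤n)))) (approx.norm≥0 n)
          (proj₁ (N≤B n (⊔ˡ {L} {P} (⊔ʳ {K ℕ.⊔ Q} ≤n))))
          (approx.gain≥0 p)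
          (ℚ.≤-trans (approx.gain-below p (approx.norm≥0 p) (approx.bounded p)) (proj₁ (N≤B p (ℕ.m≤m⊔n L P))))
          (near {η} {n} {p} 0<η (small p (ℕ.m≤n⊔m L P)) (small n (⊔ʳ {L} {P} (⊔ʳ {K ℕ.⊔ Q} ≤n)))
            (cl n p (⊔ʳ {L} {P} (⊔ʳ {K ℕ.⊔ Q} ≤n)) (ℕ.m≤n⊔m L P)))
          (approx.nonzero p)
          (gain-stage {η} {n} {p} 0<η (cl p n (ℕ.m≤n⊔m L P) (⊔ʳ {L} {P} (⊔ʳ {K ℕ.⊔ Q} ≤n))))
          (subst₂ _<_ (cong (seq s n *_) (seq-norm² a (λ i → fromℚ (w i)) n))
            (cong (λ x → seq t n * x + η * W) (seq-∙ (λ i → fromℚ (w i)) (λ i → fromℚ (w i)) n))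
            (hyp n (⊔ʳ {K} {Q} (⊔ˡ ≤n))))
      where
      open +-*-Solver
      0≤C : ∀ {S B} → 0ℚ ≤ S → 0ℚ ≤ B → 0ℚ ≤ 1ℚ + S * (B + B + 1ℚ) + S * (6 ⋅ 1ℚ * B + 9 ⋅ 1ℚ)
      0≤C 0≤S 0≤B = +-nonNeg (+-nonNeg 0≤1 (*-nonNeg 0≤S (+-nonNeg (+-nonNeg 0≤B 0≤B) 0≤1)))
        (*-nonNeg 0≤S (+-nonNeg (*-nonNeg (⋅-nonNeg 6 0≤1) 0≤B) (⋅-nonNeg 9 0≤1)))

      near : ∀ {η n p} → 0ℚ < η → precision p ≤ η → precision n ≤ η →
        Bounded (λ i j → stage a n i j - stage a p i j) η → approx.norm n ≤ approx.gain p + 3 ⋅ η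
      near {η} {n} {p} 0<η p≤η n≤η close = begin
        approx.norm n                            ≤⟨ lipschitz {p = p} {n} 0<η n≤η close ⟩
        approx.norm p + η + η                    ≤⟨ ℚ.+-monoˡ-≤ η (ℚ.+-monoˡ-≤ η (ℚ.≤-trans (approx.gain≥ p) (ℚ.+-monoʳ-≤ (approx.gain p) p≤η))) ⟩
        approx.gain p + η + η + η                ≡⟨ solve 2 (λ g η → g :+ η :+ η :+ η := g :+ (η :+ (η :+ (η :+ con 0ℚ)))) refl (approx.gain p) η ⟩
        approx.gain p + 3 ⋅ η                    ∎
        where open ℚ.≤-Reasoning

      gain-stage : ∀ {η n p} → 0ℚ < η → Bounded (λ i j → stage a p i j - stage a n i j) η →
        let w = approx.witness p ; W = w ℚᴹ.∙ w in
        approx.gain p * approx.gain p * W ≤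
          (stage a n ℚᴹ.⊙ w) ℚᴹ.∙ (stage a n ℚᴹ.⊙ w) + (approx.norm n * η * W + approx.norm n * η * W) + η * η * W
      gain-stage {η} {n} {p} 0<η close = begin
        approx.gain p * approx.gain p * W             ≤⟨ approx.gains p ⟩
        (stage a p ℚᴹ.⊙ w) ℚᴹ.∙ (stage a p ℚᴹ.⊙ w)    ≡⟨ ℚᴹ.∙-cong split split ⟩
        (λ i → x i + y i) ℚᴹ.∙ (λ i → x i + y i)      ≡⟨ sum-square-+ x y ⟩
        x ℚᴹ.∙ x + (x ℚᴹ.∙ y + x ℚᴹ.∙ y) + y ℚᴹ.∙ y   ≤⟨ ℚ.+-mono-≤ (ℚ.+-monoʳ-≤ (x ℚᴹ.∙ x) (ℚ.+-mono-≤ xy≤ xy≤)) (bound close w) ⟩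
        x ℚᴹ.∙ x + (N * η * W + N * η * W) + η * η * W ∎
        where
        open ℚ.≤-Reasoning
        w = approx.witness p
        W = w ℚᴹ.∙ w
        N = approx.norm n
        x = stage a n ℚᴹ.⊙ w
        y = (λ i j → stage a p i j - stage a n i j) ℚᴹ.⊙ w
        split : ∀ i → (stage a p ℚᴹ.⊙ w) i ≡ x i + y i
        split i = trans (ℚᴹ.sum-cong-≋ λ j → cong (_* w j)
            (solve 2 (λ a b → b := a :+ (b :- a)) refl (stage a n i j) (stage a p i j)))
          (∙-+ˡ (stage a n i) (λ j → stage a p i j - stage a n i j) w)
        xy≤ : x ℚᴹ.∙ y ≤ N * η * W
        xy≤ = square-cancel-≤ (*-nonNeg (*-nonNeg (approx.norm≥0 n) (ℚ.<⇒≤ 0<η)) (∙-nonNeg w)) (begin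
          x ℚᴹ.∙ y * x ℚᴹ.∙ y           ≤⟨ cauchy-schwarz x y ⟩
          x ℚᴹ.∙ x * y ℚᴹ.∙ y           ≤⟨ *-mono-≤ (∙-nonNeg y) (*-nonNeg (square-nonNeg N) (∙-nonNeg w)) (bound (approx.bounded n) w) (bound close w) ⟩
          N * N * W * (η * η * W)       ≡⟨ solve 3 (λ N η W → N :* N :* W :* (η :* η :* W) := N :* η :* W :* (N :* η :* W)) refl N η W ⟩
          N * η * W * (N * η * W)       ∎)

      conclude : ∀ s t N ρ W X S B r → 0ℚ < r →
        let C = 1ℚ + S * (B + B + 1ℚ) + S * (6 ⋅ 1ℚ * B + 9 ⋅ 1ℚ) ; η = r * ε in
        (C + ε) * r ≡ 1ℚ → 0ℚ ≤ s → s ≤ S → 0ℚ ≤ N → N ≤ B → 0ℚ ≤ ρ → ρ ≤ B → N ≤ ρ + 3 ⋅ η → 0ℚ < W →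
        ρ * ρ * W ≤ X + (N * η * W + N * η * W) + η * η * W → s * X < t * W + η * W →
        s * (N * N) < t + ε
      conclude s t N ρ W X S B r 0<r Cr≡1 0≤s s≤S 0≤N N≤B 0≤ρ ρ≤B N≤ 0<W ρ²≤ sX< = ℚ.≤-<-trans
        (ℚ.≤-trans upper (ℚ.+-monoʳ-≤ (s * (ρ * ρ)) (*-monoʳ-≤ η 0≤η (*-mono-≤ (+-nonNeg (*-nonNeg (⋅-nonNeg 6 0≤1) 0≤B) (⋅-nonNeg 9 0≤1)) 0≤S s≤S ℚ.≤-refl))))
        (ℚ.<-≤-trans (ℚ.+-monoˡ-< (S * (6 ⋅ 1ℚ * B + 9 ⋅ 1ℚ) * η) lower) total)
        where
        open ℚ.≤-Reasoning
        C = 1ℚ + S * (B + B + 1ℚ) + S * (6 ⋅ 1ℚ * B + 9 ⋅ 1ℚ)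
        η = r * ε
        0<η = *-pos 0<r 0<ε
        0≤η = ℚ.<⇒≤ 0<η
        0≤S = ℚ.≤-trans 0≤s s≤S
        0≤B = ℚ.≤-trans 0≤N N≤B
        Cη+εη≡ε : C * η + ε * η ≡ ε
        Cη+εη≡ε = trans (solve 3 (λ C r ε → C :* (r :* ε) :+ ε :* (r :* ε) := (C :+ ε) :* r :* ε) refl C r ε)
          (trans (cong (_* ε) Cr≡1) (ℚ.*-identityˡ ε))
        Cη≤ε : C * η ≤ ε
        Cη≤ε = subst (C * η ≤_) Cη+εη≡ε (subst (_≤ C * η + ε * η) (ℚ.+-identityʳ (C * η)) (ℚ.+-monoʳ-≤ (C * η) (*-nonNeg (ℚ.<⇒≤ 0<ε) 0≤η)))
        η≤1 : η ≤ 1ℚ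
        η≤1 = *-cancelʳ-≤ ε 0<ε (begin
          η * ε           ≡⟨ ℚ.*-comm η ε ⟩
          ε * η           ≤⟨ subst (_≤ C * η + ε * η) (ℚ.+-identityˡ (ε * η)) (ℚ.+-monoˡ-≤ (ε * η) (*-nonNeg (0≤C 0≤S 0≤B) 0≤η)) ⟩
          C * η + ε * η   ≡⟨ trans Cη+εη≡ε (sym (ℚ.*-identityˡ ε)) ⟩
          1ℚ * ε          ∎)
        upper : s * (N * N) ≤ s * (ρ * ρ) + s * (6 ⋅ 1ℚ * B + 9 ⋅ 1ℚ) * η
        upper = begin
          s * (N * N)                               ≤⟨ *-monoˡ-≤ s 0≤s (*-mono-≤ 0≤N (ℚ.≤-trans 0≤N N≤) N≤ N≤) ⟩
          s * ((ρ + 3 ⋅ η) * (ρ + 3 ⋅ η))           ≡⟨ solve 3 (λ s ρ η → s :* ((ρ :+ (η :+ (η :+ (η :+ con 0ℚ)))) :* (ρ :+ (η :+ (η :+ (η :+ con 0ℚ))))) :=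
                                                         s :* (ρ :* ρ) :+ s :* (con (6 ⋅ 1ℚ) :* ρ :+ con (9 ⋅ 1ℚ) :* η) :* η) refl s ρ η ⟩
          s * (ρ * ρ) + s * (6 ⋅ 1ℚ * ρ + 9 ⋅ 1ℚ * η) * η
            ≤⟨ ℚ.+-monoʳ-≤ (s * (ρ * ρ)) (*-monoʳ-≤ η 0≤η (*-monoˡ-≤ s 0≤s (ℚ.+-mono-≤
                 (*-monoˡ-≤ (6 ⋅ 1ℚ) (⋅-nonNeg 6 0≤1) ρ≤B)
                 (subst (9 ⋅ 1ℚ * η ≤_) (ℚ.*-identityʳ (9 ⋅ 1ℚ)) (*-monoˡ-≤ (9 ⋅ 1ℚ) (⋅-nonNeg 9 0≤1) η≤1))))) ⟩
          s * (ρ * ρ) + s * (6 ⋅ 1ℚ * B + 9 ⋅ 1ℚ) * η ∎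
        slack : N * η * W + N * η * W + η * η * W ≤ (B + B + 1ℚ) * η * W
        slack = begin
          N * η * W + N * η * W + η * η * W ≡⟨ solve 3 (λ N η W → N :* η :* W :+ N :* η :* W :+ η :* η :* W := (N :+ N :+ η) :* η :* W) refl N η W ⟩
          (N + N + η) * η * W               ≤⟨ *-monoʳ-≤ W (ℚ.<⇒≤ 0<W) (*-monoʳ-≤ η 0≤η (ℚ.+-mono-≤ (ℚ.+-mono-≤ N≤B N≤B) η≤1)) ⟩
          (B + B + 1ℚ) * η * W              ∎
        lower : s * (ρ * ρ) < t + (1ℚ + S * (B + B + 1ℚ)) * η
        lower = ℚ.*-cancelʳ-<-nonNeg W {{nonNegative (ℚ.<⇒≤ 0<W)}} (ℚ.≤-<-trans
          (begin
            s * (ρ * ρ) * W                                     ≡⟨ ℚ.*-assoc s (ρ * ρ) W ⟩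
            s * (ρ * ρ * W)                                     ≤⟨ *-monoˡ-≤ s 0≤s ρ²≤ ⟩
            s * (X + (N * η * W + N * η * W) + η * η * W)       ≡⟨ solve 4 (λ s X a b → s :* (X :+ a :+ b) := s :* X :+ s :* (a :+ b)) refl s X (N * η * W + N * η * W) (η * η * W) ⟩
            s * X + s * (N * η * W + N * η * W + η * η * W)     ≤⟨ ℚ.+-monoʳ-≤ (s * X) (*-mono-≤ 0≤slack 0≤S s≤S slack) ⟩
            s * X + S * ((B + B + 1ℚ) * η * W)                  ∎)
          (subst (s * X + S * ((B + B + 1ℚ) * η * W) <_)
            (solve 5 (λ t η W S b → (t :* W :+ η :* W) :+ S :* (b :* η :* W) := (t :+ (con 1ℚ :+ S :* b) :* η) :* W) refl t η W S (B + B + 1ℚ))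
            (ℚ.+-monoˡ-< (S * ((B + B + 1ℚ) * η * W)) sX<)))
          where
          0≤NηW = *-nonNeg (*-nonNeg 0≤N 0≤η) (ℚ.<⇒≤ 0<W)
          0≤slack = +-nonNeg (+-nonNeg 0≤NηW 0≤NηW) (*-nonNeg (square-nonNeg η) (ℚ.<⇒≤ 0<W))
        total : t + (1ℚ + S * (B + B + 1ℚ)) * η + S * (6 ⋅ 1ℚ * B + 9 ⋅ 1ℚ) * η ≤ t + ε
        total = begin
          t + (1ℚ + S * (B + B + 1ℚ)) * η + S * (6 ⋅ 1ℚ * B + 9 ⋅ 1ℚ) * η
            ≡⟨ solve 4 (λ t x y η → t :+ x :* η :+ y :* η := t :+ (x :+ y) :* η) refl t (1ℚ + S * (B + B + 1ℚ)) (S * (6 ⋅ 1ℚ * B + 9 ⋅ 1ℚ)) η ⟩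
          t + C * η ≤⟨ ℚ.+-monoʳ-≤ t Cη≤ε ⟩
          t + ε     ∎

  open ℝᴹ using (Vector; Matrix; _∙_; _⊙_; _⊹_; _⊛_; ⊝_; transpose; O; I; _≊_; entrywise; at; δ)

  ∙ᴿ-nonNeg : ∀ {m} (v : Vector m) → 0ᴿ ≤ᴿ v ∙ v
  ∙ᴿ-nonNeg v = pointwise-≤ λ n → subst (0ℚ ≤_) (sym (seq-∙ v v n)) (∙-nonNeg (stageᵛ v n))

  cauchy-schwarzᴿ : ∀ {m} (v w : Vector m) → v ∙ w *ᴿ v ∙ w ≤ᴿ v ∙ v *ᴿ w ∙ w
  cauchy-schwarzᴿ v w = pointwise-≤ λ n → subst₂ _≤_
    (cong₂ _*_ (sym (seq-∙ v w n)) (sym (seq-∙ v w n))) (cong₂ _*_ (sym (seq-∙ v v n)) (sym (seq-∙ w w n)))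
    (cauchy-schwarz (stageᵛ v n) (stageᵛ w n))

  frobenius² : ∀ {m} → Matrix m → ℝ
  frobenius² a = ℝᴹ.sum λ i → a i ∙ a i

  frobeniusᴿ : ∀ {m} (a : Matrix m) v → (a ⊙ v) ∙ (a ⊙ v) ≤ᴿ frobenius² a *ᴿ v ∙ v
  frobeniusᴿ a v = pointwise-≤ λ n → subst₂ _≤_ (sym (seq-norm² a v n))
    (cong₂ _*_ (sym (trans (seq-sum (λ i → a i ∙ a i) n) (ℚᴹ.sum-cong-≋ λ i → seq-∙ (a i) (a i) n))) (sym (seq-∙ v v n)))
    (frobenius (stage a n) (stageᵛ v n))

  entry≤ : ∀ {m} (v : Vector m) i → v i *ᴿ v i ≤ᴿ v ∙ v
  entry≤ v i = pointwise-≤ λ n → subst (seq (v i) n * seq (v i) n ≤_) (sym (seq-∙ v v n)) (term (stageᵛ v n) i)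
    where
    term : ∀ {m} (v : ℚᴹ.Vector m) i → v i * v i ≤ v ℚᴹ.∙ v
    term v zero    = subst (_≤ v ℚᴹ.∙ v) (ℚ.+-identityʳ (v zero * v zero)) (ℚ.+-monoʳ-≤ (v zero * v zero) (∙-nonNeg (v ∘ suc)))
    term v (suc i) = subst (_≤ v ℚᴹ.∙ v) (ℚ.+-identityˡ (v (suc i) * v (suc i))) (ℚ.+-mono-≤ (square-nonNeg (v zero)) (term (v ∘ suc) i))

  -- (2x - c)² ≤ c².
  x²≤cx⇒x≤c : ∀ {x c} → 0ᴿ ≤ᴿ c → x *ᴿ x ≤ᴿ c *ᴿ x → x ≤ᴿ c
  x²≤cx⇒x≤c {x} {c} 0≤c x²≤cx = ≤ᴿ-resp
    (pointwise λ n → solve 2 (λ x c → con ½ :* ((x :+ x :- c) :+ c) := x) refl (seq x n) (seq c n))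
    (pointwise λ n → solve 1 (λ c → con ½ :* (c :+ c) := c) refl (seq c n))
    (*ᴿ-monoˡ-≤ (fromℚ ½) (fromℚ-mono-≤ (ℚ.<⇒≤ (ℚ.positive⁻¹ ½))) (+ᴿ-mono-≤ 2x-c≤c (≤ᴿ-refl {c})))
    where
    open +-*-Solver
    four = fromℚ (4 ⋅ 1ℚ)
    2x-c≤c : x +ᴿ x +ᴿ -ᴿ c ≤ᴿ c
    2x-c≤c = squareᴿ-cancel-≤ 0≤c (≤ᴿ-resp
      (pointwise λ n → solve 2 (λ x c → con (4 ⋅ 1ℚ) :* (x :* x) :+ (c :* c :- con (4 ⋅ 1ℚ) :* (c :* x)) :=
        (x :+ x :- c) :* (x :+ x :- c)) refl (seq x n) (seq c n))
      (pointwise λ n → solve 2 (λ x c → con (4 ⋅ 1ℚ) :* (c :* x) :+ (c :* c :- con (4 ⋅ 1ℚ) :* (c :* x)) := c :* c) refl (seq x n) (seq c n))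
      (+ᴿ-mono-≤ (*ᴿ-monoˡ-≤ four (fromℚ-mono-≤ (⋅-nonNeg 4 0≤1)) x²≤cx)
        (≤ᴿ-refl {c *ᴿ c +ᴿ -ᴿ (four *ᴿ (c *ᴿ x))})))

  square-zero : ∀ {x} → x *ᴿ x ≤ᴿ 0ᴿ → x ≈ᴿ 0ᴿ
  square-zero {x} x²≤0 = ≤ᴿ-antisym x≤0
    (≤ᴿ-resp (pointwise λ n → ℚ.+-inverseˡ (seq x n)) (pointwise λ n → ℚ.+-identityˡ (seq x n)) (+ᴿ-mono-≤ -x≤0 (≤ᴿ-refl {x})))
    where
    open +-*-Solver
    0²≈0 : 0ᴿ ≈ᴿ 0ᴿ *ᴿ 0ᴿ
    0²≈0 = pointwise λ _ → refl
    x≤0 : x ≤ᴿ 0ᴿ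
    x≤0 = squareᴿ-cancel-≤ (≤ᴿ-refl {0ᴿ}) (≤ᴿ-resp ≈ᴿ.refl 0²≈0 x²≤0)
    -x≤0 : -ᴿ x ≤ᴿ 0ᴿ
    -x≤0 = squareᴿ-cancel-≤ (≤ᴿ-refl {0ᴿ}) (≤ᴿ-resp
      (pointwise λ n → solve 1 (λ x → x :* x := :- x :* :- x) refl (seq x n)) 0²≈0 x²≤0)

  1*ᴿ : ∀ x → 1ᴿ *ᴿ x ≈ᴿ x
  1*ᴿ x = pointwise λ n → ℚ.*-identityˡ (seq x n)

  square-of-product : ∀ x y z → (x *ᴿ x) *ᴿ ((y *ᴿ y) *ᴿ z) ≈ᴿ ((x *ᴿ y) *ᴿ (x *ᴿ y)) *ᴿ z
  square-of-product x y z = pointwise λ n →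
    solve 3 (λ x y z → (x :* x) :* ((y :* y) :* z) := ((x :* y) :* (x :* y)) :* z) refl (seq x n) (seq y n) (seq z n)
    where open +-*-Solver

  module _ {m : ℕ} where

    private
      M = Matrix (suc m)

    opnorm-≤ : ∀ (a : M) t → (∀ v → (a ⊙ v) ∙ (a ⊙ v) ≤ᴿ t *ᴿ v ∙ v) → opnorm a *ᴿ opnorm a ≤ᴿ t
    opnorm-≤ a t a≤t = ≤ᴿ-resp (1*ᴿ (opnorm a *ᴿ opnorm a)) ≈ᴿ.refl (opnorm-least a 1ᴿ t (λ _ → 0≤1)
      λ v → ≤ᴿ-resp (≈ᴿ.sym (1*ᴿ ((a ⊙ v) ∙ (a ⊙ v)))) ≈ᴿ.refl (a≤t v))

    opnorm-mono : ∀ (a b : M) → (∀ v → (a ⊙ v) ∙ (a ⊙ v) ≤ᴿ opnorm b *ᴿ opnorm b *ᴿ v ∙ v) → opnorm a ≤ᴿ opnorm b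
    opnorm-mono a b a≤b = squareᴿ-cancel-≤ (opnorm-nonNeg b) (opnorm-≤ a _ a≤b)

    ⊙-cong : ∀ {a b : M} → a ≊ b → ∀ v i → (a ⊙ v) i ≈ᴿ (b ⊙ v) i
    ⊙-cong a≊b v i = ℝᴹ.sum-cong-≋ λ j → *ᴿ-cong (at a≊b i j) (≈ᴿ.refl {v j})

    norm²-cong : ∀ {v w : Vector (suc m)} → (∀ i → v i ≈ᴿ w i) → v ∙ v ≈ᴿ w ∙ w
    norm²-cong v≈w = ℝᴹ.∙-cong v≈w v≈w

    opnorm-cong : ∀ {a b : M} → a ≊ b → opnorm a ≈ᴿ opnorm b
    opnorm-cong a≊b = ≤ᴿ-antisym (le a≊b) (le (entrywise λ i j → ≈ᴿ.sym (at a≊b i j)))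
      where
      le : ∀ {a b : M} → a ≊ b → opnorm a ≤ᴿ opnorm b
      le {a} {b} a≊b = opnorm-mono a b λ v →
        ≤ᴿ-trans (≤ᴿ-reflexive (norm²-cong (⊙-cong a≊b v))) (opnorm-bound b v)

    opnorm-frobenius : ∀ (a : M) → opnorm a *ᴿ opnorm a ≤ᴿ frobenius² a
    opnorm-frobenius a = opnorm-≤ a (frobenius² a) (frobeniusᴿ a)

    opnorm-entry : ∀ (a : M) i j → a i j *ᴿ a i j ≤ᴿ opnorm a *ᴿ opnorm a
    opnorm-entry a i j = ≤ᴿ-resp (*ᴿ-cong column column)
      (≈ᴿ.trans (*ᴿ-cong ≈ᴿ.refl eⱼ∙eⱼ) (pointwise λ n → ℚ.*-identityʳ _))
      (≤ᴿ-trans (entry≤ (a ⊙ eⱼ) i) (opnorm-bound a eⱼ))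
      where
      eⱼ : Vector (suc m)
      eⱼ k = δ k j
      column : (a ⊙ eⱼ) i ≈ᴿ a i j
      column = ℝᴹ.sum-δʳ j (a i)
      δ-diagonal : ∀ {n} (j : Fin n) → δ j j ≈ᴿ 1ᴿ
      δ-diagonal zero    = ≈ᴿ.refl
      δ-diagonal (suc j) = δ-diagonal j
      eⱼ∙eⱼ : eⱼ ∙ eⱼ ≈ᴿ 1ᴿ
      eⱼ∙eⱼ = ≈ᴿ.trans (ℝᴹ.sum-δʳ j eⱼ) (δ-diagonal j)

    opnorm-definite : ∀ (a : M) → opnorm a ≈ᴿ 0ᴿ → a ≊ O
    opnorm-definite a a≈0 .at i j = square-zero (≤ᴿ-trans (opnorm-entry a i j)
      (≤ᴿ-reflexive (≈ᴿ.trans (*ᴿ-cong a≈0 a≈0) (pointwise λ _ → refl))))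

    opnorm-triangle : ∀ (a b : M) → opnorm (a ⊹ b) ≤ᴿ opnorm a +ᴿ opnorm b
    opnorm-triangle a b = squareᴿ-cancel-≤ 0≤r+s (opnorm-≤ (a ⊹ b) ((r +ᴿ s) *ᴿ (r +ᴿ s)) λ v →
      ≤ᴿ-resp (expand v) (pointwise λ n →
          solve 3 (λ r s q → r :* r :* q :+ (r :* s :* q :+ r :* s :* q) :+ s :* s :* q := (r :+ s) :* (r :+ s) :* q)
            refl (seq r n) (seq s n) (seq (v ∙ v) n))
        (+ᴿ-mono-≤ (+ᴿ-mono-≤ (opnorm-bound a v) (+ᴿ-mono-≤ (cross v) (cross v))) (opnorm-bound b v)))
      where
      open +-*-Solver
      r = opnorm a
      s = opnorm b
      0≤r+s : 0ᴿ ≤ᴿ r +ᴿ s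
      0≤r+s = ≤ᴿ-resp (pointwise λ _ → refl) ≈ᴿ.refl (+ᴿ-mono-≤ (opnorm-nonNeg a) (opnorm-nonNeg b))
      expand : ∀ v → (a ⊙ v) ∙ (a ⊙ v) +ᴿ ((a ⊙ v) ∙ (b ⊙ v) +ᴿ (a ⊙ v) ∙ (b ⊙ v)) +ᴿ (b ⊙ v) ∙ (b ⊙ v) ≈ᴿ
        ((a ⊹ b) ⊙ v) ∙ ((a ⊹ b) ⊙ v)
      expand v = pointwise λ n → begin
        seq ((a ⊙ v) ∙ (a ⊙ v)) n + (seq ((a ⊙ v) ∙ (b ⊙ v)) n + seq ((a ⊙ v) ∙ (b ⊙ v)) n) + seq ((b ⊙ v) ∙ (b ⊙ v)) n
          ≡⟨ cong₂ _+_ (cong₂ _+_ (seq-∙ (a ⊙ v) (a ⊙ v) n) (cong₂ _+_ (seq-∙ (a ⊙ v) (b ⊙ v) n) (seq-∙ (a ⊙ v) (b ⊙ v) n))) (seq-∙ (b ⊙ v) (b ⊙ v) n) ⟩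
        x n ℚᴹ.∙ x n + (x n ℚᴹ.∙ y n + x n ℚᴹ.∙ y n) + y n ℚᴹ.∙ y n
          ≡⟨ sum-square-+ (x n) (y n) ⟨
        (λ i → x n i + y n i) ℚᴹ.∙ (λ i → x n i + y n i)
          ≡⟨ ℚᴹ.∙-cong (λ i → sym (row n i)) (λ i → sym (row n i)) ⟩
        stageᵛ ((a ⊹ b) ⊙ v) n ℚᴹ.∙ stageᵛ ((a ⊹ b) ⊙ v) n
          ≡⟨ seq-∙ ((a ⊹ b) ⊙ v) ((a ⊹ b) ⊙ v) n ⟨
        seq (((a ⊹ b) ⊙ v) ∙ ((a ⊹ b) ⊙ v)) n ∎
        where
        open ≡-Reasoning
        x y : ℕ → ℚᴹ.Vector (suc m)
        x n = stageᵛ (a ⊙ v) n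
        y n = stageᵛ (b ⊙ v) n
        row : ∀ n i → seq (((a ⊹ b) ⊙ v) i) n ≡ x n i + y n i
        row n i = trans (seq-∙ (λ j → a i j +ᴿ b i j) v n)
          (trans (∙-+ˡ (stage a n i) (stage b n i) (stageᵛ v n))
            (cong₂ _+_ (sym (seq-∙ (a i) v n)) (sym (seq-∙ (b i) v n))))
      cross : ∀ v → (a ⊙ v) ∙ (b ⊙ v) ≤ᴿ r *ᴿ s *ᴿ v ∙ v
      cross v = squareᴿ-cancel-≤ (*ᴿ-nonNeg (*ᴿ-nonNeg (opnorm-nonNeg a) (opnorm-nonNeg b)) (∙ᴿ-nonNeg v))
        (≤ᴿ-trans (cauchy-schwarzᴿ (a ⊙ v) (b ⊙ v)) (≤ᴿ-trans
          (*ᴿ-mono-≤ (∙ᴿ-nonNeg (b ⊙ v)) (*ᴿ-nonNeg (squareᴿ-nonNeg r) (∙ᴿ-nonNeg v)) (opnorm-bound a v) (opnorm-bound b v))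
          (≤ᴿ-reflexive (pointwise λ n → solve 3 (λ r s q → (r :* r :* q) :* (s :* s :* q) := (r :* s :* q) :* (r :* s :* q))
            refl (seq r n) (seq s n) (seq (v ∙ v) n)))))

    opnorm-* : ∀ (a b : M) → opnorm (a ⊛ b) ≤ᴿ opnorm a *ᴿ opnorm b
    opnorm-* a b = squareᴿ-cancel-≤ (*ᴿ-nonNeg (opnorm-nonNeg a) (opnorm-nonNeg b))
      (opnorm-≤ (a ⊛ b) ((opnorm a *ᴿ opnorm b) *ᴿ (opnorm a *ᴿ opnorm b)) λ v → ≤ᴿ-trans
        (≤ᴿ-reflexive (norm²-cong (ℝᴹ.⊛-⊙ a b v)))
        (≤ᴿ-trans (opnorm-bound a (b ⊙ v)) (≤ᴿ-trans
          (*ᴿ-monoˡ-≤ (opnorm a *ᴿ opnorm a) (squareᴿ-nonNeg (opnorm a)) (opnorm-bound b v))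
          (≤ᴿ-reflexive (square-of-product (opnorm a) (opnorm b) (v ∙ v))))))

    -- |aᵀv|⁴ = (v · a aᵀv)² ≤ |v|² ‖a‖² |aᵀv|².
    opnorm-transpose : ∀ (a : M) → opnorm (transpose a) ≤ᴿ opnorm a
    opnorm-transpose a = opnorm-mono (transpose a) a λ v →
      let w = transpose a ⊙ v in
      x²≤cx⇒x≤c (*ᴿ-nonNeg (squareᴿ-nonNeg (opnorm a)) (∙ᴿ-nonNeg v)) (≤ᴿ-trans
        (≤ᴿ-reflexive (*ᴿ-cong (ℝᴹ.adjoint (transpose a) v w) (ℝᴹ.adjoint (transpose a) v w)))
        (≤ᴿ-trans (cauchy-schwarzᴿ v (a ⊙ w)) (≤ᴿ-trans
          (*ᴿ-monoˡ-≤ (v ∙ v) (∙ᴿ-nonNeg v) (opnorm-bound a w))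
          (≤ᴿ-reflexive (pointwise λ n → solve 3 (λ q r x → q :* (r :* x) := r :* q :* x) refl
            (seq (v ∙ v) n) (seq (opnorm a *ᴿ opnorm a) n) (seq (w ∙ w) n))))))
      where open +-*-Solver

    opnorm-C* : ∀ (a : M) → opnorm (transpose a ⊛ a) ≈ᴿ opnorm a *ᴿ opnorm a
    opnorm-C* a = ≤ᴿ-antisym
      (≤ᴿ-trans (opnorm-* (transpose a) a) (*ᴿ-monoʳ-≤ (opnorm a) (opnorm-nonNeg a) (opnorm-transpose a)))
      (opnorm-≤ a t λ v → squareᴿ-cancel-≤ (*ᴿ-nonNeg (opnorm-nonNeg (transpose a ⊛ a)) (∙ᴿ-nonNeg v)) (≤ᴿ-trans
        (≤ᴿ-reflexive (*ᴿ-cong (rotate v) (rotate v)))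
        (≤ᴿ-trans (cauchy-schwarzᴿ v ((transpose a ⊛ a) ⊙ v)) (≤ᴿ-trans
          (*ᴿ-monoˡ-≤ (v ∙ v) (∙ᴿ-nonNeg v) (opnorm-bound (transpose a ⊛ a) v))
          (≤ᴿ-reflexive (pointwise λ n → solve 2 (λ q t → q :* (t :* t :* q) := t :* q :* (t :* q)) refl
            (seq (v ∙ v) n) (seq t n)))))))
      where
      open +-*-Solver
      t = opnorm (transpose a ⊛ a)
      rotate : ∀ v → (a ⊙ v) ∙ (a ⊙ v) ≈ᴿ v ∙ ((transpose a ⊛ a) ⊙ v)
      rotate v = ≈ᴿ.trans (ℝᴹ.adjoint a v (a ⊙ v)) (ℝᴹ.∙-cong {v = v} (λ i → ≈ᴿ.refl {v i}) (λ i → ≈ᴿ.sym (ℝᴹ.⊛-⊙ (transpose a) a v i)))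

    opnorm-similar : ∀ (a b : M) s → (∀ n → 0ℚ ≤ seq s n) →
      (∀ v → (b ⊙ v) ∙ (b ⊙ v) ≈ᴿ s *ᴿ (a ⊙ v) ∙ (a ⊙ v)) →
      opnorm b *ᴿ opnorm b ≈ᴿ s *ᴿ (opnorm a *ᴿ opnorm a)
    opnorm-similar a b s 0≤s scale = ≤ᴿ-antisym
      (opnorm-≤ b (s *ᴿ (opnorm a *ᴿ opnorm a)) λ v → ≤ᴿ-trans (≤ᴿ-reflexive (scale v))
        (≤ᴿ-trans (*ᴿ-monoˡ-≤ s (pointwise-≤ 0≤s) (opnorm-bound a v))
          (≤ᴿ-reflexive (pointwise λ n → sym (ℚ.*-assoc (seq s n) (seq (opnorm a *ᴿ opnorm a) n) (seq (v ∙ v) n))))))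
      (opnorm-least a s (opnorm b *ᴿ opnorm b) 0≤s λ v →
        ≤ᴿ-trans (≤ᴿ-reflexive (≈ᴿ.sym (scale v))) (opnorm-bound b v))

    -- ‖a‖² ≤ Σ aᵢⱼ² ≤ (dim · θ)²
    opnorm-small : ∀ (a : M) ε → 0ℚ < ε →
      (∀ i j → a i j *ᴿ a i j ≤ᴿ fromℚ (precision m * ε * (precision m * ε))) → opnorm a ≤ᴿ fromℚ ε
    opnorm-small a ε 0<ε a≤ = squareᴿ-cancel-≤ (fromℚ-mono-≤ (ℚ.<⇒≤ 0<ε)) (≤ᴿ-trans (opnorm-frobenius a)
      (≤ᴿ-trans (sum-≤ (λ i → a i ∙ a i) λ i → sum-≤ (λ j → a i j *ᴿ a i j) (a≤ i)) (≤ᴿ-reflexive (pointwise λ n → total))))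
      where
      open +-*-Solver
      θ = precision m * ε
      dim = suc m ⋅ 1ℚ
      sum-≤ : ∀ {n c} (f : Vector n) → (∀ i → f i ≤ᴿ fromℚ c) → ℝᴹ.sum f ≤ᴿ fromℚ ((n ⋅ 1ℚ) * c)
      sum-≤ {zero}  {c} f f≤ = ≤ᴿ-reflexive (pointwise λ _ → sym (ℚ.*-zeroˡ c))
      sum-≤ {suc n} {c} f f≤ = ≤ᴿ-trans (+ᴿ-mono-≤ (f≤ zero) (sum-≤ (f ∘ suc) (f≤ ∘ suc)))
        (≤ᴿ-reflexive (pointwise λ _ → solve 2 (λ n c → c :+ n :* c := (con 1ℚ :+ n) :* c) refl (n ⋅ 1ℚ) c))
      total : dim * (dim * (θ * θ)) ≡ ε * ε
      total = trans (solve 3 (λ d p ε → d :* (d :* (p :* ε :* (p :* ε))) := (d :* p) :* (d :* p) :* (ε :* ε)) refl dim (precision m) ε)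
        (trans (cong (λ t → t * t * (ε * ε)) (precision-inverse m)) (solve 1 (λ ε → con 1ℚ :* con 1ℚ :* (ε :* ε) := ε :* ε) refl ε))

  ≤+⇒square≤ : ∀ {x y} e → x ≤ᴿ y +ᴿ e → y ≤ᴿ x +ᴿ e → (x +ᴿ -ᴿ y) *ᴿ (x +ᴿ -ᴿ y) ≤ᴿ e *ᴿ e
  ≤+⇒square≤ {x} {y} e x≤ y≤ = 0≤y-x⁻ (≤ᴿ-resp ≈ᴿ.refl
    (pointwise λ n → solve 3 (λ x y e → (y :+ e :- x) :* (x :+ e :- y) := e :* e :- (x :- y) :* (x :- y)) refl (seq x n) (seq y n) (seq e n))
    (*ᴿ-nonNeg (0≤y-x⁺ x≤) (0≤y-x⁺ y≤)))
    where open +-*-Solver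

  square≤⇒≤+ : ∀ {x y} e → 0ᴿ ≤ᴿ e → (x +ᴿ -ᴿ y) *ᴿ (x +ᴿ -ᴿ y) ≤ᴿ e *ᴿ e → x ≤ᴿ y +ᴿ e
  square≤⇒≤+ {x} {y} e 0≤e sq≤ = ≤ᴿ-resp
    (pointwise λ n → solve 2 (λ x y → y :+ (x :- y) := x) refl (seq x n) (seq y n)) ≈ᴿ.refl
    (+ᴿ-mono-≤ (≤ᴿ-refl {y}) (squareᴿ-cancel-≤ 0≤e sq≤))
    where open +-*-Solver

  module Limit (x : ℕ → ℝ)
    (x-cauchy : ∀ ε → 0ℚ < ε → ∃[ N ] ∀ p q → N ℕ.≤ p → N ℕ.≤ q → x p ≤ᴿ x q +ᴿ fromℚ ε) where

    private
      index : ℕ → ℕ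
      index k = proj₁ (cauchy (x k) (precision k) (precision-pos k))

      term : ℕ → ℚ
      term k = seq (x k) (index k)

      term-close : ∀ k n → index k ℕ.≤ n → ∣ term k - seq (x k) n ∣ < precision k
      term-close k n ≤n = proj₂ (cauchy (x k) (precision k) (precision-pos k)) (index k) n ℕ.≤-refl ≤n

      quarter : ℚ → ℚ
      quarter ε = ½ * (½ * ε)

      quarters : ∀ x ε → x + quarter ε + (quarter ε + quarter ε) + quarter ε ≡ x + ε
      quarters = solve 2 (λ x ε → let q = con ½ :* (con ½ :* ε) in x :+ q :+ (q :+ q) :+ q := x :+ ε) refl
        where open +-*-Solver

      terms : ∀ ε → 0ℚ < ε → ∃[ N ] ∀ p q → N ℕ.≤ p → N ℕ.≤ q → term p < term q + ε
      terms ε 0<ε =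
        let η = quarter ε
            0<η = half-pos (half-pos 0<ε)
            K , small = precision-small η 0<η
            L , close = x-cauchy η 0<η
        in K ℕ.⊔ L , λ p q ≤p ≤q →
          let Q , c = below (close p q (⊔ʳ {K} ≤p) (⊔ʳ {K} ≤q)) η 0<η
              n = (index p ℕ.⊔ index q) ℕ.⊔ Q
              ≤n = ℕ.m≤m⊔n (index p ℕ.⊔ index q) Q
          in chain {p} {q} {n} (small p (⊔ˡ ≤p)) (small q (⊔ˡ ≤q))
               (∣p-q∣<r⇒p<q+r (term p) (seq (x p) n) (term-close p n (⊔ˡ ≤n)))
               (c n (ℕ.m≤n⊔m (index p ℕ.⊔ index q) Q))
               (∣p-q∣<r⇒q<p+r (term q) (seq (x q) n) (term-close q n (⊔ʳ {index p} ≤n)))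
        where
        chain : ∀ {p q n} → precision p ≤ quarter ε → precision q ≤ quarter ε →
          term p < seq (x p) n + precision p → seq (x p) n < seq (x q) n + quarter ε + quarter ε →
          seq (x q) n < term q + precision q → term p < term q + ε
        chain {p} {q} {n} p≤ q≤ tp< xp< xq< = begin-strict
          term p                                                       <⟨ tp< ⟩
          seq (x p) n + precision p                                    ≤⟨ ℚ.+-monoʳ-≤ (seq (x p) n) p≤ ⟩
          seq (x p) n + quarter ε                                      <⟨ ℚ.+-monoˡ-< (quarter ε) xp< ⟩
          seq (x q) n + quarter ε + quarter ε + quarter ε              <⟨ ℚ.+-monoˡ-< (quarter ε) (ℚ.+-monoˡ-< (quarter ε) (ℚ.+-monoˡ-< (quarter ε) xq<)) ⟩
          term q + precision q + quarter ε + quarter ε + quarter ε     ≤⟨ ℚ.+-monoˡ-≤ (quarter ε) (ℚ.+-monoˡ-≤ (quarter ε) (ℚ.+-monoˡ-≤ (quarter ε) (ℚ.+-monoʳ-≤ (term q) q≤))) ⟩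
          term q + quarter ε + quarter ε + quarter ε + quarter ε       ≡⟨ cong (_+ quarter ε) (ℚ.+-assoc (term q + quarter ε) (quarter ε) (quarter ε)) ⟩
          term q + quarter ε + (quarter ε + quarter ε) + quarter ε     ≡⟨ quarters (term q) ε ⟩
          term q + ε                                                   ∎
          where open ℚ.≤-Reasoning

    limit : ℝ
    seq    limit = term
    cauchy limit ε 0<ε = let N , t = terms ε 0<ε in
      N , λ p q ≤p ≤q → ∣p-q∣<r⁺ (term p) (term q) (t p q ≤p ≤q) (t q p ≤q ≤p)

    converges : ∀ ε → 0ℚ < ε → ∃[ N ] ∀ p → N ℕ.≤ p →
      (x p +ᴿ -ᴿ limit) *ᴿ (x p +ᴿ -ᴿ limit) ≤ᴿ fromℚ (ε * ε)
    converges ε 0<ε =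
      let K , small = precision-small (½ * ε) (half-pos 0<ε)
          L , t = terms (½ * ε) (half-pos 0<ε)
      in K ℕ.⊔ L , λ p ≤p → ≤ᴿ-resp ≈ᴿ.refl (pointwise λ _ → refl) (≤+⇒square≤ (fromℚ ε)
        (eventually-≤ (index p ℕ.⊔ L) λ n ≤n → ℚ.<⇒≤ (sum< {c = term n} (term p)
          (∣p-q∣<r⇒q<p+r (term p) (seq (x p) n) (term-close p n (⊔ˡ ≤n))) (small p (⊔ˡ ≤p))
          (t p n (⊔ʳ {K} ≤p) (⊔ʳ {index p} ≤n))))
        (eventually-≤ (index p ℕ.⊔ L) λ n ≤n → ℚ.<⇒≤ (sum<′ {c = seq (x p) n} (term p)
          (t n p (⊔ʳ {index p} ≤n) (⊔ʳ {K} ≤p))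
          (∣p-q∣<r⇒p<q+r (term p) (seq (x p) n) (term-close p n (⊔ˡ ≤n))) (small p (⊔ˡ ≤p)))))
      where
      sum< : ∀ {a c d} b → a < b + d → d ≤ ½ * ε → b < c + ½ * ε → a < c + ε
      sum< {a} {c} {d} b a< d≤ b< = begin-strict
        a                          <⟨ a< ⟩
        b + d                      ≤⟨ ℚ.+-monoʳ-≤ b d≤ ⟩
        b + ½ * ε                  <⟨ ℚ.+-monoˡ-< (½ * ε) b< ⟩
        c + ½ * ε + ½ * ε          ≡⟨ trans (ℚ.+-assoc c (½ * ε) (½ * ε)) (cong (c +_) (halves ε)) ⟩
        c + ε                      ∎
        where open ℚ.≤-Reasoning
      sum<′ : ∀ {a c d} b → a < b + ½ * ε → b < c + d → d ≤ ½ * ε → a < c + ε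
      sum<′ {a} {c} {d} b a< b< d≤ = begin-strict
        a                          <⟨ a< ⟩
        b + ½ * ε                  <⟨ ℚ.+-monoˡ-< (½ * ε) b< ⟩
        c + d + ½ * ε              ≤⟨ ℚ.+-monoˡ-≤ (½ * ε) (ℚ.+-monoʳ-≤ c d≤) ⟩
        c + ½ * ε + ½ * ε          ≡⟨ trans (ℚ.+-assoc c (½ * ε) (½ * ε)) (cong (c +_) (halves ε)) ⟩
        c + ε                      ∎
        where open ℚ.≤-Reasoning

  open ℝᴹ using (Vector; Matrix; _∙_; _⊙_; _⊹_; _⊛_; ⊝_; transpose; O; I; _≊_; entrywise; at; δ; _◂_)

  module _ {m : ℕ} where

    private
      M = Matrix (suc m)

    opnorm-complete : (s : ℕ → M) →
      (∀ ε → 0ℚ < ε → ∃[ N ] ∀ p q → N ℕ.≤ p → N ℕ.≤ q → opnorm (s p ⊹ ⊝ s q) ≤ᴿ fromℚ ε) →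
      ∃[ a ] ∀ ε → 0ℚ < ε → ∃[ N ] ∀ p → N ℕ.≤ p → opnorm (s p ⊹ ⊝ a) ≤ᴿ fromℚ ε
    opnorm-complete s s-cauchy = (λ i j → E.limit i j) , λ ε 0<ε →
      let N , c = uniformly λ i → uniformly λ j →
            E.converges i j (precision m * ε) (*-pos (precision-pos m) 0<ε)
      in N , λ p N≤p → opnorm-small (s p ⊹ ⊝ (λ i j → E.limit i j)) ε 0<ε (c p N≤p)
      where
      entry-cauchy : ∀ i j ε → 0ℚ < ε → ∃[ N ] ∀ p q → N ℕ.≤ p → N ℕ.≤ q → s p i j ≤ᴿ s q i j +ᴿ fromℚ ε
      entry-cauchy i j ε 0<ε = let N , c = s-cauchy ε 0<ε in N , λ p q ≤p ≤q →
        square≤⇒≤+ (fromℚ ε) (fromℚ-mono-≤ (ℚ.<⇒≤ 0<ε)) (≤ᴿ-trans (opnorm-entry (s p ⊹ ⊝ s q) i j)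
          (*ᴿ-mono-≤ (opnorm-nonNeg (s p ⊹ ⊝ s q)) (fromℚ-mono-≤ (ℚ.<⇒≤ 0<ε)) (c p q ≤p ≤q) (c p q ≤p ≤q)))
      module E i j = Limit (λ k → s k i j) (entry-cauchy i j)

module ComplexStructure where

  open import Defs hiding (_·_; _≋_; matrix; ∣_∣²)
  open import Algebra.Bundles using (Ring)
  import Algebra.Properties.Ring as RingProperties
  open import Algebra.Structures using (IsRing)
  open import Data.Fin.Base using (suc; zero)
  open import Data.Nat.Base as ℕ using (suc; zero; ℕ)
  import Data.Nat.Properties as ℕ
  open import Data.Product.Base using (_,_; proj₁; ∃-syntax)
  open import Data.Rational.Base
  import Data.Rational.Properties as ℚ
  open import Data.Rational.Solver using (module +-*-Solver)
  open import Relation.Binary.PropositionalEquality using (cong; refl; sym; trans)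
  open import Relation.Nullary using (¬_)
  open LinearAlgebra
  open QuadraticForms
  open RationalNorm
  open RealOrder
  open OperatorNorm

  open ℝᴹ using (Vector; Matrix; _∙_; _⊙_; _⊹_; _⊛_; ⊝_; transpose; O; I; _≊_; entrywise; at; δ; _◂_)

  -- A real matrix J with J² = -1 = -JᵀJ is a complex structure; the matrices commuting with it are
  -- the complex ones.
  module Commutant {m : ℕ} (J : Matrix (suc m)) (J²≊-1 : J ⊛ J ≊ ⊝ I) (Jᵀ≊-J : transpose J ≊ ⊝ J) where

    private
      module R = Ring (ℝᴹ.matrixRing (suc m))
      open RingProperties (ℝᴹ.matrixRing (suc m)) using (-‿distribˡ-*; -‿distribʳ-*)
      open import Relation.Binary.Reasoning.Setoid R.setoid
      M = Matrix (suc m)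

    record J-commute (a : M) : Set where
      constructor commuting
      field
        commutation : a ⊛ J ≊ J ⊛ a

    record Operator : Set where
      constructor operator
      field
        matrix   : M
        commutes : J-commute matrix
    open Operator public

    infixr 7 _∗_
    _∗_ : ℂ → M → M
    (x +i y) ∗ a = x ◂ a ⊹ y ◂ (J ⊛ a)

    private
      ⊛-congˡ : ∀ a {b c : M} → b ≊ c → a ⊛ b ≊ a ⊛ c
      ⊛-congˡ a p .at i j = ℝᴹ.sum-cong-≋ λ k → *ᴿ-cong (≈ᴿ.refl {a i k}) (at p k j)

      ⊛-congʳ : ∀ c {a b : M} → a ≊ b → a ⊛ c ≊ b ⊛ c
      ⊛-congʳ c p .at i j = ℝᴹ.sum-cong-≋ λ k → *ᴿ-cong (at p i k) (≈ᴿ.refl {c k j})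

      commute-+ : ∀ {a b} → J-commute a → J-commute b → J-commute (a ⊹ b)
      commute-+ {a} {b} (commuting p) (commuting q) = commuting (R.trans (R.distribʳ J a b) (R.trans (R.+-cong p q) (R.sym (R.distribˡ J a b))))

      commute-* : ∀ {a b} → J-commute a → J-commute b → J-commute (a ⊛ b)
      commute-* {a} {b} (commuting p) (commuting q) = commuting (begin
        (a ⊛ b) ⊛ J   ≈⟨ R.*-assoc a b J ⟩
        a ⊛ (b ⊛ J)   ≈⟨ ⊛-congˡ a q ⟩
        a ⊛ (J ⊛ b)   ≈⟨ R.*-assoc a J b ⟨
        (a ⊛ J) ⊛ b   ≈⟨ ⊛-congʳ b p ⟩
        (J ⊛ a) ⊛ b   ≈⟨ R.*-assoc J a b ⟩
        J ⊛ (a ⊛ b)   ∎)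

      commute-neg : ∀ {a} → J-commute a → J-commute (⊝ a)
      commute-neg {a} (commuting p) = commuting (R.trans (R.sym (-‿distribˡ-* a J)) (R.trans (R.-‿cong p) (-‿distribʳ-* J a)))

      ◂-cong : ∀ {x y} {a b : M} → x ≈ᴿ y → a ≊ b → x ◂ a ≊ y ◂ b
      ◂-cong p q .at i j = *ᴿ-cong p (at q i j)

      commute-◂ : ∀ x {a} → J-commute a → J-commute (x ◂ a)
      commute-◂ x {a} (commuting p) = commuting (R.trans (ℝᴹ.◂-⊛ˡ x a J) (R.trans (◂-cong {x} ≈ᴿ.refl p) (R.sym (ℝᴹ.◂-⊛ʳ x J a))))

      commute-∗ : ∀ z {a} → J-commute a → J-commute (z ∗ a)
      commute-∗ (x +i y) {a} p = commute-+ (commute-◂ x p) (commute-◂ y (commute-* {J} {a} (commuting {J} (R.refl {x = J ⊛ J})) p))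

      transpose-cong : ∀ {a b : M} → a ≊ b → transpose a ≊ transpose b
      transpose-cong p .at i j = at p j i

      neg-cancel : ∀ {a b : M} → ⊝ a ≊ ⊝ b → a ≊ b
      neg-cancel {a} {b} p = R.trans (R.sym (invol a)) (R.trans (R.-‿cong p) (invol b))
        where
        invol : ∀ a → ⊝ ⊝ a ≊ a
        invol a = RingProperties.-‿involutive (ℝᴹ.matrixRing (suc m)) a

      commute-transpose : ∀ {a} → J-commute a → J-commute (transpose a)
      commute-transpose {a} (commuting p) = commuting (neg-cancel (begin
        ⊝ (transpose a ⊛ J)           ≈⟨ -‿distribʳ-* (transpose a) J ⟩
        transpose a ⊛ ⊝ J             ≈⟨ ⊛-congˡ (transpose a) Jᵀ≊-J ⟨
        transpose a ⊛ transpose J     ≈⟨ ℝᴹ.transpose-⊛ J a ⟨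
        transpose (J ⊛ a)             ≈⟨ transpose-cong p ⟨
        transpose (a ⊛ J)             ≈⟨ ℝᴹ.transpose-⊛ a J ⟩
        transpose J ⊛ transpose a     ≈⟨ ⊛-congʳ (transpose a) Jᵀ≊-J ⟩
        (⊝ J) ⊛ transpose a           ≈⟨ -‿distribˡ-* J (transpose a) ⟨
        ⊝ (J ⊛ transpose a)           ∎))

      J-∗ : ∀ z a → J ⊛ (z ∗ a) ≊ re z ◂ (J ⊛ a) ⊹ im z ◂ (⊝ a)
      J-∗ (x +i y) a = begin
        J ⊛ (x ◂ a ⊹ y ◂ (J ⊛ a))             ≈⟨ R.distribˡ J (x ◂ a) (y ◂ (J ⊛ a)) ⟩
        J ⊛ (x ◂ a) ⊹ J ⊛ (y ◂ (J ⊛ a))       ≈⟨ R.+-cong (ℝᴹ.◂-⊛ʳ x J a) (ℝᴹ.◂-⊛ʳ y J (J ⊛ a)) ⟩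
        x ◂ (J ⊛ a) ⊹ y ◂ (J ⊛ (J ⊛ a))       ≈⟨ R.+-congˡ (◂-cong {y} ≈ᴿ.refl JJa) ⟩
        x ◂ (J ⊛ a) ⊹ y ◂ (⊝ a)               ∎
        where
        JJa : J ⊛ (J ⊛ a) ≊ ⊝ a
        JJa = begin
          J ⊛ (J ⊛ a)   ≈⟨ R.*-assoc J J a ⟨
          (J ⊛ J) ⊛ a   ≈⟨ ⊛-congʳ a J²≊-1 ⟩
          (⊝ I) ⊛ a     ≈⟨ -‿distribˡ-* I a ⟨
          ⊝ (I ⊛ a)     ≈⟨ R.-‿cong (R.*-identityˡ a) ⟩
          ⊝ a           ∎

      ∗-⊛ : ∀ z a b → (z ∗ a) ⊛ b ≊ z ∗ (a ⊛ b)
      ∗-⊛ (x +i y) a b = begin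
        (x ◂ a ⊹ y ◂ (J ⊛ a)) ⊛ b               ≈⟨ R.distribʳ b (x ◂ a) (y ◂ (J ⊛ a)) ⟩
        (x ◂ a) ⊛ b ⊹ (y ◂ (J ⊛ a)) ⊛ b         ≈⟨ R.+-cong (ℝᴹ.◂-⊛ˡ x a b) (ℝᴹ.◂-⊛ˡ y (J ⊛ a) b) ⟩
        x ◂ (a ⊛ b) ⊹ y ◂ ((J ⊛ a) ⊛ b)         ≈⟨ R.+-congˡ (◂-cong {y} ≈ᴿ.refl (R.*-assoc J a b)) ⟩
        x ◂ (a ⊛ b) ⊹ y ◂ (J ⊛ (a ⊛ b))         ∎

      ⊛-∗ : ∀ z a b → J-commute a → a ⊛ (z ∗ b) ≊ z ∗ (a ⊛ b)
      ⊛-∗ (x +i y) a b (commuting p) = begin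
        a ⊛ (x ◂ b ⊹ y ◂ (J ⊛ b))               ≈⟨ R.distribˡ a (x ◂ b) (y ◂ (J ⊛ b)) ⟩
        a ⊛ (x ◂ b) ⊹ a ⊛ (y ◂ (J ⊛ b))         ≈⟨ R.+-cong (ℝᴹ.◂-⊛ʳ x a b) (ℝᴹ.◂-⊛ʳ y a (J ⊛ b)) ⟩
        x ◂ (a ⊛ b) ⊹ y ◂ (a ⊛ (J ⊛ b))         ≈⟨ R.+-congˡ (◂-cong {y} ≈ᴿ.refl (R.trans (R.sym (R.*-assoc a J b)) (R.trans (⊛-congʳ b p) (R.*-assoc J a b)))) ⟩
        x ◂ (a ⊛ b) ⊹ y ◂ (J ⊛ (a ⊛ b))         ∎

      ∗-transpose : ∀ z {a} → J-commute a → transpose (z ∗ a) ≊ conj z ∗ transpose a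
      ∗-transpose z@(x +i y) {a} (commuting p) = R.+-congˡ (entrywise λ i j → ≈ᴿ.trans
        (*ᴿ-cong (≈ᴿ.refl {y}) (at Jaᵀ i j))
        (pointwise λ n → solve 2 (λ y a → y :* :- a := :- y :* a) refl (seq y n) (seq ((J ⊛ transpose a) i j) n)))
        where
        open +-*-Solver
        Jaᵀ : transpose (J ⊛ a) ≊ ⊝ (J ⊛ transpose a)
        Jaᵀ = begin
          transpose (J ⊛ a)           ≈⟨ transpose-cong p ⟨
          transpose (a ⊛ J)           ≈⟨ ℝᴹ.transpose-⊛ a J ⟩
          transpose J ⊛ transpose a   ≈⟨ ⊛-congʳ (transpose a) Jᵀ≊-J ⟩
          (⊝ J) ⊛ transpose a         ≈⟨ -‿distribˡ-* J (transpose a) ⟨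
          ⊝ (J ⊛ transpose a)         ∎

      J-isometry : ∀ w → (J ⊙ w) ∙ (J ⊙ w) ≈ᴿ w ∙ w
      J-isometry w = ≈ᴿ.trans (ℝᴹ.adjoint J w (J ⊙ w)) (ℝᴹ.∙-cong {v = w} (λ i → ≈ᴿ.refl {w i}) λ i →
        ≈ᴿ.trans (≈ᴿ.sym (ℝᴹ.⊛-⊙ (transpose J) J w i))
          (≈ᴿ.trans (⊙-cong JᵀJ w i) (ℝᴹ.sum-δˡ i w)))
        where
        JᵀJ : transpose J ⊛ J ≊ I
        JᵀJ = begin
          transpose J ⊛ J   ≈⟨ ⊛-congʳ J Jᵀ≊-J ⟩
          (⊝ J) ⊛ J         ≈⟨ -‿distribˡ-* J J ⟨
          ⊝ (J ⊛ J)         ≈⟨ R.-‿cong J²≊-1 ⟩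
          ⊝ ⊝ I             ≈⟨ RingProperties.-‿involutive (ℝᴹ.matrixRing (suc m)) I ⟩
          I                 ∎

      J-skew : ∀ w → w ∙ (J ⊙ w) ≈ᴿ 0ᴿ
      J-skew w = halve (≈ᴿ.trans (ℝᴹ.∙-comm w (J ⊙ w)) (≈ᴿ.trans (ℝᴹ.adjoint J w w)
        (≈ᴿ.trans (ℝᴹ.∙-cong {v = w} (λ i → ≈ᴿ.refl {w i}) (⊙-cong Jᵀ≊-J w)) negate)))
        where
        open +-*-Solver
        negate : w ∙ ((⊝ J) ⊙ w) ≈ᴿ -ᴿ (w ∙ (J ⊙ w))
        negate = ≈ᴿ.trans (ℝᴹ.sum-cong-≋ {x = λ i → w i *ᴿ ((⊝ J) ⊙ w) i} {λ i → -ᴿ (w i *ᴿ (J ⊙ w) i)} λ i → ≈ᴿ.trans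
            (*ᴿ-cong (≈ᴿ.refl {w i}) (≈ᴿ.trans (ℝᴹ.sum-cong-≋ {x = λ j → (⊝ J) i j *ᴿ w j} {λ j → -ᴿ (J i j *ᴿ w j)} λ j → pointwise λ n → sym (ℚ.neg-distribˡ-* (seq (J i j) n) (seq (w j) n)))
              (≈ᴿ.sym (ℝᴹ.-‿sum λ j → J i j *ᴿ w j))))
            (pointwise λ n → sym (ℚ.neg-distribʳ-* (seq (w i) n) (seq ((J ⊙ w) i) n))))
          (≈ᴿ.sym (ℝᴹ.-‿sum λ i → w i *ᴿ (J ⊙ w) i))
        halve : ∀ {x} → x ≈ᴿ -ᴿ x → x ≈ᴿ 0ᴿ
        halve {x} x≈-x = ≈ᴿ.trans (pointwise λ n → solve 1 (λ x → x := con ½ :* (x :+ x)) refl (seq x n))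
          (≈ᴿ.trans (*ᴿ-cong (≈ᴿ.refl {fromℚ ½}) (+ᴿ-cong (≈ᴿ.refl {x}) x≈-x))
            (pointwise λ n → solve 1 (λ x → con ½ :* (x :- x) := con 0ℚ) refl (seq x n)))

      ∗-norm : ∀ z a v → ((z ∗ a) ⊙ v) ∙ ((z ∗ a) ⊙ v) ≈ᴿ Defs.∣ z ∣² *ᴿ (a ⊙ v) ∙ (a ⊙ v)
      ∗-norm z@(x +i y) a v = ≈ᴿ.trans (ℝᴹ.∙-cong row row) (≈ᴿ.trans expand
        (≈ᴿ.trans (+ᴿ-cong (+ᴿ-cong (≈ᴿ.refl {x *ᴿ x *ᴿ w ∙ w}) (*ᴿ-cong (≈ᴿ.refl {(x *ᴿ y) +ᴿ (x *ᴿ y)}) (J-skew w)))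
            (*ᴿ-cong (≈ᴿ.refl {y *ᴿ y}) (J-isometry w)))
          (pointwise λ n → solve 3 (λ x y q → x :* x :* q :+ (x :* y :+ x :* y) :* con 0ℚ :+ y :* y :* q := (x :* x :+ y :* y) :* q)
            refl (seq x n) (seq y n) (seq (w ∙ w) n))))
        where
        open +-*-Solver
        w = a ⊙ v
        u = J ⊙ w
        row : ∀ i → ((z ∗ a) ⊙ v) i ≈ᴿ x *ᴿ w i +ᴿ y *ᴿ u i
        row i = ≈ᴿ.trans (ℝᴹ.sum-cong-≋ {x = λ j → (z ∗ a) i j *ᴿ v j} {λ j → x *ᴿ (a i j *ᴿ v j) +ᴿ y *ᴿ ((J ⊛ a) i j *ᴿ v j)} λ j → pointwise λ n →
            solve 5 (λ x a y b v → (x :* a :+ y :* b) :* v := x :* (a :* v) :+ y :* (b :* v)) refl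
              (seq x n) (seq (a i j) n) (seq y n) (seq ((J ⊛ a) i j) n) (seq (v j) n))
          (≈ᴿ.trans (ℝᴹ.∑-distrib-+ (λ j → x *ᴿ (a i j *ᴿ v j)) (λ j → y *ᴿ ((J ⊛ a) i j *ᴿ v j)))
            (+ᴿ-cong (≈ᴿ.sym (ℝᴹ.*-distribˡ-sum x λ j → a i j *ᴿ v j))
              (≈ᴿ.trans (≈ᴿ.sym (ℝᴹ.*-distribˡ-sum y λ j → (J ⊛ a) i j *ᴿ v j)) (*ᴿ-cong (≈ᴿ.refl {y}) (ℝᴹ.⊛-⊙ J a v i)))))
        expand : (λ i → x *ᴿ w i +ᴿ y *ᴿ u i) ∙ (λ i → x *ᴿ w i +ᴿ y *ᴿ u i) ≈ᴿ
          x *ᴿ x *ᴿ w ∙ w +ᴿ (x *ᴿ y +ᴿ x *ᴿ y) *ᴿ w ∙ u +ᴿ y *ᴿ y *ᴿ u ∙ u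
        expand = ≈ᴿ.trans (ℝᴹ.sum-cong-≋ {x = λ i → (x *ᴿ w i +ᴿ y *ᴿ u i) *ᴿ (x *ᴿ w i +ᴿ y *ᴿ u i)} {λ i → f i +ᴿ g i +ᴿ h i} λ i → pointwise λ n →
            solve 4 (λ x y w u → (x :* w :+ y :* u) :* (x :* w :+ y :* u) :=
              x :* x :* (w :* w) :+ (x :* y :+ x :* y) :* (w :* u) :+ y :* y :* (u :* u)) refl
              (seq x n) (seq y n) (seq (w i) n) (seq (u i) n))
          (≈ᴿ.trans (ℝᴹ.∑-distrib-+ (λ i → f i +ᴿ g i) h)
            (+ᴿ-cong (≈ᴿ.trans (ℝᴹ.∑-distrib-+ f g)
                (+ᴿ-cong (≈ᴿ.sym (ℝᴹ.*-distribˡ-sum (x *ᴿ x) λ i → w i *ᴿ w i))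
                  (≈ᴿ.sym (ℝᴹ.*-distribˡ-sum (x *ᴿ y +ᴿ x *ᴿ y) λ i → w i *ᴿ u i))))
              (≈ᴿ.sym (ℝᴹ.*-distribˡ-sum (y *ᴿ y) λ i → u i *ᴿ u i))))
          where
          f g h : Vector (suc m)
          f i = x *ᴿ x *ᴿ (w i *ᴿ w i)
          g i = (x *ᴿ y +ᴿ x *ᴿ y) *ᴿ (w i *ᴿ u i)
          h i = y *ᴿ y *ᴿ (u i *ᴿ u i)

      -- [a , J] = [a - s , J] has norm at most ‖a - s‖ (‖J‖ + ‖-J‖).
      commute-limit : ∀ a (s : ℕ → Operator) →
        (∀ ε → 0ℚ < ε → ∃[ N ] ∀ p → N ℕ.≤ p → opnorm (matrix (s p) ⊹ ⊝ a) ≤ᴿ fromℚ ε) → J-commute a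
      commute-limit a s s→a = difference (opnorm-definite ((⊝ a) ⊛ J ⊹ J ⊛ a)
        (≤ᴿ-antisym (≤ᴿ-closed small) (opnorm-nonNeg ((⊝ a) ⊛ J ⊹ J ⊛ a))))
        where
        open +-*-Solver
        difference : (⊝ a) ⊛ J ⊹ J ⊛ a ≊ O → J-commute a
        difference p = commuting (R.sym (begin
          J ⊛ a                              ≈⟨ R.+-identityˡ (J ⊛ a) ⟨
          O ⊹ J ⊛ a                          ≈⟨ R.+-congʳ (R.-‿inverseʳ (a ⊛ J)) ⟨
          a ⊛ J ⊹ ⊝ (a ⊛ J) ⊹ J ⊛ a          ≈⟨ R.+-assoc (a ⊛ J) (⊝ (a ⊛ J)) (J ⊛ a) ⟩
          a ⊛ J ⊹ (⊝ (a ⊛ J) ⊹ J ⊛ a)        ≈⟨ R.+-congˡ (R.+-congʳ (-‿distribˡ-* a J)) ⟩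
          a ⊛ J ⊹ ((⊝ a) ⊛ J ⊹ J ⊛ a)        ≈⟨ R.+-congˡ p ⟩
          a ⊛ J ⊹ O                          ≈⟨ R.+-identityʳ (a ⊛ J) ⟩
          a ⊛ J                              ∎))
        K = opnorm J +ᴿ opnorm (⊝ J)
        small : ∀ ε → 0ℚ < ε → opnorm ((⊝ a) ⊛ J ⊹ J ⊛ a) ≤ᴿ 0ᴿ +ᴿ fromℚ ε
        small ε 0<ε =
          let B , 0<B , L , K≤B = bounded-seq K
              r , 0<r , Br≡1 = reciprocal B 0<B
              N , c = s→a (r * ε) (*-pos 0<r 0<ε)
              d = matrix (s N) ⊹ ⊝ a
              d≤ = c N ℕ.≤-refl
          in ≤ᴿ-trans (≤ᴿ-reflexive (opnorm-cong (shift (s N))))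
            (≤ᴿ-trans (opnorm-triangle (d ⊛ J) ((⊝ J) ⊛ d))
            (≤ᴿ-trans (+ᴿ-mono-≤ (opnorm-* d J) (opnorm-* (⊝ J) d))
            (≤ᴿ-trans (≤ᴿ-reflexive (pointwise λ n → solve 3 (λ d j k → d :* j :+ k :* d := (j :+ k) :* d) refl
                (seq (opnorm d) n) (seq (opnorm J) n) (seq (opnorm (⊝ J)) n)))
            (≤ᴿ-trans (*ᴿ-mono-≤ {K} {fromℚ B} {opnorm d} {fromℚ (r * ε)} (opnorm-nonNeg d) (fromℚ-mono-≤ (ℚ.<⇒≤ 0<B)) (eventually-≤ L λ n ≤n → proj₁ (K≤B n ≤n)) d≤)
              (≤ᴿ-reflexive (pointwise λ _ → trans (sym (ℚ.*-assoc B r ε))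
                (trans (cong (_* ε) Br≡1) (trans (ℚ.*-identityˡ ε) (sym (ℚ.+-identityˡ ε))))))))))
          where
          shift : ∀ (b : Operator) → (⊝ a) ⊛ J ⊹ J ⊛ a ≊ (matrix b ⊹ ⊝ a) ⊛ J ⊹ (⊝ J) ⊛ (matrix b ⊹ ⊝ a)
          shift (operator b (commuting p)) .at i j = ≈ᴿ.sym (≈ᴿ.trans
            (at (R.+-cong (R.distribʳ J b (⊝ a)) (R.trans (R.sym (-‿distribˡ-* J (b ⊹ ⊝ a))) (R.-‿cong (R.trans (R.distribˡ J b (⊝ a)) (R.+-cong (R.sym p) (R.sym (-‿distribʳ-* J a))))))) i j)
            (pointwise λ n → solve 3 (λ x y z → (x :+ y) :+ :- (x :+ :- z) := y :+ z) refl
              (seq ((b ⊛ J) i j) n) (seq (((⊝ a) ⊛ J) i j) n) (seq ((J ⊛ a) i j) n)))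

    private
      _≈ᵒ_ : Operator → Operator → Set
      a ≈ᵒ b = matrix a ≊ matrix b

      _+ᵒ_ _*ᵒ_ : Operator → Operator → Operator
      operator a p +ᵒ operator b q = operator (a ⊹ b) (commute-+ p q)
      operator a p *ᵒ operator b q = operator (a ⊛ b) (commute-* p q)

      -ᵒ_ : Operator → Operator
      -ᵒ operator a p = operator (⊝ a) (commute-neg p)

      0ᵒ 1ᵒ : Operator
      0ᵒ = operator O (commuting (R.trans (R.zeroˡ J) (R.sym (R.zeroʳ J))))
      1ᵒ = operator I (commuting (R.trans (R.*-identityˡ J) (R.sym (R.*-identityʳ J))))

      isRing : IsRing _≈ᵒ_ _+ᵒ_ _*ᵒ_ -ᵒ_ 0ᵒ 1ᵒ
      isRing = record
        { +-isAbelianGroup = record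
          { isGroup = record
            { isMonoid = record
              { isSemigroup = record
                { isMagma = record
                  { isEquivalence = record { refl = R.refl ; sym = R.sym ; trans = R.trans }
                  ; ∙-cong = R.+-cong
                  }
                ; assoc = λ a b c → R.+-assoc (matrix a) (matrix b) (matrix c)
                }
              ; identity = (λ a → R.+-identityˡ (matrix a)) , (λ a → R.+-identityʳ (matrix a))
              }
            ; inverse = (λ a → R.-‿inverseˡ (matrix a)) , (λ a → R.-‿inverseʳ (matrix a))
            ; ⁻¹-cong = R.-‿cong
            }
          ; comm = λ a b → R.+-comm (matrix a) (matrix b)
          }
        ; *-cong     = R.*-cong
        ; *-assoc    = λ a b c → R.*-assoc (matrix a) (matrix b) (matrix c)
        ; *-identity = (λ a → R.*-identityˡ (matrix a)) , (λ a → R.*-identityʳ (matrix a))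
        ; distrib    = (λ a b c → R.distribˡ (matrix a) (matrix b) (matrix c))
                     , (λ a b c → R.distribʳ (matrix a) (matrix b) (matrix c))
        }

      module A = IsRing isRing

    commutant : CStarAlgebra
    commutant = record
      { Carrier = Operator
      ; _≈_ = _≈ᵒ_
      ; _+_ = _+ᵒ_
      ; _*_ = _*ᵒ_
      ; -_  = -ᵒ_
      ; 0#  = 0ᵒ
      ; 1#  = 1ᵒ
      ; isRing = isRing
      ; _•_ = λ z (operator a p) → operator (z ∗ a) (commute-∗ z p)
      ; isLeftModule = record
        { isLeftSemimodule = record
          { +ᴹ-isCommutativeMonoid = A.+-isCommutativeMonoid
          ; isPreleftSemimodule = record
            { *ₗ-cong      = λ (p , q) a≊b → R.+-cong (◂-cong p a≊b) (◂-cong q (⊛-congˡ J a≊b))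
            ; *ₗ-zeroˡ     = λ (operator a _) → entrywise λ i j → pointwise λ n →
                solve 2 (λ a b → con 0ℚ :* a :+ con 0ℚ :* b := con 0ℚ) refl (seq (a i j) n) (seq ((J ⊛ a) i j) n)
            ; *ₗ-distribʳ  = λ (operator a _) (x +i y) (x′ +i y′) → entrywise λ i j → pointwise λ n →
                solve 6 (λ x y x′ y′ a b → (x :+ x′) :* a :+ (y :+ y′) :* b := (x :* a :+ y :* b) :+ (x′ :* a :+ y′ :* b))
                  refl (seq x n) (seq y n) (seq x′ n) (seq y′ n) (seq (a i j) n) (seq ((J ⊛ a) i j) n)
            ; *ₗ-identityˡ = λ (operator a _) → entrywise λ i j → pointwise λ n →
                solve 2 (λ a b → con 1ℚ :* a :+ con 0ℚ :* b := a) refl (seq (a i j) n) (seq ((J ⊛ a) i j) n)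
            ; *ₗ-assoc     = λ (x +i y) (x′ +i y′) (operator a _) → R.trans
                (entrywise λ i j → pointwise λ n →
                  solve 6 (λ x y x′ y′ a b → (x :* x′ :+ :- (y :* y′)) :* a :+ (x :* y′ :+ y :* x′) :* b :=
                      x :* (x′ :* a :+ y′ :* b) :+ y :* (x′ :* b :+ y′ :* :- a))
                    refl (seq x n) (seq y n) (seq x′ n) (seq y′ n) (seq (a i j) n) (seq ((J ⊛ a) i j) n))
                (R.+-congˡ (◂-cong {y} ≈ᴿ.refl (R.sym (J-∗ (x′ +i y′) a))))
            ; *ₗ-zeroʳ     = λ (x +i y) → R.trans (R.+-congˡ (◂-cong {y} ≈ᴿ.refl (R.zeroʳ J)))
                (entrywise λ i j → pointwise λ n → solve 2 (λ x y → x :* con 0ℚ :+ y :* con 0ℚ := con 0ℚ) refl (seq x n) (seq y n))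
            ; *ₗ-distribˡ  = λ (x +i y) (operator a _) (operator b _) → R.trans
                (R.+-congˡ (◂-cong {y} ≈ᴿ.refl (R.distribˡ J a b)))
                (entrywise λ i j → pointwise λ n →
                  solve 6 (λ x y a b c d → x :* (a :+ b) :+ y :* (c :+ d) := (x :* a :+ y :* c) :+ (x :* b :+ y :* d))
                    refl (seq x n) (seq y n) (seq (a i j) n) (seq (b i j) n) (seq ((J ⊛ a) i j) n) (seq ((J ⊛ b) i j) n))
            }
          }
        ; -ᴹ‿cong    = λ {a} {b} → A.-‿cong {a} {b}
        ; -ᴹ‿inverse = A.-‿inverse
        }
      ; •-*-assoc = λ z a b → ∗-⊛ z (matrix a) (matrix b)
      ; *-•-comm  = λ z a b → ⊛-∗ z (matrix a) (matrix b) (commutes a)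
      ; nontrivial = λ 1≊0 → 1≉0 (at 1≊0 zero zero)
      ; _⋆ = λ (operator a p) → operator (transpose a) (commute-transpose p)
      ; ⋆-cong       = transpose-cong
      ; ⋆-involutive = λ a → R.refl {matrix a}
      ; ⋆-+          = λ a b → R.refl {transpose (matrix a ⊹ matrix b)}
      ; ⋆-•          = λ z a → ∗-transpose z (commutes a)
      ; ⋆-*          = λ a b → ℝᴹ.transpose-⊛ (matrix a) (matrix b)
      ; ‖_‖          = λ a → opnorm (matrix a)
      ; ‖‖-cong      = opnorm-cong
      ; ‖‖-nonneg    = λ a → opnorm-nonNeg (matrix a)
      ; ‖‖-definite  = λ a → opnorm-definite (matrix a)
      ; ‖‖-triangle  = λ a b → opnorm-triangle (matrix a) (matrix b)
      ; ‖‖-homogeneous = λ z a → opnorm-similar (matrix a) (z ∗ matrix a) Defs.∣ z ∣²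
          (λ n → +-nonNeg (square-nonNeg (seq (re z) n)) (square-nonNeg (seq (im z) n))) (∗-norm z (matrix a))
      ; ‖‖-submultiplicative = λ a b → opnorm-* (matrix a) (matrix b)
      ; C*-identity  = λ a → opnorm-C* (matrix a)
      ; complete     = λ s s-cauchy →
          let a , s→a = opnorm-complete (λ n → matrix (s n)) s-cauchy
          in operator a (commute-limit a s s→a) , s→a
      }
      where
      open +-*-Solver
      1≉0 : ¬ (1ᴿ ≈ᴿ 0ᴿ)
      1≉0 1≈0 = let N , c = close 1≈0 1ℚ 0<1 in ℚ.<-irrefl refl (c N ℕ.≤-refl)

module QuantumPermutation where

  open import Defs hiding (_·_; _≋_; matrix; ∣_∣²)
  open import Algebra.Bundles using (Ring)
  open import Data.Bool.Base using (Bool; _xor_; false; if_then_else_; not; true)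
  import Data.Bool.Properties as Bool
  open import Data.Empty using (⊥)
  open import Data.Fin.Base as Fin using (Fin; combine; suc; zero)
  import Data.Fin.Properties as Fin
  open import Data.Integer.Base as ℤ using (0ℤ; 1ℤ; ℤ)
  import Data.Integer.Properties as ℤ
  open import Data.Nat.Base as ℕ using (suc; zero; ℕ)
  import Data.Nat.Coprimality as Coprime
  open import Data.Product.Base using (_,_; proj₁; proj₂; ∃-syntax)
  open import Data.Rational.Base as ℚ using (0ℚ; 1ℚ; mkℚ; ½; ℚ)
  import Data.Rational.Properties as ℚ
  open import Data.Rational.Solver using (module +-*-Solver)
  open import Data.Rational.Unnormalised.Base as ℚᵘ using (*≡*)
  import Data.Rational.Unnormalised.Properties as ℚᵘ
  open import Data.Vec.Base as Vec using (Vec; []; _∷_; lookup; tabulate)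
  import Data.Vec.Properties as Vec
  open import Function.Base using (_∘_)
  open import Relation.Binary.PropositionalEquality
  open import Relation.Nullary using (Dec; contradiction)
  open import Relation.Nullary.Decidable using (_→-dec_; does; from-yes)
  open import Relation.Nullary.Reflects using (ofʸ; ofⁿ)
  open Flags
  open RootLines
  open LinearAlgebra
  open QuadraticForms using (module ℚᴹ)
  open RealOrder using (module ℝᴹ)
  open OperatorNorm using (seq-sum)
  open ComplexStructure
  open StronglyRegularGraphs using (holds)

  module ℤᴹ = Matrices ℤ.+-*-commutativeRing

  fromℤ : ℤ → ℚ
  fromℤ z = mkℚ z 0 (Coprime.sym (Coprime.1-coprimeTo ℤ.∣ z ∣))

  fromℤ-+ : ∀ x y → fromℤ (x ℤ.+ y) ≡ fromℤ x ℚ.+ fromℤ y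
  fromℤ-+ x y = ℚ.toℚᵘ-injective (ℚᵘ.≃-trans
    (*≡* (cong (ℤ._* 1ℤ) (sym (cong₂ ℤ._+_ (ℤ.*-identityʳ x) (ℤ.*-identityʳ y)))))
    (ℚᵘ.≃-sym (ℚ.toℚᵘ-homo-+ (fromℤ x) (fromℤ y))))

  fromℤ-* : ∀ x y → fromℤ (x ℤ.* y) ≡ fromℤ x ℚ.* fromℤ y
  fromℤ-* x y = ℚ.toℚᵘ-injective (ℚᵘ.≃-trans (*≡* refl)
    (ℚᵘ.≃-sym (ℚ.toℚᵘ-homo-* (fromℤ x) (fromℤ y))))

  fromℤ-sum : ∀ {n} (f : Fin n → ℤ) → fromℤ (ℤᴹ.sum f) ≡ ℚᴹ.sum (fromℤ ∘ f)
  fromℤ-sum {zero}  f = refl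
  fromℤ-sum {suc n} f = trans (fromℤ-+ (f zero) (ℤᴹ.sum (f ∘ suc))) (cong (fromℤ (f zero) ℚ.+_) (fromℤ-sum (f ∘ suc)))

  coordinates : ∀ {n} → Vec ℤ n → ℚᴹ.Vector n
  coordinates x = fromℤ ∘ lookup x

  coordinates-∙ : ∀ {n} (x y : Vec ℤ n) → coordinates x ℚᴹ.∙ coordinates y ≡ fromℤ (x ·ᶻ y)
  coordinates-∙ []      []      = refl
  coordinates-∙ (a ∷ x) (b ∷ y) = trans
    (cong₂ ℚ._+_ (sym (fromℤ-* a b)) (coordinates-∙ x y)) (sym (fromℤ-+ (a ℤ.* b) (x ·ᶻ y)))

  line : ∀ {n} → ℚ → Vec ℤ n → ℚᴹ.Matrix n
  line κ x i j = κ ℚ.* (coordinates x i ℚ.* coordinates x j)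

  open ℚᴹ using (_⊛_; _≊_; entrywise; at)

  line-symmetric : ∀ {n} κ (x : Vec ℤ n) → ℚᴹ.transpose (line κ x) ≊ line κ x
  line-symmetric κ x .at i j = cong (κ ℚ.*_) (ℚ.*-comm (coordinates x j) (coordinates x i))

  line-⊛ : ∀ {n} κ μ (x y : Vec ℤ n) i j → (line κ x ⊛ line μ y) i j ≡
    κ ℚ.* μ ℚ.* (coordinates x i ℚ.* coordinates y j) ℚ.* fromℤ (x ·ᶻ y)
  line-⊛ κ μ x y i j = trans
    (ℚᴹ.sum-cong-≋ λ k → solve 6 (λ κ μ a b c d → κ :* (a :* b) :* (μ :* (c :* d)) := κ :* μ :* (a :* d) :* (b :* c)) refl
      κ μ (coordinates x i) (coordinates x k) (coordinates y k) (coordinates y j))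
    (trans (sym (ℚᴹ.*-distribˡ-sum (κ ℚ.* μ ℚ.* (coordinates x i ℚ.* coordinates y j)) λ k → coordinates x k ℚ.* coordinates y k))
      (cong (κ ℚ.* μ ℚ.* (coordinates x i ℚ.* coordinates y j) ℚ.*_) (coordinates-∙ x y)))
    where open +-*-Solver

  line-idempotent : ∀ {n} κ (x : Vec ℤ n) → κ ℚ.* fromℤ (x ·ᶻ x) ≡ 1ℚ → line κ x ⊛ line κ x ≊ line κ x
  line-idempotent κ x unit .at i j = trans (line-⊛ κ κ x x i j) (trans
    (solve 3 (λ κ a q → κ :* κ :* a :* q := κ :* a :* (κ :* q)) refl κ (coordinates x i ℚ.* coordinates x j) (fromℤ (x ·ᶻ x)))
    (trans (cong (κ ℚ.* (coordinates x i ℚ.* coordinates x j) ℚ.*_) unit) (ℚ.*-identityʳ _)))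
    where open +-*-Solver

  line-orthogonal : ∀ {n} κ μ (x y : Vec ℤ n) → x ·ᶻ y ≡ 0ℤ → line κ x ⊛ line μ y ≊ ℚᴹ.O
  line-orthogonal κ μ x y x⊥y .at i j = trans (line-⊛ κ μ x y i j)
    (trans (cong (λ t → κ ℚ.* μ ℚ.* (coordinates x i ℚ.* coordinates y j) ℚ.* fromℤ t) x⊥y)
      (ℚ.*-zeroʳ (κ ℚ.* μ ℚ.* (coordinates x i ℚ.* coordinates y j))))

  -- The C*-algebra M₈(ℂ), acting on ℝ⁸ ⊕ ℝ⁸.

  open Blocks ℚ.+-*-commutativeRing 8

  ι : ∀ {n} → ℚᴹ.Matrix n → ℝᴹ.Matrix n
  ι A i j = fromℚ (A i j)

  ι-cong : ∀ {n} {A B : ℚᴹ.Matrix n} → A ≊ B → ι A ℝᴹ.≊ ι B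
  ι-cong p .ℝᴹ.at i j = pointwise λ _ → at p i j

  ι-⊛ : ∀ {n} (A B : ℚᴹ.Matrix n) → ι A ℝᴹ.⊛ ι B ℝᴹ.≊ ι (A ⊛ B)
  ι-⊛ A B .ℝᴹ.at i j = pointwise λ k → seq-sum (λ h → fromℚ (A i h) *ᴿ fromℚ (B h j)) k

  ι-I : ∀ {n} → ι (ℚᴹ.I {n}) ℝᴹ.≊ ℝᴹ.I
  ι-I .ℝᴹ.at i j = cell (does (i Fin.≟ j))
    where
    cell : ∀ b → fromℚ (if b then 1ℚ else 0ℚ) ≈ᴿ (if b then 1ᴿ else 0ᴿ)
    cell true  = ≈ᴿ.refl
    cell false = ≈ᴿ.refl

  private
    module ℝR n = Ring (ℝᴹ.matrixRing n)

    J²≊-1 : ι rot ℝᴹ.⊛ ι rot ℝᴹ.≊ ℝᴹ.⊝ ℝᴹ.I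
    J²≊-1 = ℝR.trans 16 (ι-⊛ rot rot) (ℝR.trans 16 (ι-cong rot²)
      (ℝR.trans 16 (entrywise′ λ i j → pointwise λ _ → refl) (ℝR.-‿cong 16 (ι-I {16}))))
      where
      entrywise′ : ∀ {A B : ℝᴹ.Matrix 16} → (∀ i j → A i j ≈ᴿ B i j) → A ℝᴹ.≊ B
      entrywise′ = ℝᴹ.entrywise

    Jᵀ≊-J : ℝᴹ.transpose (ι rot) ℝᴹ.≊ ℝᴹ.⊝ ι rot
    Jᵀ≊-J .ℝᴹ.at i j = pointwise λ _ → at rotᵀ i j

  private
    module 𝒞 = Commutant {15} (ι rot) J²≊-1 Jᵀ≊-J

  opaque
    M₈ : CStarAlgebra
    M₈ = 𝒞.commutant

  open CStarAlgebra M₈ using (Carrier; _+_; _*_; 0#; 1#; _⋆; ring; ⋆-cong) renaming (_≈_ to _≈ᵃ_)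
  private
    module 𝒜 = Ring ring
  open import Algebra.Properties.Semiring.Sum 𝒜.semiring using (sum; sum-cong-≋)

  opaque
    unfolding M₈

    op : ℚᴹ.Matrix 8 → Carrier
    op A = 𝒞.operator (ι (D A)) (𝒞.commuting (ℝR.trans 16 (ι-⊛ (D A) rot)
      (ℝR.trans 16 (ι-cong (D-rot A)) (ℝR.sym 16 (ι-⊛ rot (D A))))))

    op-cong : ∀ {A B} → A ≊ B → op A ≈ᵃ op B
    op-cong p = ι-cong (D-cong p)

    op-* : ∀ A B → op A * op B ≈ᵃ op (A ⊛ B)
    op-* A B = ℝR.trans 16 (ι-⊛ (D A) (D B)) (ι-cong (D-⊛ A B))

    op-⋆ : ∀ A → (op A) ⋆ ≈ᵃ op (ℚᴹ.transpose A)
    op-⋆ A = ι-cong (D-transpose A)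

    op-I : op ℚᴹ.I ≈ᵃ 1#
    op-I = ℝR.trans 16 (ι-cong D-I) ι-I

    op-O : op ℚᴹ.O ≈ᵃ 0#
    op-O = ℝR.trans 16 (ι-cong D-O) (ℝᴹ.entrywise λ _ _ → ≈ᴿ.refl)

    op-sum : ∀ {n} (A : Fin n → ℚᴹ.Matrix 8) → sum (λ k → op (A k)) ≈ᵃ op (λ i j → ℚᴹ.sum λ k → A k i j)
    op-sum A .ℝᴹ.at i j = ≈ᴿ.trans (total A) (pointwise λ _ → D-sum A i j)
      where
      total : ∀ {n} (A : Fin n → ℚᴹ.Matrix 8) → 𝒞.matrix (sum (λ k → op (A k))) i j ≈ᴿ fromℚ (ℚᴹ.sum λ k → D (A k) i j)
      total {zero}  A = ≈ᴿ.refl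
      total {suc n} A = ≈ᴿ.trans (+ᴿ-cong (≈ᴿ.refl {fromℚ (D (A zero) i j)}) (total (A ∘ suc))) (pointwise λ _ → refl)

  norm : Word 4 → ℤ
  norm (u ∷ _) = if u then ℤ.+ 8 else ℤ.+ 2

  scale : Word 4 → ℚ
  scale (u ∷ _) = if u then ½ ℚ.* ½ ℚ.* ½ else ½

  scale-norm : ∀ u → scale u ℚ.* fromℤ (norm u) ≡ 1ℚ
  scale-norm (true ∷ _)  = refl
  scale-norm (false ∷ _) = refl

  projection : Flag → ℚᴹ.Matrix 8
  projection (u , f) = line (scale u) (root (u , f))

  private
    Resolves : ℤ → Vec (Vec ℤ 8) 8 → Set
    Resolves N xs = ∀ r s → ℤᴹ.sum (λ z → lookup (lookup xs z) r ℤ.* lookup (lookup xs z) s) ≡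
      (if does (r Fin.≟ s) then N else 0ℤ)

    resolves? : ∀ N xs → Dec (Resolves N xs)
    resolves? N xs = Fin.all? λ r → Fin.all? λ s → _ ℤ.≟ _

  opaque
    unfolding root

    root-norm : ∀ i x → root (flag true i x) ·ᶻ root (flag true i x) ≡ norm (axis i)
    root-norm = from-yes (Fin.all? λ i → Fin.all? λ x → (root (flag true i x) ·ᶻ root (flag true i x)) ℤ.≟ norm (axis i))

    row-resolves : ∀ i f → dot f (axis i) ≡ true →
      Resolves (norm (axis i)) (tabulate λ z → root (axis i , f ⊕ fill (axis i) false (bits z)))
    row-resolves = from-yes (Fin.all? λ i → allWords? λ f → (dot f (axis i) Bool.≟ true) →-dec
      resolves? (norm (axis i)) (tabulate λ z → root (axis i , f ⊕ fill (axis i) false (bits z))))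

    column-resolves : ∀ i h → dot h (axis i) ≡ false →
      Resolves (norm (axis i)) (tabulate λ z → root (axis i , fill (axis i) true (bits z) ⊕ h))
    column-resolves = from-yes (Fin.all? λ i → allWords? λ h → (dot h (axis i) Bool.≟ false) →-dec
      resolves? (norm (axis i)) (tabulate λ z → root (axis i , fill (axis i) true (bits z) ⊕ h)))

  open RingSums ring using (sum-zero; sum-pick; sum-combine; intertwine)
  open ℚᴹ using (_≊_; at)

  projection-idempotent : ∀ p → IsFlag true p → projection p ℚᴹ.⊛ projection p ≊ projection p
  projection-idempotent (u , f) p-flag = step (flag-surjective true u f p-flag)
    where
    step : ∃[ i ] ∃[ x ] flag true i x ≡ (u , f) → projection (u , f) ℚᴹ.⊛ projection (u , f) ≊ projection (u , f)
    step (i , x , refl) = line-idempotent (scale (axis i)) (root (flag true i x))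
      (trans (cong (λ z → scale (axis i) ℚ.* fromℤ z) (root-norm i x)) (scale-norm (axis i)))

  projection-orthogonal : ∀ p q → IsFlag true p → IsFlag true q → adjacent true p q ≡ true →
    projection p ℚᴹ.⊛ projection q ≊ ℚᴹ.O
  projection-orthogonal p q p-flag q-flag p~q = line-orthogonal (scale (proj₁ p)) (scale (proj₁ q)) (root p) (root q)
    (step (flagAt-surjective true p p-flag) (flagAt-surjective true q q-flag))
    where
    step : ∃[ k ] flagAt true k ≡ p → ∃[ l ] flagAt true l ≡ q → root p ·ᶻ root q ≡ 0ℤ
    step (k , k≡) (l , l≡) = subst₂ (λ p q → root p ·ᶻ root q ≡ 0ℤ) k≡ l≡
      (holds (root-orthogonal k l) (trans (cong₂ (adjacent true) k≡ l≡) p~q))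

  resolution : ∀ u (ws : Fin 8 → Word 4) →
    (∀ r s → ℤᴹ.sum (λ z → lookup (lookup (tabulate λ z → root (u , ws z)) z) r ℤ.* lookup (lookup (tabulate λ z → root (u , ws z)) z) s) ≡
      (if does (r Fin.≟ s) then norm u else 0ℤ)) →
    sum (λ z → op (projection (u , ws z))) ≈ᵃ 1#
  resolution u ws resolves = 𝒜.trans (op-sum (λ z → projection (u , ws z)))
    (𝒜.trans (op-cong {λ i j → ℚᴹ.sum λ z → projection (u , ws z) i j} {ℚᴹ.I} (ℚᴹ.entrywise entries)) op-I)
    where
    R : Fin 8 → Vec ℤ 8
    R z = root (u , ws z)
    lookup-R : ∀ z → lookup (tabulate R) z ≡ R z
    lookup-R = Vec.lookup∘tabulate R
    final : ∀ b → scale u ℚ.* fromℤ (if b then norm u else 0ℤ) ≡ (if b then 1ℚ else 0ℚ)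
    final true  = scale-norm u
    final false = ℚ.*-zeroʳ (scale u)
    entries : ∀ r s → ℚᴹ.sum (λ z → projection (u , ws z) r s) ≡ ℚᴹ.I r s
    entries r s = begin
      ℚᴹ.sum (λ z → scale u ℚ.* (coordinates (R z) r ℚ.* coordinates (R z) s))
        ≡⟨ ℚᴹ.*-distribˡ-sum (scale u) (λ z → coordinates (R z) r ℚ.* coordinates (R z) s) ⟨
      scale u ℚ.* ℚᴹ.sum (λ z → coordinates (R z) r ℚ.* coordinates (R z) s)
        ≡⟨ cong (scale u ℚ.*_) (ℚᴹ.sum-cong-≋ λ z → trans (sym (fromℤ-* (lookup (R z) r) (lookup (R z) s)))
             (cong (λ x → fromℤ (lookup x r ℤ.* lookup x s)) (sym (lookup-R z)))) ⟩
      scale u ℚ.* ℚᴹ.sum (λ z → fromℤ (lookup (lookup (tabulate R) z) r ℤ.* lookup (lookup (tabulate R) z) s))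
        ≡⟨ cong (scale u ℚ.*_) (fromℤ-sum (λ z → lookup (lookup (tabulate R) z) r ℤ.* lookup (lookup (tabulate R) z) s)) ⟨
      scale u ℚ.* fromℤ (ℤᴹ.sum (λ z → lookup (lookup (tabulate R) z) r ℤ.* lookup (lookup (tabulate R) z) s))
        ≡⟨ cong (λ t → scale u ℚ.* fromℤ t) (resolves r s) ⟩
      scale u ℚ.* fromℤ (if does (r Fin.≟ s) then norm u else 0ℤ)
        ≡⟨ final (does (r Fin.≟ s)) ⟩
      ℚᴹ.I r s ∎
      where open ≡-Reasoning

  -- The quantum permutation: (u , f) ↦ (u , h) with the projection onto the line of (u , f + h).
  unit : Flag → Flag → Carrier
  unit (u , f) (v , h) = if u == v then op (projection (u , f ⊕ h)) else 0#

  quantum : Fin 120 → Fin 120 → Carrier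
  quantum k l = unit (flagAt true k) (flagAt false l)

  shift-isFlag : ∀ {u f h} → IsFlag true (u , f) → IsFlag false (u , h) → IsFlag true (u , f ⊕ h)
  shift-isFlag {u} {f} {h} (u≢𝟎 , f·u) (_ , h·u) = u≢𝟎 , trans (dot-⊕ˡ f h u) (cong₂ _xor_ f·u h·u)

  unit-self-adjoint : ∀ p q → unit p q ≈ᵃ unit p q ⋆
  unit-self-adjoint (u , f) (v , h) with u == v
  ... | true  = 𝒜.sym (𝒜.trans (op-⋆ (projection (u , f ⊕ h))) (op-cong (line-symmetric (scale u) (root (u , f ⊕ h)))))
  ... | false = 𝒜.trans (𝒜.sym op-O) (𝒜.trans (𝒜.sym (op-⋆ ℚᴹ.O)) (⋆-cong {op ℚᴹ.O} {0#} op-O))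

  unit-idempotent : ∀ p q → IsFlag true p → IsFlag false q → unit p q ≈ᵃ unit p q * unit p q
  unit-idempotent (u , f) (v , h) p-flag q-flag with u == v | ==-reflects u v
  ... | true  | ofʸ refl = 𝒜.sym (𝒜.trans (op-* P P) (op-cong (projection-idempotent (u , f ⊕ h) (shift-isFlag {u} {f} {h} p-flag q-flag))))
    where P = projection (u , f ⊕ h)
  ... | false | _        = 𝒜.sym (𝒜.zeroˡ 0#)

  unit-≢ : ∀ {u v} f h → u ≢ v → unit (u , f) (v , h) ≈ᵃ 0#
  unit-≢ {u} {v} f h u≢v rewrite ==-≢ u≢v = 𝒜.refl {0#}

  unit-≡ : ∀ u f h → unit (u , f) (u , h) ≡ op (projection (u , f ⊕ h))
  unit-≡ u f h rewrite ==-refl u = refl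

  sum-flags : ∀ b (F : Flag → Carrier) → sum (λ k → F (flagAt b k)) ≈ᵃ sum (λ i → sum (λ x → F (flag b i x)))
  sum-flags b F = 𝒜.trans (sum-combine {15} {8} (λ k → F (flagAt b k)))
    (sum-cong-≋ {x = λ i → sum (λ x → F (flagAt b (combine {15} {8} i x)))} {λ i → sum (λ x → F (flag b i x))} λ i → sum-cong-≋ {x = λ x → F (flagAt b (combine {15} {8} i x))} {λ x → F (flag b i x)} λ x →
      𝒜.reflexive (cong F (flagAt-combine b i x)))

  private
    separated : ∀ {i j : Fin 15} → (j ≡ i → _≡_ {A = ℕ} 0 1) → axis i ≢ axis j
    separated {i} {j} j≢i eq with j≢i (sym (axis-injective i j eq))
    ... | ()

  row-sum : ∀ p → IsFlag true p → sum (λ l → unit p (flagAt false l)) ≈ᵃ 1#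
  row-sum (u , f) p-flag = step (axis-surjective u (proj₁ p-flag)) (proj₂ p-flag)
    where
    step : ∃[ i ] axis i ≡ u → dot f u ≡ true → sum (λ l → unit (u , f) (flagAt false l)) ≈ᵃ 1#
    step (i , refl) f·u = 𝒜.trans (sum-flags false (unit (axis i , f)))
      (𝒜.trans (sum-pick i (λ j → sum (λ x → unit (axis i , f) (flag false j x))) λ j j≢i →
          sum-zero (λ x → unit (axis i , f) (flag false j x)) λ x → unit-≢ f (fill (axis j) false (bits x)) (separated {i} {j} j≢i))
      (𝒜.trans (sum-cong-≋ {x = λ x → unit (axis i , f) (flag false i x)} {λ x → op (projection (axis i , f ⊕ fill (axis i) false (bits x)))}
          λ x → 𝒜.reflexive (unit-≡ (axis i) f (fill (axis i) false (bits x))))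
        (resolution (axis i) (λ x → f ⊕ fill (axis i) false (bits x)) (row-resolves i f f·u))))

  column-sum : ∀ q → IsFlag false q → sum (λ k → unit (flagAt true k) q) ≈ᵃ 1#
  column-sum (u , h) q-flag = step (axis-surjective u (proj₁ q-flag)) (proj₂ q-flag)
    where
    step : ∃[ i ] axis i ≡ u → dot h u ≡ false → sum (λ k → unit (flagAt true k) (u , h)) ≈ᵃ 1#
    step (i , refl) h·u = 𝒜.trans (sum-flags true (λ p → unit p (axis i , h)))
      (𝒜.trans (sum-pick i (λ j → sum (λ x → unit (flag true j x) (axis i , h))) λ j j≢i →
          sum-zero (λ x → unit (flag true j x) (axis i , h)) λ x → unit-≢ (fill (axis j) true (bits x)) h (separated {i} {j} j≢i ∘ sym))
      (𝒜.trans (sum-cong-≋ {x = λ x → unit (flag true i x) (axis i , h)} {λ x → op (projection (axis i , fill (axis i) true (bits x) ⊕ h))}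
          λ x → 𝒜.reflexive (unit-≡ (axis i) (fill (axis i) true (bits x)) h))
        (resolution (axis i) (λ x → fill (axis i) true (bits x) ⊕ h) (column-resolves i h h·u))))

  ⊕-swap : ∀ {n} (a b c d : Word n) → a ⊕ b ≡ c ⊕ d → a ≡ c → b ≡ d
  ⊕-swap a b c d eq a≡c = trans (sym (⊕-cancel a b)) (trans (cong₂ _⊕_ a≡c eq) (⊕-cancel c d))

  shift-adjacent : ∀ {u v} f g h k → adjacent true (u , g) (v , f) ≡ not (adjacent false (u , k) (v , h)) →
    adjacent true (v , f ⊕ h) (u , g ⊕ k) ≡ true
  shift-adjacent {u} {v} f g h k eq with u == v | ==-reflects u v | v == u | ==-reflects v u
  ... | true  | ofʸ u≡v | false | ofⁿ v≢u = contradiction (sym u≡v) v≢u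
  ... | false | ofⁿ u≢v | true  | ofʸ v≡u = contradiction (sym v≡u) u≢v
  ... | true  | _       | true  | _       = cong not (==-≢ {x = f ⊕ h} {g ⊕ k} λ sums → clash sums eq)
    where
    clash : f ⊕ h ≡ g ⊕ k → not (g == f) ≡ not (not (k == h)) → ⊥
    clash sums eq with g == f | ==-reflects g f | k == h | ==-reflects k h
    ... | true  | ofʸ refl | false | ofⁿ k≢h = k≢h (sym (⊕-swap f h g k sums refl))
    ... | false | ofⁿ g≢f | true  | ofʸ refl = g≢f (sym (⊕-swap h f k g
      (trans (⊕-comm h f) (trans sums (⊕-comm g k))) refl))
    clash sums () | true  | _ | true  | _
    clash sums () | false | _ | false | _
  ... | false | _       | false | _       = cong not (begin
    dot (f ⊕ h) u xor dot (g ⊕ k) v                             ≡⟨ cong₂ _xor_ (dot-⊕ˡ f h u) (dot-⊕ˡ g k v) ⟩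
    (dot f u xor dot h u) xor (dot g v xor dot k v)             ≡⟨ xor-medial (dot f u) (dot h u) (dot g v) (dot k v) ⟩
    (dot f u xor dot g v) xor (dot h u xor dot k v)             ≡⟨ cong₂ _xor_ (Bool.xor-comm (dot f u) (dot g v)) (Bool.xor-comm (dot h u) (dot k v)) ⟩
    (dot g v xor dot f u) xor (dot k v xor dot h u)             ≡⟨ cong (_xor (dot k v xor dot h u)) (Bool.not-injective eq) ⟩
    (dot k v xor dot h u) xor (dot k v xor dot h u)             ≡⟨ Bool.xor-same (dot k v xor dot h u) ⟩
    false                                                       ∎)
    where open ≡-Reasoning

  unit-orthogonal : ∀ p p′ q q′ → IsFlag true p → IsFlag true p′ → IsFlag false q → IsFlag false q′ →
    adjacent true p p′ ≡ not (adjacent false q q′) → unit p′ q′ * unit p q ≈ᵃ 0#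
  unit-orthogonal (u , g) (v , f) (w , k) (t , h) p-flag p′-flag q-flag q′-flag eq
    with v == t | ==-reflects v t | u == w | ==-reflects u w
  ... | false | _        | b     | _        = 𝒜.zeroˡ (if b then op (projection (u , g ⊕ k)) else 0#)
  ... | true  | _        | false | _        = 𝒜.zeroʳ (op (projection (v , f ⊕ h)))
  ... | true  | ofʸ refl | true  | ofʸ refl = 𝒜.trans (op-* (projection (v , f ⊕ h)) (projection (u , g ⊕ k)))
    (𝒜.trans (op-cong {B = ℚᴹ.O} (projection-orthogonal (v , f ⊕ h) (u , g ⊕ k)
      (shift-isFlag {v} {f} {h} p′-flag q′-flag) (shift-isFlag {u} {g} {k} p-flag q-flag) (shift-adjacent f g h k eq))) op-O)

  quantumIsomorphic : ∀ {H} (A : AdjacencyMatrix H 120) →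
    (∀ k l → AdjacencyMatrix.entry A k l ≡ entry false k l) → QuantumIsomorphic G-E₈ H
  quantumIsomorphic {H} A entry-A = record
    { n  = 120
    ; A₁ = E₈-adjacency
    ; A₂ = A
    ; 𝒜  = M₈
    ; u  = quantum
    ; isQuantumPermutation = record
      { self-adjoint = λ k l → unit-self-adjoint (flagAt true k) (flagAt false l)
      ; idempotent   = λ k l → unit-idempotent (flagAt true k) (flagAt false l) (flagAt-isFlag true k) (flagAt-isFlag false l)
      ; row-sum      = λ k → row-sum (flagAt true k) (flagAt-isFlag true k)
      ; column-sum   = λ l → column-sum (flagAt false l) (flagAt-isFlag false l)
      }
    ; intertwines = λ g h → intertwine
        (λ k → quantum k h) (λ l → quantum g l)
        (λ k → entry true g k) (λ l → AdjacencyMatrix.entry A l h)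
        (column-sum (flagAt false h) (flagAt-isFlag false h)) (row-sum (flagAt true g) (flagAt-isFlag true g))
        (λ k l eq → unit-orthogonal (flagAt true g) (flagAt true k) (flagAt false l) (flagAt false h)
          (flagAt-isFlag true g) (flagAt-isFlag true k) (flagAt-isFlag false l) (flagAt-isFlag false h)
          (trans eq (cong not (entry-A l h))))
    }

module Bivectors where

  open import Defs hiding (_·_; matrix; ∣_∣²)
  open import Data.Bool.Base using (Bool; _xor_; _∧_; false; if_then_else_; true)
  import Data.Bool.Properties as Bool
  open import Data.Fin.Base as Fin using (Fin; suc; zero)
  import Data.Fin.Properties as Fin
  open import Data.Nat.Base as ℕ using (suc; zero; ℕ)
  import Data.Nat.Properties as ℕ
  open import Data.Product.Base using (_,_; _×_; proj₁; proj₂; ∃; ∃-syntax)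
  import Data.Product.Properties as Product
  open import Data.Sum.Base using ([_,_]′; _⊎_; inj₁; inj₂)
  open import Data.Vec.Base as Vec using (Vec; []; _∷_)
  import Data.Vec.Properties as Vec
  open import Function.Base using (_∘_)
  open import Relation.Binary.Definitions using (DecidableEquality)
  open import Relation.Binary.PropositionalEquality
  open import Relation.Nullary using (Dec; ¬_)
  open import Relation.Nullary.Decidable using (_×-dec_; _→-dec_; _⊎-dec_; from-yes; map′; ¬?)
  open Flags
  open RootLines using (_⨯_; ρ)

  anyWord? : ∀ {n p} {P : Word n → Set p} → (∀ x → Dec (P x)) → Dec (∃ P)
  anyWord? {zero}  P? = map′ ([] ,_) (λ { ([] , p) → p }) (P? [])
  anyWord? {suc n} P? = map′ [ (λ (x , p) → false ∷ x , p) , (λ (x , p) → true ∷ x , p) ]′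
    (λ { (false ∷ x , p) → inj₁ (x , p) ; (true ∷ x , p) → inj₂ (x , p) })
    (anyWord? (P? ∘ (false ∷_)) ⊎-dec anyWord? (P? ∘ (true ∷_)))

  -- (l , m) is the alternating form on 𝔽₂⁴ with first row l and lower right block m ⨯_; its Pfaffian is l · m.
  Bivector : Set
  Bivector = Word 3 × Word 3

  ∅ : Bivector
  ∅ = 𝟎 , 𝟎

  allBivectors? : ∀ {p} {P : Bivector → Set p} → (∀ x → Dec (P x)) → Dec (∀ x → P x)
  allBivectors? P? = map′ (λ p (l , m) → p l m) (λ p l m → p (l , m))
    (allWords? λ l → allWords? λ m → P? (l , m))

  anyBivector? : ∀ {p} {P : Bivector → Set p} → (∀ x → Dec (P x)) → Dec (∃ P)
  anyBivector? P? = map′ (λ (l , m , p) → (l , m) , p) (λ ((l , m) , p) → l , m , p)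
    (anyWord? λ l → anyWord? λ m → P? (l , m))

  infix 4 _≟ᵇ_
  _≟ᵇ_ : DecidableEquality Bivector
  _≟ᵇ_ = Product.≡-dec _≟ʷ_ _≟ʷ_

  ⊞-same : ∀ (p : Bivector) → p ⊞ p ≡ ∅
  ⊞-same (l , m) = cong₂ _,_ (⊕-same l) (⊕-same m)

  ⊞-cancel : ∀ (p q : Bivector) → p ⊞ (p ⊞ q) ≡ q
  ⊞-cancel (l , m) (l′ , m′) = cong₂ _,_ (⊕-cancel l l′) (⊕-cancel m m′)

  ⊞-comm : ∀ (p q : Bivector) → p ⊞ q ≡ q ⊞ p
  ⊞-comm (l , m) (l′ , m′) = cong₂ _,_ (⊕-comm l l′) (⊕-comm m m′)

  ⊞-identityʳ : ∀ (p : Bivector) → p ⊞ ∅ ≡ p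
  ⊞-identityʳ (l , m) = cong₂ _,_ (⊕-identityʳ l) (⊕-identityʳ m)

  ⊞-medial : ∀ (p q r s : Bivector) → (p ⊞ q) ⊞ (r ⊞ s) ≡ (p ⊞ r) ⊞ (q ⊞ s)
  ⊞-medial (a , a′) (b , b′) (c , c′) (d , d′) = cong₂ _,_ (⊕-medial a b c d) (⊕-medial a′ b′ c′ d′)

  ⊞≡∅ : ∀ {p q : Bivector} → p ⊞ q ≡ ∅ → p ≡ q
  ⊞≡∅ eq = cong₂ _,_ (⊕≡𝟎 (cong proj₁ eq)) (⊕≡𝟎 (cong proj₂ eq))

  ⊞-difference : ∀ (p q r : Bivector) → (r ⊞ p) ⊞ (r ⊞ q) ≡ p ⊞ q
  ⊞-difference p q r = trans (⊞-medial r p r q) (trans (cong (_⊞ (p ⊞ q)) (⊞-same r))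
    (trans (⊞-comm ∅ (p ⊞ q)) (⊞-identityʳ (p ⊞ q))))

  Pf : Bivector → Bool
  Pf (l , m) = dot l m

  polar : Bivector → Bivector → Bool
  polar (l , m) (l′ , m′) = dot l m′ xor dot l′ m

  infixr 7 _∧ʷ_
  _∧ʷ_ : ∀ {n} → Bool → Word n → Word n
  b ∧ʷ x = if b then x else 𝟎

  contract : Word 4 → Bivector → Word 4
  contract (a ∷ u) (l , m) = dot l u ∷ ((a ∧ʷ l) ⊕ (m ⨯ u))

  wedge : Word 4 → Word 4 → Bivector
  wedge (a ∷ u) (b ∷ v) = u ⨯ v , (a ∧ʷ v) ⊕ (b ∧ʷ u)

  opaque
    ⨯-⊕ˡ : ∀ m m′ u → (m ⊕ m′) ⨯ u ≡ (m ⨯ u) ⊕ (m′ ⨯ u)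
    ⨯-⊕ˡ = from-yes (allWords? λ m → allWords? λ m′ → allWords? λ u → ((m ⊕ m′) ⨯ u) ≟ʷ ((m ⨯ u) ⊕ (m′ ⨯ u)))

    triple-product : ∀ m u v → dot (m ⨯ u) v ≡ dot (m ⨯ v) u
    triple-product = from-yes (allWords? λ m → allWords? λ u → allWords? λ v → dot (m ⨯ u) v Bool.≟ dot (m ⨯ v) u)

  contract-⊞ : ∀ u p q → contract u (p ⊞ q) ≡ contract u p ⊕ contract u q
  contract-⊞ (a ∷ u) (l , m) (l′ , m′) = cong₂ _∷_ (dot-⊕ˡ l l′ u) (trans
    (cong₂ _⊕_ (distrib a) (⨯-⊕ˡ m m′ u))
    (⊕-medial (a ∧ʷ l) (a ∧ʷ l′) (m ⨯ u) (m′ ⨯ u)))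
    where
    distrib : ∀ a → a ∧ʷ (l ⊕ l′) ≡ (a ∧ʷ l) ⊕ (a ∧ʷ l′)
    distrib true  = refl
    distrib false = refl

  contract-sym : ∀ u v p → dot (contract u p) v ≡ dot (contract v p) u
  contract-sym (a ∷ u) (b ∷ v) (l , m) = begin
    (dot l u ∧ b) xor dot ((a ∧ʷ l) ⊕ (m ⨯ u)) v
      ≡⟨ cong₂ _xor_ (Bool.∧-comm (dot l u) b) (trans (dot-⊕ˡ (a ∧ʷ l) (m ⨯ u) v) (cong₂ _xor_ (scaled a v) (triple-product m u v))) ⟩
    (b ∧ dot l u) xor ((a ∧ dot l v) xor dot (m ⨯ v) u)
      ≡⟨ Bool.xor-assoc (b ∧ dot l u) (a ∧ dot l v) (dot (m ⨯ v) u) ⟨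
    ((b ∧ dot l u) xor (a ∧ dot l v)) xor dot (m ⨯ v) u
      ≡⟨ cong (_xor dot (m ⨯ v) u) (Bool.xor-comm (b ∧ dot l u) (a ∧ dot l v)) ⟩
    ((a ∧ dot l v) xor (b ∧ dot l u)) xor dot (m ⨯ v) u
      ≡⟨ Bool.xor-assoc (a ∧ dot l v) (b ∧ dot l u) (dot (m ⨯ v) u) ⟩
    (a ∧ dot l v) xor ((b ∧ dot l u) xor dot (m ⨯ v) u)
      ≡⟨ cong₂ _xor_ (Bool.∧-comm (dot l v) a) (trans (dot-⊕ˡ (b ∧ʷ l) (m ⨯ v) u) (cong (_xor dot (m ⨯ v) u) (scaled b u))) ⟨
    (dot l v ∧ a) xor dot ((b ∧ʷ l) ⊕ (m ⨯ v)) u ∎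
    where
    open ≡-Reasoning
    scaled : ∀ a v → dot (a ∧ʷ l) v ≡ a ∧ dot l v
    scaled true  v = refl
    scaled false v = dot-𝟎ˡ v

  -- A complement of the line of u, as u runs over the nonzero words.
  omit : ∀ {n} → Word (suc n) → Word n → Word (suc n)
  omit         (true ∷ u)  x       = false ∷ x
  omit {suc n} (false ∷ u) (a ∷ x) = a ∷ omit u x
  omit {zero}  (false ∷ u) x       = false ∷ x

  kernel : Word 4 → Fin 8 → Bivector
  kernel u z = wedge u (omit u (bits z))

  opaque
    contract-alternating : ∀ u p → dot (contract u p) u ≡ false
    contract-alternating = from-yes (allWords? λ u → allBivectors? λ p → dot (contract u p) u Bool.≟ false)

    kernel-singular : ∀ u p → u ≢ 𝟎 → contract u p ≡ 𝟎 → Pf p ≡ false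
    kernel-singular = from-yes (allWords? λ u → allBivectors? λ p → ¬? (u ≟ʷ 𝟎) →-dec ((contract u p ≟ʷ 𝟎) →-dec (Pf p Bool.≟ false)))

    kernel-sound : ∀ u z → u ≢ 𝟎 → contract u (kernel u z) ≡ 𝟎
    kernel-sound = from-yes (allWords? λ u → Fin.all? λ z → ¬? (u ≟ʷ 𝟎) →-dec (contract u (kernel u z) ≟ʷ 𝟎))

    kernel-injective : ∀ u y z → u ≢ 𝟎 → kernel u y ≡ kernel u z → y ≡ z
    kernel-injective = from-yes (allWords? λ u → Fin.all? λ y → Fin.all? λ z →
      ¬? (u ≟ʷ 𝟎) →-dec ((kernel u y ≟ᵇ kernel u z) →-dec (y Fin.≟ z)))

    kernel-exhaustive : ∀ u p → u ≢ 𝟎 → contract u p ≡ 𝟎 → ∃[ z ] p ≡ kernel u z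
    kernel-exhaustive = from-yes (allWords? λ u → allBivectors? λ p → ¬? (u ≟ʷ 𝟎) →-dec
      ((contract u p ≟ʷ 𝟎) →-dec Fin.any? λ z → p ≟ᵇ kernel u z))

    kernels-meet : ∀ u v p → u ≢ 𝟎 → v ≢ 𝟎 → u ≢ v → contract u p ≡ 𝟎 → contract v p ≡ 𝟎 → p ≡ ∅ ⊎ p ≡ wedge u v
    kernels-meet = from-yes (allWords? λ u → allWords? λ v → allBivectors? λ p →
      ¬? (u ≟ʷ 𝟎) →-dec (¬? (v ≟ʷ 𝟎) →-dec (¬? (u ≟ʷ v) →-dec ((contract u p ≟ʷ 𝟎) →-dec
      ((contract v p ≟ʷ 𝟎) →-dec ((p ≟ᵇ ∅) ⊎-dec (p ≟ᵇ wedge u v)))))))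

    wedge-meets : ∀ u v → u ≢ 𝟎 → v ≢ 𝟎 → u ≢ v →
      wedge u v ≢ ∅ × contract u (wedge u v) ≡ 𝟎 × contract v (wedge u v) ≡ 𝟎
    wedge-meets = from-yes (allWords? λ u → allWords? λ v → ¬? (u ≟ʷ 𝟎) →-dec (¬? (v ≟ʷ 𝟎) →-dec (¬? (u ≟ʷ v) →-dec
      (¬? (wedge u v ≟ᵇ ∅) ×-dec ((contract u (wedge u v) ≟ʷ 𝟎) ×-dec (contract v (wedge u v) ≟ʷ 𝟎))))))

    kernels-differ : ∀ u v → u ≢ 𝟎 → v ≢ 𝟎 → u ≢ v → ∃[ p ] (contract u p ≡ 𝟎 × contract v p ≢ 𝟎)
    kernels-differ = from-yes (allWords? λ u → allWords? λ v → ¬? (u ≟ʷ 𝟎) →-dec (¬? (v ≟ʷ 𝟎) →-dec (¬? (u ≟ʷ v) →-dec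
      (anyBivector? λ p → (contract u p ≟ʷ 𝟎) ×-dec ¬? (contract v p ≟ʷ 𝟎)))))

    contract-surjective : ∀ u h → u ≢ 𝟎 → dot h u ≡ false → ∃[ p ] contract u p ≡ h
    contract-surjective = from-yes (allWords? λ u → allWords? λ h → ¬? (u ≟ʷ 𝟎) →-dec ((dot h u Bool.≟ false) →-dec
      anyBivector? λ p → contract u p ≟ʷ h))

    kernel-surjective : ∀ u v h → u ≢ 𝟎 → v ≢ 𝟎 → u ≢ v → dot h u ≡ false → dot h v ≡ false →
      ∃[ p ] (contract u p ≡ 𝟎 × contract v p ≡ h)
    kernel-surjective = from-yes (allWords? λ u → allWords? λ v → allWords? λ h →
      ¬? (u ≟ʷ 𝟎) →-dec (¬? (v ≟ʷ 𝟎) →-dec (¬? (u ≟ʷ v) →-dec ((dot h u Bool.≟ false) →-dec ((dot h v Bool.≟ false) →-dec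
      anyBivector? λ p → (contract u p ≟ʷ 𝟎) ×-dec (contract v p ≟ʷ h))))))

  opaque
    encode : Bivector → Word 8
    encode (l , m) = Vec.map (λ y → dot l y xor dot (ρ y) m) (words 3)

  private
    O I : Bool
    O = false
    I = true

    parities : ∀ {n k} → Vec (Word n) k → Word n → Word k
    parities gs x = Vec.map (λ g → dot g x) gs

    parities-⊕ : ∀ {n k} (gs : Vec (Word n) k) x y → parities gs (x ⊕ y) ≡ parities gs x ⊕ parities gs y
    parities-⊕ []       x y = refl
    parities-⊕ (g ∷ gs) x y = cong₂ _∷_ (dot-⊕ʳ g x y) (parities-⊕ gs x y)

    checksˡ checksᵐ : Vec (Word 8) 3
    checksˡ = (O ∷ O ∷ O ∷ I ∷ I ∷ I ∷ I ∷ O ∷ [])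
            ∷ (I ∷ I ∷ O ∷ O ∷ O ∷ I ∷ I ∷ O ∷ [])
            ∷ (O ∷ I ∷ I ∷ O ∷ I ∷ O ∷ I ∷ O ∷ []) ∷ []
    checksᵐ = (I ∷ I ∷ I ∷ I ∷ O ∷ O ∷ O ∷ O ∷ [])
            ∷ (I ∷ I ∷ O ∷ O ∷ I ∷ I ∷ O ∷ O ∷ [])
            ∷ (I ∷ O ∷ I ∷ O ∷ I ∷ O ∷ I ∷ O ∷ []) ∷ []

  opaque
    decode : Word 8 → Bivector
    decode x = parities checksˡ x , parities checksᵐ x

    decode-⊕ : ∀ x y → decode (x ⊕ y) ≡ decode x ⊞ decode y
    decode-⊕ x y = cong₂ _,_ (parities-⊕ checksˡ x y) (parities-⊕ checksᵐ x y)

  even? : ∀ {n} (x : Word n) → Dec (EvenWeight x)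
  even? x = Vec.foldr′ _xor_ false x Bool.≟ false

  opaque
    unfolding encode decode

    decode-encode : ∀ p → decode (encode p) ≡ p
    decode-encode = from-yes (allBivectors? λ p → decode (encode p) ≟ᵇ p)

    encode-even : ∀ p → EvenWeight (encode p)
    encode-even = from-yes (allBivectors? λ p → even? (encode p))

    encode-decode : ∀ x → EvenWeight x → x ≋ encode (decode x)
    encode-decode = from-yes (allWords? λ x → even? x →-dec ((encode (decode x) ≟ʷ x) ⊎-dec (encode (decode x) ≟ʷ (𝟏 ⊕ x))))

    decode-𝟏 : decode 𝟏 ≡ ∅
    decode-𝟏 = refl

    singular⇒apart : ∀ x → EvenWeight x → Pf (decode x) ≡ false → ¬ (weight x ≡ 2 ⊎ weight (x ⊕ 𝟏) ≡ 2)
    singular⇒apart = from-yes (allWords? λ x → even? x →-dec ((Pf (decode x) Bool.≟ false) →-dec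
      ¬? ((weight x ℕ.≟ 2) ⊎-dec (weight (x ⊕ 𝟏) ℕ.≟ 2))))

    apart⇒singular : ∀ x → EvenWeight x → ¬ (weight x ≡ 2 ⊎ weight (x ⊕ 𝟏) ≡ 2) → Pf (decode x) ≡ false
    apart⇒singular = from-yes (allWords? λ x → even? x →-dec
      (¬? ((weight x ℕ.≟ 2) ⊎-dec (weight (x ⊕ 𝟏) ℕ.≟ 2)) →-dec (Pf (decode x) Bool.≟ false)))

module Cocliques where

  open import Defs hiding (_·_; matrix; ∣_∣²)
  open import Data.Bool.Base using (Bool; _xor_; false; if_then_else_; true)
  import Data.Bool.Properties as Bool
  open import Data.Fin.Base as Fin using (Fin; suc; zero)
  import Data.Fin.Properties as Fin
  open import Data.Nat.Base using (suc; zero)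
  open import Data.Product.Base using (_,_; _×_; proj₁; proj₂; swap; ∃-syntax)
  open import Data.Sum.Base using (_⊎_; inj₁; inj₂)
  open import Data.Vec.Base as Vec using (Vec; []; _∷_)
  import Data.Vec.Properties as Vec
  open import Function.Bundles using (Equivalence; _⇔_; mk⇔)
  open import Relation.Binary.Bundles using (Setoid)
  open import Relation.Binary.PropositionalEquality
  open import Relation.Nullary using (Dec; contradiction; no; yes; ¬_)
  open import Relation.Nullary.Decidable using (_×-dec_; _→-dec_; _⊎-dec_; decidable-stable; from-yes; ¬?)
  open StronglyRegularGraphs
  open Flags
  open Bivectors

  -- The planes {ω | ω u = 0} of the Klein quadric and their images under swap are the two classes of
  -- totally singular subspaces; σ true exchanges them.
  σ : Bool → Bivector → Bivector
  σ b p = if b then swap p else p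

  σ-⊞ : ∀ b p q → σ b (p ⊞ q) ≡ σ b p ⊞ σ b q
  σ-⊞ true  _ _ = refl
  σ-⊞ false _ _ = refl

  σ-involutive : ∀ b p → σ b (σ b p) ≡ p
  σ-involutive true  _ = refl
  σ-involutive false _ = refl

  Pf-σ : ∀ b p → Pf (σ b p) ≡ Pf p
  Pf-σ true  (l , m) = dot-comm m l
  Pf-σ false _       = refl

  coordinates : Bool → Word 8 → Bivector
  coordinates b x = σ b (decode x)

  word : Bool → Bivector → Word 8
  word b p = encode (σ b p)

  label : Bool → Word 4 → Word 8 → Word 4
  label b u x = contract u (coordinates b x)

  coordinates-word : ∀ b p → coordinates b (word b p) ≡ p
  coordinates-word b p = trans (cong (σ b) (decode-encode (σ b p))) (σ-involutive b p)

  coordinates-⊕ : ∀ b x y → coordinates b (x ⊕ y) ≡ coordinates b x ⊞ coordinates b y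
  coordinates-⊕ b x y = trans (cong (σ b) (decode-⊕ x y)) (σ-⊞ b (decode x) (decode y))

  label-⊕ : ∀ b u x y → label b u (x ⊕ y) ≡ label b u x ⊕ label b u y
  label-⊕ b u x y = trans (cong (contract u) (coordinates-⊕ b x y)) (contract-⊞ u (coordinates b x) (coordinates b y))

  ⊕-even : ∀ {n} (x y : Word n) → EvenWeight x → EvenWeight y → EvenWeight (x ⊕ y)
  ⊕-even x y ex ey = trans (parity-⊕ x y) (cong₂ _xor_ ex ey)
    where
    parity-⊕ : ∀ {n} (x y : Word n) → Vec.foldr′ _xor_ false (x ⊕ y) ≡ Vec.foldr′ _xor_ false x xor Vec.foldr′ _xor_ false y
    parity-⊕ []      []      = refl
    parity-⊕ (a ∷ x) (b ∷ y) = trans (cong ((a xor b) xor_) (parity-⊕ x y))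
      (xor-medial a b (Vec.foldr′ _xor_ false x) (Vec.foldr′ _xor_ false y))

  ≋-sym : ∀ {x y : Word 8} → x ≋ y → y ≋ x
  ≋-sym {x} {y} = Setoid.sym (record { isEquivalence = ≋-isEquivalence }) {x} {y}

  ≋-trans : ∀ {x y z : Word 8} → x ≋ y → y ≋ z → x ≋ z
  ≋-trans {x} {y} {z} = Setoid.trans (record { isEquivalence = ≋-isEquivalence }) {x} {y} {z}

  coordinates-resp : ∀ b {x y} → x ≋ y → coordinates b x ≡ coordinates b y
  coordinates-resp b         (inj₁ refl) = refl
  coordinates-resp b {x} (inj₂ refl) = sym (cong (σ b) (trans (decode-⊕ 𝟏 x)
    (trans (cong (_⊞ decode x) decode-𝟏) (trans (⊞-comm ∅ (decode x)) (⊞-identityʳ (decode x))))))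

  coordinates-injective : ∀ b x y → EvenWeight x → EvenWeight y → coordinates b x ≡ coordinates b y → x ≋ y
  coordinates-injective b x y ex ey eq = ≋-trans {x} {encode (decode x)} {y} (encode-decode x ex)
    (subst (λ p → encode p ≋ y) (sym decode≡) (≋-sym {y} {encode (decode y)} (encode-decode y ey)))
    where
    decode≡ : decode x ≡ decode y
    decode≡ = trans (sym (σ-involutive b (decode x))) (trans (cong (σ b) eq) (σ-involutive b (decode y)))

  Cube : Set
  Cube = Graph.Vertex foldedHalved8Cube

  cube : Setoid _ _
  cube = Graph.vertices foldedHalved8Cube

  vertexAt : Bool → Bivector → Cube
  vertexAt b p = word b p , encode-even (σ b p)

  coset : ∀ b u h → IsFlag false (u , h) → Enumeration cube (λ (x , _) → label b u x ≡ h) 8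
  coset b u h (u≢𝟎 , h·u) = record
    { element    = λ z → vertexAt b (at z)
    ; sound      = λ z → trans (cong (contract u) (coordinates-word b (at z))) (trans (contract-⊞ u p (kernel u z))
        (trans (cong₂ _⊕_ p-label (kernel-sound u z u≢𝟎)) (⊕-identityʳ h)))
    ; injective  = λ y z y≋z → kernel-injective u y z u≢𝟎 (trans (sym (⊞-cancel p (kernel u y)))
        (trans (cong (p ⊞_) (trans (sym (coordinates-word b (at y))) (trans (coordinates-resp b y≋z) (coordinates-word b (at z)))))
          (⊞-cancel p (kernel u z))))
    ; exhaustive = λ (x , ex) lx →
        let z , eq = kernel-exhaustive u (p ⊞ coordinates b x) u≢𝟎 (trans (contract-⊞ u p (coordinates b x))
              (trans (cong₂ _⊕_ p-label lx) (⊕-same h)))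
        in z , coordinates-injective b x (word b (at z)) ex (encode-even (σ b (at z)))
             (sym (trans (coordinates-word b (at z)) (trans (cong (p ⊞_) (sym eq)) (⊞-cancel p (coordinates b x)))))
    }
    where
    p       = proj₁ (contract-surjective u h u≢𝟎 h·u)
    p-label = proj₂ (contract-surjective u h u≢𝟎 h·u)
    at : Fin 8 → Bivector
    at z = p ⊞ kernel u z

  record Describes (b : Bool) (S : Coclique) (p : Flag) : Set where
    constructor describes
    field
      isFlag : IsFlag false p
      member : ∀ (v : Cube) → v ∈ S ⇔ label b (proj₁ p) (proj₁ v) ≡ proj₂ p

    contains : ∀ {v : Cube} → label b (proj₁ p) (proj₁ v) ≡ proj₂ p → v ∈ S
    contains {v} = Equivalence.from (member v)

    labelled : ∀ {v : Cube} → v ∈ S → label b (proj₁ p) (proj₁ v) ≡ proj₂ p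
    labelled {v} = Equivalence.to (member v)

  same-label : ∀ b u h (S : Coclique) → u ≢ 𝟎 →
    (∀ i → label b u (proj₁ (IndependentSet.point S i)) ≡ h) → Describes b S (u , h)
  same-label b u h S u≢𝟎 all-h = describes h-flag λ v → mk⇔
    (λ (i , v≋) → trans (cong (contract u) (coordinates-resp b v≋)) (all-h i))
    (λ lv → saturated (coset b u h h-flag) (λ x y x≋y lx → trans (cong (contract u) (sym (coordinates-resp b x≋y))) lx)
      (IndependentSet.point S) all-h (IndependentSet.injective S) v lv)
    where
    h-flag : IsFlag false (u , h)
    h-flag = u≢𝟎 , subst (λ t → dot t u ≡ false) (all-h zero)
      (contract-alternating u (coordinates b (proj₁ (IndependentSet.point S zero))))

  cosetCoclique : ∀ b p → IsFlag false p → Coclique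
  cosetCoclique b (u , h) p-flag = record
    { point       = element
    ; injective   = injective
    ; independent = λ i j → singular⇒apart′ (element i) (element j) (sound i) (sound j)
    }
    where
    open Enumeration (coset b u h p-flag)
    singular⇒apart′ : ∀ (v w : Cube) → label b u (proj₁ v) ≡ h → label b u (proj₁ w) ≡ h → ¬ (Graph._~_ foldedHalved8Cube v w)
    singular⇒apart′ (x , ex) (y , ey) lx ly = singular⇒apart (x ⊕ y) (⊕-even x y ex ey)
      (trans (sym (Pf-σ b (decode (x ⊕ y)))) (kernel-singular u (coordinates b (x ⊕ y)) (proj₁ p-flag)
        (trans (label-⊕ b u x y) (trans (cong₂ _⊕_ lx ly) (⊕-same h)))))

  cosetCoclique-describes : ∀ b p (p-flag : IsFlag false p) → Describes b (cosetCoclique b p p-flag) p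
  cosetCoclique-describes b (u , h) p-flag = same-label b u h (cosetCoclique b (u , h) p-flag) (proj₁ p-flag)
    (Enumeration.sound (coset b u h p-flag))

  opaque
    -- Two points of the Klein quadric on a common line lie in one plane u and one plane v of each class,
    -- and every point joined to both lies in one of them.
    pencil : ∀ x y → x ≢ ∅ → y ≢ ∅ → x ≢ y → Pf x ≡ false → Pf y ≡ false → Pf (x ⊞ y) ≡ false →
      ∃[ u ] (u ≢ 𝟎 × contract u x ≡ 𝟎 × contract u y ≡ 𝟎 ×
      ∃[ v ] (v ≢ 𝟎 × contract v (swap x) ≡ 𝟎 × contract v (swap y) ≡ 𝟎 × dot u v ≡ false ×
      ∀ z → Pf z ≡ false → Pf (z ⊞ x) ≡ false → Pf (z ⊞ y) ≡ false → contract u z ≡ 𝟎 ⊎ contract v (swap z) ≡ 𝟎))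
    pencil = from-yes (allBivectors? λ x → allBivectors? λ y → ¬? (x ≟ᵇ ∅) →-dec (¬? (y ≟ᵇ ∅) →-dec (¬? (x ≟ᵇ y) →-dec
      ((Pf x Bool.≟ false) →-dec ((Pf y Bool.≟ false) →-dec ((Pf (x ⊞ y) Bool.≟ false) →-dec
      (anyWord? λ u → ¬? (u ≟ʷ 𝟎) ×-dec ((contract u x ≟ʷ 𝟎) ×-dec ((contract u y ≟ʷ 𝟎) ×-dec
      (anyWord? λ v → ¬? (v ≟ʷ 𝟎) ×-dec ((contract v (swap x) ≟ʷ 𝟎) ×-dec ((contract v (swap y) ≟ʷ 𝟎) ×-dec ((dot u v Bool.≟ false) ×-dec
      (allBivectors? λ z → (Pf z Bool.≟ false) →-dec ((Pf (z ⊞ x) Bool.≟ false) →-dec ((Pf (z ⊞ y) Bool.≟ false) →-dec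
        ((contract u z ≟ʷ 𝟎) ⊎-dec (contract v (swap z) ≟ʷ 𝟎))))))))))))))))))

    opposite : ∀ u v → u ≢ 𝟎 → v ≢ 𝟎 → dot u v ≡ false → ∀ z → contract u z ≡ 𝟎 → contract v (swap z) ≢ 𝟎 →
      ∀ w → contract v (swap w) ≡ 𝟎 → contract u w ≢ 𝟎 → Pf (z ⊞ w) ≡ true
    opposite = from-yes (allWords? λ u → allWords? λ v → ¬? (u ≟ʷ 𝟎) →-dec (¬? (v ≟ʷ 𝟎) →-dec ((dot u v Bool.≟ false) →-dec
      (allBivectors? λ z → (contract u z ≟ʷ 𝟎) →-dec (¬? (contract v (swap z) ≟ʷ 𝟎) →-dec
      (allBivectors? λ w → (contract v (swap w) ≟ʷ 𝟎) →-dec (¬? (contract u w ≟ʷ 𝟎) →-dec (Pf (z ⊞ w) Bool.≟ true))))))))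

  module _ (q : Fin 8 → Bivector) (q-injective : ∀ k l → q k ≡ q l → k ≡ l) (q-zero : q zero ≡ ∅)
    (differences : ∀ k l → Pf (q k ⊞ q l) ≡ false) where

    private
      one two : Fin 8
      one = suc zero
      two = suc (suc zero)

      q≢∅ : ∀ k → k ≢ zero → q k ≢ ∅
      q≢∅ k k≢0 eq = k≢0 (q-injective k zero (trans eq (sym q-zero)))

      singular : ∀ k → Pf (q k) ≡ false
      singular k = trans (cong Pf (sym (trans (cong (q k ⊞_) q-zero) (⊞-identityʳ (q k))))) (differences k zero)

    plane : ∃[ b ] ∃[ w ] (w ≢ 𝟎 × ∀ k → contract w (σ b (q k)) ≡ 𝟎)
    plane =
      let u , u≢𝟎 , _ , _ , v , v≢𝟎 , _ , _ , u⊥v , cover = pencil (q one) (q two) (q≢∅ one λ ()) (q≢∅ two λ ())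
            (λ eq → contradiction (q-injective one two eq) λ ()) (singular one) (singular two) (differences one two)
      in choose u v u≢𝟎 v≢𝟎 u⊥v (λ k → cover (q k) (singular k) (differences k one) (differences k two))
           (Fin.any? λ j → ¬? (contract v (swap (q j)) ≟ʷ 𝟎))
      where
      choose : ∀ u v → u ≢ 𝟎 → v ≢ 𝟎 → dot u v ≡ false →
        (∀ k → contract u (q k) ≡ 𝟎 ⊎ contract v (swap (q k)) ≡ 𝟎) → Dec (∃[ j ] contract v (swap (q j)) ≢ 𝟎) →
        ∃[ b ] ∃[ w ] (w ≢ 𝟎 × ∀ k → contract w (σ b (q k)) ≡ 𝟎)
      choose u v u≢𝟎 v≢𝟎 u⊥v cover (no none) = true , v , v≢𝟎 , λ k →
        decidable-stable (contract v (swap (q k)) ≟ʷ 𝟎) λ ≢𝟎 → none (k , ≢𝟎)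
      choose u v u≢𝟎 v≢𝟎 u⊥v cover (yes (j , j∉v)) = false , u , u≢𝟎 , λ k → inside k (cover k)
        where
        outside : ∀ k → contract u (q k) ≡ 𝟎 ⊎ contract v (swap (q k)) ≡ 𝟎 → contract v (swap (q k)) ≢ 𝟎 → contract u (q k) ≡ 𝟎
        outside k (inj₁ k∈u) _   = k∈u
        outside k (inj₂ k∈v) k∉v = contradiction k∈v k∉v
        inside : ∀ k → contract u (q k) ≡ 𝟎 ⊎ contract v (swap (q k)) ≡ 𝟎 → contract u (q k) ≡ 𝟎
        inside k (inj₁ k∈u) = k∈u
        inside k (inj₂ k∈v) = decidable-stable (contract u (q k) ≟ʷ 𝟎) λ k∉u → contradiction
          (trans (sym (opposite u v u≢𝟎 v≢𝟎 u⊥v (q j) (outside j (cover j) j∉v) j∉v (q k) k∈v k∉u)) (differences j k)) λ ()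

  classify : ∀ S → ∃[ b ] ∃[ p ] Describes b S p
  classify S =
    let b , w , w≢𝟎 , kernel-q = plane q q-injective (⊞-same (p zero)) q-differences
    in b , (w , label b w (s zero)) , same-label b w (label b w (s zero)) S w≢𝟎 λ k → sym (⊕≡𝟎
         (trans (sym (trans (cong (contract w) (σ-⊞ b (p zero) (p k))) (contract-⊞ w (σ b (p zero)) (σ b (p k))))) (kernel-q k)))
    where
    open IndependentSet S
    s : Fin 8 → Word 8
    s k = proj₁ (point k)
    s-even : ∀ k → EvenWeight (s k)
    s-even k = proj₂ (point k)
    p q : Fin 8 → Bivector
    p k = decode (s k)
    q k = p zero ⊞ p k

    q-differences : ∀ k l → Pf (q k ⊞ q l) ≡ false
    q-differences k l = trans (cong Pf (trans (⊞-difference (p k) (p l) (p zero)) (sym (decode-⊕ (s k) (s l)))))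
      (apart⇒singular (s k ⊕ s l) (⊕-even (s k) (s l) (s-even k) (s-even l)) (independent k l))

    q-injective : ∀ k l → q k ≡ q l → k ≡ l
    q-injective k l eq = injective k l (coordinates-injective false (s k) (s l) (s-even k) (s-even l)
      (trans (sym (⊞-cancel (p zero) (p k))) (trans (cong (p zero ⊞_) eq) (⊞-cancel (p zero) (p l)))))

  meet-in-two : ∀ b {S T} {u h v k} → Describes b S (u , h) → Describes b T (v , k) → u ≢ v → dot h v ≡ dot k u →
    Enumeration cube (λ x → x ∈ S × x ∈ T) 2
  meet-in-two b {S} {T} {u} {h} {v} {k} dS dT u≢v h·v≡k·u = record
    { element    = element
    ; sound      = λ i → S.contains {element i} (proj₁ (labels i)) , T.contains {element i} (proj₂ (labels i))
    ; injective  = distinct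
    ; exhaustive = λ (x , ex) (x∈S , x∈T) → locate x ex
        (difference u h x (S.labelled {x , ex} x∈S) (proj₁ p-labels)) (difference v k x (T.labelled {x , ex} x∈T) (proj₂ p-labels))
    }
    where
    module S = Describes dS
    module T = Describes dT
    u≢𝟎 = proj₁ S.isFlag
    v≢𝟎 = proj₁ T.isFlag
    p₁ = contract-surjective u h u≢𝟎 (proj₂ S.isFlag)
    d  = k ⊕ contract v (proj₁ p₁)
    d·u : dot d u ≡ false
    d·u = trans (dot-⊕ˡ k (contract v (proj₁ p₁)) u) (trans
      (cong (dot k u xor_) (trans (contract-sym v u (proj₁ p₁)) (trans (cong (λ t → dot t v) (proj₂ p₁)) h·v≡k·u)))
      (Bool.xor-same (dot k u)))
    d·v : dot d v ≡ false
    d·v = trans (dot-⊕ˡ k (contract v (proj₁ p₁)) v) (cong₂ _xor_ (proj₂ T.isFlag) (contract-alternating v (proj₁ p₁)))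
    p₂ = kernel-surjective u v d u≢𝟎 v≢𝟎 u≢v d·u d·v
    p = proj₁ p₁ ⊞ proj₁ p₂
    p-labels : contract u p ≡ h × contract v p ≡ k
    p-labels = trans (contract-⊞ u (proj₁ p₁) (proj₁ p₂)) (trans (cong₂ _⊕_ (proj₂ p₁) (proj₁ (proj₂ p₂))) (⊕-identityʳ h))
             , trans (contract-⊞ v (proj₁ p₁) (proj₁ p₂)) (trans (cong (contract v (proj₁ p₁) ⊕_) (trans (proj₂ (proj₂ p₂)) (⊕-comm k (contract v (proj₁ p₁)))))
                 (⊕-cancel (contract v (proj₁ p₁)) k))
    w = wedge u v
    w-meets = wedge-meets u v u≢𝟎 v≢𝟎 u≢v
    at : Fin 2 → Bivector
    at zero    = p
    at (suc _) = p ⊞ w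
    element : Fin 2 → Cube
    element i = vertexAt b (at i)
    at-labels : ∀ i → contract u (at i) ≡ h × contract v (at i) ≡ k
    at-labels zero    = p-labels
    at-labels (suc _) = trans (contract-⊞ u p w) (trans (cong₂ _⊕_ (proj₁ p-labels) (proj₁ (proj₂ w-meets))) (⊕-identityʳ h))
                      , trans (contract-⊞ v p w) (trans (cong₂ _⊕_ (proj₂ p-labels) (proj₂ (proj₂ w-meets))) (⊕-identityʳ k))
    labels : ∀ i → label b u (word b (at i)) ≡ h × label b v (word b (at i)) ≡ k
    labels i = trans (cong (contract u) (coordinates-word b (at i))) (proj₁ (at-labels i))
             , trans (cong (contract v) (coordinates-word b (at i))) (proj₂ (at-labels i))
    p≢p⊞w : p ≢ p ⊞ w
    p≢p⊞w eq = proj₁ w-meets (trans (sym (⊞-cancel p w)) (trans (cong (p ⊞_) (sym eq)) (⊞-same p)))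
    at-resp : ∀ i j → word b (at i) ≋ word b (at j) → at i ≡ at j
    at-resp i j eq = trans (sym (coordinates-word b (at i))) (trans (coordinates-resp b eq) (coordinates-word b (at j)))
    distinct : ∀ i j → word b (at i) ≋ word b (at j) → i ≡ j
    distinct zero       zero       _  = refl
    distinct zero       (suc zero) eq = contradiction (at-resp zero (suc zero) eq) p≢p⊞w
    distinct (suc zero) zero       eq = contradiction (sym (at-resp (suc zero) zero eq)) p≢p⊞w
    distinct (suc zero) (suc zero) _  = refl
    difference : ∀ u h x → label b u x ≡ h → contract u p ≡ h → contract u (p ⊞ coordinates b x) ≡ 𝟎
    difference u h x lx lp = trans (contract-⊞ u p (coordinates b x)) (trans (cong₂ _⊕_ lp lx) (⊕-same h))
    locate : ∀ x → EvenWeight x → contract u (p ⊞ coordinates b x) ≡ 𝟎 → contract v (p ⊞ coordinates b x) ≡ 𝟎 →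
      ∃[ i ] x ≋ word b (at i)
    locate x ex inU inV with kernels-meet u v (p ⊞ coordinates b x) u≢𝟎 v≢𝟎 u≢v inU inV
    ... | inj₁ eq = zero , coordinates-injective b x (word b p) ex (encode-even (σ b p))
      (trans (sym (⊞≡∅ eq)) (sym (coordinates-word b p)))
    ... | inj₂ eq = suc zero , coordinates-injective b x (word b (p ⊞ w)) ex (encode-even (σ b (p ⊞ w)))
      (trans (sym (⊞-cancel p (coordinates b x))) (trans (cong (p ⊞_) eq) (sym (coordinates-word b (p ⊞ w)))))

  common-point : ∀ b {S T} {u h v k} → Describes b S (u , h) → Describes b T (v , k) →
    ∀ (x : Cube) → x ∈ S → x ∈ T → dot h v ≡ dot k u
  common-point b {u = u} {h} {v} {k} dS dT x x∈S x∈T = trans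
    (cong (λ t → dot t v) (sym (Describes.labelled dS {x} x∈S)))
    (trans (contract-sym u v (coordinates b (proj₁ x))) (cong (λ t → dot t u) (Describes.labelled dT {x} x∈T)))

  Describes-unique : ∀ b {S T p q} → Describes b S p → Describes b T q → S ≐ T → p ≡ q
  Describes-unique b {S} {T} {u , h} {v , k} dS dT S≐T = step (u ≟ʷ v)
    where
    module S = Describes dS
    module T = Describes dT
    both : ∀ (x : Cube) → x ∈ S → label b u (proj₁ x) ≡ h × label b v (proj₁ x) ≡ k
    both x x∈S = S.labelled {x} x∈S , T.labelled {x} (Equivalence.to (S≐T x) x∈S)
    s : Cube
    s = IndependentSet.point S zero
    s∈S : s ∈ S
    s∈S = zero , inj₁ refl
    step : Dec (u ≡ v) → (u , h) ≡ (v , k)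
    step (yes refl) = cong (u ,_) (trans (sym (proj₁ (both s s∈S))) (proj₂ (both s s∈S)))
    step (no u≢v) = contradiction contract-v p∉v
      where
      differ = kernels-differ u v (proj₁ S.isFlag) (proj₁ T.isFlag) u≢v
      p   = proj₁ differ
      p∉v = proj₂ (proj₂ differ)
      t : Cube
      t = proj₁ s ⊕ word b p , ⊕-even (proj₁ s) (word b p) (proj₂ s) (encode-even (σ b p))
      t-label : ∀ w → label b w (proj₁ t) ≡ label b w (proj₁ s) ⊕ contract w p
      t-label w = trans (label-⊕ b w (proj₁ s) (word b p)) (cong (λ q → label b w (proj₁ s) ⊕ contract w q) (coordinates-word b p))
      t∈S : t ∈ S
      t∈S = S.contains {t} (trans (t-label u) (trans (cong₂ _⊕_ (proj₁ (both s s∈S)) (proj₁ (proj₂ differ))) (⊕-identityʳ h)))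
      contract-v : contract v p ≡ 𝟎
      contract-v = trans (sym (⊕-cancel k (contract v p))) (trans (cong (k ⊕_)
        (trans (cong (_⊕ contract v p) (sym (proj₂ (both s s∈S)))) (trans (sym (t-label v)) (proj₂ (both t t∈S))))) (⊕-same k))

module Orbits where

  open import Defs hiding (_·_; matrix; ∣_∣²)
  open import Data.Bool.Base using (Bool; _xor_; false; if_then_else_; not; true)
  import Data.Bool.Properties as Bool
  open import Data.Fin.Base as Fin using (Fin; suc; zero)
  open import Data.Fin.Permutation as Perm using (Permutation′; _∘ₚ_; _⟨$⟩ʳ_; _⟨$⟩ˡ_; flip; transpose)
  import Data.Fin.Permutation.Transposition.List as Transpositions
  import Data.Fin.Properties as Fin
  open import Data.List.Base as List using (List; []; _∷_)
  open import Data.List.Relation.Unary.All as All using (All; []; _∷_)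
  open import Data.Nat.Base as ℕ using (suc; zero; ℕ)
  open import Data.Nat.Divisibility using (_∣_; divides)
  open import Data.Product.Base using (_,_; _×_; proj₁; proj₂; swap; ∃-syntax)
  open import Data.Sum.Base using (inj₁; inj₂)
  open import Data.Vec.Base as Vec using (Vec; []; _[_]≔_; _∷_; lookup)
  import Data.Vec.Properties as Vec
  open import Function.Base using (_∘_; id)
  open import Function.Bundles using (Equivalence; _⇔_; mk⇔)
  open import Relation.Binary.Construct.Closure.ReflexiveTransitive using (_◅_; ε)
  open import Relation.Binary.PropositionalEquality
  open import Relation.Nullary.Decidable using (_×-dec_; _→-dec_; from-yes; ¬?)
  open StronglyRegularGraphs
  open Flags
  open Bivectors
  open Cocliques

  permute-cong : ∀ {n} {π π′ : Permutation′ n} → π Perm.≈ π′ → ∀ x → permute π x ≡ permute π′ x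
  permute-cong π≈π′ x = Vec.tabulate-cong λ i → cong (lookup x) (π≈π′ i)

  permute-∘ : ∀ {n} (π π′ : Permutation′ n) x → permute (π ∘ₚ π′) x ≡ permute π (permute π′ x)
  permute-∘ π π′ x = Vec.tabulate-cong λ i → sym (Vec.lookup∘tabulate (λ j → lookup x (π′ ⟨$⟩ʳ j)) (π ⟨$⟩ʳ i))

  permute-id : ∀ {n} (x : Word n) → permute Perm.id x ≡ x
  permute-id x = Vec.tabulate∘lookup x

  permute-flip : ∀ {n} (π : Permutation′ n) x → permute π (permute (flip π) x) ≡ x
  permute-flip π x = trans (Vec.tabulate-cong λ i → trans (Vec.lookup∘tabulate (λ j → lookup x (π ⟨$⟩ˡ j)) (π ⟨$⟩ʳ i))
    (cong (lookup x) (Perm.inverseˡ π))) (Vec.tabulate∘lookup x)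

  -- A transposition of coordinates acts on even words modulo 𝟏 as the reflection in the bivector
  -- of the word of weight 2 supported on the two coordinates.

  dyad : Fin 8 → Fin 8 → Word 8
  dyad i j = (𝟎 [ i ]≔ true) ⊕ (𝟎 [ j ]≔ true)

  reflect : Bivector → Bivector → Bivector
  reflect r p = if polar p r then p ⊞ r else p

  opaque
    unfolding decode

    dyad-nonsingular : ∀ i j → i ≢ j → Pf (decode (dyad i j)) ≡ true
    dyad-nonsingular = from-yes (Fin.all? λ i → Fin.all? λ j → ¬? (i Fin.≟ j) →-dec (Pf (decode (dyad i j)) Bool.≟ true))

    nonsingular-dyad : ∀ r → Pf r ≡ true → ∃[ i ] ∃[ j ] (i ≢ j × decode (dyad i j) ≡ r)
    nonsingular-dyad = from-yes (allBivectors? λ r → (Pf r Bool.≟ true) →-dec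
      (Fin.any? λ i → Fin.any? λ j → ¬? (i Fin.≟ j) ×-dec (decode (dyad i j) ≟ᵇ r)))

    transpose-reflects : ∀ i j → i ≢ j → ∀ x → EvenWeight x →
      EvenWeight (permute (transpose i j) x) × decode (permute (transpose i j) x) ≡ reflect (decode (dyad i j)) (decode x)
    transpose-reflects = from-yes (Fin.all? λ i → Fin.all? λ j → ¬? (i Fin.≟ j) →-dec (allWords? λ x → even? x →-dec
      (even? (permute (transpose i j) x) ×-dec
      (decode (permute (transpose i j) x) ≟ᵇ reflect (decode (dyad i j)) (decode x)))))

    -- The reflection in r exchanges the two classes of planes.
    reflect-plane : ∀ u → u ≢ 𝟎 → ∀ r → Pf r ≡ true → contract u r ≢ 𝟎 × contract (contract u r) (swap r) ≡ u ×
      ∀ p → contract u p ≡ 𝟎 → contract (contract u r) (swap (reflect r p)) ≡ 𝟎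
    reflect-plane = from-yes (allWords? λ u → ¬? (u ≟ʷ 𝟎) →-dec (allBivectors? λ r → (Pf r Bool.≟ true) →-dec
      (¬? (contract u r ≟ʷ 𝟎) ×-dec ((contract (contract u r) (swap r) ≟ʷ u) ×-dec
      (allBivectors? λ p → (contract u p ≟ʷ 𝟎) →-dec (contract (contract u r) (swap (reflect r p)) ≟ʷ 𝟎))))))

    two-reflections : ∀ u v → u ≢ 𝟎 → v ≢ 𝟎 →
      ∃[ r ] (Pf r ≡ true × dot (contract u r) v ≡ false × ∃[ s ] (Pf s ≡ true × contract (contract u r) s ≡ v))
    two-reflections = from-yes (allWords? λ u → allWords? λ v → ¬? (u ≟ʷ 𝟎) →-dec (¬? (v ≟ʷ 𝟎) →-dec
      (anyBivector? λ r → (Pf r Bool.≟ true) ×-dec ((dot (contract u r) v Bool.≟ false) ×-dec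
      (anyBivector? λ s → (Pf s Bool.≟ true) ×-dec (contract (contract u r) s ≟ʷ v))))))

  reflect-⊞ : ∀ r p q → reflect r (p ⊞ q) ≡ reflect r p ⊞ reflect r q
  reflect-⊞ r p q = trans (cong (λ b → if b then (p ⊞ q) ⊞ r else p ⊞ q) (polar-⊞ p q r)) (cases (polar p r) (polar q r))
    where
    polar-⊞ : ∀ p q r → polar (p ⊞ q) r ≡ polar p r xor polar q r
    polar-⊞ (l , m) (l′ , m′) (l″ , m″) = trans (cong₂ _xor_ (dot-⊕ˡ l l′ m″) (dot-⊕ʳ l″ m m′))
      (xor-medial (dot l m″) (dot l′ m″) (dot l″ m) (dot l″ m′))
    ⊞-assoc : ∀ (p q r : Bivector) → (p ⊞ q) ⊞ r ≡ p ⊞ (q ⊞ r)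
    ⊞-assoc (a , a′) (b , b′) (c , c′) = cong₂ _,_ (⊕-assoc a b c) (⊕-assoc a′ b′ c′)
    cases : ∀ a b → (if a xor b then (p ⊞ q) ⊞ r else p ⊞ q) ≡ (if a then p ⊞ r else p) ⊞ (if b then q ⊞ r else q)
    cases false false = refl
    cases false true  = ⊞-assoc p q r
    cases true  false = trans (⊞-assoc p q r) (trans (cong (p ⊞_) (⊞-comm q r)) (sym (⊞-assoc p r q)))
    cases true  true  = sym (trans (⊞-medial p r q r) (trans (cong ((p ⊞ q) ⊞_) (⊞-same r)) (⊞-identityʳ (p ⊞ q))))

  reflect-σ : ∀ b r p → σ b (reflect r p) ≡ reflect (σ b r) (σ b p)
  reflect-σ false r         p         = refl
  reflect-σ true  r@(l , m) p@(l′ , m′) = trans (choice (polar p r)) (cong (λ b → if b then swap p ⊞ swap r else swap p)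
    (trans (cong₂ _xor_ (dot-comm l′ m) (dot-comm l m′)) (Bool.xor-comm (dot m l′) (dot m′ l))))
    where
    choice : ∀ b → swap (if b then p ⊞ r else p) ≡ (if b then swap p ⊞ swap r else swap p)
    choice true  = refl
    choice false = refl

  record Moves (f : Word 8 → Word 8) (b : Bool) (u : Word 4) (b′ : Bool) (u′ : Word 4) : Set where
    field
      even   : ∀ x → EvenWeight x → EvenWeight (f x)
      cosets : ∀ x y → EvenWeight x → EvenWeight y → label b u x ≡ label b u y → label b′ u′ (f x) ≡ label b′ u′ (f y)
  open Moves

  Moves-resp : ∀ {f g b u b′ u′} → (∀ x → f x ≡ g x) → Moves f b u b′ u′ → Moves g b u b′ u′
  Moves-resp {b′ = b′} {u′} f≗g m .even x ex = subst EvenWeight (f≗g x) (even m x ex)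
  Moves-resp {b′ = b′} {u′} f≗g m .cosets x y ex ey eq =
    subst₂ (λ x y → label b′ u′ x ≡ label b′ u′ y) (f≗g x) (f≗g y) (cosets m x y ex ey eq)

  Moves-∘ : ∀ {f g b u b′ u′ b″ u″} → Moves g b′ u′ b″ u″ → Moves f b u b′ u′ → Moves (g ∘ f) b u b″ u″
  Moves-∘ {f} n m .even   x ex         = even n (f x) (even m x ex)
  Moves-∘ {f} n m .cosets x y ex ey eq = cosets n (f x) (f y) (even m x ex) (even m y ey) (cosets m x y ex ey eq)

  σ-not : ∀ b p → σ (not b) p ≡ swap (σ b p)
  σ-not true  p = refl
  σ-not false p = refl

  mirror : Bool → Fin 8 → Fin 8 → Bivector
  mirror b i j = σ b (decode (dyad i j))

  mirror-nonsingular : ∀ b i j → i ≢ j → Pf (mirror b i j) ≡ true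
  mirror-nonsingular b i j i≢j = trans (Pf-σ b (decode (dyad i j))) (dyad-nonsingular i j i≢j)

  transpose-moves : ∀ b u i j → u ≢ 𝟎 → i ≢ j →
    Moves (permute (transpose i j)) b u (not b) (contract u (mirror b i j))
  transpose-moves b u i j u≢𝟎 i≢j = record
    { even   = λ x ex → proj₁ (transpose-reflects i j i≢j x ex)
    ; cosets = λ x y ex ey eq → trans (shifted x ex) (trans (same (coordinates b x) (coordinates b y) eq) (sym (shifted y ey)))
    }
    where
    r = mirror b i j
    u′ = contract u r
    shifted : ∀ x → EvenWeight x → label (not b) u′ (permute (transpose i j) x) ≡ contract u′ (swap (reflect r (coordinates b x)))
    shifted x ex = cong (contract u′) (trans (σ-not b (decode (permute (transpose i j) x)))
      (cong swap (trans (cong (σ b) (proj₂ (transpose-reflects i j i≢j x ex))) (reflect-σ b (decode (dyad i j)) (decode x)))))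
    same : ∀ p q → contract u p ≡ contract u q → contract u′ (swap (reflect r p)) ≡ contract u′ (swap (reflect r q))
    same p q eq = ⊕≡𝟎 (trans (sym (contract-⊞ u′ (swap (reflect r p)) (swap (reflect r q))))
      (trans (cong (contract u′ ∘ swap) (sym (reflect-⊞ r p q)))
        (proj₂ (proj₂ (reflect-plane u u≢𝟎 r (mirror-nonsingular b i j i≢j))) (p ⊞ q)
          (trans (contract-⊞ u p q) (trans (cong (_⊕ contract u q) eq) (⊕-same (contract u q)))))))

  classAfter : ℕ → Bool → Bool
  classAfter zero    b = b
  classAfter (suc n) b = not (classAfter n b)

  transpositions-move : ∀ (ts : Transpositions.TranspositionList 8) → All (λ (i , j) → i ≢ j) ts → ∀ b u → u ≢ 𝟎 →
    ∃[ u′ ] (u′ ≢ 𝟎 × Moves (permute (Transpositions.eval ts)) b u (classAfter (List.length ts) b) u′)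
  transpositions-move []             []           b u u≢𝟎 = u , u≢𝟎 ,
    Moves-resp (λ x → sym (permute-id x)) (record { even = λ _ → id ; cosets = λ _ _ _ _ → id })
  transpositions-move ((i , j) ∷ ts) (i≢j ∷ ts≢) b u u≢𝟎 =
    let u′ , u′≢𝟎 , m = transpositions-move ts ts≢ b u u≢𝟎
        b′ = classAfter (List.length ts) b
    in contract u′ (mirror b′ i j)
     , proj₁ (reflect-plane u′ u′≢𝟎 (mirror b′ i j) (mirror-nonsingular b′ i j i≢j))
     , Moves-resp (λ x → sym (permute-∘ (transpose i j) (Transpositions.eval ts) x))
         (Moves-∘ (transpose-moves b′ u′ i j u′≢𝟎 i≢j) m)

  classAfter-even : ∀ n b → 2 ∣ n → classAfter n b ≡ b
  classAfter-even n b (divides k refl) = twice k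
    where
    twice : ∀ k → classAfter (k ℕ.* 2) b ≡ b
    twice zero    = refl
    twice (suc k) = trans (Bool.not-involutive (classAfter (k ℕ.* 2) b)) (twice k)

  even-permutation-moves : ∀ π → EvenPermutation π → ∀ b u → u ≢ 𝟎 →
    ∃[ u′ ] (u′ ≢ 𝟎 × Moves (permute π) b u b u′)
  even-permutation-moves π (ts , ts≢ , 2∣ , π≈) b u u≢𝟎 =
    let u′ , u′≢𝟎 , m = transpositions-move ts ts≢ b u u≢𝟎
    in u′ , u′≢𝟎 , subst (λ b′ → Moves (permute π) b u b′ u′) (classAfter-even (List.length ts) b 2∣)
         (Moves-resp (λ x → sym (permute-cong {π = π} {Transpositions.eval ts} π≈ x)) m)

  ∈ʷ⇔ : ∀ {b S u h} → Describes b S (u , h) → ∀ x → x ∈ʷ S ⇔ (EvenWeight x × label b u x ≡ h)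
  ∈ʷ⇔ {b} {S} d x = mk⇔
    (λ x∈S → evenness x∈S , Describes.labelled d {x , evenness x∈S} x∈S)
    (λ (ex , lx) → Describes.contains d {x , ex} lx)
    where
    evenness : x ∈ʷ S → EvenWeight x
    evenness (i , inj₁ eq) = subst EvenWeight eq (proj₂ (IndependentSet.point S i))
    evenness (i , inj₂ eq) = subst EvenWeight (trans (cong (𝟏 ⊕_) eq) (⊕-cancel 𝟏 x))
      (⊕-even 𝟏 (proj₁ (IndependentSet.point S i)) refl (proj₂ (IndependentSet.point S i)))

  point∈ʷ : ∀ S k → proj₁ (IndependentSet.point S k) ∈ʷ S
  point∈ʷ S k = k , inj₁ refl

  step-describes : ∀ {b S T p} → S ↝ T → Describes b S p → ∃[ q ] Describes b T q
  step-describes {b} {S} {T} {u , h} (translation t et maps) d = _ , same-label b u (label b u t ⊕ h) T (proj₁ (Describes.isFlag d)) labels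
    where
    labels : ∀ k → label b u (proj₁ (IndependentSet.point T k)) ≡ label b u t ⊕ h
    labels k = trans (cong (label b u) (sym (⊕-cancel t x))) (trans (label-⊕ b u t (t ⊕ x)) (cong (label b u t ⊕_)
      (proj₂ (Equivalence.to (∈ʷ⇔ d (t ⊕ x)) (Equivalence.from (maps (t ⊕ x)) (subst (_∈ʷ T) (sym (⊕-cancel t x)) (point∈ʷ T k)))))))
      where x = proj₁ (IndependentSet.point T k)
  step-describes {b} {S} {T} {u , h} (permutation π π-even maps) d =
    let u′ , u′≢𝟎 , m = even-permutation-moves π π-even b u (proj₁ (Describes.isFlag d))
    in _ , same-label b u′ (label b u′ (proj₁ (IndependentSet.point T zero))) T u′≢𝟎 (labels u′ m)
    where
    t : Fin 8 → Word 8
    t k = proj₁ (IndependentSet.point T k)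
    preimage : ∀ k → EvenWeight (permute (flip π) (t k)) × label b u (permute (flip π) (t k)) ≡ h
    preimage k = Equivalence.to (∈ʷ⇔ d (permute (flip π) (t k)))
      (Equivalence.from (maps (permute (flip π) (t k))) (subst (_∈ʷ T) (sym (permute-flip π (t k))) (point∈ʷ T k)))
    labels : ∀ u′ → Moves (permute π) b u b u′ → ∀ k → label b u′ (t k) ≡ label b u′ (t zero)
    labels u′ m k = subst₂ (λ x y → label b u′ x ≡ label b u′ y) (permute-flip π (t k)) (permute-flip π (t zero))
      (cosets m (permute (flip π) (t k)) (permute (flip π) (t zero)) (proj₁ (preimage k)) (proj₁ (preimage zero))
        (trans (proj₂ (preimage k)) (sym (proj₂ (preimage zero)))))

  orbit-describes : ∀ {b S T p} → InOrbitOf S T → Describes b S p → ∃[ q ] Describes b T q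
  orbit-describes ε        d = _ , d
  orbit-describes (s ◅ ss) d = orbit-describes ss (proj₂ (step-describes s d))

  translate : ∀ {b S T u h k} → Describes b S (u , h) → Describes b T (u , k) → S ↝ T
  translate {b} {S} {T} {u} {h} {k} dS dT = translation t (encode-even (σ b p)) λ x → mk⇔
    (λ x∈S → let ex , lx = Equivalence.to (∈ʷ⇔ dS x) x∈S in
      Equivalence.from (∈ʷ⇔ dT (t ⊕ x)) (⊕-even t x (encode-even (σ b p)) ex ,
        trans (label-⊕ b u t x) (trans (cong₂ _⊕_ t-label lx) (trans (⊕-comm (h ⊕ k) h) (⊕-cancel h k)))))
    (λ t⊕x∈T → let etx , ltx = Equivalence.to (∈ʷ⇔ dT (t ⊕ x)) t⊕x∈T in
      Equivalence.from (∈ʷ⇔ dS x) (subst EvenWeight (⊕-cancel t x) (⊕-even t (t ⊕ x) (encode-even (σ b p)) etx) ,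
        trans (cong (label b u) (sym (⊕-cancel t x))) (trans (label-⊕ b u t (t ⊕ x)) (trans (cong₂ _⊕_ t-label ltx)
          (trans (cong (_⊕ k) (⊕-comm h k)) (trans (⊕-assoc k h k) (trans (cong (k ⊕_) (⊕-comm h k)) (⊕-cancel k h))))))))
    where
    u≢𝟎 = proj₁ (Describes.isFlag dS)
    solution = contract-surjective u (h ⊕ k) u≢𝟎
      (trans (dot-⊕ˡ h k u) (cong₂ _xor_ (proj₂ (Describes.isFlag dS)) (proj₂ (Describes.isFlag dT))))
    p = proj₁ solution
    t = word b p
    t-label : label b u t ≡ h ⊕ k
    t-label = trans (cong (contract u) (coordinates-word b p)) (proj₂ solution)

  transitive : ∀ b u v → u ≢ 𝟎 → v ≢ 𝟎 → ∃[ ts ] (EvenPermutation (Transpositions.eval ts) ×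
    Moves (permute (Transpositions.eval ts)) b u b v × ∃[ g ] (Moves g b v b u × ∀ x → g (permute (Transpositions.eval ts) x) ≡ x))
  transitive b u v u≢𝟎 v≢𝟎 =
    let r , Pr , _ , s , Ps , eq = two-reflections u v u≢𝟎 v≢𝟎
        i , j , i≢j , r≡ = nonsingular-dyad (σ b r) (trans (Pf-σ b r) Pr)
        k , l , k≢l , s≡ = nonsingular-dyad (σ (not b) s) (trans (Pf-σ (not b) s) Ps)
    in build i j k l i≢j k≢l (trans (cong (contract (contract u (mirror b i j))) (trans (cong (σ (not b)) s≡) (σ-involutive (not b) s)))
         (trans (cong (λ r → contract (contract u r) s) (trans (cong (σ b) r≡) (σ-involutive b r))) eq))
    where
    undo : ∀ i j (x : Word 8) → permute (transpose j i) (permute (transpose i j) x) ≡ x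
    undo i j = permute-flip (transpose j i)

    dyad-comm : ∀ b i j → mirror b j i ≡ mirror b i j
    dyad-comm b i j = cong (σ b ∘ decode) (⊕-comm (𝟎 [ j ]≔ true) (𝟎 [ i ]≔ true))

    build : ∀ i j k l → i ≢ j → k ≢ l → contract (contract u (mirror b i j)) (mirror (not b) k l) ≡ v →
      ∃[ ts ] (EvenPermutation (Transpositions.eval ts) ×
      Moves (permute (Transpositions.eval ts)) b u b v × ∃[ g ] (Moves g b v b u × ∀ x → g (permute (Transpositions.eval ts) x) ≡ x))
    build i j k l i≢j k≢l eq = ts , (ts , k≢l ∷ i≢j ∷ [] , divides 1 refl , λ _ → refl)
      , Moves-resp (λ x → sym (two x)) forward
      , permute (transpose j i) ∘ permute (transpose l k) , backward
      , λ x → trans (cong (permute (transpose j i) ∘ permute (transpose l k)) (two x))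
          (trans (cong (permute (transpose j i)) (undo k l (permute (transpose i j) x))) (undo i j x))
      where
      ts : Transpositions.TranspositionList 8
      ts = (k , l) ∷ (i , j) ∷ []
      w = contract u (mirror b i j)
      w-facts = reflect-plane u u≢𝟎 (mirror b i j) (mirror-nonsingular b i j i≢j)
      w≢𝟎 = proj₁ w-facts
      v-facts = reflect-plane w w≢𝟎 (mirror (not b) k l) (mirror-nonsingular (not b) k l k≢l)
      two : ∀ x → permute (Transpositions.eval ts) x ≡ permute (transpose k l) (permute (transpose i j) x)
      two x = trans (permute-∘ (transpose k l) (transpose i j ∘ₚ Perm.id) x) (cong (permute (transpose k l))
        (trans (permute-∘ (transpose i j) Perm.id x) (cong (permute (transpose i j)) (permute-id x))))
      forward : Moves (permute (transpose k l) ∘ permute (transpose i j)) b u b v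
      forward = subst₂ (Moves (permute (transpose k l) ∘ permute (transpose i j)) b u) (Bool.not-involutive b) eq
        (Moves-∘ (transpose-moves (not b) w k l w≢𝟎 k≢l) (transpose-moves b u i j u≢𝟎 i≢j))
      back-l : Moves (permute (transpose l k)) b v (not b) w
      back-l = subst (Moves (permute (transpose l k)) b v (not b))
        (trans (cong₂ contract (sym eq) (trans (dyad-comm b k l) (trans (cong (λ c → σ c (decode (dyad k l))) (sym (Bool.not-involutive b)))
          (σ-not (not b) (decode (dyad k l)))))) (proj₁ (proj₂ v-facts)))
        (transpose-moves b v l k v≢𝟎 (k≢l ∘ sym))
      back-j : Moves (permute (transpose j i)) (not b) w b u
      back-j = subst₂ (Moves (permute (transpose j i)) (not b) w) (Bool.not-involutive b)
        (trans (cong (contract w) (trans (dyad-comm (not b) i j) (σ-not b (decode (dyad i j))))) (proj₁ (proj₂ w-facts)))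
        (transpose-moves (not b) w j i w≢𝟎 (i≢j ∘ sym))
      backward : Moves (permute (transpose j i) ∘ permute (transpose l k)) b v b u
      backward = Moves-∘ back-j back-l

  reachable : ∀ {b S T p q} → Describes b S p → Describes b T q → InOrbitOf S T
  reachable {b} {S} {T} {u , h} {v , k} dS dT =
    let ts , ts-even , m , g , m′ , undo = transitive b u v u≢𝟎 v≢𝟎
        f = permute (Transpositions.eval ts)
        s′ = f (s zero)
        flag′ : IsFlag false (v , label b v s′)
        flag′ = v≢𝟎 , contract-alternating v (coordinates b s′)
        d′ = cosetCoclique-describes b (v , label b v s′) flag′
    in permutation (Transpositions.eval ts) ts-even (λ x → mk⇔
         (λ x∈S → let ex , lx = Equivalence.to (∈ʷ⇔ dS x) x∈S in
           Equivalence.from (∈ʷ⇔ d′ (f x)) (even m x ex , cosets m x (s zero) ex (s-even zero) (trans lx (sym s-label))))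
         (λ fx∈ → let ef , lf = Equivalence.to (∈ʷ⇔ d′ (f x)) fx∈ in
           Equivalence.from (∈ʷ⇔ dS x) (subst EvenWeight (undo x) (even m′ (f x) ef) ,
             trans (cong (label b u) (sym (undo x))) (trans (cosets m′ (f x) s′ ef (even m (s zero) (s-even zero)) lf)
               (trans (cong (label b u) (undo (s zero))) s-label)))))
       ◅ (translate d′ dT ◅ ε)
    where
    u≢𝟎 = proj₁ (Describes.isFlag dS)
    v≢𝟎 = proj₁ (Describes.isFlag dT)
    s : Fin 8 → Word 8
    s k = proj₁ (IndependentSet.point S k)
    s-even : ∀ k → EvenWeight (s k)
    s-even k = proj₂ (IndependentSet.point S k)
    s-label : label b u (s zero) ≡ h
    s-label = proj₂ (Equivalence.to (∈ʷ⇔ dS (s zero)) (point∈ʷ S zero))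

open import Defs
open import Data.Bool.Base using (Bool; _xor_; false; not; true)
import Data.Bool.Properties as Bool
open import Data.Fin.Base as Fin using (Fin; zero)
import Data.Fin.Properties as Fin
open import Data.Product.Base using (_,_; _×_; proj₁; proj₂; ∃-syntax)
open import Data.Unit.Base using (tt)
open import Function.Base using (_∘_)
open import Function.Bundles using (Equivalence; Inverse; _⇔_)
import Function.Properties.Equivalence as ⇔
open import Relation.Binary.Bundles using (Setoid)
open import Relation.Binary.PropositionalEquality
open import Relation.Nullary using (contradiction; ¬_)
open import Relation.Nullary.Reflects using (Reflects; ofʸ; ofⁿ)
open StronglyRegularGraphs
open Flags
open RootLines
open QuantumPermutation
open Bivectors
open Cocliques
open Orbits using (orbit-describes; reachable)

same-coset : ∀ {b S T p} → Describes b S p → Describes b T p → S ≐ T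
same-coset dS dT v = ⇔.trans (Describes.member dS v) (⇔.sym (Describes.member dT v))

module _ {b : Bool} {S T : Coclique} {p q : Flag} (dS : Describes b S p) (dT : Describes b T q) where

  Apart : Set
  Apart = ¬ (S ≐ T) × ¬ Enumeration cube (λ v → v ∈ S × v ∈ T) 2

  apart-reflects : Reflects Apart (adjacent false p q)
  apart-reflects = by-axes p q dS dT
    where
    by-axes : ∀ p q → Describes b S p → Describes b T q → Reflects Apart (adjacent false p q)
    by-axes (u , h) (v , k) dS dT with u == v | ==-reflects u v
    ... | true  | ofʸ refl = parallel
      where
      parallel : Reflects Apart (not (h == k))
      parallel with h == k | ==-reflects h k
      ... | true  | ofʸ refl = ofⁿ λ (S≢T , _) → S≢T (same-coset dS dT)
      ... | false | ofⁿ h≢k  = ofʸ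
        ( (λ S≐T → h≢k (cong proj₂ (Describes-unique b dS dT S≐T)))
        , (λ e → let module E = Enumeration e in h≢k (trans
            (sym (Describes.labelled dS {E.element zero} (proj₁ (E.sound zero))))
            (Describes.labelled dT {E.element zero} (proj₂ (E.sound zero))))))
    ... | false | ofⁿ u≢v = crossing (dot h v) (dot k u) refl refl
      where
      crossing : ∀ c d → dot h v ≡ c → dot k u ≡ d → Reflects Apart (c xor d)
      crossing true  true  hv ku = ofⁿ λ (_ , apart) → apart (meet-in-two b dS dT u≢v (trans hv (sym ku)))
      crossing false false hv ku = ofⁿ λ (_ , apart) → apart (meet-in-two b dS dT u≢v (trans hv (sym ku)))
      crossing true  false hv ku = ofʸ
        ( (λ S≐T → u≢v (cong proj₁ (Describes-unique b dS dT S≐T)))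
        , (λ e → let module E = Enumeration e in contradiction
            (trans (sym hv) (trans (common-point b dS dT (E.element zero) (proj₁ (E.sound zero)) (proj₂ (E.sound zero))) ku)) λ ()))
      crossing false true  hv ku = ofʸ
        ( (λ S≐T → u≢v (cong proj₁ (Describes-unique b dS dT S≐T)))
        , (λ e → let module E = Enumeration e in contradiction
            (trans (sym hv) (trans (common-point b dS dT (E.element zero) (proj₁ (E.sound zero)) (proj₂ (E.sound zero))) ku)) λ ()))

module _ (S₀ : Coclique) {b : Bool} {p₀ : Flag} (d₀ : Describes b S₀ p₀) where

  private
    H = complement (Γ₁ S₀)

    coclique : Fin 120 → Coclique
    coclique k = cosetCoclique b (flagAt false k) (flagAt-isFlag false k)

    coclique-describes : ∀ k → Describes b (coclique k) (flagAt false k)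
    coclique-describes k = cosetCoclique-describes b (flagAt false k) (flagAt-isFlag false k)

  Γ-adjacency : AdjacencyMatrix H 120
  Γ-adjacency = record
    { labelling = record
      { element    = λ k → coclique k , reachable d₀ (coclique-describes k)
      ; sound      = λ _ → tt
      ; injective  = λ k l eq → flagAt-injective false k l (Describes-unique b (coclique-describes k) (coclique-describes l) eq)
      ; exhaustive = λ (T , path) _ →
          let q , dT = orbit-describes path d₀
              k , k≡ = flagAt-surjective false q (Describes.isFlag dT)
          in k , same-coset (subst (Describes b T) (sym k≡) dT) (coclique-describes k)
      }
    ; entry     = entry false
    ; reflects  = λ k l → apart-reflects (coclique-describes k) (coclique-describes l)
    }

  Γ-stronglyRegular : StronglyRegular H
  Γ-stronglyRegular = 120 , 63 , 30 , 36 ,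
    stronglyRegular Γ-adjacency (entry-regular false) (entry-common false)

HasThirdVertices : Graph → Set
HasThirdVertices G = ∀ u v → ¬ (u ≈ v) → ¬ (u ~ v) →
  ∃[ w ] (¬ (w ≈ u) × ¬ (w ≈ v) × ∀ z → u ~ z → v ~ z → w ~ z)
  where open Graph G

≅-HasThirdVertices : ∀ {G H} → G ≅ H → HasThirdVertices G → HasThirdVertices H
≅-HasThirdVertices {G} {H} G≅H third u v u≉v u≁v =
  let w , w≉u , w≉v , closed = third (from u) (from v) (u≉v ∘ from-injective u v) (u≁v ∘ from-adjacent u v)
  in to w
   , (λ tow≈u → w≉u (G.trans (G.sym (from-to w)) (Inverse.from-cong bijection tow≈u)))
   , (λ tow≈v → w≉v (G.trans (G.sym (from-to w)) (Inverse.from-cong bijection tow≈v)))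
   , λ z u~z v~z → Graph.~-resp H H.refl (to-from z) (Equivalence.to (adjacency w (from z))
       (closed (from z) (adjacent-from u z u~z) (adjacent-from v z v~z)))
  where
  open _≅_ G≅H
  open Inverse bijection using (to; from)
  module G = Setoid (Graph.vertices G)
  module H = Setoid (Graph.vertices H)
  to-from : ∀ x → to (from x) H.≈ x
  to-from x = Inverse.inverseˡ bijection G.refl
  from-to : ∀ x → from (to x) G.≈ x
  from-to x = Inverse.inverseʳ bijection H.refl
  from-injective : ∀ x y → from x G.≈ from y → x H.≈ y
  from-injective x y eq = H.trans (H.sym (to-from x)) (H.trans (Inverse.to-cong bijection eq) (to-from y))
  from-adjacent : ∀ x y → Graph._~_ G (from x) (from y) → Graph._~_ H x y
  from-adjacent x y a = Graph.~-resp H (to-from x) (to-from y) (Equivalence.to (adjacency (from x) (from y)) a)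
  adjacent-from : ∀ x y → Graph._~_ H x y → Graph._~_ G (from x) (from y)
  adjacent-from x y a = Equivalence.from (adjacency (from x) (from y))
    (Graph.~-resp H (H.sym (to-from x)) (H.sym (to-from y)) a)

third-vertices : ∀ {G n} (A : AdjacencyMatrix G n) → let open AdjacencyMatrix A using () renaming (entry to a) in
  (∀ k l → k ≢ l → a k l ≡ false → ∃[ w ] (w ≢ k × w ≢ l × ∀ z → a k z ≡ true → a l z ≡ true → a w z ≡ true)) →
  HasThirdVertices G
third-vertices {G} A third u v u≉v u≁v =
  let k , u≈ = exhaustive u tt
      l , v≈ = exhaustive v tt
      w , w≢k , w≢l , closed = third k l
        (λ k≡l → u≉v (V.trans u≈ (V.sym (subst (λ t → v V.≈ vertex t) (sym k≡l) v≈))))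
        (false-of (reflects k l) (u≁v ∘ ~-resp (V.sym u≈) (V.sym v≈)))
  in vertex w
   , (λ w≈u → w≢k (injective w k (V.trans w≈u u≈)))
   , (λ w≈v → w≢l (injective w l (V.trans w≈v v≈)))
   , λ z u~z v~z → let j , z≈ = exhaustive z tt in
       ~-resp V.refl (V.sym z≈) (holds (reflects w j) (closed j
         (true-of (reflects k j) (~-resp u≈ z≈ u~z)) (true-of (reflects l j) (~-resp v≈ z≈ v~z))))
  where
  open Graph G using (_~_; ~-resp)
  open AdjacencyMatrix A
  open Enumeration labelling using (exhaustive; injective)
  module V = Setoid (Graph.vertices G)

no-third-vertices : ∀ {G n} (A : AdjacencyMatrix G n) → let open AdjacencyMatrix A using () renaming (entry to a) in
  ∀ k l → k ≢ l → a k l ≡ false →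
  (∀ w → w ≢ k → w ≢ l → ∃[ z ] (a k z ≡ true × a l z ≡ true × a w z ≡ false)) → ¬ HasThirdVertices G
no-third-vertices {G} A k l k≢l k≁l fails third =
  let w , w≉k , w≉l , closed = third (vertex k) (vertex l) (k≢l ∘ injective k l)
        (λ k~l → contradiction (trans (sym k≁l) (true-of (reflects k l) k~l)) λ ())
      i , w≈ = exhaustive w tt
      z , k~z , l~z , i≁z = fails i (λ i≡k → w≉k (subst (λ t → w V.≈ vertex t) i≡k w≈)) (λ i≡l → w≉l (subst (λ t → w V.≈ vertex t) i≡l w≈))
      w~z = closed (vertex z) (holds (reflects k z) k~z) (holds (reflects l z) l~z)
  in contradiction (trans (sym i≁z) (true-of (reflects i z) (~-resp w≈ V.refl w~z))) λ ()
  where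
  open Graph G using (_~_; ~-resp)
  open AdjacencyMatrix A
  open Enumeration labelling using (exhaustive; injective)
  module V = Setoid (Graph.vertices G)

theorem3p13 : (S₀ : Coclique) →
    QuantumIsomorphic G-E₈ (complement (Γ₁ S₀))
    × ¬ (G-E₈ ≅ complement (Γ₁ S₀))
    × StronglyRegular G-E₈
    × StronglyRegular (complement (Γ₁ S₀))
theorem3p13 S₀ =
  let b , p , d₀ = classify S₀
  in quantumIsomorphic (Γ-adjacency S₀ d₀) (λ _ _ → refl)
   , (λ iso → no-third-vertices (Γ-adjacency S₀ d₀) zero eight (λ ()) eight-nonadjacent third-flag-fails
       (≅-HasThirdVertices iso (third-vertices E₈-adjacency third-flag)))
   , E₈-stronglyRegular
   , Γ-stronglyRegular S₀ d₀
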